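{- The $k$-EFTS problem admits (polynomial-time) approximation ratio $2$ for arbitrary edge costs, and approximation ratio $1+4/k$ for unit costs.
   Context: In the $k$-Edge-Fault-Tolerant-Subgraph problem ($k$-EFTS) the input is a finite undirected graph $G=(V,E)$ (parallel edges allowed) with nonnegative edge costs and a positive integer $k$. A feasible solution is a subgraph $H$ of $G$ such that for all $s,t\in V$ and every $F\subseteq E$ with $|F|<k$: if there is an $st$-path in $G\setminus F$ then there is an $st$-path in $H\setminus F$. The goal is to find a feasible solution of minimum total cost. Unit costs means every edge has cost $1$. A problem admits approximation ratio $\rho$ if there is a polynomial-time algorithm that always outputs a feasible solution of cost at most $\rho$ times the optimum. -}

module Defs where

open import Data.Bool using (Bool; true; false; if_then_else_)
open import Data.Fin using (Fin; zero; toℕ)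
open import Data.Fin.Subset using (Subset; _∈_; _─_; ⊤; ∣_∣)
open import Data.Integer as ℤ using ()
open import Data.List using (List; []; _∷_; foldr; map; tabulate)
open import Data.List.Relation.Unary.Unique.Propositional using (Unique)
open import Data.Nat as ℕ using (ℕ; suc; _<_; NonZero)
open import Data.Nat.Binary using (ℕᵇ; 2[1+_]; 1+[2_]; fromℕ)
open import Data.Product using (_×_; _,_; proj₁; proj₂; ∃₂; ∃-syntax)
open import Data.Rational as ℚ using (ℚ; 0ℚ; 1ℚ; ↥_; ↧ₙ_)
open import Data.Rational.Properties using (+-0-commutativeMonoid)
open import Data.Sum using (_⊎_)
open import Data.Vec as Vec using (Vec; lookup; replicate; toList; _[_]≔_)
open import Relation.Binary.PropositionalEquality using (_≡_; _≢_)

open import Algebra.Properties.CommutativeMonoid.Sum +-0-commutativeMonoid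
  using (sum)

-- Distinct edge indices may have the same ends (parallel edges).  The order
-- in which the two ends of an edge are listed carries no meaning: see Joins.
record Multigraph : Set where
  field
    order    : ℕ
    edges    : ℕ
    ends     : Fin edges → Fin order × Fin order
    loopless : ∀ e → proj₁ (ends e) ≢ proj₂ (ends e)

  Vertex : Set
  Vertex = Fin order

  Edge : Set
  Edge = Fin edges

  EdgeSet : Set
  EdgeSet = Subset edges

  Joins : Edge → Vertex → Vertex → Set
  Joins e u v = ends e ≡ (u , v) ⊎ ends e ≡ (v , u)

  -- Walks in the spanning subgraph with edge set S.
  data Walk (S : EdgeSet) : Vertex → Vertex → Set where
    stop : ∀ {u} → Walk S u u
    step : ∀ {u v w} (e : Edge) → e ∈ S → Joins e u v → Walk S v w → Walk S u w

  vertices : ∀ {S u v} → Walk S u v → List Vertex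
  vertices {u = u} stop           = u ∷ []
  vertices {u = u} (step _ _ _ w) = u ∷ vertices w

  HasPath : EdgeSet → Vertex → Vertex → Set
  HasPath S s t = ∃[ w ] Unique (vertices {S} {s} {t} w)

-- Costs are rational, so that an instance is a finite input.
record Instance : Set where
  field
    graph : Multigraph
  open Multigraph graph public
  field
    k             : ℕ
    {{k-nonZero}} : NonZero k
    cost          : Edge → ℚ
    cost-nonneg   : ∀ e → 0ℚ ℚ.≤ cost e

  -- A subgraph is given by its edge set; it keeps all vertices.
  Feasible : EdgeSet → Set
  Feasible H = ∀ (s t : Vertex) (F : EdgeSet) → ∣ F ∣ < k →
               HasPath (⊤ ─ F) s t → HasPath (H ─ F) s t

  totalCost : EdgeSet → ℚ
  totalCost H = sum (λ e → if lookup H e then cost e else 0ℚ)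

  Optimal : EdgeSet → Set
  Optimal H = Feasible H × (∀ H′ → Feasible H′ → totalCost H ℚ.≤ totalCost H′)

UnitCosts : Instance → Set
UnitCosts I = ∀ e → cost e ≡ 1ℚ
  where open Instance I

-- The model of computation for polynomial time: WHILE programs over binary trees (N. D. Jones,
-- "Computability and Complexity from a Programming Perspective").

data Tree : Set where
  nil : Tree
  _·_ : Tree → Tree → Tree

infixr 5 _·_

size : Tree → ℕ
size nil     = 1
size (l · r) = suc (size l ℕ.+ size r)

hd tl : Tree → Tree
hd nil     = nil
hd (l · r) = l
tl nil     = nil
tl (l · r) = r

data Expr (n : ℕ) : Set where
  nil       : Expr n
  var       : Fin n → Expr n
  cons      : Expr n → Expr n → Expr n
  head tail : Expr n → Expr n

infix  4 _:=_
infixr 3 _⨾_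

data Command (n : ℕ) : Set where
  _:=_        : Fin n → Expr n → Command n
  _⨾_         : Command n → Command n → Command n
  while_loop_ : Fin n → Command n → Command n

Store : ℕ → Set
Store n = Vec Tree n

eval : ∀ {n} → Expr n → Store n → Tree
eval nil        σ = nil
eval (var x)    σ = lookup σ x
eval (cons a b) σ = eval a σ · eval b σ
eval (head a)   σ = hd (eval a σ)
eval (tail a)   σ = tl (eval a σ)

-- Jones charges one unit per operator.  Here each operator is charged the size
-- of the tree it returns, i.e. the cost of copying that tree without sharing.
-- Hence the total size of the store is at most the size of the initial store
-- plus the elapsed time, and running times agree with those of Turing machines
-- up to a polynomial.
exprTime : ∀ {n} → Expr n → Store n → ℕ
exprTime e@nil        σ = size (eval e σ)
exprTime e@(var _)    σ = size (eval e σ)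
exprTime e@(cons a b) σ = size (eval e σ) ℕ.+ (exprTime a σ ℕ.+ exprTime b σ)
exprTime e@(head a)   σ = size (eval e σ) ℕ.+ exprTime a σ
exprTime e@(tail a)   σ = size (eval e σ) ℕ.+ exprTime a σ

-- ⟨ c , σ ⟩⇓⟨ σ′ , t ⟩: started in σ, the command c halts in σ′ after time t.
-- A loop runs as long as its variable is not nil; each test takes time 1.
data ⟨_,_⟩⇓⟨_,_⟩ {n : ℕ} : Command n → Store n → Store n → ℕ → Set where
  assign : ∀ {x e σ} →
           ⟨ x := e , σ ⟩⇓⟨ σ [ x ]≔ eval e σ , exprTime e σ ⟩
  seq    : ∀ {c d σ₀ σ₁ σ₂ t₁ t₂} →
           ⟨ c , σ₀ ⟩⇓⟨ σ₁ , t₁ ⟩ → ⟨ d , σ₁ ⟩⇓⟨ σ₂ , t₂ ⟩ →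
           ⟨ c ⨾ d , σ₀ ⟩⇓⟨ σ₂ , t₁ ℕ.+ t₂ ⟩
  exit   : ∀ {x c σ} → lookup σ x ≡ nil →
           ⟨ while x loop c , σ ⟩⇓⟨ σ , 1 ⟩
  again  : ∀ {x c σ₀ σ₁ σ₂ t₁ t₂} → lookup σ₀ x ≢ nil →
           ⟨ c , σ₀ ⟩⇓⟨ σ₁ , t₁ ⟩ → ⟨ while x loop c , σ₁ ⟩⇓⟨ σ₂ , t₂ ⟩ →
           ⟨ while x loop c , σ₀ ⟩⇓⟨ σ₂ , suc (t₁ ℕ.+ t₂) ⟩

-- Variable 0 holds the input and the output; all others are initially nil.
record Program : Set where
  field
    extraVars : ℕ
    body      : Command (suc extraVars)

Computes : Program → Tree → Tree → ℕ → Set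
Computes p i o t =
  ∃[ σ ] ⟨ body , i Vec.∷ replicate extraVars nil ⟩⇓⟨ σ , t ⟩ × lookup σ zero ≡ o
  where open Program p

encodeList : List Tree → Tree
encodeList = foldr _·_ nil

encodeBool : Bool → Tree
encodeBool false = nil
encodeBool true  = nil · nil

-- Bijective base-2 digits, least significant first: the size of the code is
-- linear in the number of bits.
encodeℕᵇ : ℕᵇ → Tree
encodeℕᵇ ℕᵇ.zero  = nil
encodeℕᵇ 2[1+ x ] = encodeBool false · encodeℕᵇ x
encodeℕᵇ 1+[2 x ] = encodeBool true  · encodeℕᵇ x

encodeℕ : ℕ → Tree
encodeℕ n = encodeℕᵇ (fromℕ n)

-- Only applied to nonnegative rationals, so the sign is not recorded.
encodeℚ≥0 : ℚ → Tree
encodeℚ≥0 q = encodeℕ ℤ.∣ ↥ q ∣ · encodeℕ (↧ₙ q)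

encodeFin : ∀ {n} → Fin n → Tree
encodeFin v = encodeℕ (toℕ v)

encodeInstance : Instance → Tree
encodeInstance I =
  encodeℕ k
  · encodeList (tabulate {n = order} encodeFin)
  · encodeList (tabulate λ e →
      encodeFin (proj₁ (ends e)) · encodeFin (proj₂ (ends e)) · encodeℚ≥0 (cost e))
  where open Instance I

-- One bit per edge, in the order of the input.
encodeSubset : ∀ {n} → Subset n → Tree
encodeSubset S = encodeList (map encodeBool (toList S))

-- One polynomial-time program that, on each instance I in the class C (with k
-- part of the input), outputs a feasible subgraph of cost at most ρ I times
-- the optimum.
AdmitsApproximationRatio : (C : Instance → Set) (ρ : Instance → ℚ) → Set
AdmitsApproximationRatio C ρ =
  ∃[ p ] ∃₂ λ (a d : ℕ) → ∀ I → C I → let open Instance I in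
    ∃₂ λ (H : EdgeSet) (t : ℕ) →
        Computes p (encodeInstance I) (encodeSubset H) t
      × t ℕ.≤ a ℕ.* size (encodeInstance I) ℕ.^ d
      × Feasible H
      × (∀ H* → Optimal H* → totalCost H ℚ.≤ ρ I ℚ.* totalCost H*)

-- A subgraph is feasible exactly when every cut either keeps all its edges or keeps at least k of
-- them.  Relax this to 0 ≤ y ≤ 1 with y(δS) ≥ k for every S on whose boundary y is not identically 1.
-- Tight sets of an extreme solution uncross, so a laminar family of at least as many tight sets as
-- fractional edges determines it.  Counting edges against this family shows that some edge has
-- y_e = 0 or y_e ≥ 1/2, and, when no edge has value 0 or 1, that at most 4/k times as many edges as
-- in any feasible subgraph are fractional.  Hence edges can be decided one at a time, which loses a
-- factor 2; for unit costs one stops when all values are fractional and keeps every undecided edge.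
--
-- Polynomial time needs only approximate optima.  The dearest edge and the cost of an optimal
-- solution are guessed and costs are rounded to multiples of 1/m of that edge, so that all numbers
-- are polynomially bounded and arithmetic can be unary.  Feasibility of the relaxation within a
-- budget is tested on a fine grid by the relaxation (perceptron) method: step towards a violated
-- constraint, with minimum cuts as separation oracle.  Padding the result makes all cut constraints
-- hold exactly at the price of a small excess of the budget, and the m + 1 excesses together stay
-- below half of one grid-scaled unit of cost.
module Submission where

open import Defs
open import Data.Bool using (Bool; true; false; if_then_else_; not; _∧_; _∨_; _xor_; T)
open import Data.Bool.ListAction using (any)
import Data.Bool.Properties as Bool
open import Data.Empty using (⊥; ⊥-elim)
open import Data.Fin as Fin using (Fin; zero; suc; toℕ)
import Data.Fin.Properties as Fin
import Data.Fin.Subset as Subset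
import Data.Fin.Subset.Properties as Subset
open import Data.Integer as ℤ using (ℤ)
import Data.Integer.Properties as ℤ
import Data.Integer.Tactic.RingSolver as ℤ-Ring
open import Data.List as List using (List; []; _∷_; _++_; length; foldl; reverse; concatMap; map; tabulate; replicate)
open import Data.List.Membership.Propositional using (_∈_; find; lose)
open import Data.List.Membership.Propositional.Properties using (∈-filter⁻; ∈-filter⁺; ∈-concatMap⁻; ∈-concatMap⁺; ∈-++⁺ˡ; ∈-++⁺ʳ; ∈-map⁺; ∈-allFin; ∈-tabulate⁺; ∈-tabulate⁻)
import Data.List.Properties as List
open import Data.List.Relation.Unary.All as All using (All; []; _∷_)
import Data.List.Relation.Unary.All.Properties as All
open import Data.List.Relation.Unary.AllPairs as AllPairs using (AllPairs; []; _∷_)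
import Data.List.Relation.Unary.AllPairs.Properties as AllPairs
open import Data.List.Relation.Unary.Any as Any using (here; there)
open import Data.List.Relation.Unary.Unique.Propositional using (Unique)
open import Data.Nat as ℕ using (ℕ; zero; suc; NonZero; _+_; _*_; _∸_; _^_; _≤_; _<_; z≤n; s≤s)
open import Data.Nat.Binary as Binary using (ℕᵇ; 2[1+_]; 1+[2_]; fromℕ)
import Data.Nat.Binary.Properties as Binary
open import Data.Nat.Properties
import Data.Nat.Tactic.RingSolver as ℕ-Ring
open import Data.Product using (Σ; _×_; _,_; proj₁; proj₂; ∃; ∃₂)
open import Data.Rational as ℚ using (ℚ; mkℚ; 0ℚ; 1ℚ)
import Data.Rational.Properties as ℚ
open import Data.Rational.Unnormalised as ℚᵘ using (ℚᵘ; mkℚᵘ)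
import Data.Rational.Unnormalised.Properties as ℚᵘ
open import Data.Sum as Sum using (_⊎_; inj₁; inj₂; [_,_]′)
open import Data.Unit using (⊤; tt)
open import Data.Vec as Vec using (Vec; []; _∷_; lookup; _[_]≔_)
open import Data.Vec.Base using (here; there)
import Data.Vec.Properties as Vec
open import Function using (_∘_; id; case_of_)
open import Function.Bundles using (Equivalence)
open import Relation.Binary.PropositionalEquality using (_≡_; _≢_; refl; sym; trans; cong; cong₂; subst; subst₂; module ≡-Reasoning)
open import Relation.Nullary using (¬_; Dec; yes; no; contradiction)
open import Relation.Nullary.Decidable as Dec using (_×-dec_)
open import Algebra.Properties.CommutativeMonoid.Sum ℚ.+-0-commutativeMonoid using (sum)

-- Polynomials

-- A ratio of exactly 2 has to survive two losses. The rounded cost of an edge falls short by at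
-- most one unit, hence by m units in all. This equals the rounded cost of the guessed dearest edge,
-- which is taken at the start and so escapes the factor 2: for an optimum of rounded cost b′ one
-- gets `paid lo + m ≤ 2 b′`, and the m pays for the rounding. The excess budgets of the relaxation
-- method add up to less than half the grid size; since rounded costs are integers, they vanish when
-- the inequality is divided by that number. With unit costs all rounded costs are equal and only
-- the second loss occurs.
--
-- The exponentially many cuts, the extreme solutions and the laminar families live in the proof
-- only; the program merely asks which single decision keeps the relaxation feasible. Being extreme,
-- or independent of other sets, is a statement about all integer vectors and is not decided here.
-- Such objects are obtained under a double negation, which suffices because they are used only to
-- refute something or to prove a decidable inequality.

data Poly : Set where
  con     : ℕ → Poly
  arg     : Poly
  _⊞_ _⊠_ : Poly → Poly → Poly
  _⟨_⟩    : Poly → Poly → Poly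

infixl 6 _⊞_
infixl 7 _⊠_
infixl 8 _⟨_⟩

⟦_⟧ : Poly → ℕ → ℕ
⟦ con c ⟧ n = c
⟦ arg   ⟧ n = n
⟦ p ⊞ q ⟧ n = ⟦ p ⟧ n + ⟦ q ⟧ n
⟦ p ⊠ q ⟧ n = ⟦ p ⟧ n * ⟦ q ⟧ n
⟦ p ⟨ q ⟩ ⟧ n = ⟦ p ⟧ (⟦ q ⟧ n)

⟦⟧-mono : ∀ p {m n} → m ≤ n → ⟦ p ⟧ m ≤ ⟦ p ⟧ n
⟦⟧-mono (con c) m≤n = ≤-refl
⟦⟧-mono arg     m≤n = m≤n
⟦⟧-mono (p ⊞ q) m≤n = +-mono-≤ (⟦⟧-mono p m≤n) (⟦⟧-mono q m≤n)
⟦⟧-mono (p ⊠ q) m≤n = *-mono-≤ (⟦⟧-mono p m≤n) (⟦⟧-mono q m≤n)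
⟦⟧-mono (p ⟨ q ⟩) m≤n = ⟦⟧-mono p (⟦⟧-mono q m≤n)

^-monoʳ : ∀ n {d e} → 1 ≤ n → d ≤ e → n ^ d ≤ n ^ e
^-monoʳ n@(suc _) _ d≤e = ^-monoʳ-≤ n d≤e

^-distribʳ-* : ∀ m n d → (m * n) ^ d ≡ m ^ d * n ^ d
^-distribʳ-* m n zero    = refl
^-distribʳ-* m n (suc d) = trans (cong ((m * n) *_) (^-distribʳ-* m n d)) (swap m n (m ^ d) (n ^ d))
  where
  swap : ∀ w x y z → (w * x) * (y * z) ≡ (w * y) * (x * z)
  swap = ℕ-Ring.solve-∀

-- The coefficient is a successor so that `suc b * n ^ e` is at least 1, as the induction hypothesis
-- for the outer polynomial of a composition demands.
monomial-bound : ∀ p → ∃₂ λ a d → ∀ n → 1 ≤ n → ⟦ p ⟧ n ≤ suc a * n ^ d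
monomial-bound (con c) = c , 0 , λ n _ → ≤-trans (n≤1+n c) (≤-reflexive (sym (*-identityʳ (suc c))))
monomial-bound arg     = 0 , 1 , λ n _ → ≤-reflexive (sym (trans (+-identityʳ _) (*-identityʳ n)))
monomial-bound (p ⊞ q) with monomial-bound p | monomial-bound q
... | a , d , f | b , e , g = a + suc b , d + e , λ n 1≤n → begin
  ⟦ p ⟧ n + ⟦ q ⟧ n                             ≤⟨ +-mono-≤ (f n 1≤n) (g n 1≤n) ⟩
  suc a * n ^ d + suc b * n ^ e                 ≤⟨ +-mono-≤ (*-monoʳ-≤ (suc a) (^-monoʳ n 1≤n (m≤m+n d e)))
                                                            (*-monoʳ-≤ (suc b) (^-monoʳ n 1≤n (m≤n+m e d))) ⟩
  suc a * n ^ (d + e) + suc b * n ^ (d + e)     ≡⟨ *-distribʳ-+ (n ^ (d + e)) (suc a) (suc b) ⟨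
  (suc a + suc b) * n ^ (d + e)                 ∎
  where open ≤-Reasoning
monomial-bound (p ⊠ q) with monomial-bound p | monomial-bound q
... | a , d , f | b , e , g = b + a * suc b , d + e , λ n 1≤n → begin
  ⟦ p ⟧ n * ⟦ q ⟧ n                             ≤⟨ *-mono-≤ (f n 1≤n) (g n 1≤n) ⟩
  (suc a * n ^ d) * (suc b * n ^ e)             ≡⟨ swap (suc a) (n ^ d) (suc b) (n ^ e) ⟩
  (suc a * suc b) * (n ^ d * n ^ e)             ≡⟨ cong ((suc a * suc b) *_) (sym (^-distribˡ-+-* n d e)) ⟩
  (suc a * suc b) * n ^ (d + e)                 ∎
  where
  open ≤-Reasoning
  swap : ∀ w x y z → (w * x) * (y * z) ≡ (w * y) * (x * z)
  swap = ℕ-Ring.solve-∀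
monomial-bound (p ⟨ q ⟩) with monomial-bound p | monomial-bound q
... | a , d , f | b , e , g = ℕ.pred (suc a * suc b ^ d) , e * d , λ n 1≤n → begin
  ⟦ p ⟧ (⟦ q ⟧ n)                               ≤⟨ ⟦⟧-mono p (g n 1≤n) ⟩
  ⟦ p ⟧ (suc b * n ^ e)                         ≤⟨ f _ (*-mono-≤ {1} {suc b} (s≤s z≤n) (^-monoʳ n {0} {e} 1≤n z≤n)) ⟩
  suc a * (suc b * n ^ e) ^ d                   ≡⟨ cong (suc a *_) (^-distribʳ-* (suc b) (n ^ e) d) ⟩
  suc a * (suc b ^ d * (n ^ e) ^ d)             ≡⟨ cong (λ k → suc a * (suc b ^ d * k)) (^-*-assoc n e d) ⟩
  suc a * (suc b ^ d * n ^ (e * d))             ≡⟨ *-assoc (suc a) (suc b ^ d) _ ⟨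
  suc a * suc b ^ d * n ^ (e * d)               ≡⟨ cong (_* n ^ (e * d)) (suc-pred _ ⦃ m*n≢0 (suc a) (suc b ^ d) ⦃ _ ⦄ ⦃ m^n≢0 (suc b) d ⦄ ⦄) ⟨
  suc (ℕ.pred (suc a * suc b ^ d)) * n ^ (e * d)  ∎
  where open ≤-Reasoning

-- Executions with a polynomial time bound

total : ∀ {n} → Store n → ℕ
total []      = 0
total (t ∷ σ) = size t + total σ

size-pos : ∀ t → 1 ≤ size t
size-pos nil     = s≤s z≤n
size-pos (_ · _) = s≤s z≤n

size-hd : ∀ t → size (hd t) ≤ size t
size-hd nil     = ≤-refl
size-hd (l · r) = m≤n⇒m≤1+n (m≤m+n _ _)

size-tl : ∀ t → size (tl t) ≤ size t
size-tl nil     = ≤-refl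
size-tl (l · r) = m≤n⇒m≤1+n (m≤n+m _ _)

size-eval : ∀ {n} (e : Expr n) σ → size (eval e σ) ≤ exprTime e σ
size-eval nil        σ = ≤-refl
size-eval (var x)    σ = ≤-refl
size-eval (cons a b) σ = m≤m+n _ _
size-eval (head a)   σ = m≤m+n _ _
size-eval (tail a)   σ = m≤m+n _ _

total-update : ∀ {n} (σ : Store n) x v → total (σ [ x ]≔ v) ≤ total σ + size v
total-update (t ∷ σ) zero    v = ≤-trans (≤-reflexive (+-comm (size v) (total σ))) (+-monoˡ-≤ (size v) (m≤n+m (total σ) (size t)))
total-update (t ∷ σ) (suc x) v = ≤-trans (+-monoʳ-≤ (size t) (total-update σ x v)) (≤-reflexive (sym (+-assoc (size t) _ _)))

-- Every operator is charged the size of its result, so the store cannot grow faster than time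
-- passes. This makes time bounds compose: the second command starts from a store bounded by the
-- initial size plus the time of the first.
total-growth : ∀ {n} {c : Command n} {σ σ′ t} → ⟨ c , σ ⟩⇓⟨ σ′ , t ⟩ → total σ′ ≤ total σ + t
total-growth (assign {x} {e} {σ}) = ≤-trans (total-update σ x _) (+-monoʳ-≤ (total σ) (size-eval e σ))
total-growth (seq {σ₀ = σ₀} {σ₁ = σ₁} {t₁ = t₁} {t₂} p q) = begin
  _                     ≤⟨ total-growth q ⟩
  total σ₁ + t₂         ≤⟨ +-monoˡ-≤ t₂ (total-growth p) ⟩
  total σ₀ + t₁ + t₂    ≡⟨ +-assoc (total σ₀) t₁ t₂ ⟩
  total σ₀ + (t₁ + t₂)  ∎
  where open ≤-Reasoning
total-growth (exit _) = m≤m+n _ 1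
total-growth (again {σ₀ = σ₀} {σ₁ = σ₁} {t₁ = t₁} {t₂} _ p q) = begin
  _                         ≤⟨ total-growth q ⟩
  total σ₁ + t₂             ≤⟨ +-monoˡ-≤ t₂ (total-growth p) ⟩
  total σ₀ + t₁ + t₂        ≡⟨ +-assoc (total σ₀) t₁ t₂ ⟩
  total σ₀ + (t₁ + t₂)      ≤⟨ +-monoʳ-≤ (total σ₀) (n≤1+n _) ⟩
  total σ₀ + suc (t₁ + t₂)  ∎
  where open ≤-Reasoning

record Run {n : ℕ} (c : Command n) (σ σ′ : Store n) (p : Poly) : Set where
  constructor ran
  field
    duration  : ℕ
    execution : ⟨ c , σ ⟩⇓⟨ σ′ , duration ⟩
    in-time   : duration ≤ ⟦ p ⟧ (total σ)

exprBound : ∀ {n} → Expr n → Poly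
exprBound nil        = con 1
exprBound (var x)    = arg
exprBound (cons a b) = (con 1 ⊞ (exprBound a ⊞ exprBound b)) ⊞ (exprBound a ⊞ exprBound b)
exprBound (head a)   = exprBound a ⊞ exprBound a
exprBound (tail a)   = exprBound a ⊞ exprBound a

size-lookup : ∀ {n} (σ : Store n) x → size (lookup σ x) ≤ total σ
size-lookup (t ∷ σ) zero    = m≤m+n _ _
size-lookup (t ∷ σ) (suc x) = ≤-trans (size-lookup σ x) (m≤n+m _ _)

exprTime-bound : ∀ {n} (e : Expr n) σ → exprTime e σ ≤ ⟦ exprBound e ⟧ (total σ)
exprTime-bound nil        σ = ≤-refl
exprTime-bound (var x)    σ = size-lookup σ x
exprTime-bound (cons a b) σ =
  +-mono-≤ (s≤s (+-mono-≤ (≤-trans (size-eval a σ) (exprTime-bound a σ)) (≤-trans (size-eval b σ) (exprTime-bound b σ))))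
           (+-mono-≤ (exprTime-bound a σ) (exprTime-bound b σ))
exprTime-bound (head a)   σ =
  +-mono-≤ (≤-trans (size-hd _) (≤-trans (size-eval a σ) (exprTime-bound a σ))) (exprTime-bound a σ)
exprTime-bound (tail a)   σ =
  +-mono-≤ (≤-trans (size-tl _) (≤-trans (size-eval a σ) (exprTime-bound a σ))) (exprTime-bound a σ)

run-assign : ∀ {n} {x : Fin n} {e σ} → Run (x := e) σ (σ [ x ]≔ eval e σ) (exprBound e)
run-assign {e = e} {σ} = ran _ assign (exprTime-bound e σ)

infixr 4 _▷_
_▷_ : ∀ {n} {c d : Command n} {σ₀ σ₁ σ₂ p q} → Run c σ₀ σ₁ p → Run d σ₁ σ₂ q →
      Run (c ⨾ d) σ₀ σ₂ (p ⊞ q ⟨ arg ⊞ p ⟩)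
_▷_ {σ₀ = σ₀} {p = p} {q} (ran t r t≤) (ran u r′ u≤) =
  ran (t + u) (seq r r′) (+-mono-≤ t≤ (≤-trans u≤ (⟦⟧-mono q (≤-trans (total-growth r) (+-monoʳ-≤ (total σ₀) t≤)))))

run-weaken : ∀ {n} {c : Command n} {σ σ′ p q} → (∀ k → ⟦ p ⟧ k ≤ ⟦ q ⟧ k) → Run c σ σ′ p → Run c σ σ′ q
run-weaken {σ = σ} le (ran t r t≤) = ran t r (≤-trans t≤ (le (total σ)))

-- Polynomial-time functions between types with a tree encoding

record Coded : Set₁ where
  field
    Carrier : Set
    enc     : Carrier → Tree

open Coded public

infixl 5 _⊗_
_⊗_ : Coded → Coded → Coded
Carrier (A ⊗ B) = Carrier A × Carrier B
enc (A ⊗ B) (a , b) = enc A a · enc B b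

Lst : Coded → Coded
Carrier (Lst A) = List (Carrier A)
enc (Lst A) []       = nil
enc (Lst A) (x ∷ xs) = enc A x · enc (Lst A) xs

Unit Bit Nat : Coded
Carrier Unit   = ⊤
enc Unit _     = nil
Carrier Bit    = Bool
enc Bit        = encodeBool
Carrier Nat    = ℕ
enc Nat zero    = nil
enc Nat (suc n) = nil · enc Nat n

-- The programs keep their argument in register 0, a stack that they leave
-- unchanged in register 1, and nil in the loop register 2 between steps.
val stk tmp : Fin 3
val = zero
stk = suc zero
tmp = suc (suc zero)

st : Tree → Tree → Tree → Store 3
st v s t = v ∷ s ∷ t ∷ []

record PT (X Y : Coded) (f : Carrier X → Carrier Y) : Set where
  field
    cmd  : Command 3
    time : Poly
    run  : ∀ x s → Run cmd (st (enc X x) s nil) (st (enc Y (f x)) s nil) time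

open PT public

-- The result is part of the final store, hence at most the initial store plus the running time. The
-- 2 accounts for the two registers that hold nil.
sizeBound : ∀ {X Y f} → PT X Y f → Poly
sizeBound F = (arg ⊞ time F) ⟨ arg ⊞ con 2 ⟩

size-output : ∀ {X Y f} (F : PT X Y f) x → size (enc Y (f x)) ≤ ⟦ sizeBound F ⟧ (size (enc X x))
size-output {X} {Y} {f} F x with run F x nil
... | ran t r t≤ = begin
  size (enc Y (f x))                                    ≤⟨ m≤m+n _ _ ⟩
  total (st (enc Y (f x)) nil nil)                      ≤⟨ total-growth r ⟩
  total (st (enc X x) nil nil) + t                      ≤⟨ +-monoʳ-≤ _ t≤ ⟩
  ⟦ sizeBound F ⟧ (size (enc X x))                      ∎
  where open ≤-Reasoning

recode : ∀ {X Y Z f g} → (∀ x → enc Y (f x) ≡ enc Z (g x)) → PT X Y f → PT X Z g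
cmd  (recode e F) = cmd F
time (recode e F) = time F
run  (recode {X} {Y} e F) x s = subst (λ y → Run (cmd F) _ (st y s nil) (time F)) (e x) (run F x s)

ext : ∀ {X Y f g} → (∀ x → f x ≡ g x) → PT X Y f → PT X Y g
ext {Y = Y} e = recode (λ x → cong (enc Y) (e x))

reinterpret : ∀ {X Y f} → (∀ x → enc X x ≡ enc Y (f x)) → PT X Y f
cmd  (reinterpret e) = val := var val
time (reinterpret e) = arg
run  (reinterpret {X} {Y} e) x s = subst (λ y → Run _ _ (st y s nil) arg) (e x) run-assign

idPT : ∀ {X} → PT X X id
idPT = reinterpret λ _ → refl

infixr 9 _∙_
_∙_ : ∀ {X Y Z g f} → PT Y Z g → PT X Y f → PT X Z (λ x → g (f x))
G ∙ F = record { run = λ x s → run F x s ▷ run G _ s }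

literal : Tree → Expr 3
literal nil     = nil
literal (l · r) = cons (literal l) (literal r)

eval-literal : ∀ t σ → eval (literal t) σ ≡ t
eval-literal nil     σ = refl
eval-literal (l · r) σ = cong₂ _·_ (eval-literal l σ) (eval-literal r σ)

const : ∀ {X} Y (y : Carrier Y) → PT X Y (λ _ → y)
cmd  (const Y y) = val := literal (enc Y y)
time (const Y y) = exprBound (literal (enc Y y))
run  (const {X} Y y) x s =
  subst (λ v → Run (val := literal (enc Y y)) (st (enc X x) s nil) (st v s nil) (exprBound (literal (enc Y y))))
        (eval-literal (enc Y y) (st (enc X x) s nil)) run-assign

fst : ∀ {A B} → PT (A ⊗ B) A proj₁
fst = record { run = λ x s → run-assign {x = val} {head (var val)} }

snd : ∀ {A B} → PT (A ⊗ B) B proj₂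
snd = record { run = λ x s → run-assign {x = val} {tail (var val)} }

infixr 4 _&_
-- The argument waits on the stack while the first program runs; the result of that program then
-- takes its place there while the second one runs.
_&_ : ∀ {X A B f g} → PT X A f → PT X B g → PT X (A ⊗ B) (λ x → f x , g x)
F & G = record { run = λ x s →
  run-assign {x = stk} {cons (var val) (var stk)} ▷
  run F x _ ▷
  run-assign {x = tmp} {head (var stk)} ▷
  run-assign {x = stk} {cons (var val) (tail (var stk))} ▷
  run-assign {x = val} {var tmp} ▷
  run-assign {x = tmp} {nil} ▷
  run G x _ ▷
  run-assign {x = val} {cons (head (var stk)) (var val)} ▷
  run-assign {x = stk} {tail (var stk)} }

run-exit : ∀ {n x} {c : Command n} {σ} → lookup σ x ≡ nil → Run (while x loop c) σ σ (con 1)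
run-exit eq = ran 1 (exit eq) ≤-refl

run-once : ∀ {n x} {c : Command n} {σ σ′ p} → lookup σ x ≢ nil → lookup σ′ x ≡ nil → Run c σ σ′ p →
           Run (while x loop c) σ σ′ (con 1 ⊞ (p ⊞ con 1))
run-once ne eq (ran t r t≤) = ran _ (again ne r (exit eq)) (s≤s (+-monoˡ-≤ 1 t≤))

-- WHILE has no conditional: a flag on the stack, cleared by the first loop,
-- decides whether the second loop is entered.
branch : Command 3 → Command 3 → Command 3
branch f g =
  tmp := head (var val) ⨾
  stk := cons (cons nil nil) (var stk) ⨾
  (while tmp loop (stk := cons nil (tail (var stk)) ⨾ tmp := nil ⨾ f)) ⨾
  tmp := head (var stk) ⨾
  stk := tail (var stk) ⨾
  (while tmp loop (val := tail (var val) ⨾ tmp := nil ⨾ g))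

-- The bound is existential so that unification finds it. It depends on the bound of the chosen
-- branch only, hence is uniform in the stored trees.
run-branch-cons : ∃ λ (bound : Poly → Poly) → ∀ {f g l r x s y p} →
                  Run f (st ((l · r) · x) (nil · s) nil) (st y (nil · s) nil) p →
                  Run (branch f g) (st ((l · r) · x) s nil) (st y s nil) (bound p)
run-branch-cons = _ , λ F →
  run-assign ▷ run-assign ▷ run-once (λ ()) refl (run-assign ▷ run-assign ▷ F) ▷
  run-assign ▷ run-assign ▷ run-exit refl

run-branch-nil : ∃ λ (bound : Poly → Poly) → ∀ {f g x s y p} →
                 Run g (st x s nil) (st y s nil) p →
                 Run (branch f g) (st (nil · x) s nil) (st y s nil) (bound p)
run-branch-nil = _ , λ G →
  run-assign ▷ run-assign ▷ run-exit refl ▷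
  run-assign ▷ run-assign ▷ run-once (λ ()) refl (run-assign ▷ run-assign ▷ G)

⊞-weakenˡ : ∀ {n} {c : Command n} {σ σ′ p} q → Run c σ σ′ p → Run c σ σ′ (p ⊞ q)
⊞-weakenˡ {p = p} q = run-weaken (λ k → m≤m+n (⟦ p ⟧ k) (⟦ q ⟧ k))

⊞-weakenʳ : ∀ {n} {c : Command n} {σ σ′ q} p → Run c σ σ′ q → Run c σ σ′ (p ⊞ q)
⊞-weakenʳ {q = q} p = run-weaken (λ k → m≤n+m (⟦ q ⟧ k) (⟦ p ⟧ k))

ifPT : ∀ {Γ A b f g} → PT Γ Bit b → PT Γ A f → PT Γ A g → PT Γ A (λ γ → if b γ then f γ else g γ)
ifPT {Γ} {A} {b} {f} {g} B F G = record { run = λ γ s → run (B & idPT) γ s ▷ choose γ s (b γ) }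
  where
  drop : Expr 3
  drop = tail (var val)
  choose : ∀ γ s c → Run (branch (val := drop ⨾ cmd F) (cmd G)) (st (encodeBool c · enc Γ γ) s nil)
                         (st (enc A (if c then f γ else g γ)) s nil)
                         (proj₁ run-branch-cons (exprBound drop ⊞ time F ⟨ arg ⊞ exprBound drop ⟩) ⊞
                          proj₁ run-branch-nil (time G))
  choose γ s true  = ⊞-weakenˡ _ (proj₂ run-branch-cons (run-assign ▷ run F γ (nil · s)))
  choose γ s false = ⊞-weakenʳ _ (proj₂ run-branch-nil (run G γ s))

caseList : {A B : Set} → List A → B → (A → List A → B) → B
caseList []       n c = n
caseList (x ∷ xs) n c = c x xs

caseListPT : ∀ {Γ A B xs n c} → PT Γ (Lst A) xs → PT Γ B n → PT (Γ ⊗ A ⊗ Lst A) B c →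
             PT Γ B (λ γ → caseList (xs γ) (n γ) (λ y ys → c ((γ , y) , ys)))
caseListPT {Γ} {A} {B} {xs} {n} {c} XS N C = record { run = λ γ s → run (XS & idPT) γ s ▷ choose γ s (xs γ) }
  where
  regroup : Expr 3
  regroup = cons (cons (tail (var val)) (head (head (var val)))) (tail (head (var val)))
  choose : ∀ γ s l → Run (branch (val := regroup ⨾ cmd C) (cmd N)) (st (enc (Lst A) l · enc Γ γ) s nil)
                         (st (enc B (caseList l (n γ) (λ y ys → c ((γ , y) , ys)))) s nil)
                         (proj₁ run-branch-cons (exprBound regroup ⊞ time C ⟨ arg ⊞ exprBound regroup ⟩) ⊞
                          proj₁ run-branch-nil (time N))
  choose γ s (y ∷ ys) = ⊞-weakenˡ _ (proj₂ run-branch-cons (run-assign ▷ run C ((γ , y) , ys) (nil · s)))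
  choose γ s []       = ⊞-weakenʳ _ (proj₂ run-branch-nil (run N γ s))

length≤size : ∀ A xs → length xs ≤ size (enc (Lst A) xs)
length≤size A []       = z≤n
length≤size A (x ∷ xs) = s≤s (≤-trans (length≤size A xs) (m≤n+m _ _))

size-++ʳ : ∀ A ys zs → size (enc (Lst A) zs) ≤ size (enc (Lst A) (ys ++ zs))
size-++ʳ A []       zs = ≤-refl
size-++ʳ A (y ∷ ys) zs = m≤n⇒m≤1+n (≤-trans (size-++ʳ A ys zs) (m≤n+m _ _))

stateBound : Poly → Poly
stateBound Q = (con 1 ⊞ (arg ⊞ Q)) ⊞ (arg ⊞ (arg ⊞ con 0))

stateBound-bound : ∀ Q n {a b c d} → a ≤ n → b ≤ ⟦ Q ⟧ n → c ≤ n → d ≤ n →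
                   suc (a + b) + (c + (d + 0)) ≤ ⟦ stateBound Q ⟧ n
stateBound-bound Q n a b c d = +-mono-≤ (s≤s (+-mono-≤ a b)) (+-mono-≤ c (+-mono-≤ d z≤n))

loopTime : Poly → Poly → Poly
loopTime pb M = con 1 ⊞ arg ⊠ (con 1 ⊞ pb ⟨ M ⟩)

loopTime-bound : ∀ pb M n {l t} → l ≤ n → t ≤ suc (l * suc (⟦ pb ⟧ (⟦ M ⟧ n))) → t ≤ ⟦ loopTime pb M ⟧ n
loopTime-bound pb M n {l} {t} l≤n t≤ = begin
  t                                      ≤⟨ t≤ ⟩
  suc (l * suc (⟦ pb ⟧ (⟦ M ⟧ n)))       ≤⟨ s≤s (*-monoˡ-≤ _ l≤n) ⟩
  suc (n * suc (⟦ pb ⟨ M ⟩ ⟧ n))         ∎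
  where open ≤-Reasoning

-- The body's time bound is a parameter here, which keeps it from being unfolded.
module FoldLoop {Γ A B : Coded} (step : Carrier (Γ ⊗ B ⊗ A) → Carrier B) (body : Command 3) (pb : Poly)
  (run-body : ∀ γ b a zs s →
    Run body (st (enc (Γ ⊗ B) (γ , b)) s (enc (Lst A) (a ∷ zs))) (st (enc (Γ ⊗ B) (γ , step ((γ , b) , a))) s (enc (Lst A) zs)) pb)
  where

  run-loop : ∀ γ s M zs b →
    (∀ ys ws → zs ≡ ys ++ ws → total (st (enc (Γ ⊗ B) (γ , foldl (λ b a → step ((γ , b) , a)) b ys)) s (enc (Lst A) ws)) ≤ M) →
    ∃ λ t → ⟨ while tmp loop body , st (enc (Γ ⊗ B) (γ , b)) s (enc (Lst A) zs) ⟩⇓⟨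
              st (enc (Γ ⊗ B) (γ , foldl (λ b a → step ((γ , b) , a)) b zs)) s nil , t ⟩
          × t ≤ suc (length zs * suc (⟦ pb ⟧ M))
  run-loop γ s M [] b bd = 1 , exit refl , ≤-refl
  run-loop γ s M (a ∷ zs) b bd
    with run-body γ b a zs s | run-loop γ s M zs (step ((γ , b) , a)) (λ ys ws e → bd (a ∷ ys) ws (cong (a ∷_) e))
  ... | ran t r t≤ | u , r′ , u≤ = suc (t + u) , again (λ ()) r r′ , s≤s (begin
    t + u                                        ≤⟨ +-mono-≤ (≤-trans t≤ (⟦⟧-mono pb (bd [] (a ∷ zs) refl))) u≤ ⟩
    ⟦ pb ⟧ M + suc (length zs * suc (⟦ pb ⟧ M))   ≡⟨ +-suc _ _ ⟩
    suc (length zs) * suc (⟦ pb ⟧ M)             ∎)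
    where open ≤-Reasoning

  module _ (xs : Carrier Γ → List (Carrier A)) (init : Carrier Γ → Carrier B) (Q : Poly)
    (bd : ∀ γ ys ws → xs γ ≡ ys ++ ws → size (enc B (foldl (λ b a → step ((γ , b) , a)) (init γ) ys)) ≤ ⟦ Q ⟧ (size (enc Γ γ)))
    where

    loop-bounded : ∀ γ s n → size (enc Γ γ) ≤ n → size s ≤ n → size (enc (Lst A) (xs γ)) ≤ n →
      ∃ λ t → ⟨ while tmp loop body , st (enc (Γ ⊗ B) (γ , init γ)) s (enc (Lst A) (xs γ)) ⟩⇓⟨
                st (enc (Γ ⊗ B) (γ , foldl (λ b a → step ((γ , b) , a)) (init γ) (xs γ))) s nil , t ⟩
            × t ≤ ⟦ loopTime pb (stateBound Q) ⟧ n
    loop-bounded γ s n γ≤n s≤n xs≤n = let (t , r , t≤) = run-loop γ s (⟦ stateBound Q ⟧ n) (xs γ) (init γ) total≤M in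
                t , r , loopTime-bound pb (stateBound Q) n (≤-trans (length≤size A (xs γ)) xs≤n) t≤
      where
      total≤M : ∀ ys ws → xs γ ≡ ys ++ ws →
                total (st (enc (Γ ⊗ B) (γ , foldl (λ b a → step ((γ , b) , a)) (init γ) ys)) s (enc (Lst A) ws)) ≤ ⟦ stateBound Q ⟧ n
      total≤M ys ws e = stateBound-bound Q n γ≤n (≤-trans (bd γ ys ws e) (⟦⟧-mono Q γ≤n)) s≤n
        (≤-trans (≤-trans (size-++ʳ A ys ws) (≤-reflexive (cong (size ∘ enc (Lst A)) (sym e)))) xs≤n)

    whole : ∀ γ s → Run (while tmp loop body) (st (enc (Γ ⊗ B) (γ , init γ)) s (enc (Lst A) (xs γ)))
                        (st (enc (Γ ⊗ B) (γ , foldl (λ b a → step ((γ , b) , a)) (init γ) (xs γ))) s nil)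
                        (loopTime pb (stateBound Q))
    whole γ s = let (t , r , t≤) = loop-bounded γ s (total (st (enc (Γ ⊗ B) (γ , init γ)) s (enc (Lst A) (xs γ))))
                                     (≤-trans (m≤n⇒m≤1+n (m≤m+n _ _)) (size-lookup (st (enc (Γ ⊗ B) (γ , init γ)) s (enc (Lst A) (xs γ))) val))
                                     (size-lookup (st (enc (Γ ⊗ B) (γ , init γ)) s (enc (Lst A) (xs γ))) stk)
                                     (size-lookup (st (enc (Γ ⊗ B) (γ , init γ)) s (enc (Lst A) (xs γ))) tmp)
                in ran t r t≤

-- A polynomial bound for one step gives none for its iterates, whose sizes could multiply in every
-- round. Hence `Q` has to bound the accumulator after every prefix of the list.
foldPT : ∀ {Γ A B step} → PT (Γ ⊗ B ⊗ A) B step → ∀ {xs init} (Q : Poly) →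
  (∀ γ ys ws → xs γ ≡ ys ++ ws → size (enc B (foldl (λ b a → step ((γ , b) , a)) (init γ) ys)) ≤ ⟦ Q ⟧ (size (enc Γ γ))) →
  PT Γ (Lst A) xs → PT Γ B init → PT Γ B (λ γ → foldl (λ b a → step ((γ , b) , a)) (init γ) (xs γ))
foldPT {Γ} {A} {B} {step} S {xs} {init} Q bd XS I = snd ∙ withContext
  where
  S′ : PT (Γ ⊗ B ⊗ A) (Γ ⊗ B) (λ x → proj₁ (proj₁ x) , step x)
  S′ = (fst ∙ fst) & S
  body : Command 3
  -- The step expects the loop register to be nil, so the rest of the list is parked on the stack.
  body = stk := cons (tail (var tmp)) (var stk) ⨾ val := cons (var val) (head (var tmp)) ⨾ tmp := nil ⨾
         cmd S′ ⨾ tmp := head (var stk) ⨾ stk := tail (var stk)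
  run-body : ∃ λ p → ∀ γ b a zs s →
    Run body (st (enc (Γ ⊗ B) (γ , b)) s (enc (Lst A) (a ∷ zs))) (st (enc (Γ ⊗ B) (γ , step ((γ , b) , a))) s (enc (Lst A) zs)) p
  run-body = _ , λ γ b a zs s →
    run-assign {x = stk} {cons (tail (var tmp)) (var stk)} ▷
    run-assign {x = val} {cons (var val) (head (var tmp))} ▷
    run-assign {x = tmp} {nil} ▷
    run S′ ((γ , b) , a) (enc (Lst A) zs · s) ▷
    run-assign {x = tmp} {head (var stk)} ▷
    run-assign {x = stk} {tail (var stk)}
  open FoldLoop {Γ} {A} {B} step body (proj₁ run-body) (proj₂ run-body)
  withContext : PT Γ (Γ ⊗ B) (λ γ → γ , foldl (λ b a → step ((γ , b) , a)) (init γ) (xs γ))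
  withContext = record { run = λ γ s →
    run (XS & idPT & I) γ s ▷ run-assign {x = tmp} {head (var val)} ▷ run-assign {x = val} {tail (var val)} ▷ whole xs init Q bd γ s }

-- List and unary arithmetic primitives

v0 : ∀ {Γ A} → PT (Γ ⊗ A) A proj₂
v0 = snd

v1 : ∀ {Γ A B} → PT (Γ ⊗ A ⊗ B) A (λ γ → proj₂ (proj₁ γ))
v1 = snd ∙ fst

v2 : ∀ {Γ A B C} → PT (Γ ⊗ A ⊗ B ⊗ C) A (λ γ → proj₂ (proj₁ (proj₁ γ)))
v2 = snd ∙ fst ∙ fst

consPT : ∀ {Γ A f g} → PT Γ A f → PT Γ (Lst A) g → PT Γ (Lst A) (λ γ → f γ ∷ g γ)
consPT F G = recode (λ _ → refl) (F & G)

nilPT : ∀ {Γ} A → PT Γ (Lst A) (λ _ → [])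
nilPT A = const (Lst A) []

size-prefix : ∀ A ys zs → size (enc (Lst A) ys) ≤ size (enc (Lst A) (ys ++ zs))
size-prefix A []       zs = size-pos _
size-prefix A (y ∷ ys) zs = s≤s (+-monoʳ-≤ _ (size-prefix A ys zs))

elements-smaller : ∀ A xs → All (λ x → size (enc A x) ≤ size (enc (Lst A) xs)) xs
elements-smaller A []       = []
elements-smaller A (x ∷ xs) =
  m≤n⇒m≤1+n (m≤m+n _ _) ∷ All.map (λ le → m≤n⇒m≤1+n (≤-trans le (m≤n+m _ _))) (elements-smaller A xs)

revOnto : ∀ {A : Set} → List A → List A → List A
revOnto ys xs = foldl (λ acc x → x ∷ acc) ys xs

size-revOnto : ∀ A ys xs → size (enc (Lst A) (revOnto ys xs)) ≤ size (enc (Lst A) ys) + size (enc (Lst A) xs)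
size-revOnto A ys []       = m≤m+n _ _
size-revOnto A ys (x ∷ xs) = begin
  size (enc (Lst A) (revOnto (x ∷ ys) xs))                      ≤⟨ size-revOnto A (x ∷ ys) xs ⟩
  suc (size (enc A x) + size (enc (Lst A) ys)) + size (enc (Lst A) xs)
                                                                ≡⟨ shift (size (enc A x)) (size (enc (Lst A) ys)) (size (enc (Lst A) xs)) ⟩
  size (enc (Lst A) ys) + suc (size (enc A x) + size (enc (Lst A) xs)) ∎
  where
  open ≤-Reasoning
  shift : ∀ a b c → suc (a + b) + c ≡ b + suc (a + c)
  shift = ℕ-Ring.solve-∀

revOntoPT : ∀ {Γ A f g} → PT Γ (Lst A) f → PT Γ (Lst A) g → PT Γ (Lst A) (λ γ → revOnto (f γ) (g γ))
revOntoPT {A = A} F G =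
  foldPT (consPT v0 v1) (arg ⊞ arg)
    (λ { (ys , xs) zs ws refl → ≤-trans (size-revOnto A ys zs) (+-mono-≤ (m≤n⇒m≤1+n (m≤m+n _ _))
                                          (m≤n⇒m≤1+n (≤-trans (size-prefix A zs ws) (m≤n+m _ _)))) })
    v0 fst ∙ (F & G)

revOnto-++ : ∀ {A : Set} (ys xs : List A) → revOnto ys xs ≡ reverse xs ++ ys
revOnto-++ ys []       = refl
revOnto-++ ys (x ∷ xs) = begin
  revOnto (x ∷ ys) xs               ≡⟨ revOnto-++ (x ∷ ys) xs ⟩
  reverse xs ++ List.[ x ] ++ ys    ≡⟨ List.++-assoc (reverse xs) List.[ x ] ys ⟨
  (reverse xs ++ List.[ x ]) ++ ys  ≡⟨ cong (_++ ys) (List.unfold-reverse x xs) ⟨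
  reverse (x ∷ xs) ++ ys            ∎
  where open ≡-Reasoning

reversePT : ∀ {Γ A f} → PT Γ (Lst A) f → PT Γ (Lst A) (λ γ → reverse (f γ))
reversePT {A = A} {f} F = ext (λ γ → trans (revOnto-++ [] (f γ)) (List.++-identityʳ _)) (revOntoPT (nilPT A) F)

module _ {A B : Set} (f : A → List B) where

  revConcat : List B → List A → List B
  revConcat acc xs = foldl (λ acc x → revOnto acc (f x)) acc xs

  revConcat-concatMap : ∀ acc xs → revConcat acc xs ≡ reverse (concatMap f xs) ++ acc
  revConcat-concatMap acc []       = refl
  revConcat-concatMap acc (x ∷ xs) = begin
    revConcat (revOnto acc (f x)) xs                        ≡⟨ revConcat-concatMap _ xs ⟩
    reverse (concatMap f xs) ++ revOnto acc (f x)           ≡⟨ cong (reverse (concatMap f xs) ++_) (revOnto-++ acc (f x)) ⟩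
    reverse (concatMap f xs) ++ reverse (f x) ++ acc        ≡⟨ List.++-assoc (reverse (concatMap f xs)) _ _ ⟨
    (reverse (concatMap f xs) ++ reverse (f x)) ++ acc      ≡⟨ cong (_++ acc) (List.reverse-++ (f x) (concatMap f xs)) ⟨
    reverse (f x ++ concatMap f xs) ++ acc                  ∎
    where open ≡-Reasoning

size-revConcat : ∀ {A : Set} B (f : A → List (Carrier B)) n acc xs →
  All (λ x → size (enc (Lst B) (f x)) ≤ n) xs →
  size (enc (Lst B) (revConcat f acc xs)) ≤ size (enc (Lst B) acc) + length xs * n
size-revConcat B f n acc []       []       = m≤m+n _ _
size-revConcat B f n acc (x ∷ xs) (p ∷ ps) = begin
  size (enc (Lst B) (revConcat f (revOnto acc (f x)) xs))       ≤⟨ size-revConcat B f n _ xs ps ⟩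
  size (enc (Lst B) (revOnto acc (f x))) + length xs * n        ≤⟨ +-monoˡ-≤ (length xs * n) (size-revOnto B acc (f x)) ⟩
  size (enc (Lst B) acc) + size (enc (Lst B) (f x)) + length xs * n
                                                                ≤⟨ +-monoˡ-≤ (length xs * n) (+-monoʳ-≤ (size (enc (Lst B) acc)) p) ⟩
  size (enc (Lst B) acc) + n + length xs * n                    ≡⟨ +-assoc (size (enc (Lst B) acc)) n _ ⟩
  size (enc (Lst B) acc) + (n + length xs * n)                  ∎
  where open ≤-Reasoning

-- Map, filter, length, sum and `any` all reduce to this loop, with unary numbers as lists of units,
-- so its accumulator bound is proved once for all of them. A step can cheaply only prepend; hence
-- the list is built in reverse.
concatMapPT : ∀ {Γ A B f xs} → PT (Γ ⊗ A) (Lst B) f → PT Γ (Lst A) xs →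
              PT Γ (Lst B) (λ γ → concatMap (λ a → f (γ , a)) (xs γ))
concatMapPT {Γ} {A} {B} {f} {xs} F XS = ext
  (λ γ → begin
     reverse (revConcat (λ a → f (γ , a)) [] (xs γ))                    ≡⟨ cong reverse (revConcat-concatMap _ [] (xs γ)) ⟩
     reverse (reverse (concatMap (λ a → f (γ , a)) (xs γ)) ++ [])       ≡⟨ cong reverse (List.++-identityʳ (reverse (concatMap (λ a → f (γ , a)) (xs γ)))) ⟩
     reverse (reverse (concatMap (λ a → f (γ , a)) (xs γ)))             ≡⟨ List.reverse-involutive (concatMap (λ a → f (γ , a)) (xs γ)) ⟩
     concatMap (λ a → f (γ , a)) (xs γ)                                 ∎)
  (reversePT (foldPT {Γ} {B = Lst B} (revOntoPT v1 (F ∙ (fst ∙ fst & v0))) (con 1 ⊞ sizeBound XS ⊠ sizeBound F ⟨ elementBound ⟩) bound XS (nilPT B)))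
  where
  open ≡-Reasoning
  elementBound : Poly
  elementBound = con 1 ⊞ (arg ⊞ sizeBound XS)
  bound : ∀ γ ys ws → xs γ ≡ ys ++ ws → _
  bound γ ys ws e =
    ≤-trans (size-revConcat B (λ a → f (γ , a)) _ [] ys
               (All.map (λ {a} le → ≤-trans (size-output F (γ , a)) (⟦⟧-mono (sizeBound F) (s≤s (+-monoʳ-≤ _ (≤-trans le (size-output XS γ))))))
                        (All.++⁻ˡ ys (subst (All _) e (elements-smaller A (xs γ))))))
            (s≤s (*-monoˡ-≤ _ (≤-trans (length≤size A ys) (≤-trans (size-prefix A ys ws)
              (≤-trans (≤-reflexive (cong (size ∘ enc (Lst A)) (sym e))) (size-output XS γ))))))

notPT : ∀ {Γ b} → PT Γ Bit b → PT Γ Bit (λ γ → not (b γ))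
notPT {b = b} B = ext (λ γ → eq (b γ)) (ifPT B (const Bit false) (const Bit true))
  where
  eq : ∀ x → (if x then false else true) ≡ not x
  eq true  = refl
  eq false = refl

andPT : ∀ {Γ b c} → PT Γ Bit b → PT Γ Bit c → PT Γ Bit (λ γ → b γ ∧ c γ)
andPT {b = b} {c} B C = ext (λ γ → eq (b γ) (c γ)) (ifPT B C (const Bit false))
  where
  eq : ∀ x y → (if x then y else false) ≡ x ∧ y
  eq true  y = refl
  eq false y = refl

orPT : ∀ {Γ b c} → PT Γ Bit b → PT Γ Bit c → PT Γ Bit (λ γ → b γ ∨ c γ)
orPT {b = b} {c} B C = ext (λ γ → eq (b γ) (c γ)) (ifPT B (const Bit true) C)
  where
  eq : ∀ x y → (if x then true else y) ≡ x ∨ y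
  eq true  y = refl
  eq false y = refl

xorPT : ∀ {Γ b c} → PT Γ Bit b → PT Γ Bit c → PT Γ Bit (λ γ → b γ xor c γ)
xorPT {b = b} {c} B C = ext (λ γ → eq (b γ) (c γ)) (ifPT B (notPT C) C)
  where
  eq : ∀ x y → (if x then not y else y) ≡ x xor y
  eq true  y = refl
  eq false y = refl

mapPT : ∀ {Γ A B f xs} → PT (Γ ⊗ A) B f → PT Γ (Lst A) xs → PT Γ (Lst B) (λ γ → map (λ a → f (γ , a)) (xs γ))
mapPT {B = B} {f} {xs} F XS = ext (λ γ → eq _ (xs γ)) (concatMapPT (consPT F (nilPT B)) XS)
  where
  eq : ∀ {A B : Set} (g : A → B) ys → concatMap (λ a → g a ∷ []) ys ≡ map g ys
  eq g []       = refl
  eq g (y ∷ ys) = cong (g y ∷_) (eq g ys)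

filterPT : ∀ {Γ A p xs} → PT (Γ ⊗ A) Bit p → PT Γ (Lst A) xs → PT Γ (Lst A) (λ γ → List.filterᵇ (λ a → p (γ , a)) (xs γ))
filterPT {A = A} {p} {xs} P XS = ext (λ γ → eq _ (xs γ)) (concatMapPT (ifPT P (consPT v0 (nilPT A)) (nilPT A)) XS)
  where
  eq : ∀ {A : Set} (q : A → Bool) ys → concatMap (λ a → if q a then a ∷ [] else []) ys ≡ List.filterᵇ q ys
  eq q []       = refl
  eq q (y ∷ ys) with q y
  ... | true  = cong (y ∷_) (eq q ys)
  ... | false = eq q ys

units : ℕ → List ⊤
units n = replicate n tt

enc-units : ∀ n → enc Nat n ≡ enc (Lst Unit) (units n)
enc-units zero    = refl
enc-units (suc n) = cong (nil ·_) (enc-units n)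

enc-length : ∀ (us : List ⊤) → enc (Lst Unit) us ≡ enc Nat (length us)
enc-length []       = refl
enc-length (u ∷ us) = cong (nil ·_) (enc-length us)

unitsPT : ∀ {Γ n} → PT Γ Nat n → PT Γ (Lst Unit) (λ γ → units (n γ))
unitsPT {n = n} = recode (λ γ → enc-units (n γ))

lengthPT : ∀ {Γ A xs} → PT Γ (Lst A) xs → PT Γ Nat (λ γ → length (xs γ))
lengthPT {xs = xs} XS = recode (λ γ → trans (enc-length _) (cong (enc Nat) (List.length-map _ (xs γ)))) (mapPT (const Unit tt) XS)

sumOver : ∀ {A : Set} → (A → ℕ) → List A → ℕ
sumOver f []       = 0
sumOver f (x ∷ xs) = f x + sumOver f xs

sumPT : ∀ {Γ A f xs} → PT (Γ ⊗ A) Nat f → PT Γ (Lst A) xs → PT Γ Nat (λ γ → sumOver (λ a → f (γ , a)) (xs γ))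
sumPT {xs = xs} F XS = recode (λ γ → trans (enc-length _) (cong (enc Nat) (eq _ (xs γ)))) (concatMapPT (unitsPT F) XS)
  where
  eq : ∀ {A : Set} (g : A → ℕ) ys → length (concatMap (λ a → units (g a)) ys) ≡ sumOver g ys
  eq g []       = refl
  eq g (y ∷ ys) = trans (List.length-++ (units (g y))) (cong₂ _+_ (List.length-replicate (g y)) (eq g ys))

sucPT : ∀ {Γ f} → PT Γ Nat f → PT Γ Nat (λ γ → suc (f γ))
sucPT F = recode (λ _ → refl) (const Unit tt & F)

predPT : ∀ {Γ f} → PT Γ Nat f → PT Γ Nat (λ γ → ℕ.pred (f γ))
predPT {f = f} F = recode (λ γ → trans (eq (f γ)) (cong (enc Nat) refl)) (caseListPT (unitsPT F) (nilPT Unit) v0)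
  where
  eq : ∀ n → enc (Lst Unit) (caseList (units n) [] (λ _ us → us)) ≡ enc Nat (ℕ.pred n)
  eq zero    = refl
  eq (suc n) = sym (enc-units n)

infixl 6 _⊕_ _⊝_
infixl 7 _⊛_

_⊕_ : ∀ {Γ f g} → PT Γ Nat f → PT Γ Nat g → PT Γ Nat (λ γ → f γ + g γ)
_⊕_ {f = f} {g} F G = ext (λ γ → cong (f γ +_) (+-identityʳ (g γ))) (sumPT v0 (consPT F (consPT G (nilPT Nat))))

_⊛_ : ∀ {Γ f g} → PT Γ Nat f → PT Γ Nat g → PT Γ Nat (λ γ → f γ * g γ)
_⊛_ {f = f} {g} F G = ext (λ γ → eq (g γ) (f γ)) (sumPT (G ∙ fst) (unitsPT F))
  where
  eq : ∀ n k → sumOver (λ _ → n) (units k) ≡ k * n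
  eq n zero    = refl
  eq n (suc k) = cong (n +_) (eq n k)

iter : ∀ {A : Set} → ℕ → (A → A) → A → A
iter zero    f x = x
iter (suc n) f x = iter n f (f x)

iterPT : ∀ {Γ B step n init} → PT (Γ ⊗ B) B step → (Q : Poly) →
  (∀ γ j → j ≤ n γ → size (enc B (iter j (λ b → step (γ , b)) (init γ))) ≤ ⟦ Q ⟧ (size (enc Γ γ))) →
  PT Γ Nat n → PT Γ B init → PT Γ B (λ γ → iter (n γ) (λ b → step (γ , b)) (init γ))
iterPT {Γ} {B} {step} {n} {init} S Q bd N I = ext (λ γ → trans (eq _ _ (units (n γ))) (cong (λ k → iter k _ _) (List.length-replicate (n γ))))
  (foldPT (S ∙ fst) Q (λ γ ys ws e → subst (λ b → size (enc B b) ≤ _) (sym (eq _ _ ys)) (bd γ (length ys) (le γ ys ws e))) (unitsPT N) I)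
  where
  eq : ∀ {B : Set} (f : B → B) b (us : List ⊤) → foldl (λ b _ → f b) b us ≡ iter (length us) f b
  eq f b []       = refl
  eq f b (u ∷ us) = eq f (f b) us
  le : ∀ γ ys ws → units (n γ) ≡ ys ++ ws → length ys ≤ n γ
  le γ ys ws e = ≤-trans (m≤m+n (length ys) (length ws))
    (≤-reflexive (trans (sym (List.length-++ ys)) (trans (cong length (sym e)) (List.length-replicate (n γ)))))

size-Nat : ∀ n → size (enc Nat n) ≡ suc (n + n)
size-Nat zero    = refl
size-Nat (suc n) = cong suc (trans (cong suc (size-Nat n)) (cong suc (sym (+-suc n n))))

size-Nat-mono : ∀ {m n} → m ≤ n → size (enc Nat m) ≤ size (enc Nat n)
size-Nat-mono {m} {n} m≤n = subst₂ _≤_ (sym (size-Nat m)) (sym (size-Nat n)) (s≤s (+-mono-≤ m≤n m≤n))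

n≤size-Nat : ∀ n → n ≤ size (enc Nat n)
n≤size-Nat n = subst (n ≤_) (sym (size-Nat n)) (m≤n⇒m≤1+n (m≤m+n n n))

iter-pred : ∀ m n → iter m ℕ.pred n ≡ n ∸ m
iter-pred zero    n       = refl
iter-pred (suc m) zero    = trans (iter-pred m 0) (0∸n≡0 m)
iter-pred (suc m) (suc n) = iter-pred m n

_⊝_ : ∀ {Γ f g} → PT Γ Nat f → PT Γ Nat g → PT Γ Nat (λ γ → f γ ∸ g γ)
_⊝_ F G = ext (λ { (n , m) → iter-pred m n })
  (iterPT (predPT v0) arg (λ { (n , m) j _ → ≤-trans (size-Nat-mono (≤-trans (≤-reflexive (iter-pred j n)) (m∸n≤m n j))) (m≤n⇒m≤1+n (m≤m+n (size (enc Nat n)) (size (enc Nat m)))) }) snd fst) ∙ (F & G)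

isZeroPT : ∀ {Γ f} → PT Γ Nat f → PT Γ Bit (λ γ → f γ ℕ.≤ᵇ 0)
isZeroPT {f = f} F = ext (λ γ → eq (f γ)) (caseListPT (unitsPT F) (const Bit true) (const Bit false))
  where
  eq : ∀ n → caseList (units n) true (λ _ _ → false) ≡ (n ℕ.≤ᵇ 0)
  eq zero    = refl
  eq (suc n) = refl

leqPT : ∀ {Γ f g} → PT Γ Nat f → PT Γ Nat g → PT Γ Bit (λ γ → f γ ℕ.≤ᵇ g γ)
leqPT {f = f} {g} F G = ext (λ γ → eq (f γ) (g γ)) (isZeroPT (F ⊝ G))
  where
  eq : ∀ m n → (m ∸ n ℕ.≤ᵇ 0) ≡ (m ℕ.≤ᵇ n)
  eq zero    zero    = refl
  eq zero    (suc n) = refl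
  eq (suc m) zero    = refl
  eq (suc zero) (suc n) = eq zero n
  eq (suc (suc m)) (suc n) = eq (suc m) n

eqPT : ∀ {Γ f g} → PT Γ Nat f → PT Γ Nat g → PT Γ Bit (λ γ → f γ ℕ.≡ᵇ g γ)
eqPT {f = f} {g} F G = ext (λ γ → eq (f γ) (g γ)) (andPT (leqPT F G) (leqPT G F))
  where
  eq : ∀ m n → (m ℕ.≤ᵇ n) ∧ (n ℕ.≤ᵇ m) ≡ (m ℕ.≡ᵇ n)
  eq zero    zero    = refl
  eq zero    (suc n) = refl
  eq (suc m) zero    = refl
  eq (suc zero) (suc zero) = refl
  eq (suc zero) (suc (suc n)) = refl
  eq (suc (suc m)) (suc zero) = refl
  eq (suc (suc m)) (suc (suc n)) = eq (suc m) (suc n)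

minPT : ∀ {Γ f g} → PT Γ Nat f → PT Γ Nat g → PT Γ Nat (λ γ → f γ ℕ.⊓ g γ)
minPT {f = f} {g} F G = ext (λ γ → m∸[m∸n]≡n⊓m (f γ) (g γ)) (F ⊝ (F ⊝ G))
  where
  m∸[m∸n]≡n⊓m : ∀ m n → m ∸ (m ∸ n) ≡ m ℕ.⊓ n
  m∸[m∸n]≡n⊓m m n with ≤-total m n
  ... | inj₁ m≤n = trans (cong (m ∸_) (m≤n⇒m∸n≡0 m≤n)) (sym (m≤n⇒m⊓n≡m m≤n))
  ... | inj₂ n≤m = trans (m∸[m∸n]≡n n≤m) (sym (m≥n⇒m⊓n≡n n≤m))

maxPT : ∀ {Γ f g} → PT Γ Nat f → PT Γ Nat g → PT Γ Nat (λ γ → f γ ℕ.⊔ g γ)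
maxPT {f = f} {g} F G = ext (λ γ → eq (f γ) (g γ)) (F ⊕ (G ⊝ F))
  where
  eq : ∀ m n → m + (n ∸ m) ≡ m ℕ.⊔ n
  eq m n with ≤-total m n
  ... | inj₁ m≤n = trans (m+[n∸m]≡n m≤n) (sym (m≤n⇒m⊔n≡n m≤n))
  ... | inj₂ n≤m = trans (cong (m +_) (m≤n⇒m∸n≡0 n≤m)) (trans (+-identityʳ m) (sym (m≥n⇒m⊔n≡m n≤m)))

anyPT : ∀ {Γ A p xs} → PT (Γ ⊗ A) Bit p → PT Γ (Lst A) xs → PT Γ Bit (λ γ → any (λ a → p (γ , a)) (xs γ))
anyPT {p = p} {xs} P XS = ext (λ γ → eq _ (xs γ)) (caseListPT (filterPT P XS) (const Bit false) (const Bit true))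
  where
  eq : ∀ {A : Set} (q : A → Bool) ys → caseList (List.filterᵇ q ys) false (λ _ _ → true) ≡ any q ys
  eq q []       = refl
  eq q (y ∷ ys) with q y
  ... | true  = refl
  ... | false = eq q ys

iter-suc : ∀ {A : Set} n (f : A → A) x → iter (suc n) f x ≡ f (iter n f x)
iter-suc zero    f x = refl
iter-suc (suc n) f x = iter-suc n f (f x)

size-list : ∀ A n xs → All (λ x → size (enc A x) ≤ n) xs → size (enc (Lst A) xs) ≤ suc (length xs * suc n)
size-list A n []       []       = ≤-refl
size-list A n (x ∷ xs) (p ∷ ps) = s≤s (≤-trans (+-mono-≤ p (size-list A n xs ps)) (≤-reflexive (+-suc n _)))

downFrom-bound : ∀ n j → j ≤ n → All (λ i → size (enc Nat i) ≤ size (enc Nat n)) (List.downFrom j)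
downFrom-bound n zero    j≤n = []
downFrom-bound n (suc j) j≤n = size-Nat-mono (<⇒≤ j≤n) ∷ downFrom-bound n j (<⇒≤ j≤n)

-- The number to be prepended next is the length of the list built so far, so no counter is carried
-- along.
downFromPT : ∀ {Γ n} → PT Γ Nat n → PT Γ (Lst Nat) (λ γ → List.downFrom (n γ))
downFromPT N = ext eq (iterPT (consPT (lengthPT v0) v0) (con 1 ⊞ arg ⊠ (con 1 ⊞ arg)) bound idPT (nilPT Nat)) ∙ N
  where
  grow : List ℕ → List ℕ
  grow l = length l ∷ l
  eq : ∀ j → iter j grow [] ≡ List.downFrom j
  eq zero    = refl
  eq (suc j) = trans (iter-suc j grow []) (trans (cong grow (eq j)) (cong (_∷ List.downFrom j) (List.length-downFrom j)))
  bound : ∀ n j → j ≤ n → size (enc (Lst Nat) (iter j grow [])) ≤ suc (size (enc Nat n) * suc (size (enc Nat n)))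
  bound n j j≤n = subst (λ l → size (enc (Lst Nat) l) ≤ _) (sym (eq j))
    (≤-trans (size-list Nat (size (enc Nat n)) (List.downFrom j) (downFrom-bound n j j≤n))
             (s≤s (*-monoˡ-≤ _ (≤-trans (≤-reflexive (List.length-downFrom j)) (≤-trans j≤n (n≤size-Nat n))))))

-- Binary numbers as lists of exponents

-- A list of (unary) exponents denotes the sum of the corresponding powers of
-- two; repetitions are allowed, so that addition and multiplication need no carries.
value : List ℕ → ℕ
value = sumOver (2 ^_)

sumOver-++ : ∀ {A : Set} (f : A → ℕ) xs ys → sumOver f (xs ++ ys) ≡ sumOver f xs + sumOver f ys
sumOver-++ f []       ys = refl
sumOver-++ f (x ∷ xs) ys = trans (cong (f x +_) (sumOver-++ f xs ys)) (sym (+-assoc (f x) _ _))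

times : List ℕ → List ℕ → List ℕ
times xs ys = concatMap (λ x → map (λ y → x + y) ys) xs

timesPT : ∀ {Γ f g} → PT Γ (Lst Nat) f → PT Γ (Lst Nat) g → PT Γ (Lst Nat) (λ γ → times (f γ) (g γ))
timesPT F G = concatMapPT (mapPT (v1 ⊕ v0) (G ∙ fst)) F

value-shift : ∀ x ys → value (map (λ y → x + y) ys) ≡ 2 ^ x * value ys
value-shift x []       = sym (*-zeroʳ (2 ^ x))
value-shift x (y ∷ ys) = trans (cong₂ _+_ (^-distribˡ-+-* 2 x y) (value-shift x ys)) (sym (*-distribˡ-+ (2 ^ x) (2 ^ y) _))

value-times : ∀ xs ys → value (times xs ys) ≡ value xs * value ys
value-times []       ys = refl
value-times (x ∷ xs) ys = begin
  value (map (λ y → x + y) ys ++ times xs ys)             ≡⟨ sumOver-++ (2 ^_) (map (λ y → x + y) ys) _ ⟩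
  value (map (λ y → x + y) ys) + value (times xs ys)      ≡⟨ cong₂ _+_ (value-shift x ys) (value-times xs ys) ⟩
  2 ^ x * value ys + value xs * value ys                  ≡⟨ *-distribʳ-+ (value ys) (2 ^ x) _ ⟨
  (2 ^ x + value xs) * value ys                           ∎
  where open ≡-Reasoning

repeat : ℕ → List ℕ → List ℕ
repeat n xs = concatMap (λ _ → xs) (units n)

repeatPT : ∀ {Γ f g} → PT Γ Nat f → PT Γ (Lst Nat) g → PT Γ (Lst Nat) (λ γ → repeat (f γ) (g γ))
repeatPT F G = concatMapPT (G ∙ fst) (unitsPT F)

value-repeat : ∀ n xs → value (repeat n xs) ≡ n * value xs
value-repeat zero    xs = refl
value-repeat (suc n) xs = trans (sumOver-++ (2 ^_) xs _) (cong (value xs +_) (value-repeat n xs))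

-- Comparison from the least significant digit upwards

low : List ℕ → ℕ
low xs = length (List.filterᵇ (λ x → x ℕ.≤ᵇ 0) xs)

high : List ℕ → List ℕ
high xs = map ℕ.pred (List.filterᵇ (λ x → not (x ℕ.≤ᵇ 0)) xs)

value-split : ∀ xs → value xs ≡ low xs + 2 * value (high xs)
value-split []           = refl
value-split (zero  ∷ xs) = cong suc (value-split xs)
value-split (suc x ∷ xs) = trans (cong (2 * 2 ^ x +_) (value-split xs)) (shuffle (2 ^ x) (low xs) (value (high xs)))
  where
  shuffle : ∀ a b c → 2 * a + (b + 2 * c) ≡ b + 2 * (a + c)
  shuffle = ℕ-Ring.solve-∀

length-split : ∀ xs → low xs + length (high xs) ≡ length xs
length-split []           = refl
length-split (zero  ∷ xs) = cong suc (length-split xs)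
length-split (suc x ∷ xs) = trans (+-suc (low xs) _) (cong suc (length-split xs))

high-≤ : ∀ K xs → All (_≤ suc K) xs → All (_≤ K) (high xs)
high-≤ K []           []           = []
high-≤ K (zero  ∷ xs) (p ∷ ps)     = high-≤ K xs ps
high-≤ K (suc x ∷ xs) (s≤s p ∷ ps) = p ∷ high-≤ K xs ps

high-empty : ∀ xs → All (_≤ 0) xs → high xs ≡ []
high-empty []           []        = refl
high-empty (zero  ∷ xs) (p ∷ ps)  = high-empty xs ps

lowPT : ∀ {Γ f} → PT Γ (Lst Nat) f → PT Γ Nat (λ γ → low (f γ))
lowPT F = lengthPT (filterPT (isZeroPT v0) F)

highPT : ∀ {Γ f} → PT Γ (Lst Nat) f → PT Γ (Lst Nat) (λ γ → high (f γ))
highPT F = mapPT (predPT v0) (filterPT (notPT (isZeroPT v0)) F)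

halvesPT : ∀ {Γ f} → PT Γ Nat f → PT Γ (Nat ⊗ Nat) (λ γ → ℕ.⌊ f γ /2⌋ , ℕ.⌈ f γ /2⌉)
halvesPT F = ext eq (iterPT (snd ∙ v0 & sucPT (fst ∙ v0)) (con 1 ⊞ (arg ⊞ arg)) bound idPT (const (Nat ⊗ Nat) (0 , 0))) ∙ F
  where
  turn : ℕ × ℕ → ℕ × ℕ
  turn p = proj₂ p , suc (proj₁ p)
  eq : ∀ n → iter n turn (0 , 0) ≡ (ℕ.⌊ n /2⌋ , ℕ.⌈ n /2⌉)
  eq zero    = refl
  eq (suc n) = trans (iter-suc n turn (0 , 0)) (cong turn (eq n))
  bound : ∀ n j → j ≤ n → size (enc (Nat ⊗ Nat) (iter j turn (0 , 0))) ≤ suc (size (enc Nat n) + size (enc Nat n))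
  bound n j j≤n = subst (λ p → size (enc (Nat ⊗ Nat) p) ≤ _) (sym (eq j))
    (s≤s (+-mono-≤ (size-Nat-mono (≤-trans (⌊n/2⌋≤n j) j≤n)) (size-Nat-mono (≤-trans (⌈n/2⌉≤n j) j≤n))))

Compare : Coded
Compare = (Lst Nat ⊗ Lst Nat) ⊗ (Nat ⊗ Nat)

-- The unary parts of both sides are cancelled against each other before halving. A surplus d on the
-- left is halved upwards and one on the right downwards, because d + 2x ≤ 2y iff ⌈d/2⌉ + x ≤ y, and
-- 2x ≤ d + 2y iff x ≤ ⌊d/2⌋ + y.
advance : Carrier Compare → Carrier Compare
advance ((A , B) , (a , b)) =
  (high A , high B) ,
  (ℕ.⌈ (a + low A) ∸ (b + low B) /2⌉ , ℕ.⌊ (b + low B) ∸ (a + low A) /2⌋)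

leqState : Carrier Compare → Set
leqState ((A , B) , (a , b)) = a + value A ≤ b + value B

⌊/2⌋-+ : ∀ d y → ℕ.⌊ d + (y + y) /2⌋ ≡ ℕ.⌊ d /2⌋ + y
⌊/2⌋-+ d zero    = trans (cong ℕ.⌊_/2⌋ (+-identityʳ d)) (sym (+-identityʳ _))
⌊/2⌋-+ d (suc y) = begin
  ℕ.⌊ d + suc (y + suc y) /2⌋    ≡⟨ cong ℕ.⌊_/2⌋ (shift d y) ⟩
  suc ℕ.⌊ d + (y + y) /2⌋        ≡⟨ cong suc (⌊/2⌋-+ d y) ⟩
  suc (ℕ.⌊ d /2⌋ + y)            ≡⟨ +-suc _ y ⟨
  ℕ.⌊ d /2⌋ + suc y              ∎
  where
  open ≡-Reasoning
  shift : ∀ d y → d + suc (y + suc y) ≡ suc (suc (d + (y + y)))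
  shift = ℕ-Ring.solve-∀

floor-≤ : ∀ d x y → x + x ≤ d + (y + y) → x ≤ ℕ.⌊ d /2⌋ + y
floor-≤ d x y le = subst₂ _≤_ (sym (n≡⌊n+n/2⌋ x)) (⌊/2⌋-+ d y) (⌊n/2⌋-mono le)

floor-≤⁻¹ : ∀ d x y → x ≤ ℕ.⌊ d /2⌋ + y → x + x ≤ d + (y + y)
floor-≤⁻¹ d x y le = begin
  x + x                                        ≤⟨ +-mono-≤ le le ⟩
  (ℕ.⌊ d /2⌋ + y) + (ℕ.⌊ d /2⌋ + y)            ≡⟨ swap ℕ.⌊ d /2⌋ y ⟩
  (ℕ.⌊ d /2⌋ + ℕ.⌊ d /2⌋) + (y + y)            ≤⟨ +-monoˡ-≤ (y + y) (≤-trans (+-monoʳ-≤ ℕ.⌊ d /2⌋ (⌊n/2⌋≤⌈n/2⌉ d)) (≤-reflexive (⌊n/2⌋+⌈n/2⌉≡n d))) ⟩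
  d + (y + y)                                  ∎
  where
  open ≤-Reasoning
  swap : ∀ a b → (a + b) + (a + b) ≡ (a + a) + (b + b)
  swap = ℕ-Ring.solve-∀

ceil-≤ : ∀ d x y → d + (x + x) ≤ y + y → ℕ.⌈ d /2⌉ + x ≤ y
ceil-≤ d x y le = subst₂ _≤_ (⌊/2⌋-+ (suc d) x) (sym (n≡⌈n+n/2⌉ y)) (⌊n/2⌋-mono (s≤s le))

ceil-≤⁻¹ : ∀ d x y → ℕ.⌈ d /2⌉ + x ≤ y → d + (x + x) ≤ y + y
ceil-≤⁻¹ d x y le = begin
  d + (x + x)                                  ≤⟨ +-monoˡ-≤ (x + x) (≤-trans (≤-reflexive (sym (⌊n/2⌋+⌈n/2⌉≡n d))) (+-monoˡ-≤ ℕ.⌈ d /2⌉ (⌊n/2⌋≤⌈n/2⌉ d))) ⟩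
  (ℕ.⌈ d /2⌉ + ℕ.⌈ d /2⌉) + (x + x)            ≡⟨ swap ℕ.⌈ d /2⌉ x ⟩
  (ℕ.⌈ d /2⌉ + x) + (ℕ.⌈ d /2⌉ + x)            ≤⟨ +-mono-≤ le le ⟩
  y + y                                        ∎
  where
  open ≤-Reasoning
  swap : ∀ a b → (a + a) + (b + b) ≡ (a + b) + (a + b)
  swap = ℕ-Ring.solve-∀

double : ∀ x → 2 * x ≡ x + x
double x = cong (_+_ x) (+-identityʳ x)

halve-≤ : ∀ u w x y → (u + 2 * x ≤ w + 2 * y → ℕ.⌈ u ∸ w /2⌉ + x ≤ ℕ.⌊ w ∸ u /2⌋ + y) ×
                      (ℕ.⌈ u ∸ w /2⌉ + x ≤ ℕ.⌊ w ∸ u /2⌋ + y → u + 2 * x ≤ w + 2 * y)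
halve-≤ u w x y rewrite double x | double y with ≤-total u w
... | inj₁ u≤w with w ∸ u | m+[n∸m]≡n u≤w | u ∸ w | m≤n⇒m∸n≡0 u≤w
... | d | refl | _ | refl rewrite +-assoc u d (y + y) =
  (λ le → floor-≤ d x y (+-cancelˡ-≤ u _ _ le)) , (λ le → +-monoʳ-≤ u (floor-≤⁻¹ d x y le))
halve-≤ u w x y | inj₂ w≤u with u ∸ w | m+[n∸m]≡n w≤u | w ∸ u | m≤n⇒m∸n≡0 w≤u
... | d | refl | _ | refl rewrite +-assoc w d (x + x) =
  (λ le → ceil-≤ d x y (+-cancelˡ-≤ w _ _ le)) , (λ le → +-monoʳ-≤ w (ceil-≤⁻¹ d x y le))

regroup : ∀ a A → a + value A ≡ (a + low A) + 2 * value (high A)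
regroup a A = trans (cong (a +_) (value-split A)) (sym (+-assoc a (low A) _))

advance-correct : ∀ s → (leqState s → leqState (advance s)) × (leqState (advance s) → leqState s)
advance-correct ((A , B) , (a , b)) =
  let (f , g) = halve-≤ (a + low A) (b + low B) (value (high A)) (value (high B)) in
  (λ le → f (subst₂ _≤_ (regroup a A) (regroup b B) le)) , (λ le → subst₂ _≤_ (sym (regroup a A)) (sym (regroup b B)) (g le))

advance-iter : ∀ n s → (leqState s → leqState (iter n advance s)) × (leqState (iter n advance s) → leqState s)
advance-iter zero    s = id , id
advance-iter (suc n) s =
  (λ le → proj₁ (advance-iter n (advance s)) (proj₁ (advance-correct s) le)) ,
  (λ le → proj₂ (advance-correct s) (proj₂ (advance-iter n (advance s)) le))

advance-exhausts : ∀ n s → All (_≤ n) (proj₁ (proj₁ s)) → All (_≤ n) (proj₂ (proj₁ s)) →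
                   proj₁ (iter (suc n) advance s) ≡ ([] , [])
advance-exhausts zero    s p q = cong₂ _,_ (high-empty _ p) (high-empty _ q)
advance-exhausts (suc n) s p q = advance-exhausts n (advance s) (high-≤ n _ p) (high-≤ n _ q)

-- The sum of all exponents is a crude bound on the largest one; one round more than that empties
-- both lists, and then the carries alone decide.
leqList : List ℕ → List ℕ → Bool
leqList A B = let (a , b) = proj₂ (iter (suc (sumOver id A + sumOver id B)) advance ((A , B) , (0 , 0))) in a ℕ.≤ᵇ b

all-≤-sum : ∀ xs → All (_≤ sumOver id xs) xs
all-≤-sum []       = []
all-≤-sum (x ∷ xs) = m≤m+n x _ ∷ All.map (λ le → ≤-trans le (m≤n+m _ x)) (all-≤-sum xs)

leqList-correct : ∀ A B → (T (leqList A B) → value A ≤ value B) × (value A ≤ value B → T (leqList A B))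
leqList-correct A B = (λ t → back (fromCarries _ done (≤ᵇ⇒≤ _ _ t))) , (λ le → ≤⇒≤ᵇ (toCarries _ done (forth le)))
  where
  n : ℕ
  n = sumOver id A + sumOver id B
  s : Carrier Compare
  s = iter (suc n) advance ((A , B) , (0 , 0))
  done : proj₁ s ≡ ([] , [])
  done = advance-exhausts n ((A , B) , (0 , 0)) (All.map (λ le → ≤-trans le (m≤m+n _ _)) (all-≤-sum A)) (All.map (λ le → ≤-trans le (m≤n+m _ _)) (all-≤-sum B))
  forth : value A ≤ value B → leqState s
  forth = proj₁ (advance-iter (suc n) ((A , B) , (0 , 0)))
  back : leqState s → value A ≤ value B
  back = proj₂ (advance-iter (suc n) ((A , B) , (0 , 0)))
  toCarries : ∀ s → proj₁ s ≡ ([] , []) → leqState s → proj₁ (proj₂ s) ≤ proj₂ (proj₂ s)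
  toCarries (_ , (a , b)) refl le = subst₂ _≤_ (+-identityʳ a) (+-identityʳ b) le
  fromCarries : ∀ s → proj₁ s ≡ ([] , []) → proj₁ (proj₂ s) ≤ proj₂ (proj₂ s) → leqState s
  fromCarries (_ , (a , b)) refl le = subst₂ _≤_ (sym (+-identityʳ a)) (sym (+-identityʳ b)) le

-- An exponent that leaves a list adds at most one to the carry, so carry plus length never grows.
-- This keeps the unary carries small although the numbers compared may be exponentially large.
SmallState : ℕ → Carrier Compare → Set
SmallState K ((A , B) , (a , b)) = (All (_≤ K) A × a + length A ≤ K) × (All (_≤ K) B × b + length B ≤ K)

high-small : ∀ K xs → All (_≤ K) xs → All (_≤ K) (high xs)
high-small K xs p = high-≤ K xs (All.map m≤n⇒m≤1+n p)

carry-small : ∀ {K c u} A a → c ≤ ℕ.⌈ u /2⌉ → u ≤ a + low A → a + length A ≤ K → c + length (high A) ≤ K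
carry-small {K} {c} {u} A a c≤ u≤ le = begin
  c + length (high A)            ≤⟨ +-monoˡ-≤ (length (high A)) (≤-trans c≤ (≤-trans (⌈n/2⌉≤n u) u≤)) ⟩
  a + low A + length (high A)    ≡⟨ trans (+-assoc a (low A) _) (cong (a +_) (length-split A)) ⟩
  a + length A                   ≤⟨ le ⟩
  K                              ∎
  where open ≤-Reasoning

advance-small : ∀ K s → SmallState K s → SmallState K (advance s)
advance-small K ((A , B) , (a , b)) ((pA , lA) , (pB , lB)) =
  (high-small K A pA , carry-small A a ≤-refl (m∸n≤m (a + low A) (b + low B)) lA) ,
  (high-small K B pB , carry-small B b (⌊n/2⌋≤⌈n/2⌉ _) (m∸n≤m (b + low B) (a + low A)) lB)

iter-invariant : ∀ {A : Set} (P : A → Set) {f : A → A} → (∀ x → P x → P (f x)) → ∀ n x → P x → P (iter n f x)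
iter-invariant P pres zero    x p = p
iter-invariant P pres (suc n) x p = iter-invariant P pres n _ (pres x p)

natListBound : Poly
natListBound = con 1 ⊞ arg ⊠ (con 1 ⊞ (con 1 ⊞ (arg ⊞ arg)))

size-natList : ∀ K xs → All (_≤ K) xs → length xs ≤ K → size (enc (Lst Nat) xs) ≤ ⟦ natListBound ⟧ K
size-natList K xs p l = ≤-trans (size-list Nat (suc (K + K)) xs (All.map (λ {x} le → ≤-trans (size-Nat-mono le) (≤-reflexive (size-Nat K))) p))
                                (s≤s (*-monoˡ-≤ (suc (suc (K + K))) l))

smallBound : Poly
smallBound = con 1 ⊞ ((con 1 ⊞ (natListBound ⊞ natListBound)) ⊞ (con 1 ⊞ ((con 1 ⊞ (arg ⊞ arg)) ⊞ (con 1 ⊞ (arg ⊞ arg)))))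

size-small : ∀ K s → SmallState K s → size (enc Compare s) ≤ ⟦ smallBound ⟧ K
size-small K ((A , B) , (a , b)) ((pA , lA) , (pB , lB)) =
  s≤s (+-mono-≤ (s≤s (+-mono-≤ (size-natList K A pA (≤-trans (m≤n+m _ a) lA)) (size-natList K B pB (≤-trans (m≤n+m _ b) lB))))
                (s≤s (+-mono-≤ (≤-trans (size-Nat-mono (≤-trans (m≤m+n a _) lA)) (≤-reflexive (size-Nat K)))
                               (≤-trans (size-Nat-mono (≤-trans (m≤m+n b _) lB)) (≤-reflexive (size-Nat K))))))

all-≤-size : ∀ xs → All (_≤ size (enc (Lst Nat) xs)) xs
all-≤-size xs = All.map (λ {x} le → ≤-trans (n≤size-Nat x) le) (elements-smaller Nat xs)

leqListPT : ∀ {Γ f g} → PT Γ (Lst Nat) f → PT Γ (Lst Nat) g → PT Γ Bit (λ γ → leqList (f γ) (g γ))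
leqListPT F G = leqPT (fst ∙ snd) (snd ∙ snd) ∙ loopPT ∙ (F & G)
  where
  advancePT : PT (Lst Nat ⊗ Lst Nat ⊗ Compare) Compare (λ γ → advance (proj₂ γ))
  advancePT = advance′ ∙ v0
    where
    u w : PT Compare Nat _
    u = fst ∙ snd ⊕ lowPT (fst ∙ fst)
    w = snd ∙ snd ⊕ lowPT (snd ∙ fst)
    advance′ : PT Compare Compare advance
    advance′ = (highPT (fst ∙ fst) & highPT (snd ∙ fst)) & (snd ∙ halvesPT (u ⊝ w) & fst ∙ halvesPT (w ⊝ u))
  bound : ∀ γ j → j ≤ suc (sumOver id (proj₁ γ) + sumOver id (proj₂ γ)) →
          size (enc Compare (iter j advance (γ , (0 , 0)))) ≤ ⟦ smallBound ⟧ (size (enc (Lst Nat ⊗ Lst Nat) γ))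
  bound (A , B) j _ = size-small _ _ (iter-invariant (SmallState _) (advance-small _) j _
    ((All.map (λ le → ≤-trans le A≤) (all-≤-size A) , ≤-trans (length≤size Nat A) A≤) ,
     (All.map (λ le → ≤-trans le B≤) (all-≤-size B) , ≤-trans (length≤size Nat B) B≤)))
    where
    A≤ : size (enc (Lst Nat) A) ≤ size (enc (Lst Nat ⊗ Lst Nat) (A , B))
    A≤ = m≤n⇒m≤1+n (m≤m+n _ _)
    B≤ : size (enc (Lst Nat) B) ≤ size (enc (Lst Nat ⊗ Lst Nat) (A , B))
    B≤ = m≤n⇒m≤1+n (m≤n+m _ _)
  loopPT : PT (Lst Nat ⊗ Lst Nat) Compare (λ γ → iter (suc (sumOver id (proj₁ γ) + sumOver id (proj₂ γ))) advance (γ , (0 , 0)))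
  loopPT = iterPT advancePT smallBound bound (sucPT (sumPT v0 fst ⊕ sumPT v0 snd)) (idPT & const (Nat ⊗ Nat) (0 , 0))

-- Decoding of binary numbers

digits : ℕᵇ → List Bool
digits ℕᵇ.zero  = []
digits 2[1+ x ] = false ∷ digits x
digits 1+[2 x ] = true ∷ digits x

enc-digits : ∀ x → encodeℕᵇ x ≡ enc (Lst Bit) (digits x)
enc-digits ℕᵇ.zero  = refl
enc-digits 2[1+ x ] = cong (nil ·_) (enc-digits x)
enc-digits 1+[2 x ] = cong ((nil · nil) ·_) (enc-digits x)

digitValue : List Bool → ℕ
digitValue []           = 0
digitValue (true  ∷ ds) = suc (2 * digitValue ds)
digitValue (false ∷ ds) = 2 * suc (digitValue ds)

digitValue-digits : ∀ x → digitValue (digits x) ≡ Binary.toℕ x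
digitValue-digits ℕᵇ.zero  = refl
digitValue-digits 2[1+ x ] = cong (λ n → 2 * suc n) (digitValue-digits x)
digitValue-digits 1+[2 x ] = cong (λ n → suc (2 * n)) (digitValue-digits x)

-- The digit 2 of the bijective notation becomes a repeated exponent, which exponent lists permit.
readDigit : ℕ × List ℕ → Bool → ℕ × List ℕ
readDigit p b = suc (proj₁ p) , (if b then proj₁ p ∷ proj₂ p else proj₁ p ∷ proj₁ p ∷ proj₂ p)

exponents : List Bool → List ℕ
exponents ds = proj₂ (foldl readDigit (0 , []) ds)

value-readDigits : ∀ i acc ds → value (proj₂ (foldl readDigit (i , acc) ds)) ≡ value acc + 2 ^ i * digitValue ds
value-readDigits i acc []           = sym (trans (cong (value acc +_) (*-zeroʳ (2 ^ i))) (+-identityʳ _))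
value-readDigits i acc (true  ∷ ds) = trans (value-readDigits (suc i) (i ∷ acc) ds) (shuffle (2 ^ i) (value acc) (digitValue ds))
  where
  shuffle : ∀ p a v → (p + a) + 2 * p * v ≡ a + p * suc (2 * v)
  shuffle = ℕ-Ring.solve-∀
value-readDigits i acc (false ∷ ds) = trans (value-readDigits (suc i) (i ∷ i ∷ acc) ds) (shuffle (2 ^ i) (value acc) (digitValue ds))
  where
  shuffle : ∀ p a v → (p + (p + a)) + 2 * p * v ≡ a + p * (2 * suc v)
  shuffle = ℕ-Ring.solve-∀

value-exponents : ∀ ds → value (exponents ds) ≡ digitValue ds
value-exponents ds = trans (value-readDigits 0 [] ds) (+-identityʳ _)

exponentsPT : ∀ {Γ f} → PT Γ (Lst Bit) f → PT Γ (Lst Nat) (λ γ → exponents (f γ))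
exponentsPT F = snd ∙ foldPT step bound-poly bound idPT (const (Nat ⊗ Lst Nat) (0 , [])) ∙ F
  where
  step : PT (Lst Bit ⊗ (Nat ⊗ Lst Nat) ⊗ Bit) (Nat ⊗ Lst Nat) (λ γ → readDigit (proj₂ (proj₁ γ)) (proj₂ γ))
  step = sucPT (fst ∙ v1) & ifPT v0 (consPT (fst ∙ v1) (snd ∙ v1)) (consPT (fst ∙ v1) (consPT (fst ∙ v1) (snd ∙ v1)))
  Small : ℕ → ℕ × List ℕ → Set
  Small K (i , acc) = i ≤ K × All (_≤ K) acc × length acc ≤ i + i
  small : ∀ K ds i acc → i + length ds ≤ K → Small K (i , acc) → Small K (foldl readDigit (i , acc) ds)
  small K []           i acc le p = p
  small K (true  ∷ ds) i acc le (a , b , c) =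
    small K ds (suc i) (i ∷ acc) (≤-trans (≤-reflexive (sym (+-suc i _))) le)
      (≤-trans (≤-trans (s≤s (m≤m+n i _)) (≤-reflexive (sym (+-suc i (length ds))))) le , a ∷ b , s≤s (≤-trans c (+-monoʳ-≤ i (n≤1+n i))))
  small K (false ∷ ds) i acc le (a , b , c) =
    small K ds (suc i) (i ∷ i ∷ acc) (≤-trans (≤-reflexive (sym (+-suc i _))) le)
      (≤-trans (≤-trans (s≤s (m≤m+n i _)) (≤-reflexive (sym (+-suc i (length ds))))) le , a ∷ a ∷ b ,
       s≤s (≤-trans (s≤s c) (≤-reflexive (sym (+-suc i i)))))
  bound-poly : Poly
  bound-poly = con 1 ⊞ ((con 1 ⊞ (arg ⊞ arg)) ⊞ natListBound ⟨ arg ⊞ arg ⟩)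
  bound : ∀ γ ys ws → γ ≡ ys ++ ws → size (enc (Nat ⊗ Lst Nat) (foldl readDigit (0 , []) ys)) ≤ ⟦ bound-poly ⟧ (size (enc (Lst Bit) γ))
  bound γ ys ws refl = let (p , q , r) = small K ys 0 [] ys≤K (z≤n , [] , z≤n) in
    s≤s (+-mono-≤ (≤-trans (size-Nat-mono p) (≤-reflexive (size-Nat K)))
                  (size-natList (K + K) _ (All.map (λ le → ≤-trans le (m≤m+n K K)) q) (≤-trans r (+-mono-≤ p p))))
    where
    K : ℕ
    K = size (enc (Lst Bit) (ys ++ ws))
    ys≤K : length ys ≤ K
    ys≤K = ≤-trans (length≤size Bit ys) (size-prefix Bit ys ws)

Bin : Coded
Carrier Bin = ℕ
enc Bin     = encodeℕ

binary : ℕ → List ℕ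
binary n = exponents (digits (fromℕ n))

binaryPT : ∀ {Γ f} → PT Γ Bin f → PT Γ (Lst Nat) (λ γ → binary (f γ))
binaryPT F = exponentsPT (reinterpret (λ n → enc-digits (fromℕ n)) ∙ F)

value-binary : ∀ n → value (binary n) ≡ n
value-binary n = trans (value-exponents (digits (fromℕ n))) (trans (digitValue-digits (fromℕ n)) (Binary.toℕ-fromℕ n))

-- Counting an initial segment of ℕ

countBelow : ℕ → (ℕ → Bool) → ℕ
countBelow n p = length (List.filterᵇ p (List.downFrom n))

countBelowPT : ∀ {Γ n p} → PT Γ Nat n → PT (Γ ⊗ Nat) Bit p → PT Γ Nat (λ γ → countBelow (n γ) (λ j → p (γ , j)))
countBelowPT N P = lengthPT (filterPT P (downFromPT N))

countBelow-≤ : ∀ n p → countBelow n p ≤ n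
countBelow-≤ n p = ≤-trans (List.length-filter (λ x → Bool.T? (p x)) (List.downFrom n)) (≤-reflexive (List.length-downFrom n))

countBelow-full : ∀ n p → (∀ j → T (p (suc j)) → T (p j)) → (∀ j → suc j ≡ n → T (p j)) → countBelow n p ≡ n
countBelow-full zero    p down top = refl
countBelow-full (suc n) p down top with p n in eq
... | true  = cong suc (countBelow-full n p down (λ { j refl → down j (subst T (sym eq) tt) }))
... | false = ⊥-elim (subst T eq (top n refl))

-- For a downward closed test the number of successes is also the place where they stop. This serves
-- as unary search, for truncation and for division.
countBelow-threshold : ∀ n p → (∀ j → T (p (suc j)) → T (p j)) → let c = countBelow n p in
                       (∀ j → suc j ≡ c → T (p j)) × (c < n → ¬ T (p c))
countBelow-threshold zero    p down = (λ j ()) , λ ()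
countBelow-threshold (suc n) p down with p n in eq
... | true rewrite countBelow-full n p down (λ { j refl → down j (subst T (sym eq) tt) }) =
      (λ { j refl → subst T (sym eq) tt }) , λ lt → contradiction lt (n≮n (suc n))
... | false = let (f , g) = countBelow-threshold n p down in
      f , λ _ → case m≤n⇒m<n∨m≡n (countBelow-≤ n p) of λ where
        (inj₁ lt) → g lt
        (inj₂ e)  → subst (λ k → ¬ T (p k)) (sym e) (subst (λ b → ¬ T b) (sym eq) id)

-- A number given in binary is turned into unary without ever writing a unary number beyond the cap.
truncate : ℕ → List ℕ → ℕ
truncate K xs = countBelow K (λ j → leqList (repeat (suc j) (0 ∷ [])) xs)

truncatePT : ∀ {Γ K f} → PT Γ Nat K → PT Γ (Lst Nat) f → PT Γ Nat (λ γ → truncate (K γ) (f γ))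
truncatePT K F = countBelowPT K (leqListPT (repeatPT (sucPT v0) (const (Lst Nat) (0 ∷ []))) (F ∙ fst))

value-ones : ∀ n → value (repeat n (0 ∷ [])) ≡ n
value-ones n = trans (value-repeat n (0 ∷ [])) (*-identityʳ n)

truncate-⊓ : ∀ K xs → truncate K xs ≡ K ℕ.⊓ value xs
truncate-⊓ K xs = ≤-antisym (⊓-glb (countBelow-≤ K p) c≤v) v⊓K≤c
  where
  p : ℕ → Bool
  p j = leqList (repeat (suc j) (0 ∷ [])) xs
  holds : ∀ j → T (p j) → suc j ≤ value xs
  holds j t = subst (_≤ value xs) (value-ones (suc j)) (proj₁ (leqList-correct (repeat (suc j) (0 ∷ [])) xs) t)
  fails : ∀ j → ¬ T (p j) → value xs ≤ j
  fails j ¬t = ≮⇒≥ (λ lt → ¬t (proj₂ (leqList-correct (repeat (suc j) (0 ∷ [])) xs) (subst (_≤ value xs) (sym (value-ones (suc j))) lt)))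
  down : ∀ j → T (p (suc j)) → T (p j)
  down j t = proj₂ (leqList-correct (repeat (suc j) (0 ∷ [])) xs) (subst (_≤ value xs) (sym (value-ones (suc j))) (≤-trans (n≤1+n (suc j)) (holds (suc j) t)))
  th : (∀ j → suc j ≡ truncate K xs → T (p j)) × (truncate K xs < K → ¬ T (p (truncate K xs)))
  th = countBelow-threshold K p down
  c≤v : truncate K xs ≤ value xs
  c≤v with truncate K xs | proj₁ th
  ... | zero  | _ = z≤n
  ... | suc c | f = holds c (f c refl)
  v⊓K≤c : K ℕ.⊓ value xs ≤ truncate K xs
  v⊓K≤c with m≤n⇒m<n∨m≡n (countBelow-≤ K p)
  ... | inj₁ lt = ≤-trans (m⊓n≤n K _) (fails _ (proj₂ th lt))
  ... | inj₂ e  = ≤-trans (m⊓n≤m K _) (≤-reflexive (sym e))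

-- Minimum cuts by path reversal

count : ∀ {A : Set} → (A → Bool) → List A → ℕ
count p xs = length (List.filterᵇ p xs)

count-mono : ∀ {A : Set} (p q : A → Bool) xs → (∀ x → T (q x) → T (p x)) → count q xs ≤ count p xs
count-mono p q []       imp = z≤n
count-mono p q (x ∷ xs) imp with q x | p x | imp x
... | true  | true  | _ = s≤s (count-mono p q xs imp)
... | true  | false | f = ⊥-elim (f tt)
... | false | true  | _ = m≤n⇒m≤1+n (count-mono p q xs imp)
... | false | false | _ = count-mono p q xs imp

count-strict : ∀ {A : Set} (p q : A → Bool) xs {x} → (∀ x → T (q x) → T (p x)) → x ∈ xs → T (p x) → ¬ T (q x) → count q xs < count p xs
count-strict p q (x ∷ xs) imp (here refl) px ¬qx with q x | p x
... | true  | _    = ⊥-elim (¬qx tt)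
... | false | true = s≤s (count-mono p q xs imp)
count-strict p q (x ∷ xs) imp (there x∈) py ¬qy with q x | p x | imp x
... | true  | true  | _ = s≤s (count-strict p q xs imp x∈ py ¬qy)
... | true  | false | f = ⊥-elim (f tt)
... | false | true  | _ = m≤n⇒m≤1+n (count-strict p q xs imp x∈ py ¬qy)
... | false | false | _ = count-strict p q xs imp x∈ py ¬qy

iter-fixed : ∀ {A : Set} (f : A → A) n {x} → f x ≡ x → iter n f x ≡ x
iter-fixed f zero    e = refl
iter-fixed f (suc n) e = trans (cong (iter n f) e) (iter-fixed f n e)

iter-reaches-fixpoint : ∀ {A : Set} (f : A → A) (μ : A → ℕ) → (∀ x → f x ≡ x ⊎ μ (f x) < μ x) →
                        ∀ n x → μ x ≤ n → f (iter n f x) ≡ iter n f x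
iter-reaches-fixpoint f μ dec n x le with dec x
... | inj₁ e = trans (cong f (iter-fixed f n e)) (trans e (sym (iter-fixed f n e)))
iter-reaches-fixpoint f μ dec zero    x le | inj₂ lt = contradiction (≤-trans lt le) (λ ())
iter-reaches-fixpoint f μ dec (suc n) x le | inj₂ lt = iter-reaches-fixpoint f μ dec n (f x) (ℕ.s≤s⁻¹ (≤-trans lt le))

Arc : Coded
Arc = Nat ⊗ Nat

Arcs : Set
Arcs = List (ℕ × ℕ)

sameArc : ℕ × ℕ → ℕ × ℕ → Bool
sameArc a b = (proj₁ a ℕ.≡ᵇ proj₁ b) ∧ (proj₂ a ℕ.≡ᵇ proj₂ b)

T-∧ : ∀ {a b} → T (a ∧ b) → T a × T b
T-∧ {true} {true} _ = tt , tt

∧-T : ∀ {a b} → T a → T b → T (a ∧ b)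
∧-T {true} {true} _ _ = tt

T-not : ∀ {a} → T (not a) → ¬ T a
T-not {false} _ ()

not-T : ∀ {a} → ¬ T a → T (not a)
not-T {true}  f = f tt
not-T {false} f = tt

sameArc-sound : ∀ a b → T (sameArc a b) → a ≡ b
sameArc-sound (u , v) (u′ , v′) t = let (p , q) = T-∧ {u ℕ.≡ᵇ u′} t in cong₂ _,_ (≡ᵇ⇒≡ u u′ p) (≡ᵇ⇒≡ v v′ q)

sameArc-refl : ∀ a → T (sameArc a a)
sameArc-refl (u , v) = ∧-T (≡⇒≡ᵇ u u refl) (≡⇒≡ᵇ v v refl)

flip : ℕ × ℕ → ℕ × ℕ
flip a = proj₂ a , proj₁ a

-- Only the first occurrence of a parallel arc is reversed.
flipStep : ℕ × ℕ → Bool × Arcs → ℕ × ℕ → Bool × Arcs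
flipStep a p b = if proj₁ p ∧ sameArc a b then (false , flip b ∷ proj₂ p) else (proj₁ p , b ∷ proj₂ p)

flipFirst : ℕ × ℕ → Arcs → Arcs
flipFirst a A = proj₂ (foldl (flipStep a) (true , []) A)

bit : Bool → ℕ
bit true  = 1
bit false = 0

exits : (ℕ → Bool) → ℕ × ℕ → ℕ
exits S a = bit (S (proj₁ a) ∧ not (S (proj₂ a)))

outdeg : (ℕ → Bool) → Arcs → ℕ
outdeg S = sumOver (exits S)

flip-rest : ∀ a A acc S → outdeg S (proj₂ (foldl (flipStep a) (false , acc) A)) ≡ outdeg S acc + outdeg S A
flip-rest a []      acc S = sym (+-identityʳ _)
flip-rest a (b ∷ A) acc S = trans (flip-rest a A (b ∷ acc) S) (shuffle (exits S b) (outdeg S acc) (outdeg S A))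
  where
  shuffle : ∀ x y z → (x + y) + z ≡ y + (x + z)
  shuffle = ℕ-Ring.solve-∀

outdeg-flip : ∀ a A acc S → a ∈ A →
  outdeg S (proj₂ (foldl (flipStep a) (true , acc) A)) + exits S a ≡ outdeg S acc + outdeg S A + exits S (flip a)
outdeg-flip a (b ∷ A) acc S a∈ with sameArc a b in eq
... | true rewrite sameArc-sound a b (subst T (sym eq) tt) =
      trans (cong (_+ exits S b) (flip-rest b A (flip b ∷ acc) S)) (shuffle (exits S (flip b)) (outdeg S acc) (outdeg S A) (exits S b))
  where
  shuffle : ∀ x y z w → x + y + z + w ≡ y + (w + z) + x
  shuffle = ℕ-Ring.solve-∀
outdeg-flip a (b ∷ A) acc S (here refl) | false = ⊥-elim (subst T eq (sameArc-refl a))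
outdeg-flip a (b ∷ A) acc S (there a∈)  | false =
  trans (outdeg-flip a A (b ∷ acc) S a∈) (cong (_+ exits S (flip a)) (shuffle (exits S b) (outdeg S acc) (outdeg S A)))
  where
  shuffle : ∀ x y z → (x + y) + z ≡ y + (x + z)
  shuffle = ℕ-Ring.solve-∀

flip-keeps : ∀ a f A acc {x} → x ≢ a → x ∈ acc ⊎ x ∈ A → x ∈ proj₂ (foldl (flipStep a) (f , acc) A)
flip-keeps a f []      acc x≢a (inj₁ x∈) = x∈
flip-keeps a f (b ∷ A) acc x≢a x∈ with f ∧ sameArc a b in eq | x∈
... | true  | inj₁ p           = flip-keeps a false A (flip b ∷ acc) x≢a (inj₁ (there p))
... | true  | inj₂ (here refl) = ⊥-elim (x≢a (sym (sameArc-sound a b (proj₂ (T-∧ {f} (subst T (sym eq) tt))))))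
... | true  | inj₂ (there p)   = flip-keeps a false A (flip b ∷ acc) x≢a (inj₂ p)
... | false | inj₁ p           = flip-keeps a f A (b ∷ acc) x≢a (inj₁ (there p))
... | false | inj₂ (here e)    = flip-keeps a f A (b ∷ acc) x≢a (inj₁ (here e))
... | false | inj₂ (there p)   = flip-keeps a f A (b ∷ acc) x≢a (inj₂ p)

size-flip : ∀ a f A acc → size (enc (Lst Arc) (proj₂ (foldl (flipStep a) (f , acc) A))) + 1 ≡ size (enc (Lst Arc) acc) + size (enc (Lst Arc) A)
size-flip a f []      acc = refl
size-flip a f (b ∷ A) acc with f ∧ sameArc a b
... | true  = trans (size-flip a false A (flip b ∷ acc)) (shuffle (size (enc Nat (proj₁ b))) (size (enc Nat (proj₂ b))) (size (enc (Lst Arc) acc)) (size (enc (Lst Arc) A)))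
  where
  shuffle : ∀ x y z w → suc (suc (y + x) + z) + w ≡ z + suc (suc (x + y) + w)
  shuffle = ℕ-Ring.solve-∀
... | false = trans (size-flip a f A (b ∷ acc)) (shuffle (size (enc Nat (proj₁ b))) (size (enc Nat (proj₂ b))) (size (enc (Lst Arc) acc)) (size (enc (Lst Arc) A)))
  where
  shuffle : ∀ x y z w → suc (suc (x + y) + z) + w ≡ z + suc (suc (x + y) + w)
  shuffle = ℕ-Ring.solve-∀

size-flipFirst : ∀ a A → size (enc (Lst Arc) (flipFirst a A)) ≡ size (enc (Lst Arc) A)
size-flipFirst a A = suc-injective (trans (+-comm 1 _) (size-flip a true A []))

module Search (s : ℕ) where

  reached : Arcs → ℕ → Bool
  reached Q v = (v ℕ.≡ᵇ s) ∨ any (λ a → v ℕ.≡ᵇ proj₂ a) Q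

  leaving : Arcs → Arcs → Arcs
  leaving A Q = List.filterᵇ (λ a → reached Q (proj₁ a) ∧ not (reached Q (proj₂ a))) A

  grow : Arcs → Arcs → Arcs
  grow A Q = caseList (leaving A Q) Q (λ a _ → a ∷ Q)

  search : Arcs → Arcs
  search A = iter (length A) (grow A) []

  -- The arcs of the search tree are listed with the latest first. The arc that entered a vertex was
  -- found after the arc that entered its tail, so one pass over the list walks from the sink back
  -- to the source.
  traceStep : ℕ × Arcs → ℕ × ℕ → ℕ × Arcs
  traceStep p a = if proj₂ a ℕ.≡ᵇ proj₁ p then (proj₁ a , flipFirst a (proj₂ p)) else p

  augment : ℕ → Arcs → Arcs
  augment t A = proj₂ (foldl traceStep (t , A) (search A))

  reached-here : ∀ a Q → T (reached (a ∷ Q) (proj₂ a))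
  reached-here a Q with proj₂ a ℕ.≡ᵇ s | proj₂ a ℕ.≡ᵇ proj₂ a | ≡⇒≡ᵇ (proj₂ a) (proj₂ a) refl
  ... | true  | _    | _ = tt
  ... | false | true | _ = tt

  reached-there : ∀ a Q v → T (reached Q v) → T (reached (a ∷ Q) v)
  reached-there a Q v t with v ℕ.≡ᵇ s | v ℕ.≡ᵇ proj₂ a
  ... | true  | _     = tt
  ... | false | true  = tt
  ... | false | false = t

  reached-cons : ∀ a Q v → T (reached (a ∷ Q) v) → v ≡ proj₂ a ⊎ T (reached Q v)
  reached-cons a Q v t with v ℕ.≡ᵇ s | v ℕ.≡ᵇ proj₂ a in eq
  ... | true  | _     = inj₂ tt
  ... | false | true  = inj₁ (≡ᵇ⇒≡ v (proj₂ a) (subst T (sym eq) tt))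
  ... | false | false = inj₂ t

  reached-nil : ∀ v → T (reached [] v) → v ≡ s
  reached-nil v t with v ℕ.≡ᵇ s in eq
  ... | true = ≡ᵇ⇒≡ v s (subst T (sym eq) tt)

  reached-source : ∀ Q → T (reached Q s)
  reached-source Q with s ℕ.≡ᵇ s | ≡⇒≡ᵇ s s refl
  ... | true | _ = tt

  ∈-leaving : ∀ {A Q a as} → leaving A Q ≡ a ∷ as → a ∈ A × T (reached Q (proj₁ a)) × ¬ T (reached Q (proj₂ a))
  ∈-leaving {A} {Q} {a} eq with ∈-filter⁻ (λ a → Bool.T? (reached Q (proj₁ a) ∧ not (reached Q (proj₂ a)))) {xs = A} (subst (a ∈_) (sym eq) (here refl))
  ... | a∈ , t = let (p , q) = T-∧ {reached Q (proj₁ a)} t in a∈ , p , T-not q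

  unreached : Arcs → Arcs → ℕ
  unreached A Q = count (λ a → not (reached Q (proj₂ a))) A

  grow-progress : ∀ A Q → grow A Q ≡ Q ⊎ unreached A (grow A Q) < unreached A Q
  grow-progress A Q with leaving A Q in eq
  ... | []     = inj₁ refl
  ... | a ∷ as = let (a∈ , p , q) = ∈-leaving {A} {Q} eq in
    inj₂ (count-strict _ _ A (λ x t → not-T (λ r → T-not t (reached-there a Q (proj₂ x) r))) a∈ (not-T q) (λ t → T-not t (reached-here a Q)))

  fixpoint-closed : ∀ A Q → grow A Q ≡ Q → leaving A Q ≡ []
  fixpoint-closed A Q e with leaving A Q
  ... | []     = refl
  ... | a ∷ as = contradiction (cong length e) 1+n≢n

  search-closed : ∀ A → leaving A (search A) ≡ []
  search-closed A = fixpoint-closed A (search A)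
    (iter-reaches-fixpoint (grow A) (unreached A) (grow-progress A) (length A) [] (List.length-filter (λ x → Bool.T? _) A))

  data SearchTree (A : Arcs) : Arcs → Set where
    []  : SearchTree A []
    add : ∀ {a Q} → a ∈ A → T (reached Q (proj₁ a)) → ¬ T (reached Q (proj₂ a)) → SearchTree A Q → SearchTree A (a ∷ Q)

  search-tree : ∀ A → SearchTree A (search A)
  search-tree A = iter-invariant (SearchTree A) step (length A) [] []
    where
    step : ∀ Q → SearchTree A Q → SearchTree A (grow A Q)
    step Q tr with leaving A Q in eq
    ... | []     = tr
    ... | a ∷ as = let (a∈ , p , q) = ∈-leaving {A} {Q} eq in add a∈ p q tr

  head-reached : ∀ {A Q x} → SearchTree A Q → x ∈ Q → T (reached Q (proj₂ x))
  head-reached {Q = a ∷ Q} (add _ _ _ tr) (here refl) = reached-here a Q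
  head-reached {Q = a ∷ Q} {x} (add _ _ _ tr) (there x∈) = reached-there a Q (proj₂ x) (head-reached tr x∈)

  -- Reversing a walk from s to `cur` changes the out-degree of a set containing s only through the
  -- end of the walk: by one if `cur` lies outside, else not at all. The tree arcs still to be
  -- examined survive a reversal, because their heads were reached before the head of the reversed
  -- arc.
  trace-outdeg : ∀ {A₀} Q S cur A → SearchTree A₀ Q → T (S s) → T (reached Q cur) → (∀ {x} → x ∈ Q → x ∈ A) →
                 outdeg S (proj₂ (foldl traceStep (cur , A) Q)) + bit (not (S cur)) ≡ outdeg S A
  trace-outdeg [] S cur A tr Ss r Q⊆A with reached-nil cur r
  ... | refl with S s | Ss
  ... | true | _ = +-identityʳ _
  trace-outdeg (a ∷ Q) S cur A (add a∈ p q tr) Ss r Q⊆A with proj₂ a ℕ.≡ᵇ cur in eq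
  ... | false = trace-outdeg Q S cur A tr Ss
                  ([ (λ e → ⊥-elim (subst T eq (≡⇒≡ᵇ (proj₂ a) cur (sym e)))) , id ]′ (reached-cons a Q cur r))
                  (λ x∈ → Q⊆A (there x∈))
  ... | true with ≡ᵇ⇒≡ (proj₂ a) cur (subst T (sym eq) tt)
  ... | refl = combine (outdeg S A) (S (proj₁ a)) (S (proj₂ a))
                 (trace-outdeg Q S (proj₁ a) (flipFirst a A) tr Ss p
                   (λ {x} x∈ → flip-keeps a true A [] (λ { refl → q (head-reached tr x∈) }) (inj₂ (Q⊆A (there x∈)))))
                 (outdeg-flip a A [] S (Q⊆A (here refl)))
    where
    combine : ∀ {f g} o b c → f + bit (not b) ≡ g → g + bit (b ∧ not c) ≡ o + bit (c ∧ not b) → f + bit (not c) ≡ o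
    combine {f} {g} o true  true  e₁ e₂ = trans e₁ (trans (sym (+-identityʳ g)) (trans e₂ (+-identityʳ o)))
    combine {f} {g} o true  false e₁ e₂ = trans (cong (_+ 1) (trans (sym (+-identityʳ f)) e₁)) (trans e₂ (+-identityʳ o))
    combine {f} {g} o false true  e₁ e₂ = trans (+-identityʳ f) (+-cancelʳ-≡ 1 f o (trans e₁ (trans (sym (+-identityʳ g)) e₂)))
    combine {f} {g} o false false e₁ e₂ = trans e₁ (trans (sym (+-identityʳ g)) (trans e₂ (+-identityʳ o)))

  tree-⊆ : ∀ {A Q x} → SearchTree A Q → x ∈ Q → x ∈ A
  tree-⊆ (add a∈ _ _ tr) (here refl) = a∈
  tree-⊆ (add _ _ _ tr)  (there x∈)  = tree-⊆ tr x∈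

  augment-outdeg : ∀ t A S → T (S s) → ¬ T (S t) → T (reached (search A) t) → outdeg S (augment t A) + 1 ≡ outdeg S A
  augment-outdeg t A S Ss ¬St r with S t | trace-outdeg (search A) S t A (search-tree A) Ss r (tree-⊆ (search-tree A))
  ... | true  | _ = ⊥-elim (¬St tt)
  ... | false | e = e

  augment-stuck : ∀ t A → ¬ T (reached (search A) t) → augment t A ≡ A
  augment-stuck t A ¬r = go (search A) ¬r
    where
    go : ∀ Q → ¬ T (reached Q t) → proj₂ (foldl traceStep (t , A) Q) ≡ A
    go []      ¬r = refl
    go (a ∷ Q) ¬r with proj₂ a ℕ.≡ᵇ t in eq
    ... | true  = ⊥-elim (¬r (subst (λ v → T (reached (a ∷ Q) v)) (≡ᵇ⇒≡ (proj₂ a) t (subst T (sym eq) tt)) (reached-here a Q)))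
    ... | false = go Q (λ r → ¬r (reached-there a Q t r))

  residual : ℕ → ℕ → Arcs → Arcs
  residual n t A = iter n (augment t) A

  reachable-before : ∀ n t A → T (reached (search (residual n t A)) t) → T (reached (search A) t)
  reachable-before n t A r with Bool.T? (reached (search A) t)
  ... | yes r′ = r′
  ... | no ¬r  = subst (λ B → T (reached (search B) t)) (iter-fixed (augment t) n (augment-stuck t A ¬r)) r

  -- A failed augmentation leaves the network unchanged for ever. As the sink is still reachable,
  -- all n augmentations succeeded, each lowered every separating cut by exactly one, and one more
  -- is possible.
  all-cuts-large : ∀ n t A → T (reached (search (residual n t A)) t) → ∀ S → T (S s) → ¬ T (S t) → n < outdeg S A
  all-cuts-large zero    t A r S Ss ¬St = subst (0 <_) (trans (+-comm 1 _) (augment-outdeg t A S Ss ¬St r)) (s≤s z≤n)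
  all-cuts-large (suc n) t A r S Ss ¬St = subst (suc n <_) (trans (+-comm 1 _) (augment-outdeg t A S Ss ¬St (reachable-before (suc n) t A r)))
                                            (s≤s (all-cuts-large n t (augment t A) r S Ss ¬St))

  outdeg-residual : ∀ n t A S → T (S s) → ¬ T (S t) → outdeg S A ≤ n + outdeg S (residual n t A)
  outdeg-residual zero    t A S Ss ¬St = ≤-refl
  outdeg-residual (suc n) t A S Ss ¬St with Bool.T? (reached (search A) t)
  ... | yes r = ≤-trans (≤-reflexive (trans (sym (augment-outdeg t A S Ss ¬St r)) (+-comm _ 1))) (s≤s (outdeg-residual n t (augment t A) S Ss ¬St))
  ... | no ¬r = ≤-trans (≤-trans (≤-reflexive (cong (outdeg S) (sym (augment-stuck t A ¬r)))) (outdeg-residual n t (augment t A) S Ss ¬St)) (n≤1+n _)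

  outdeg-closed : ∀ A Q → leaving A Q ≡ [] → outdeg (reached Q) A ≡ 0
  outdeg-closed []      Q e = refl
  outdeg-closed (a ∷ A) Q e with reached Q (proj₁ a) ∧ not (reached Q (proj₂ a))
  ... | false = outdeg-closed A Q e

  -- No arc of the final network leaves the reached set, and n augmentations have lowered its
  -- out-degree by at most n. Together with `all-cuts-large` this is max-flow min-cut, truncated at
  -- flow value n.
  small-cut : ∀ n t A → let Q = search (residual n t A) in ¬ T (reached Q t) → outdeg (reached Q) A ≤ n
  small-cut n t A ¬r = ≤-trans (outdeg-residual n t A (reached Q) (reached-source Q) ¬r)
    (≤-reflexive (trans (cong (n +_) (outdeg-closed (residual n t A) Q (search-closed (residual n t A)))) (+-identityʳ n)))
    where
    Q : Arcs
    Q = search (residual n t A)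

foldl-invariant : ∀ {A B : Set} (P : B → Set) (R : A → Set) {step : B → A → B} →
                  (∀ b a → P b → R a → P (step b a)) → ∀ ys b → All R ys → P b → P (foldl step b ys)
foldl-invariant P R pres []       b []       p = p
foldl-invariant P R pres (y ∷ ys) b (r ∷ rs) p = foldl-invariant P R pres ys _ rs (pres b y p r)

sameArcPT : ∀ {Γ f g} → PT Γ Arc f → PT Γ Arc g → PT Γ Bit (λ γ → sameArc (f γ) (g γ))
sameArcPT F G = andPT (eqPT (fst ∙ F) (fst ∙ G)) (eqPT (snd ∙ F) (snd ∙ G))

flipFirstPT : ∀ {Γ f g} → PT Γ Arc f → PT Γ (Lst Arc) g → PT Γ (Lst Arc) (λ γ → flipFirst (f γ) (g γ))
flipFirstPT F G = snd ∙ foldPT step (con 4 ⊞ (arg ⊞ arg)) bound snd (const (Bit ⊗ Lst Arc) (true , [])) ∙ (F & G)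
  where
  step : PT (Arc ⊗ Lst Arc ⊗ (Bit ⊗ Lst Arc) ⊗ Arc) (Bit ⊗ Lst Arc) (λ γ → flipStep (proj₁ (proj₁ (proj₁ γ))) (proj₂ (proj₁ γ)) (proj₂ γ))
  step = ifPT (andPT (fst ∙ v1) (sameArcPT (fst ∙ fst ∙ fst) v0))
              (const Bit false & consPT (snd ∙ v0 & fst ∙ v0) (snd ∙ v1))
              (fst ∙ v1 & consPT v0 (snd ∙ v1))
  size-bit : ∀ b → size (encodeBool b) ≤ 3
  size-bit true  = ≤-refl
  size-bit false = s≤s z≤n
  bound : ∀ γ ys ws → proj₂ γ ≡ ys ++ ws →
          size (enc (Bit ⊗ Lst Arc) (foldl (flipStep (proj₁ γ)) (true , []) ys)) ≤ 4 + (size (enc (Arc ⊗ Lst Arc) γ) + size (enc (Arc ⊗ Lst Arc) γ))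
  bound (a , A) ys ws e = s≤s (+-mono-≤ (size-bit _) (≤-trans (≤-reflexive (size-flipFirst a ys))
    (≤-trans (≤-trans (size-prefix Arc ys ws) (≤-reflexive (cong (size ∘ enc (Lst Arc)) (sym e))))
             (≤-trans (m≤n⇒m≤1+n (m≤n+m _ (size (enc Arc a)))) (m≤m+n _ _)))))

reachedPT : ∀ {Γ s Q v} → PT Γ Nat s → PT Γ (Lst Arc) Q → PT Γ Nat v → PT Γ Bit (λ γ → Search.reached (s γ) (Q γ) (v γ))
reachedPT S Q V = orPT (eqPT V S) (anyPT (eqPT (V ∙ fst) (snd ∙ v0)) Q)

searchPT : ∀ {Γ s A} → PT Γ Nat s → PT Γ (Lst Arc) A → PT Γ (Lst Arc) (λ γ → Search.search (s γ) (A γ))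
searchPT S A = iterPT growPT (con 1 ⊞ arg ⊠ (con 1 ⊞ arg)) bound (lengthPT snd) (nilPT Arc) ∙ (S & A)
  where
  growPT : PT (Nat ⊗ Lst Arc ⊗ Lst Arc) (Lst Arc) (λ γ → Search.grow (proj₁ (proj₁ γ)) (proj₂ (proj₁ γ)) (proj₂ γ))
  growPT = caseListPT (filterPT (andPT (reachedPT (fst ∙ fst ∙ fst) v1 (fst ∙ v0)) (notPT (reachedPT (fst ∙ fst ∙ fst) v1 (snd ∙ v0)))) v1)
                      v0 (consPT v1 v2)
  bound : ∀ γ j → j ≤ length (proj₂ γ) →
          size (enc (Lst Arc) (iter j (Search.grow (proj₁ γ) (proj₂ γ)) [])) ≤
          suc (size (enc (Nat ⊗ Lst Arc) γ) * suc (size (enc (Nat ⊗ Lst Arc) γ)))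
  bound (s , A) j j≤ = ≤-trans (size-list Arc K _ (proj₁ inv))
      (s≤s (*-monoˡ-≤ (suc K) (≤-trans (proj₂ inv) (≤-trans j≤ (≤-trans (length≤size Arc A) A≤K)))))
    where
    open Search s
    K : ℕ
    K = size (enc (Nat ⊗ Lst Arc) (s , A))
    A≤K : size (enc (Lst Arc) A) ≤ K
    A≤K = m≤n⇒m≤1+n (m≤n+m _ _)
    Small : Arcs → ℕ → Set
    Small Q n = All (λ a → size (enc Arc a) ≤ K) Q × length Q ≤ n
    grow-small : ∀ n Q → Small Q n → Small (grow A Q) (suc n)
    grow-small n Q (p , q) with leaving A Q in eq
    ... | []     = p , m≤n⇒m≤1+n q
    ... | a ∷ as = ≤-trans (All.lookup (elements-smaller Arc A) (proj₁ (∈-leaving {A} {Q} eq))) A≤K ∷ p , s≤s q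
    steps : ∀ j n Q → Small Q n → Small (iter j (grow A) Q) (n + j)
    steps zero    n Q p = subst (Small Q) (sym (+-identityʳ n)) p
    steps (suc j) n Q p = subst (Small _) (sym (+-suc n j)) (steps j (suc n) (grow A Q) (grow-small n Q p))
    inv : Small (iter j (grow A) []) j
    inv = steps j 0 [] ([] , z≤n)

size-trace : ∀ s Q cur A → size (enc (Lst Arc) (proj₂ (foldl (Search.traceStep s) (cur , A) Q))) ≡ size (enc (Lst Arc) A)
size-trace s []      cur A = refl
size-trace s (a ∷ Q) cur A with proj₂ a ℕ.≡ᵇ cur
... | true  = trans (size-trace s Q (proj₁ a) (flipFirst a A)) (size-flipFirst a A)
... | false = size-trace s Q cur A

size-residual : ∀ s n t A → size (enc (Lst Arc) (Search.residual s n t A)) ≡ size (enc (Lst Arc) A)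
size-residual s zero    t A = refl
size-residual s (suc n) t A = trans (size-residual s n t (Search.augment s t A)) (size-trace s (Search.search s A) t A)

residualPT : ∀ {Γ s n t A} → PT Γ Nat s → PT Γ Nat n → PT Γ Nat t → PT Γ (Lst Arc) A →
             PT Γ (Lst Arc) (λ γ → Search.residual (s γ) (n γ) (t γ) (A γ))
residualPT S N T A = iterPT augmentPT arg bound (fst ∙ snd ∙ fst) snd ∙ ((S & (N & T)) & A)
  where
  Ctx : Coded
  Ctx = Nat ⊗ (Nat ⊗ Nat) ⊗ Lst Arc
  tracePT : PT (Nat ⊗ Nat ⊗ Lst Arc ⊗ Lst Arc) (Nat ⊗ Lst Arc)
               (λ γ → foldl (Search.traceStep (proj₁ (proj₁ (proj₁ γ)))) (proj₂ (proj₁ (proj₁ γ)) , proj₂ (proj₁ γ)) (proj₂ γ))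
  tracePT = foldPT (ifPT (eqPT (snd ∙ v0) (fst ∙ v1)) (fst ∙ v0 & flipFirstPT v0 (snd ∙ v1)) v1)
                   (con 1 ⊞ (arg ⊞ arg)) bound v0 (v2 & v1)
    where
    bound : ∀ γ ys ws → proj₂ γ ≡ ys ++ ws →
            size (enc (Nat ⊗ Lst Arc) (foldl (Search.traceStep (proj₁ (proj₁ (proj₁ γ)))) (proj₂ (proj₁ (proj₁ γ)) , proj₂ (proj₁ γ)) ys)) ≤
            suc (size (enc (Nat ⊗ Nat ⊗ Lst Arc ⊗ Lst Arc) γ) + size (enc (Nat ⊗ Nat ⊗ Lst Arc ⊗ Lst Arc) γ))
    bound (((s , t) , A) , Q) ys ws refl = s≤s (+-mono-≤
      (foldl-invariant (λ p → size (enc Nat (proj₁ p)) ≤ K) (λ a → size (enc Arc a) ≤ K)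
        (λ p a pK aK → keep p a pK aK) ys (t , A)
        (All.++⁻ˡ ys (All.map (λ le → ≤-trans le (m≤n⇒m≤1+n (m≤n+m _ _))) (elements-smaller Arc (ys ++ ws))))
        (m≤n⇒m≤1+n (≤-trans (m≤n⇒m≤1+n (≤-trans (m≤n⇒m≤1+n (m≤n+m _ (size (enc Nat s)))) (m≤m+n _ (size (enc (Lst Arc) A))))) (m≤m+n _ _))))
      (≤-trans (≤-reflexive (size-trace s ys t A)) (m≤n⇒m≤1+n (≤-trans (m≤n⇒m≤1+n (m≤n+m (size (enc (Lst Arc) A)) (suc (size (enc Nat s) + size (enc Nat t))))) (m≤m+n _ _)))))
      where
      K : ℕ
      K = size (enc (Nat ⊗ Nat ⊗ Lst Arc ⊗ Lst Arc) (((s , t) , A) , ys ++ ws))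
      keep : ∀ p a → size (enc Nat (proj₁ p)) ≤ K → size (enc Arc a) ≤ K → size (enc Nat (proj₁ (Search.traceStep s p a))) ≤ K
      keep p a pK aK with proj₂ a ℕ.≡ᵇ proj₁ p
      ... | true  = ≤-trans (m≤n⇒m≤1+n (m≤m+n _ _)) aK
      ... | false = pK
  augmentPT : PT (Ctx ⊗ Lst Arc) (Lst Arc) (λ γ → Search.augment (proj₁ (proj₁ (proj₁ γ))) (proj₂ (proj₂ (proj₁ (proj₁ γ)))) (proj₂ γ))
  augmentPT = snd ∙ tracePT ∙ (((fst ∙ fst ∙ fst & snd ∙ snd ∙ fst ∙ fst) & v0) & searchPT (fst ∙ fst ∙ fst) v0)
  bound : ∀ γ j → j ≤ proj₁ (proj₂ (proj₁ γ)) →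
          size (enc (Lst Arc) (Search.residual (proj₁ (proj₁ γ)) j (proj₂ (proj₂ (proj₁ γ))) (proj₂ γ))) ≤ size (enc Ctx γ)
  bound ((s , (n , t)) , A) j _ = ≤-trans (≤-reflexive (size-residual s j t A)) (m≤n⇒m≤1+n (m≤n+m _ _))

-- The algorithm for one guess

-- Parameters: the grid N on which fractional solutions live, the padding V,
-- the largest violated cut value, the slack of the budget, the number of
-- relaxation steps, the budget increase per taken unit of cost, the loss per move.
Par : Coded
Par = Nat ⊗ Nat ⊗ Nat ⊗ Nat ⊗ Nat ⊗ Nat ⊗ Nat

gridOf padOf cutOf slackOf stepsOf raiseOf lossOf : Carrier Par → ℕ
gridOf  p = proj₁ (proj₁ (proj₁ (proj₁ (proj₁ (proj₁ p)))))
padOf   p = proj₂ (proj₁ (proj₁ (proj₁ (proj₁ (proj₁ p)))))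
cutOf   p = proj₂ (proj₁ (proj₁ (proj₁ (proj₁ p))))
slackOf p = proj₂ (proj₁ (proj₁ (proj₁ p)))
stepsOf p = proj₂ (proj₁ (proj₁ p))
raiseOf p = proj₂ (proj₁ p)
lossOf  p = proj₂ p

-- Index, ends, cost, whether the edge is taken, whether it is still allowed,
-- and the current value of the fractional solution.
Item : Coded
Item = Nat ⊗ Arc ⊗ Nat ⊗ (Bit ⊗ Bit) ⊗ Nat

Items : Set
Items = List (Carrier Item)

idxOf costOf posOf : Carrier Item → ℕ
idxOf  r = proj₁ (proj₁ (proj₁ (proj₁ r)))
costOf r = proj₂ (proj₁ (proj₁ r))
posOf  r = proj₂ r

arcOf : Carrier Item → ℕ × ℕ
arcOf r = proj₂ (proj₁ (proj₁ (proj₁ r)))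

takenOf allowedOf : Carrier Item → Bool
takenOf   r = proj₁ (proj₂ (proj₁ r))
allowedOf r = proj₂ (proj₂ (proj₁ r))

-- The projection onto the interval left to the edge: {N} once taken, {0} once dropped, [0, N] while
-- undecided.
clip : ℕ → Bool → Bool → ℕ → ℕ
clip N lo hi z = (z ℕ.⊓ (if hi then N else 0)) ℕ.⊔ (if lo then N else 0)

place : ℕ → Carrier Item → ℕ → Carrier Item
place N r z = proj₁ r , clip N (takenOf r) (allowedOf r) z

-- The oracle sees the point raised by the padding. A cut violated even there is violated by a
-- margin at the unpadded point, which makes the next step worthwhile; if there is none, the padded
-- point satisfies all cuts exactly.
lifted : Carrier Par → Carrier Item → ℕ
lifted p r = clip (gridOf p) (takenOf r) (allowedOf r) (posOf r + padOf p)

-- Capacities are multiplicities: an edge of value v becomes v pairs of opposite arcs, so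
-- out-degrees are cut values.
arcsOf : Carrier Par → Items → Arcs
arcsOf p rs = concatMap (λ r → concatMap (λ _ → arcOf r ∷ flip (arcOf r) ∷ []) (units (lifted p r))) rs

cutFrom : ℕ → ℕ × ℕ → Arcs → List (ℕ × Arcs)
cutFrom n a A = let Q = Search.search (proj₁ a) (Search.residual (proj₁ a) n (proj₂ a) A) in
                if Search.reached (proj₁ a) Q (proj₂ a) then [] else (proj₁ a , Q) ∷ []

-- A set is constrained only if some edge on its boundary is not full, so it suffices to separate
-- the two ends of each such edge.
cuts : Carrier Par → Items → List (ℕ × Arcs)
cuts p rs = concatMap (λ r → if gridOf p ℕ.≤ᵇ lifted p r then [] else cutFrom (cutOf p) (arcOf r) (arcsOf p rs)) rs

crosses : (ℕ → Bool) → ℕ × ℕ → Bool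
crosses S a = S (proj₁ a) xor S (proj₂ a)

side : ℕ × Arcs → ℕ → Bool
side c = Search.reached (proj₁ c) (proj₂ c)

spend : Items → ℕ
spend = sumOver (λ r → costOf r * posOf r)

pushUp : Carrier Par → ℕ × Arcs → Items → Items
pushUp p c rs = map (λ r → place (gridOf p) r (posOf r + bit (crosses (side c) (arcOf r)))) rs

pushDown : Carrier Par → Items → Items
pushDown p rs = map (λ r → place (gridOf p) r (posOf r ∸ costOf r)) rs

adjust : Carrier Par → ℕ → Items → Items
adjust p β rs = caseList (cuts p rs) (if spend rs ℕ.≤ᵇ β + slackOf p then rs else pushDown p rs) (λ c _ → pushUp p c rs)

settle : Carrier Par → ℕ → Items → Items
settle p β rs = iter (stepsOf p) (adjust p β) (map (λ r → place (gridOf p) r 0) rs)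

accepted : Carrier Par → ℕ → Items → Bool
accepted p β rs = caseList (cuts p rs) true (λ _ _ → false) ∧ (spend rs ℕ.≤ᵇ β + slackOf p)

Guess : Coded
Guess = Lst Item ⊗ Nat

query : Carrier Par → Carrier Guess → Bool
query p s = accepted p (proj₂ s) (settle p (proj₂ s) (proj₁ s))

undecided : Carrier Item → Bool
undecided r = allowedOf r ∧ not (takenOf r)

mark : Bool → Bool → ℕ → Carrier Item → Carrier Item
mark lo hi i r = if idxOf r ℕ.≡ᵇ i then ((proj₁ (proj₁ r) , (lo , hi)) , posOf r) else r

-- Raising y_e to 1 costs N c_e (1 - y_e) more. The additional budget `raiseOf p * costOf r` covers
-- this exactly when 1 - y_e is at most raise / N or the edge is free.
moves : Carrier Par → Carrier Guess → List (Carrier Guess)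
moves p s = concatMap (λ r → if undecided r then
  (map (mark false false (idxOf r)) (proj₁ s) , proj₂ s) ∷
  (map (mark true  true  (idxOf r)) (proj₁ s) , proj₂ s + raiseOf p * costOf r) ∷ [] else []) (proj₁ s)

-- Acceptance certifies a solution only for a budget enlarged by the loss. The new budget includes
-- the loss, so that the existence of an exact solution remains an invariant.
move : Carrier Par → Carrier Guess → Carrier Guess
move p s = caseList (List.filterᵇ (query p) (moves p s)) s (λ s′ _ → proj₁ s′ , proj₂ s′ + lossOf p)

decide : Carrier Par → Carrier Guess → Carrier Guess
decide p s = iter (length (proj₁ s)) (move p) s

-- Running times

gridPT : PT Par Nat gridOf
gridPT = fst ∙ fst ∙ fst ∙ fst ∙ fst ∙ fst
padPT : PT Par Nat padOf
padPT = snd ∙ fst ∙ fst ∙ fst ∙ fst ∙ fst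
cutPT : PT Par Nat cutOf
cutPT = snd ∙ fst ∙ fst ∙ fst ∙ fst
slackPT : PT Par Nat slackOf
slackPT = snd ∙ fst ∙ fst ∙ fst
stepsPT : PT Par Nat stepsOf
stepsPT = snd ∙ fst ∙ fst
raisePT : PT Par Nat raiseOf
raisePT = snd ∙ fst
lossPT : PT Par Nat lossOf
lossPT = snd

idxPT : PT Item Nat idxOf
idxPT = fst ∙ fst ∙ fst ∙ fst
arcPT : PT Item Arc arcOf
arcPT = snd ∙ fst ∙ fst ∙ fst
costPT : PT Item Nat costOf
costPT = snd ∙ fst ∙ fst
takenPT : PT Item Bit takenOf
takenPT = fst ∙ snd ∙ fst
allowedPT : PT Item Bit allowedOf
allowedPT = snd ∙ snd ∙ fst
posPT : PT Item Nat posOf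
posPT = snd

clipPT : ∀ {Γ N lo hi z} → PT Γ Nat N → PT Γ Bit lo → PT Γ Bit hi → PT Γ Nat z → PT Γ Nat (λ γ → clip (N γ) (lo γ) (hi γ) (z γ))
clipPT N lo hi Z = maxPT (minPT Z (ifPT hi N (const Nat 0))) (ifPT lo N (const Nat 0))

placePT : ∀ {Γ N r z} → PT Γ Nat N → PT Γ Item r → PT Γ Nat z → PT Γ Item (λ γ → place (N γ) (r γ) (z γ))
placePT N R Z = fst ∙ R & clipPT N (takenPT ∙ R) (allowedPT ∙ R) Z

liftedPT : ∀ {Γ p r} → PT Γ Par p → PT Γ Item r → PT Γ Nat (λ γ → lifted (p γ) (r γ))
liftedPT P R = clipPT (gridPT ∙ P) (takenPT ∙ R) (allowedPT ∙ R) (posPT ∙ R ⊕ padPT ∙ P)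

arcsPT : ∀ {Γ p rs} → PT Γ Par p → PT Γ (Lst Item) rs → PT Γ (Lst Arc) (λ γ → arcsOf (p γ) (rs γ))
arcsPT P RS = concatMapPT (concatMapPT (consPT (arcPT ∙ v1) (consPT (snd ∙ arcPT ∙ v1 & fst ∙ arcPT ∙ v1) (nilPT Arc)))
                                       (unitsPT (liftedPT (P ∙ fst) v0))) RS

cutFromPT : ∀ {Γ n a A} → PT Γ Nat n → PT Γ Arc a → PT Γ (Lst Arc) A → PT Γ (Lst (Nat ⊗ Lst Arc)) (λ γ → cutFrom (n γ) (a γ) (A γ))
cutFromPT N A L = ifPT (reachedPT (fst ∙ fst) v0 (snd ∙ fst)) (nilPT _) (consPT (fst ∙ fst & v0) (nilPT _)) ∙
                  (A & searchPT (fst ∙ A) (residualPT (fst ∙ A) N (snd ∙ A) L))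

cutsPT : ∀ {Γ p rs} → PT Γ Par p → PT Γ (Lst Item) rs → PT Γ (Lst (Nat ⊗ Lst Arc)) (λ γ → cuts (p γ) (rs γ))
cutsPT P RS = concatMapPT (ifPT (leqPT (gridPT ∙ fst ∙ fst) (liftedPT (fst ∙ fst) v0)) (nilPT _)
                                (cutFromPT (cutPT ∙ fst ∙ fst) (arcPT ∙ v0) (arcsPT (fst ∙ fst) v1))) snd ∙ (P & RS)

bitPT : ∀ {Γ b} → PT Γ Bit b → PT Γ Nat (λ γ → bit (b γ))
bitPT {b = b} B = ext (λ γ → eq (b γ)) (ifPT B (const Nat 1) (const Nat 0))
  where
  eq : ∀ b → (if b then 1 else 0) ≡ bit b
  eq true  = refl
  eq false = refl

spendPT : ∀ {Γ rs} → PT Γ (Lst Item) rs → PT Γ Nat (λ γ → spend (rs γ))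
spendPT RS = sumPT (costPT ∙ v0 ⊛ posPT ∙ v0) RS

adjustPT : PT (Par ⊗ Nat ⊗ Lst Item ⊗ Lst Item) (Lst Item) (λ γ → adjust (proj₁ (proj₁ (proj₁ γ))) (proj₂ (proj₁ (proj₁ γ))) (proj₂ γ))
adjustPT = caseListPT (cutsPT P v0)
  (ifPT (leqPT (spendPT v0) (v2 ⊕ slackPT ∙ P)) v0 (mapPT (placePT (gridPT ∙ P ∙ fst) v0 (posPT ∙ v0 ⊝ costPT ∙ v0)) v0))
  (mapPT (placePT (gridPT ∙ P ∙ fst ∙ fst ∙ fst) v0
            (posPT ∙ v0 ⊕ bitPT (xorPT (reachedPT (fst ∙ v2) (snd ∙ v2) (fst ∙ arcPT ∙ v0)) (reachedPT (fst ∙ v2) (snd ∙ v2) (snd ∙ arcPT ∙ v0))))) v2)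
  where
  P : ∀ {A B C} → PT (Par ⊗ A ⊗ B ⊗ C) Par (λ γ → proj₁ (proj₁ (proj₁ γ)))
  P = fst ∙ fst ∙ fst

clip-≤ : ∀ N lo hi z → clip N lo hi z ≤ N
clip-≤ N lo hi z = ⊔-lub (≤-trans (m⊓n≤n z _) (if-≤ hi)) (if-≤ lo)
  where
  if-≤ : ∀ b → (if b then N else 0) ≤ N
  if-≤ true  = ≤-refl
  if-≤ false = z≤n

put : ℕ → Carrier Item → Carrier Item
put N r = proj₁ r , N

size-map : ∀ A (f : Carrier A → Carrier A) xs → All (λ x → size (enc A x) ≤ size (enc A (f x))) xs →
           size (enc (Lst A) xs) ≤ size (enc (Lst A) (map f xs))
size-map A f []       []       = ≤-refl
size-map A f (x ∷ xs) (p ∷ ps) = s≤s (+-mono-≤ p (size-map A f xs ps))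

-- Intermediate states are bounded by the output of the program `full`, which is never run: it sets
-- every position to the grid size, the largest value that can occur, and its size bound is
-- polynomial for free.
settlePT : ∀ {Γ p β rs} → PT Γ Par p → PT Γ Nat β → PT Γ (Lst Item) rs → PT Γ (Lst Item) (λ γ → settle (p γ) (β γ) (rs γ))
settlePT P β RS = iterPT adjustPT (sizeBound full) bound (stepsPT ∙ fst ∙ fst) (mapPT (placePT (gridPT ∙ fst ∙ fst ∙ fst) v0 (const Nat 0)) v0) ∙ ((P & β) & RS)
  where
  full : PT (Par ⊗ Nat ⊗ Lst Item) (Lst Item) (λ γ → map (put (gridOf (proj₁ (proj₁ γ)))) (proj₂ γ))
  full = mapPT (fst ∙ v0 & gridPT ∙ fst ∙ fst ∙ fst) v0
  module _ (p : Carrier Par) where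
    Small : Items → Items → Set
    Small rs rs′ = map (put (gridOf p)) rs′ ≡ map (put (gridOf p)) rs × All (λ r → posOf r ≤ gridOf p) rs′
    placed : ∀ rs rs′ (z : Carrier Item → ℕ) → map (put (gridOf p)) rs′ ≡ map (put (gridOf p)) rs → Small rs (map (λ r → place (gridOf p) r (z r)) rs′)
    placed rs rs′ z e = trans (trans (sym (List.map-∘ rs′)) refl) e , all rs′
      where
      all : ∀ rs′ → All (λ r → posOf r ≤ gridOf p) (map (λ r → place (gridOf p) r (z r)) rs′)
      all []        = []
      all (r ∷ rs′) = clip-≤ _ (takenOf r) (allowedOf r) _ ∷ all rs′
    adjust-small : ∀ β rs rs′ → Small rs rs′ → Small rs (adjust p β rs′)
    adjust-small β rs rs′ sm with cuts p rs′ | spend rs′ ℕ.≤ᵇ β + slackOf p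
    ... | c ∷ _ | _     = placed rs rs′ _ (proj₁ sm)
    ... | []    | true  = sm
    ... | []    | false = placed rs rs′ _ (proj₁ sm)
  bound : ∀ γ j → j ≤ stepsOf (proj₁ (proj₁ γ)) →
          size (enc (Lst Item) (iter j (adjust (proj₁ (proj₁ γ)) (proj₂ (proj₁ γ))) (map (λ r → place (gridOf (proj₁ (proj₁ γ))) r 0) (proj₂ γ)))) ≤
          ⟦ sizeBound full ⟧ (size (enc (Par ⊗ Nat ⊗ Lst Item) γ))
  bound ((p , β) , rs) j _ =
    let (e , le) = iter-invariant (Small p rs) (adjust-small p β rs) j _ (placed p rs rs (λ _ → 0) refl) in
    ≤-trans (size-map Item (put (gridOf p)) _ (All.map (λ q → s≤s (+-monoʳ-≤ _ (size-Nat-mono q))) le))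
            (≤-trans (≤-reflexive (cong (size ∘ enc (Lst Item)) e)) (size-output full ((p , β) , rs)))

queryPT : ∀ {Γ p s} → PT Γ Par p → PT Γ Guess s → PT Γ Bit (λ γ → query (p γ) (s γ))
queryPT P S = andPT (caseListPT (cutsPT (fst ∙ fst) v0) (const Bit true) (const Bit false)) (leqPT (spendPT v0) (snd ∙ v1 ⊕ slackPT ∙ fst ∙ fst)) ∙
              ((P & S) & settlePT P (snd ∙ S) (fst ∙ S))

markPT : ∀ {Γ lo hi i r} → PT Γ Bit lo → PT Γ Bit hi → PT Γ Nat i → PT Γ Item r → PT Γ Item (λ γ → mark (lo γ) (hi γ) (i γ) (r γ))
markPT lo hi I R = ifPT (eqPT (idxPT ∙ R) I) ((fst ∙ fst ∙ R & (lo & hi)) & posPT ∙ R) R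

movesPT : ∀ {Γ p s} → PT Γ Par p → PT Γ Guess s → PT Γ (Lst Guess) (λ γ → moves (p γ) (s γ))
movesPT P S = concatMapPT (ifPT (andPT (allowedPT ∙ v0) (notPT (takenPT ∙ v0)))
    (consPT (mapPT (markPT (const Bit false) (const Bit false) (idxPT ∙ v1) v0) (fst ∙ v1) & snd ∙ v1)
    (consPT (mapPT (markPT (const Bit true) (const Bit true) (idxPT ∙ v1) v0) (fst ∙ v1) & snd ∙ v1 ⊕ raisePT ∙ fst ∙ fst ⊛ costPT ∙ v0)
            (nilPT Guess))) (nilPT Guess)) (fst ∙ snd) ∙ (P & S)

movePT : ∀ {Γ p s} → PT Γ Par p → PT Γ Guess s → PT Γ Guess (λ γ → move (p γ) (s γ))
movePT P S = caseListPT (filterPT (queryPT (fst ∙ fst) v0) (movesPT fst snd)) snd (fst ∙ v1 & snd ∙ v1 ⊕ lossPT ∙ fst ∙ fst ∙ fst) ∙ (P & S)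

filterᵇ-cases : ∀ {A : Set} (q : A → Bool) xs →
  (List.filterᵇ q xs ≡ [] × All (λ x → ¬ T (q x)) xs) ⊎
  (∃₂ λ y ys → List.filterᵇ q xs ≡ y ∷ ys × y ∈ xs × T (q y))
filterᵇ-cases q [] = inj₁ (refl , [])
filterᵇ-cases q (x ∷ xs) with q x in eq
... | true  = inj₂ (x , List.filterᵇ q xs , refl , here refl , subst T (sym eq) tt)
... | false with filterᵇ-cases q xs
... | inj₁ (e , a)              = inj₁ (e , subst T eq ∷ a)
... | inj₂ (y , ys , e , y∈ , t) = inj₂ (y , ys , e , there y∈ , t)

firstMatch : ∀ {A B : Set} (q : A → Bool) xs (d : B) (f : A → B) → let b = caseList (List.filterᵇ q xs) d (λ x _ → f x) in
  (b ≡ d × All (λ x → ¬ T (q x)) xs) ⊎ (∃ λ y → y ∈ xs × T (q y) × b ≡ f y)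
firstMatch q xs d f with filterᵇ-cases q xs
... | inj₁ (e , a)                = inj₁ (cong (λ l → caseList l d (λ x _ → f x)) e , a)
... | inj₂ (y , ys , e , y∈ , t) = inj₂ (y , y∈ , t , cong (λ l → caseList l d (λ x _ → f x)) e)

MoveResult : Carrier Par → Carrier Guess → Carrier Guess → Set
MoveResult p s s″ = (s″ ≡ s × All (λ s′ → ¬ T (query p s′)) (moves p s)) ⊎
                    (∃ λ s′ → s′ ∈ moves p s × T (query p s′) × s″ ≡ (proj₁ s′ , proj₂ s′ + lossOf p))

move-result : ∀ p s → MoveResult p s (move p s)
move-result p s = firstMatch (query p) (moves p s) s _

dropped taken : Carrier Par → Carrier Guess → Carrier Item → Carrier Guess
dropped p s r = map (mark false false (idxOf r)) (proj₁ s) , proj₂ s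
taken   p s r = map (mark true  true  (idxOf r)) (proj₁ s) , proj₂ s + raiseOf p * costOf r

movesFor : Carrier Par → Carrier Guess → Carrier Item → List (Carrier Guess)
movesFor p s r = if undecided r then dropped p s r ∷ taken p s r ∷ [] else []

∈-moves⁻ : ∀ p s {s′} → s′ ∈ moves p s → ∃ λ r → r ∈ proj₁ s × T (undecided r) × (s′ ≡ dropped p s r ⊎ s′ ≡ taken p s r)
∈-moves⁻ p s s′∈ = let (r , r∈ , q) = find (∈-concatMap⁻ (movesFor p s) {xs = proj₁ s} s′∈) in r , r∈ , look r q
  where
  look : ∀ r {s′} → s′ ∈ movesFor p s r → T (undecided r) × (s′ ≡ dropped p s r ⊎ s′ ≡ taken p s r)
  look r q with undecided r | q
  ... | true | here e         = tt , inj₁ e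
  ... | true | there (here e) = tt , inj₂ e

∈-moves⁺ : ∀ p s {r} → r ∈ proj₁ s → T (undecided r) → dropped p s r ∈ moves p s × taken p s r ∈ moves p s
∈-moves⁺ p s {r} r∈ u = ∈-concatMap⁺ (movesFor p s) (lose r∈ (look r u (here refl))) , ∈-concatMap⁺ (movesFor p s) (lose r∈ (look r u (there (here refl))))
  where
  look : ∀ r → T (undecided r) → ∀ {s′} → s′ ∈ dropped p s r ∷ taken p s r ∷ [] → s′ ∈ movesFor p s r
  look r u q with undecided r | u
  ... | true | _ = q

iter-indexed : ∀ {A : Set} (P : ℕ → A → Set) {f : A → A} → (∀ n x → P n x → P (suc n) (f x)) → ∀ j n x → P n x → P (n + j) (iter j f x)
iter-indexed P         pres zero    n x p = subst (λ k → P k x) (sym (+-identityʳ n)) p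
iter-indexed P {f = f} pres (suc j) n x p = subst (λ k → P k (iter j f (f x))) (sym (+-suc n j)) (iter-indexed P pres j (suc n) (f x) (pres n x p))

-- True is the longer code of a flag, so this maximises the size of an item while forgetting exactly
-- what a move changes in it.
unmark : Carrier Item → Carrier Item
unmark r = (proj₁ (proj₁ r) , (true , true)) , posOf r

unmark-mark : ∀ lo hi i rs → map unmark (map (mark lo hi i) rs) ≡ map unmark rs
unmark-mark lo hi i []       = refl
unmark-mark lo hi i (r ∷ rs) = cong₂ _∷_ (eq r) (unmark-mark lo hi i rs)
  where
  eq : ∀ r → unmark (mark lo hi i r) ≡ unmark r
  eq r with idxOf r ℕ.≡ᵇ i
  ... | true  = refl
  ... | false = refl

cost≤sum : ∀ rs {r} → r ∈ rs → costOf r ≤ sumOver costOf (map unmark rs)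
cost≤sum (r ∷ rs) (here refl) = m≤m+n _ _
cost≤sum (r ∷ rs) (there r∈)  = ≤-trans (cost≤sum rs r∈) (m≤n+m _ _)

module DecideTime where

  total-cost : PT (Par ⊗ Guess) Nat (λ γ → sumOver costOf (map unmark (proj₁ (proj₂ γ))))
  total-cost = sumPT (costPT ∙ v0) (mapPT ((fst ∙ fst ∙ v0 & const (Bit ⊗ Bit) (true , true)) & posPT ∙ v0) (fst ∙ snd))
  growth : Carrier Par → Items → ℕ
  growth p rs = raiseOf p * sumOver costOf (map unmark rs) + lossOf p
  full : PT (Par ⊗ Guess) Guess (λ γ → map unmark (proj₁ (proj₂ γ)) , proj₂ (proj₂ γ) + length (proj₁ (proj₂ γ)) * growth (proj₁ γ) (proj₁ (proj₂ γ)))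
  full = mapPT ((fst ∙ fst ∙ v0 & const (Bit ⊗ Bit) (true , true)) & posPT ∙ v0) (fst ∙ snd) &
         snd ∙ snd ⊕ lengthPT (fst ∙ snd) ⊛ (raisePT ∙ fst ⊛ total-cost ⊕ lossPT ∙ fst)
  drop-bound : ∀ a b c d {x} → x ≤ a + b → x + d ≤ a + ((c + d) + b)
  drop-bound a b c d {x} le = ≤-trans (+-mono-≤ le (m≤n+m d c)) (≤-reflexive (shuffle a b (c + d)))
    where
    shuffle : ∀ a b c → a + b + c ≡ a + (c + b)
    shuffle = ℕ-Ring.solve-∀
  take-bound : ∀ a b d {c x y} → x ≤ a + b → y ≤ c → x + y + d ≤ a + ((c + d) + b)
  take-bound a b d {c} le le′ = ≤-trans (+-monoˡ-≤ d (+-mono-≤ le le′)) (≤-reflexive (shuffle a b c d))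
    where
    shuffle : ∀ a b c d → a + b + c + d ≡ a + ((c + d) + b)
    shuffle = ℕ-Ring.solve-∀
  module _ (p : Carrier Par) (s : Carrier Guess) where
    Small : ℕ → Carrier Guess → Set
    Small n s′ = map unmark (proj₁ s′) ≡ map unmark (proj₁ s) × proj₂ s′ ≤ proj₂ s + n * growth p (proj₁ s)
    step : ∀ n s′ → Small n s′ → Small (suc n) (move p s′)
    step n s′ (e , le) = case move-result p s′ of λ where
      (inj₁ (eq , _)) → subst (Small (suc n)) (sym eq) (e , ≤-trans le (+-monoʳ-≤ (proj₂ s) (m≤n+m _ _)))
      (inj₂ (y , y∈ , _ , eq)) → subst (Small (suc n)) (sym eq) (case ∈-moves⁻ p s′ y∈ of λ where
        (r , r∈ , _ , inj₁ e′) → subst (λ y → Small (suc n) (proj₁ y , proj₂ y + lossOf p)) (sym e′)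
          (trans (unmark-mark false false (idxOf r) (proj₁ s′)) e , drop-bound (proj₂ s) (n * growth p (proj₁ s)) (raiseOf p * sumOver costOf (map unmark (proj₁ s))) (lossOf p) le)
        (r , r∈ , _ , inj₂ e′) → subst (λ y → Small (suc n) (proj₁ y , proj₂ y + lossOf p)) (sym e′)
          (trans (unmark-mark true true (idxOf r) (proj₁ s′)) e , take-bound (proj₂ s) (n * growth p (proj₁ s)) (lossOf p) le
            (*-monoʳ-≤ (raiseOf p) (subst (λ l → costOf r ≤ sumOver costOf l) e (cost≤sum (proj₁ s′) r∈)))))
  size-unmark : ∀ r → size (enc Item r) ≤ size (enc Item (unmark r))
  size-unmark r = s≤s (+-monoˡ-≤ (size (enc Nat (posOf r))) (s≤s (+-monoʳ-≤ (size (enc (Nat ⊗ Arc ⊗ Nat) (proj₁ (proj₁ r)))) (s≤s (+-mono-≤ (size-bit (takenOf r)) (size-bit (allowedOf r)))))))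
    where
    size-bit : ∀ b → size (encodeBool b) ≤ 3
    size-bit true  = ≤-refl
    size-bit false = s≤s z≤n
  bound : ∀ γ j → j ≤ length (proj₁ (proj₂ γ)) → size (enc Guess (iter j (move (proj₁ γ)) (proj₂ γ))) ≤ ⟦ sizeBound full ⟧ (size (enc (Par ⊗ Guess) γ))
  bound (p , s) j j≤ =
    let (e , le) = iter-indexed (Small p s) (step p s) j 0 s (refl , m≤m+n _ _) in
    ≤-trans (s≤s (+-mono-≤ (≤-trans (size-map Item unmark _ (All.universal size-unmark _)) (≤-reflexive (cong (size ∘ enc (Lst Item)) e)))
                           (size-Nat-mono (≤-trans le (+-monoʳ-≤ (proj₂ s) (*-monoˡ-≤ (growth p (proj₁ s)) j≤))))))
            (size-output full (p , s))
  loopPT : PT (Par ⊗ Guess) Guess (λ γ → decide (proj₁ γ) (proj₂ γ))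
  loopPT = iterPT {Par ⊗ Guess} {Guess} {λ γ → move (proj₁ (proj₁ γ)) (proj₂ γ)} {λ γ → length (proj₁ (proj₂ γ))} {proj₂}
                  (movePT {s = proj₂} (fst ∙ fst) v0) (sizeBound full) bound (lengthPT (fst ∙ snd)) snd

decidePT : ∀ {Γ p s} → PT Γ Par p → PT Γ Guess s → PT Γ Guess (λ γ → decide (p γ) (s γ))
decidePT P S = DecideTime.loopPT ∙ (P & S)

-- The whole algorithm

numberFrom : ∀ {A : Set} → ℕ → List A → List (ℕ × A)
numberFrom i []       = []
numberFrom i (x ∷ xs) = (i , x) ∷ numberFrom (suc i) xs

numberStep : ∀ {A : Set} → ℕ × List (ℕ × A) → A → ℕ × List (ℕ × A)
numberStep p x = suc (proj₁ p) , (proj₁ p , x) ∷ proj₂ p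

numbered : ∀ {A : Set} → List A → List (ℕ × A)
numbered xs = reverse (proj₂ (foldl numberStep (0 , []) xs))

numbered-correct : ∀ {A : Set} (xs : List A) → numbered xs ≡ numberFrom 0 xs
numbered-correct xs = trans (cong reverse (trans (go 0 [] xs) (List.++-identityʳ _))) (List.reverse-involutive _)
  where
  go : ∀ {A : Set} i acc (xs : List A) → proj₂ (foldl numberStep (i , acc) xs) ≡ reverse (numberFrom i xs) ++ acc
  go i acc []       = refl
  go i acc (x ∷ xs) = trans (go (suc i) ((i , x) ∷ acc) xs)
    (trans (sym (List.++-assoc (reverse (numberFrom (suc i) xs)) ((i , x) ∷ []) acc))
           (cong (_++ acc) (sym (List.unfold-reverse (i , x) (numberFrom (suc i) xs)))))

module _ {A : Coded} where

  numberBound : Poly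
  numberBound = con 1 ⊞ ((con 1 ⊞ (arg ⊞ arg)) ⊞ (con 1 ⊞ arg ⊠ (con 1 ⊞ (con 1 ⊞ ((con 1 ⊞ (arg ⊞ arg)) ⊞ arg)))))

  number-small : ∀ K ys i acc → i + length ys ≤ K → All (λ a → size (enc A a) ≤ K) ys →
    All (λ q → size (enc (Nat ⊗ A) q) ≤ suc (suc (K + K) + K)) acc → length acc ≤ i →
    size (enc (Nat ⊗ Lst (Nat ⊗ A)) (foldl numberStep (i , acc) ys)) ≤ ⟦ numberBound ⟧ K
  number-small K []       i acc le []       p q =
    s≤s (+-mono-≤ (≤-trans (size-Nat-mono i≤K) (≤-reflexive (size-Nat K)))
                  (≤-trans (size-list (Nat ⊗ A) (suc (suc (K + K) + K)) acc p) (s≤s (*-monoˡ-≤ _ (≤-trans q i≤K)))))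
    where
    i≤K : i ≤ K
    i≤K = ≤-trans (m≤m+n i 0) le
  number-small K (y ∷ ys) i acc le (r ∷ rs) p q =
    number-small K ys (suc i) ((i , y) ∷ acc) (≤-trans (≤-reflexive (sym (+-suc i _))) le) rs
      (s≤s (+-mono-≤ (≤-trans (size-Nat-mono (≤-trans (m≤m+n i _) le)) (≤-reflexive (size-Nat K))) r) ∷ p) (s≤s q)

  numberedPT : ∀ {Γ xs} → PT Γ (Lst A) xs → PT Γ (Lst (Nat ⊗ A)) (λ γ → numbered (xs γ))
  numberedPT XS = reversePT (snd ∙ foldPT {Lst A} {A} {Nat ⊗ Lst (Nat ⊗ A)} {λ γ → numberStep (proj₂ (proj₁ γ)) (proj₂ γ)}
                                    (sucPT (fst ∙ v1) & consPT (fst ∙ v1 & v0) (snd ∙ v1)) numberBound bound idPT (const (Nat ⊗ Lst (Nat ⊗ A)) (0 , []))) ∙ XS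
    where
    bound : ∀ xs ys ws → xs ≡ ys ++ ws → size (enc (Nat ⊗ Lst (Nat ⊗ A)) (foldl numberStep (0 , []) ys)) ≤ ⟦ numberBound ⟧ (size (enc (Lst A) xs))
    bound xs ys ws refl = number-small _ ys 0 [] (≤-trans (length≤size A ys) (size-prefix A ys ws))
                            (All.++⁻ˡ ys (elements-smaller A (ys ++ ws))) [] z≤n

-- The ends of an edge, and numerator and denominator of its cost
Edge : Coded
Edge = Arc ⊗ (Lst Nat ⊗ Lst Nat)

IEdge : Coded
IEdge = Nat ⊗ Edge

numer denom : Carrier IEdge → List ℕ
numer e = proj₁ (proj₂ (proj₂ e))
denom e = proj₂ (proj₂ (proj₂ e))

-- ⌊C c_e / c_{e₀}⌋, capped at C and found by counting instead of dividing. If e₀ is free, every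
-- test succeeds and the value is C.
scaled : ℕ → Carrier IEdge → Carrier IEdge → ℕ
scaled C e₀ e = countBelow C (λ j → leqList (repeat (suc j) (times (numer e₀) (denom e))) (repeat C (times (numer e) (denom e₀))))

noDearer : Carrier IEdge → Carrier IEdge → Bool
noDearer e e₀ = leqList (times (numer e) (denom e₀)) (times (numer e₀) (denom e))

item : ℕ → Carrier IEdge → Carrier IEdge → Carrier Item
item C e₀ e = (((proj₁ e , proj₁ (proj₂ e)) , scaled C e₀ e) , ((proj₁ e ℕ.≡ᵇ proj₁ e₀) , noDearer e e₀)) , 0

-- One m³ bounds the sum of the squared rounded costs, each at most m; this is the slack of the
-- budget test. The other bounds the cost of padding m edges by m each. The first query and at most
-- m moves incur this error, and `scaleOf` exceeds the total by one.
errorOf scaleOf gridSize : ℕ → ℕ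
errorOf m  = m * m * m + m * m * m
scaleOf m  = suc (suc m * errorOf m)
gridSize m = scaleOf m + scaleOf m

errorPT : PT Nat Nat errorOf
errorPT = idPT ⊛ idPT ⊛ idPT ⊕ idPT ⊛ idPT ⊛ idPT

scalePT : PT Nat Nat scaleOf
scalePT = sucPT (sucPT idPT ⊛ errorPT)

gridSizePT : PT Nat Nat gridSize
gridSizePT = scalePT ⊕ scalePT

-- The algorithms differ only in the raise: for ratio 2 an edge of value at least 1/2 (half the grid
-- size) may be taken, for unit costs only an edge of value 1.
abstract
  parameters : Bool → ℕ → ℕ → Carrier Par
  parameters b m k =
    (((((gridSize m , m) , ℕ.pred (gridSize m * k)) , m * m * m) , suc (m * (gridSize m * gridSize m))) , (if b then scaleOf m else 0)) , errorOf m

  parametersPT : ∀ b → PT (Nat ⊗ Nat) Par (λ γ → parameters b (proj₁ γ) (proj₂ γ))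
  parametersPT b = (((((gridSizePT ∙ fst & fst) & predPT (gridSizePT ∙ fst ⊛ snd)) & fst ⊛ fst ⊛ fst) &
    sucPT (fst ⊛ (gridSizePT ∙ fst ⊛ gridSizePT ∙ fst))) & ifPT (const Bit b) (scalePT ∙ fst) (const Nat 0)) & errorPT ∙ fst

  parameters-≡ : ∀ b m k → parameters b m k ≡
    ((((((gridSize m , m) , ℕ.pred (gridSize m * k)) , m * m * m) , suc (m * (gridSize m * gridSize m))) , (if b then scaleOf m else 0)) , errorOf m)
  parameters-≡ b m k = refl

Cand : Coded
Cand = Nat ⊗ (Lst Nat ⊗ Lst Nat) ⊗ Lst Bit

-- The successor turns the costs, which were rounded down, into upper bounds on the true ones.
weight : Items → ℕ
weight = sumOver (λ r → if allowedOf r then suc (costOf r) else 0)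

candidate : Carrier IEdge → Items → Carrier Cand
candidate e₀ rs = (weight rs , proj₂ (proj₂ e₀)) , map allowedOf rs

attempt : Carrier Par → List (Carrier IEdge) → Carrier IEdge → ℕ → List (Carrier Cand)
attempt p L e₀ b = let rs = map (item (length L) e₀) L in
  if query p (rs , gridOf p * b) then candidate e₀ (proj₁ (decide p (rs , gridOf p * b + lossOf p))) ∷ [] else []

-- Rounded costs are at most the number m of edges, so m² bounds the rounded cost of every edge set.
candidates : Carrier Par → List (Carrier IEdge) → List (Carrier Cand)
candidates p L = concatMap (λ e₀ → concatMap (λ b → attempt p L e₀ b) (List.downFrom (suc (length L * length L)))) L

-- Weights that belong to different guesses are in different units. Each is multiplied by the price
-- of its own guessed edge, and the fractions are cross-multiplied.
noWorse : Carrier Cand → Carrier Cand → Bool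
noWorse c d = leqList (repeat (proj₁ (proj₁ c)) (times (proj₁ (proj₂ (proj₁ c))) (proj₂ (proj₂ (proj₁ d)))))
                      (repeat (proj₁ (proj₁ d)) (times (proj₁ (proj₂ (proj₁ d))) (proj₂ (proj₂ (proj₁ c)))))

choose : Carrier Cand → Carrier Cand → Carrier Cand
choose c d = if noWorse c d then c else d

-- If there is an edge, the guess that fits a feasible subgraph yields a candidate; the default is
-- reached only without edges.
solve : Bool → ℕ → List (Carrier IEdge) → List Bool
solve b k L = caseList (candidates (parameters b (length L) k) L) (map (λ _ → true) L) (λ c cs → proj₂ (foldl choose c cs))

Raw : Coded
Raw = Bin ⊗ (Lst Bin ⊗ Lst (Bin ⊗ (Bin ⊗ (Bin ⊗ Bin))))

-- Vertex numbers lie below the length of the vertex list of the input, so the cap changes nothing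
-- and keeps the unary numbers polynomial.
decodeEdge : ℕ → Carrier (Bin ⊗ (Bin ⊗ (Bin ⊗ Bin))) → Carrier Edge
decodeEdge n e = (truncate n (binary (proj₁ e)) , truncate n (binary (proj₁ (proj₂ e)))) ,
                 (binary (proj₁ (proj₂ (proj₂ e))) , binary (proj₂ (proj₂ (proj₂ e))))

edgesOf : Carrier Raw → List (Carrier IEdge)
edgesOf r = numbered (map (decodeEdge (length (proj₁ (proj₂ r)))) (proj₂ (proj₂ r)))

connectivityOf : Carrier Raw → ℕ
connectivityOf r = truncate (suc (4 * length (proj₂ (proj₂ r)))) (binary (proj₁ r))

algorithm : Bool → Carrier Raw → List Bool
algorithm b r = solve b (connectivityOf r) (edgesOf r)

scaledPT : PT (Nat ⊗ IEdge ⊗ IEdge) Nat (λ γ → scaled (proj₁ (proj₁ γ)) (proj₂ (proj₁ γ)) (proj₂ γ))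
scaledPT = countBelowPT (fst ∙ fst) (leqListPT
  (repeatPT (sucPT v0) (timesPT (fst ∙ snd ∙ snd ∙ v2) (snd ∙ snd ∙ snd ∙ v1)))
  (repeatPT (fst ∙ fst ∙ fst) (timesPT (fst ∙ snd ∙ snd ∙ v1) (snd ∙ snd ∙ snd ∙ v2))))

itemPT : PT (Nat ⊗ IEdge ⊗ IEdge) Item (λ γ → item (proj₁ (proj₁ γ)) (proj₂ (proj₁ γ)) (proj₂ γ))
itemPT = (((fst ∙ v0 & fst ∙ snd ∙ v0) & scaledPT) & (eqPT (fst ∙ v0) (fst ∙ v1) &
  leqListPT (timesPT (fst ∙ snd ∙ snd ∙ v0) (snd ∙ snd ∙ snd ∙ v1)) (timesPT (fst ∙ snd ∙ snd ∙ v1) (snd ∙ snd ∙ snd ∙ v0)))) & const Nat 0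

itemsPT : PT (Lst IEdge ⊗ IEdge) (Lst Item) (λ γ → map (item (length (proj₁ γ)) (proj₂ γ)) (proj₁ γ))
itemsPT = mapPT (itemPT ∙ ((lengthPT (fst ∙ fst) & snd ∙ fst) & v0)) fst

candidatePT : ∀ {Γ e rs} → PT Γ IEdge e → PT Γ (Lst Item) rs → PT Γ Cand (λ γ → candidate (e γ) (rs γ))
candidatePT E RS = (sumPT (ifPT (allowedPT ∙ v0) (sucPT (costPT ∙ v0)) (const Nat 0)) RS & snd ∙ snd ∙ E) & mapPT (allowedPT ∙ v0) RS

attemptPT : PT (Par ⊗ Lst IEdge ⊗ IEdge ⊗ Nat) (Lst Cand) (λ γ → attempt (proj₁ (proj₁ (proj₁ γ))) (proj₂ (proj₁ (proj₁ γ))) (proj₂ (proj₁ γ)) (proj₂ γ))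
attemptPT = body ∙ (idPT & itemsPT ∙ (v2 & v1))
  where
  body : PT (Par ⊗ Lst IEdge ⊗ IEdge ⊗ Nat ⊗ Lst Item) (Lst Cand) (λ γ → let p = proj₁ (proj₁ (proj₁ (proj₁ γ))); e₀ = proj₂ (proj₁ (proj₁ γ)); b = proj₂ (proj₁ γ); rs = proj₂ γ in
           if query p (rs , gridOf p * b) then candidate e₀ (proj₁ (decide p (rs , gridOf p * b + lossOf p))) ∷ [] else [])
  body = ifPT (queryPT P (v0 & gridPT ∙ P ⊛ v1)) (consPT (candidatePT v2 (fst ∙ decidePT P (v0 & gridPT ∙ P ⊛ v1 ⊕ lossPT ∙ P))) (nilPT Cand)) (nilPT Cand)
    where
    P : ∀ {A B C D} → PT (Par ⊗ A ⊗ B ⊗ C ⊗ D) Par (λ γ → proj₁ (proj₁ (proj₁ (proj₁ γ))))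
    P = fst ∙ fst ∙ fst ∙ fst

candidatesPT : PT (Par ⊗ Lst IEdge) (Lst Cand) (λ γ → candidates (proj₁ γ) (proj₂ γ))
candidatesPT = concatMapPT (concatMapPT attemptPT (downFromPT (sucPT (lengthPT v1 ⊛ lengthPT v1)))) snd

noWorsePT : ∀ {Γ c d} → PT Γ Cand c → PT Γ Cand d → PT Γ Bit (λ γ → noWorse (c γ) (d γ))
noWorsePT C D = leqListPT (repeatPT (fst ∙ fst ∙ C) (timesPT (fst ∙ snd ∙ fst ∙ C) (snd ∙ snd ∙ fst ∙ D)))
                          (repeatPT (fst ∙ fst ∙ D) (timesPT (fst ∙ snd ∙ fst ∙ D) (snd ∙ snd ∙ fst ∙ C)))

choosePT : PT (Cand ⊗ Lst Cand ⊗ Cand ⊗ Cand) Cand (λ γ → choose (proj₂ (proj₁ γ)) (proj₂ γ))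
choosePT = ifPT (noWorsePT v1 v0) v1 v0

if-invariant : ∀ {A : Set} (P : A → Set) (b : Bool) {x y : A} → P x → P y → P (if b then x else y)
if-invariant P true  p q = p
if-invariant P false p q = q

bestPT : PT (Cand ⊗ Lst Cand) Cand (λ γ → foldl choose (proj₁ γ) (proj₂ γ))
bestPT = foldPT choosePT arg bound snd fst
  where
  bound : ∀ γ ys ws → proj₂ γ ≡ ys ++ ws → size (enc Cand (foldl choose (proj₁ γ) ys)) ≤ size (enc (Cand ⊗ Lst Cand) γ)
  bound (c , cs) ys ws refl = foldl-invariant Small Small (λ b a p q → if-invariant Small (noWorse b a) p q) ys c
      (All.++⁻ˡ ys (All.map (λ le → ≤-trans le (m≤n⇒m≤1+n (m≤n+m _ _))) (elements-smaller Cand (ys ++ ws)))) (m≤n⇒m≤1+n (m≤m+n _ _))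
    where
    Small : Carrier Cand → Set
    Small d = size (enc Cand d) ≤ size (enc (Cand ⊗ Lst Cand) (c , ys ++ ws))

solvePT : ∀ b → PT (Nat ⊗ Lst IEdge) (Lst Bit) (λ γ → solve b (proj₁ γ) (proj₂ γ))
solvePT b = caseListPT (candidatesPT ∙ (parametersPT b ∙ (lengthPT snd & fst) & snd)) (mapPT (const Bit true) snd) (snd ∙ bestPT ∙ (v1 & v0))

decodeEdgePT : ∀ {Γ n e} → PT Γ Nat n → PT Γ (Bin ⊗ (Bin ⊗ (Bin ⊗ Bin))) e → PT Γ Edge (λ γ → decodeEdge (n γ) (e γ))
decodeEdgePT N E = (truncatePT N (binaryPT (fst ∙ E)) & truncatePT N (binaryPT (fst ∙ snd ∙ E))) & (binaryPT (fst ∙ snd ∙ snd ∙ E) & binaryPT (snd ∙ snd ∙ snd ∙ E))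

edgesPT : PT Raw (Lst IEdge) edgesOf
edgesPT = numberedPT (mapPT (decodeEdgePT (lengthPT (fst ∙ snd ∙ fst)) v0) (snd ∙ snd))

connectivityPT : PT Raw Nat connectivityOf
connectivityPT = truncatePT (sucPT (const Nat 4 ⊛ lengthPT (snd ∙ snd))) (binaryPT fst)

algorithmPT : ∀ b → PT Raw (Lst Bit) (algorithm b)
algorithmPT b = _∙_ {f = λ r → connectivityOf r , edgesOf r} (solvePT b) (connectivityPT & edgesPT)

-- Integer sums

∑ : ∀ {m} → (Fin m → ℤ) → ℤ
∑ {zero}  f = ℤ.0ℤ
∑ {suc m} f = f zero ℤ.+ ∑ (f ∘ suc)

∑-cong : ∀ {m} {f g : Fin m → ℤ} → (∀ e → f e ≡ g e) → ∑ f ≡ ∑ g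
∑-cong {zero}  eq = refl
∑-cong {suc m} eq = cong₂ ℤ._+_ (eq zero) (∑-cong (eq ∘ suc))

∑-zero : ∀ {m} {f : Fin m → ℤ} → (∀ e → f e ≡ ℤ.0ℤ) → ∑ f ≡ ℤ.0ℤ
∑-zero {zero}  eq = refl
∑-zero {suc m} eq = trans (cong₂ ℤ._+_ (eq zero) (∑-zero (eq ∘ suc))) refl

∑-+ : ∀ {m} (f g : Fin m → ℤ) → ∑ (λ e → f e ℤ.+ g e) ≡ ∑ f ℤ.+ ∑ g
∑-+ {zero}  f g = refl
∑-+ {suc m} f g = trans (cong (λ t → (f zero ℤ.+ g zero) ℤ.+ t) (∑-+ (f ∘ suc) (g ∘ suc))) (shuffle (f zero) (g zero) (∑ (f ∘ suc)) (∑ (g ∘ suc)))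
  where
  shuffle : ∀ a b c d → (a ℤ.+ b) ℤ.+ (c ℤ.+ d) ≡ (a ℤ.+ c) ℤ.+ (b ℤ.+ d)
  shuffle = ℤ-Ring.solve-∀

∑-* : ∀ {m} a (f : Fin m → ℤ) → ∑ (λ e → a ℤ.* f e) ≡ a ℤ.* ∑ f
∑-* {zero}  a f = sym (ℤ.*-zeroʳ a)
∑-* {suc m} a f = trans (cong (λ t → a ℤ.* f zero ℤ.+ t) (∑-* a (f ∘ suc))) (sym (ℤ.*-distribˡ-+ a (f zero) _))

∑-mono : ∀ {m} {f g : Fin m → ℤ} → (∀ e → f e ℤ.≤ g e) → ∑ f ℤ.≤ ∑ g
∑-mono {zero}  le = ℤ.≤-refl
∑-mono {suc m} le = ℤ.+-mono-≤ (le zero) (∑-mono (le ∘ suc))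

∑-nonneg : ∀ {m} {f : Fin m → ℤ} → (∀ e → ℤ.0ℤ ℤ.≤ f e) → ℤ.0ℤ ℤ.≤ ∑ f
∑-nonneg {m} {f} p = subst (ℤ._≤ ∑ f) (∑-zero {m} (λ _ → refl)) (∑-mono p)

∑-strict : ∀ {m} {f g : Fin m → ℤ} → (∀ e → f e ℤ.≤ g e) → ∀ e → f e ℤ.< g e → ∑ f ℤ.< ∑ g
∑-strict le zero    lt = ℤ.+-mono-<-≤ lt (∑-mono (le ∘ suc))
∑-strict le (suc e) lt = ℤ.+-mono-≤-< (le zero) (∑-strict (le ∘ suc) e lt)

∑-linear : ∀ {m} a b (r f g : Fin m → ℤ) →
           ∑ (λ e → r e ℤ.* (a ℤ.* f e ℤ.+ b ℤ.* g e)) ≡ a ℤ.* ∑ (λ e → r e ℤ.* f e) ℤ.+ b ℤ.* ∑ (λ e → r e ℤ.* g e)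
∑-linear a b r f g = begin
  ∑ (λ e → r e ℤ.* (a ℤ.* f e ℤ.+ b ℤ.* g e))                        ≡⟨ ∑-cong (λ e → shuffle a b (r e) (f e) (g e)) ⟩
  ∑ (λ e → a ℤ.* (r e ℤ.* f e) ℤ.+ b ℤ.* (r e ℤ.* g e))              ≡⟨ ∑-+ (λ e → a ℤ.* (r e ℤ.* f e)) (λ e → b ℤ.* (r e ℤ.* g e)) ⟩
  ∑ (λ e → a ℤ.* (r e ℤ.* f e)) ℤ.+ ∑ (λ e → b ℤ.* (r e ℤ.* g e))    ≡⟨ cong₂ ℤ._+_ (∑-* a (λ e → r e ℤ.* f e)) (∑-* b (λ e → r e ℤ.* g e)) ⟩
  a ℤ.* ∑ (λ e → r e ℤ.* f e) ℤ.+ b ℤ.* ∑ (λ e → r e ℤ.* g e)        ∎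
  where
  open ≡-Reasoning
  shuffle : ∀ a b r f g → r ℤ.* (a ℤ.* f ℤ.+ b ℤ.* g) ≡ a ℤ.* (r ℤ.* f) ℤ.+ b ℤ.* (r ℤ.* g)
  shuffle = ℤ-Ring.solve-∀

*-nonneg : ∀ {a b} → ℤ.0ℤ ℤ.≤ a → ℤ.0ℤ ℤ.≤ b → ℤ.0ℤ ℤ.≤ a ℤ.* b
*-nonneg {a} {b} 0≤a 0≤b = subst (ℤ._≤ a ℤ.* b) (ℤ.*-zeroʳ a) (ℤ.*-monoˡ-≤-nonNeg a ⦃ ℤ.nonNegative 0≤a ⦄ 0≤b)

*-pos : ∀ {a b} → ℤ.0ℤ ℤ.< a → ℤ.0ℤ ℤ.< b → ℤ.0ℤ ℤ.< a ℤ.* b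
*-pos {a} {b} 0<a 0<b = subst (ℤ._< a ℤ.* b) (ℤ.*-zeroʳ a) (ℤ.*-monoˡ-<-pos a ⦃ ℤ.positive 0<a ⦄ 0<b)

-- Homogeneous linear systems

size-of : ∀ {m} → (Fin m → Bool) → ℕ
size-of {zero}  U = 0
size-of {suc m} U = bit (U zero) + size-of (U ∘ suc)

without : ∀ {m} → Fin m → (Fin m → Bool) → Fin m → Bool
without p U e = U e ∧ not (Dec.isYes (p Fin.≟ e))

size-cong : ∀ {m} {U V : Fin m → Bool} → (∀ e → U e ≡ V e) → size-of U ≡ size-of V
size-cong {zero}  eq = refl
size-cong {suc m} eq = cong₂ _+_ (cong bit (eq zero)) (size-cong (eq ∘ suc))

size-without : ∀ {m} (p : Fin m) U → T (U p) → size-of U ≡ suc (size-of (without p U))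
size-without zero U Up with U zero | Up
... | true | _ = cong suc (size-cong (λ e → sym (Bool.∧-identityʳ (U (suc e)))))
size-without (suc p) U Up = trans (cong₂ _+_ (cong bit (sym (Bool.∧-identityʳ (U zero)))) (size-without p (U ∘ suc) Up))
  (trans (+-suc _ _) (cong (λ k → suc (bit (U zero ∧ true) + k)) (size-cong (λ e → cong (λ b → U (suc e) ∧ not b) (same e)))))
  where
  same : ∀ e → Dec.isYes (p Fin.≟ e) ≡ Dec.isYes (suc p Fin.≟ suc e)
  same e with p Fin.≟ e
  ... | yes _ = refl
  ... | no  _ = refl

size-member : ∀ {m} (U : Fin m → Bool) → 0 < size-of U → ∃ λ e → T (U e)
size-member {suc m} U lt with U zero in eq
... | true  = zero , subst T (sym eq) tt
... | false = let (e , t) = size-member (U ∘ suc) lt in suc e , t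

Solution : ∀ {m} → List (Fin m → ℤ) → (Fin m → Bool) → Set
Solution {m} rows U = ∃ λ (z : Fin m → ℤ) →
  (∃ λ e → z e ≢ ℤ.0ℤ) × (∀ e → ¬ T (U e) → z e ≡ ℤ.0ℤ) × All (λ r → ∑ (λ e → r e ℤ.* z e) ≡ ℤ.0ℤ) rows

without-¬ : ∀ {m} p (U : Fin m → Bool) e → ¬ T (U e) → ¬ T (without p U e)
without-¬ p U e ¬u t = ¬u (proj₁ (T-∧ {U e} t))

without-self : ∀ {m} (p : Fin m) U → ¬ T (without p U p)
without-self p U t with p Fin.≟ p | proj₂ (T-∧ {U p} t)
... | no p≢p | _ = p≢p refl

*≢0 : ∀ {a b} → a ≢ ℤ.0ℤ → b ≢ ℤ.0ℤ → a ℤ.* b ≢ ℤ.0ℤ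
*≢0 {a} {b} a≢0 b≢0 e with ℤ.i*j≡0⇒i≡0∨j≡0 a e
... | inj₁ a≡0 = a≢0 a≡0
... | inj₂ b≡0 = b≢0 b≡0

-- Elimination without division. Two solutions of the remaining rows are chosen, the second one
-- vanishing at a coordinate p₁ where the first does not. The combination of both that annihilates
-- the new row is nonzero at p₁, provided the second has a nonzero product with that row; otherwise
-- the second itself serves.
nontrivial-solution : ∀ {m} (rows : List (Fin m → ℤ)) U → length rows < size-of U → Solution rows U
nontrivial-solution {m} [] U lt with size-member U lt
... | p , Up = unit , (p , unit-p) , (λ e ¬u → unit-off e (λ { refl → ¬u Up })) , []
  where
  unit : Fin m → ℤ
  unit e = if Dec.isYes (p Fin.≟ e) then ℤ.1ℤ else ℤ.0ℤ
  unit-p : unit p ≢ ℤ.0ℤ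
  unit-p eq with p Fin.≟ p
  ... | no p≢p = p≢p refl
  unit-off : ∀ e → e ≢ p → unit e ≡ ℤ.0ℤ
  unit-off e e≢p with p Fin.≟ e
  ... | yes p≡e = ⊥-elim (e≢p (sym p≡e))
  ... | no _    = refl
nontrivial-solution {m} (r ∷ rows) U lt with size-member U (≤-trans (s≤s z≤n) lt)
... | p , Up with nontrivial-solution rows U (<⇒≤ lt)
... | z₁ , (p₁ , z₁p) , off₁ , orth₁
  with nontrivial-solution rows (without p₁ U) (ℕ.s≤s⁻¹ (subst (suc (length rows) <_) (size-without p₁ U (support p₁ z₁p)) lt))
  where
  support : ∀ e → z₁ e ≢ ℤ.0ℤ → T (U e)
  support e ne with Bool.T? (U e)
  ... | yes t = t
  ... | no ¬t = ⊥-elim (ne (off₁ e ¬t))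
... | z₂ , (p₂ , z₂p) , off₂ , orth₂ with ∑ (λ e → r e ℤ.* z₁ e) ℤ.≟ ℤ.0ℤ | ∑ (λ e → r e ℤ.* z₂ e) ℤ.≟ ℤ.0ℤ
... | yes d₁≡0 | _        = z₁ , (p₁ , z₁p) , off₁ , d₁≡0 ∷ orth₁
... | no _     | yes d₂≡0 = z₂ , (p₂ , z₂p) , (λ e ¬u → off₂ e (without-¬ p₁ U e ¬u)) , d₂≡0 ∷ orth₂
... | no d₁≢0  | no d₂≢0  = z , (p₁ , z≢0) , off , orth-r ∷ All.zipWith (λ {r′} → orth r′) (orth₁ , orth₂)
  where
  d₁ d₂ : ℤ
  d₁ = ∑ (λ e → r e ℤ.* z₁ e)
  d₂ = ∑ (λ e → r e ℤ.* z₂ e)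
  z : Fin m → ℤ
  z e = d₂ ℤ.* z₁ e ℤ.+ (ℤ.- d₁) ℤ.* z₂ e
  z₂p₁ : z₂ p₁ ≡ ℤ.0ℤ
  z₂p₁ = off₂ p₁ (without-self p₁ U)
  z≢0 : z p₁ ≢ ℤ.0ℤ
  z≢0 eq = *≢0 d₂≢0 z₁p (trans (sym (trans (cong (λ k → d₂ ℤ.* z₁ p₁ ℤ.+ (ℤ.- d₁) ℤ.* k) z₂p₁) (drop d₂ (z₁ p₁) d₁))) eq)
    where
    drop : ∀ a b c → a ℤ.* b ℤ.+ (ℤ.- c) ℤ.* ℤ.0ℤ ≡ a ℤ.* b
    drop = ℤ-Ring.solve-∀
  off : ∀ e → ¬ T (U e) → z e ≡ ℤ.0ℤ
  off e ¬u = trans (cong₂ (λ a b → d₂ ℤ.* a ℤ.+ (ℤ.- d₁) ℤ.* b) (off₁ e ¬u) (off₂ e (without-¬ p₁ U e ¬u))) (vanish d₂ d₁)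
    where
    vanish : ∀ a b → a ℤ.* ℤ.0ℤ ℤ.+ (ℤ.- b) ℤ.* ℤ.0ℤ ≡ ℤ.0ℤ
    vanish = ℤ-Ring.solve-∀
  orth-r : ∑ (λ e → r e ℤ.* z e) ≡ ℤ.0ℤ
  orth-r = trans (∑-linear d₂ (ℤ.- d₁) r z₁ z₂) (cancel d₁ d₂)
    where
    cancel : ∀ a b → b ℤ.* a ℤ.+ (ℤ.- a) ℤ.* b ≡ ℤ.0ℤ
    cancel = ℤ-Ring.solve-∀
  orth : ∀ r′ → (∑ (λ e → r′ e ℤ.* z₁ e) ≡ ℤ.0ℤ) × (∑ (λ e → r′ e ℤ.* z₂ e) ≡ ℤ.0ℤ) → ∑ (λ e → r′ e ℤ.* z e) ≡ ℤ.0ℤ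
  orth r′ (e₁ , e₂) = trans (∑-linear d₂ (ℤ.- d₁) r′ z₁ z₂) (trans (cong₂ (λ a b → d₂ ℤ.* a ℤ.+ (ℤ.- d₁) ℤ.* b) e₁ e₂) (vanish d₂ d₁))
    where
    vanish : ∀ a b → a ℤ.* ℤ.0ℤ ℤ.+ (ℤ.- b) ℤ.* ℤ.0ℤ ≡ ℤ.0ℤ
    vanish = ℤ-Ring.solve-∀

-- The first constraint that a line leaves

module _ {I : Set} (g h : I → ℤ) where

  -- On the line g + t h, constraint j is left at t = g j / (- h j). This is constraint i at that
  -- point, multiplied by the positive number - h j.
  Leaves : I → I → Set
  Leaves j i = ℤ.0ℤ ℤ.≤ (ℤ.- h j) ℤ.* g i ℤ.+ g j ℤ.* h i

  -- The ratio test of the simplex method: among the constraints that decrease along the line, the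
  -- one with the least ratio is found by a scan of the list, in integers.
  first-leaving : ∀ is → All (λ i → ℤ.0ℤ ℤ.≤ g i) is →
    All (λ i → ℤ.0ℤ ℤ.≤ h i) is ⊎ (∃ λ j → j ∈ is × h j ℤ.< ℤ.0ℤ × All (Leaves j) is)
  first-leaving [] [] = inj₁ []
  first-leaving (x ∷ is) (gx ∷ gs) with ℤ.0ℤ ℤ.≤? h x | first-leaving is gs
  ... | yes hx | inj₁ hs = inj₁ (hx ∷ hs)
  ... | yes hx | inj₂ (j , j∈ , hj , ls) = inj₂ (j , there j∈ , hj , leaves-nonneg j x (All.lookup gs j∈) hj gx hx ∷ ls)
    where
    leaves-nonneg : ∀ j i → ℤ.0ℤ ℤ.≤ g j → h j ℤ.< ℤ.0ℤ → ℤ.0ℤ ℤ.≤ g i → ℤ.0ℤ ℤ.≤ h i → Leaves j i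
    leaves-nonneg j i gj hj gi hi = ℤ.+-mono-≤ (*-nonneg (ℤ.<⇒≤ (ℤ.neg-mono-< hj)) gi) (*-nonneg gj hi)
  ... | no ¬hx | inj₁ hs = inj₂ (x , here refl , ℤ.≰⇒> ¬hx , self ∷ All.zipWith (λ (gi , hi) → ℤ.+-mono-≤ (*-nonneg (ℤ.<⇒≤ (ℤ.neg-mono-< (ℤ.≰⇒> ¬hx))) gi) (*-nonneg gx hi)) (gs , hs))
    where
    self : Leaves x x
    self = ℤ.≤-reflexive (cancel (h x) (g x))
      where
      cancel : ∀ a b → ℤ.0ℤ ≡ (ℤ.- a) ℤ.* b ℤ.+ b ℤ.* a
      cancel = ℤ-Ring.solve-∀
  ... | no ¬hx | inj₂ (j , j∈ , hj , ls) with ℤ.0ℤ ℤ.≤? (ℤ.- h j) ℤ.* g x ℤ.+ g j ℤ.* h x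
  ... | yes l = inj₂ (j , there j∈ , hj , l ∷ ls)
  ... | no ¬l = inj₂ (x , here refl , hx , self ∷ All.zipWith (λ (gi , l) → earlier _ gi l) (gs , ls))
    where
    hx : h x ℤ.< ℤ.0ℤ
    hx = ℤ.≰⇒> ¬hx
    self : Leaves x x
    self = ℤ.≤-reflexive (cancel (h x) (g x))
      where
      cancel : ∀ a b → ℤ.0ℤ ≡ (ℤ.- a) ℤ.* b ℤ.+ b ℤ.* a
      cancel = ℤ-Ring.solve-∀
    earlier : ∀ i → ℤ.0ℤ ℤ.≤ g i → Leaves j i → Leaves x i
    earlier i gi l with ℤ.0ℤ ℤ.≤? h i
    ... | yes hi = ℤ.+-mono-≤ (*-nonneg (ℤ.<⇒≤ (ℤ.neg-mono-< hx)) gi) (*-nonneg gx hi)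
    ... | no ¬hi = ℤ.*-cancelˡ-≤-pos ℤ.0ℤ ((ℤ.- h x) ℤ.* g i ℤ.+ g x ℤ.* h i) (ℤ.- h j) ⦃ ℤ.positive (ℤ.neg-mono-< hj) ⦄ (begin
      (ℤ.- h j) ℤ.* ℤ.0ℤ                                                                ≡⟨ ℤ.*-zeroʳ (ℤ.- h j) ⟩
      ℤ.0ℤ                                                                              ≤⟨ ℤ.+-mono-≤ (*-nonneg (ℤ.<⇒≤ (ℤ.neg-mono-< hx)) l)
                                                                                                    (*-nonneg (ℤ.<⇒≤ (ℤ.neg-mono-< (ℤ.≰⇒> ¬hi))) (ℤ.<⇒≤ (ℤ.neg-mono-< (ℤ.≰⇒> ¬l)))) ⟩
      (ℤ.- h x) ℤ.* ((ℤ.- h j) ℤ.* g i ℤ.+ g j ℤ.* h i) ℤ.+ (ℤ.- h i) ℤ.* (ℤ.- ((ℤ.- h j) ℤ.* g x ℤ.+ g j ℤ.* h x))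
                                                                                        ≡⟨ regroup′ (h x) (h j) (h i) (g x) (g j) (g i) ⟩
      (ℤ.- h j) ℤ.* ((ℤ.- h x) ℤ.* g i ℤ.+ g x ℤ.* h i)                                  ∎)
      where
      open ℤ.≤-Reasoning
      regroup′ : ∀ hx hj hi gx gj gi → (ℤ.- hx) ℤ.* ((ℤ.- hj) ℤ.* gi ℤ.+ gj ℤ.* hi) ℤ.+ (ℤ.- hi) ℤ.* (ℤ.- ((ℤ.- hj) ℤ.* gx ℤ.+ gj ℤ.* hx)) ≡
                                       (ℤ.- hj) ℤ.* ((ℤ.- hx) ℤ.* gi ℤ.+ gx ℤ.* hi)
      regroup′ = ℤ-Ring.solve-∀

-- Extreme fractional solutions

subsets : ∀ n → List (Vec Bool n)
subsets zero    = [] ∷ []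
subsets (suc n) = map (false ∷_) (subsets n) ++ map (true ∷_) (subsets n)

∈-subsets : ∀ {n} (S : Vec Bool n) → S ∈ subsets n
∈-subsets []          = here refl
∈-subsets (false ∷ S) = ∈-++⁺ˡ (∈-map⁺ (false ∷_) (∈-subsets S))
∈-subsets (true ∷ S)  = ∈-++⁺ʳ (map (false ∷_) (subsets _)) (∈-map⁺ (true ∷_) (∈-subsets S))

module Cuts {n m : ℕ} (ends : Fin m → Fin n × Fin n) where

  VSet : Set
  VSet = Vec Bool n

  cr : VSet → Fin m → ℕ
  cr S e = bit (lookup S (proj₁ (ends e)) xor lookup S (proj₂ (ends e)))

  across : VSet → (Fin m → ℤ) → ℤ
  across S z = ∑ (λ e → ℤ.+ cr S e ℤ.* z e)

  -- y is scaled by the common denominator q: the fractional solution is y / q.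
  record Feas (k : ℤ) (U fix : Fin m → Bool) (c : Fin m → ℤ) (β : ℤ) (q : ℤ) (y : Fin m → ℤ) : Set where
    field
      q-pos   : ℤ.0ℤ ℤ.< q
      lower   : ∀ e → ℤ.0ℤ ℤ.≤ y e
      upper   : ∀ e → y e ℤ.≤ q
      fixed   : ∀ e → ¬ T (U e) → y e ≡ (if fix e then q else ℤ.0ℤ)
      covered : ∀ S → (∀ e → cr S e ≡ 1 → y e ≡ q) ⊎ k ℤ.* q ℤ.≤ across S y
      budget  : ∑ (λ e → c e ℤ.* y e) ℤ.≤ β ℤ.* q

  module Extremes (k : ℤ) (U fix : Fin m → Bool) (c : Fin m → ℤ) (β : ℤ)
    (stuck : ∀ q y → Feas k U fix c β q y → ∀ e → T (U e) → ℤ.0ℤ ℤ.< y e × y e ℤ.< q) where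

    Feasible′ : ℤ → (Fin m → ℤ) → Set
    Feasible′ = Feas k U fix c β

    Tight : ℤ → (Fin m → ℤ) → VSet → Set
    Tight q y S = across S y ≡ k ℤ.* q

    Supported : (Fin m → ℤ) → Set
    Supported z = ∀ e → ¬ T (U e) → z e ≡ ℤ.0ℤ

    Extreme : ℤ → (Fin m → ℤ) → Set
    Extreme q y = ∀ z → Supported z → (∀ S → Tight q y S → across S z ≡ ℤ.0ℤ) → ∀ e → z e ≡ ℤ.0ℤ

    tight? : ℤ → (Fin m → ℤ) → VSet → Bool
    tight? q y S = Dec.isYes (across S y ℤ.≟ k ℤ.* q)

    isYes-sound : ∀ {P : Set} (d : Dec P) → T (Dec.isYes d) → P
    isYes-sound (yes p) _ = p

    isYes-complete : ∀ {P : Set} (d : Dec P) → P → T (Dec.isYes d)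
    isYes-complete (yes _) p = tt
    isYes-complete (no ¬p) p = ⊥-elim (¬p p)

    tightness : ℤ → (Fin m → ℤ) → ℕ
    tightness q y = count (tight? q y) (subsets n)

    module Line (q : ℤ) (y : Fin m → ℤ) (F : Feasible′ q y) (z : Fin m → ℤ) (supp : Supported z)
      (orth : ∀ S → Tight q y S → across S z ≡ ℤ.0ℤ) where

      open Feas F

      Constraint : Set
      Constraint = Fin m ⊎ (Fin m ⊎ VSet)

      g h : Constraint → ℤ
      g (inj₁ e)        = y e
      g (inj₂ (inj₁ e)) = q ℤ.- y e
      g (inj₂ (inj₂ S)) = across S y ℤ.- k ℤ.* q
      h (inj₁ e)        = z e
      h (inj₂ (inj₁ e)) = ℤ.- z e
      h (inj₂ (inj₂ S)) = across S z

      large : List VSet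
      large = List.filter (λ S → k ℤ.* q ℤ.≤? across S y) (subsets n)

      constraints : List Constraint
      constraints = map inj₁ (List.allFin m) ++ map (inj₂ ∘ inj₁) (List.allFin m) ++ map (inj₂ ∘ inj₂) large

      ∈-lower : ∀ e → inj₁ e ∈ constraints
      ∈-lower e = ∈-++⁺ˡ (∈-map⁺ inj₁ (∈-allFin e))

      ∈-upper : ∀ e → inj₂ (inj₁ e) ∈ constraints
      ∈-upper e = ∈-++⁺ʳ (map inj₁ (List.allFin m)) (∈-++⁺ˡ (∈-map⁺ (inj₂ ∘ inj₁) (∈-allFin e)))

      ∈-cut : ∀ S → k ℤ.* q ℤ.≤ across S y → inj₂ (inj₂ S) ∈ constraints
      ∈-cut S le = ∈-++⁺ʳ (map inj₁ (List.allFin m)) (∈-++⁺ʳ (map (inj₂ ∘ inj₁) (List.allFin m))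
        (∈-map⁺ (inj₂ ∘ inj₂) (∈-filter⁺ (λ S → k ℤ.* q ℤ.≤? across S y) (∈-subsets S) le)))

      satisfied : All (λ i → ℤ.0ℤ ℤ.≤ g i) constraints
      satisfied = All.++⁺ (All.map⁺ (All.universal lower (List.allFin m)))
        (All.++⁺ (All.map⁺ (All.universal (λ e → ℤ.i≤j⇒0≤j-i (upper e)) (List.allFin m)))
                 (All.map⁺ (All.map ℤ.i≤j⇒0≤j-i (All.all-filter (λ S → k ℤ.* q ℤ.≤? across S y) (subsets n)))))

      module Step (j : Constraint) (gj : ℤ.0ℤ ℤ.≤ g j) (hj : h j ℤ.< ℤ.0ℤ) (leaves : All (Leaves g h j) constraints)
        (descends : ∑ (λ e → c e ℤ.* z e) ℤ.≤ ℤ.0ℤ) where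

        s t q′ : ℤ
        s = ℤ.- h j
        t = g j
        q′ = s ℤ.* q

        s-pos : ℤ.0ℤ ℤ.< s
        s-pos = ℤ.neg-mono-< hj

        y′ : Fin m → ℤ
        y′ e = s ℤ.* y e ℤ.+ t ℤ.* z e

        across-y′ : ∀ S → across S y′ ≡ s ℤ.* across S y ℤ.+ t ℤ.* across S z
        across-y′ S = ∑-linear s t (λ e → ℤ.+ cr S e) y z

        unmoved : ∀ {e} → z e ≡ ℤ.0ℤ → y′ e ≡ s ℤ.* y e
        unmoved {e} eq = trans (cong (λ x → s ℤ.* y e ℤ.+ t ℤ.* x) eq) (drop (s ℤ.* y e) t)
          where
          drop : ∀ a b → a ℤ.+ b ℤ.* ℤ.0ℤ ≡ a
          drop = ℤ-Ring.solve-∀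

        below : ∀ a b x → ℤ.0ℤ ℤ.≤ s ℤ.* (a ℤ.- b) ℤ.+ t ℤ.* (ℤ.- x) → s ℤ.* b ℤ.+ t ℤ.* x ℤ.≤ s ℤ.* a
        below a b x le = ℤ.0≤i-j⇒j≤i (subst (ℤ.0ℤ ℤ.≤_) (rearrange s t a b x) le)
          where
          rearrange : ∀ s t a b x → s ℤ.* (a ℤ.- b) ℤ.+ t ℤ.* (ℤ.- x) ≡ s ℤ.* a ℤ.- (s ℤ.* b ℤ.+ t ℤ.* x)
          rearrange = ℤ-Ring.solve-∀

        above : ∀ a b x → ℤ.0ℤ ℤ.≤ s ℤ.* (b ℤ.- k ℤ.* a) ℤ.+ t ℤ.* x → k ℤ.* (s ℤ.* a) ℤ.≤ s ℤ.* b ℤ.+ t ℤ.* x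
        above a b x le = ℤ.0≤i-j⇒j≤i (subst (ℤ.0ℤ ℤ.≤_) (rearrange s t a b x k) le)
          where
          rearrange : ∀ s t a b x k → s ℤ.* (b ℤ.- k ℤ.* a) ℤ.+ t ℤ.* x ≡ (s ℤ.* b ℤ.+ t ℤ.* x) ℤ.- k ℤ.* (s ℤ.* a)
          rearrange = ℤ-Ring.solve-∀

        feasible : Feasible′ q′ y′
        feasible = record
          { q-pos   = *-pos s-pos q-pos
          ; lower   = λ e → All.lookup leaves (∈-lower e)
          ; upper   = λ e → below q (y e) (z e) (All.lookup leaves (∈-upper e))
          ; fixed   = λ e ¬u → trans (unmoved (supp e ¬u)) (trans (cong (s ℤ.*_) (fixed e ¬u)) (scale-if (fix e)))
          ; covered = λ S → case covered S of λ where
              -- Open edges lie strictly below q, so the edges of a full boundary are determined and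
              -- do not move.
              (inj₁ full) → inj₁ (λ e e∈ → trans (unmoved (supp e (λ u → ℤ.<⇒≢ (proj₂ (stuck q y F e u)) (full e e∈)))) (cong (s ℤ.*_) (full e e∈)))
              (inj₂ le)   → inj₂ (subst (k ℤ.* q′ ℤ.≤_) (sym (across-y′ S)) (above q (across S y) (across S z) (All.lookup leaves (∈-cut S le))))
          ; budget  = begin
              ∑ (λ e → c e ℤ.* y′ e)                                             ≡⟨ ∑-linear s t c y z ⟩
              s ℤ.* ∑ (λ e → c e ℤ.* y e) ℤ.+ t ℤ.* ∑ (λ e → c e ℤ.* z e)        ≤⟨ ℤ.+-mono-≤ (ℤ.*-monoˡ-≤-nonNeg s ⦃ ℤ.nonNegative (ℤ.<⇒≤ s-pos) ⦄ budget)
                                                                                               (ℤ.*-monoˡ-≤-nonNeg t ⦃ ℤ.nonNegative gj ⦄ descends) ⟩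
              s ℤ.* (β ℤ.* q) ℤ.+ t ℤ.* ℤ.0ℤ                                     ≡⟨ rearrange s β q t ⟩
              β ℤ.* q′                                                           ∎
          }
          where
          open ℤ.≤-Reasoning
          scale-if : ∀ b → s ℤ.* (if b then q else ℤ.0ℤ) ≡ (if b then q′ else ℤ.0ℤ)
          scale-if true  = refl
          scale-if false = ℤ.*-zeroʳ s
          rearrange : ∀ s β q t → s ℤ.* (β ℤ.* q) ℤ.+ t ℤ.* ℤ.0ℤ ≡ β ℤ.* (s ℤ.* q)
          rearrange = ℤ-Ring.solve-∀

        undetermined : ∀ e → z e ≢ ℤ.0ℤ → T (U e)
        undetermined e ne with Bool.T? (U e)
        ... | yes u = u
        ... | no ¬u = ⊥-elim (ne (supp e ¬u))

        tight-stays : ∀ S → Tight q y S → Tight q′ y′ S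
        tight-stays S ti = trans (across-y′ S) (trans (cong₂ (λ a b → s ℤ.* a ℤ.+ t ℤ.* b) ti (orth S ti)) (rearrange s k q t))
          where
          rearrange : ∀ s k q t → s ℤ.* (k ℤ.* q) ℤ.+ t ℤ.* ℤ.0ℤ ≡ k ℤ.* (s ℤ.* q)
          rearrange = ℤ-Ring.solve-∀

      module _ (j : Constraint) where
        -- The first constraint met must be a cut: at the point reached, an open edge on one of its
        -- bounds would contradict `stuck`. The cut is new, since z is orthogonal to the cuts tight
        -- before.
        new-tight : (gj : ℤ.0ℤ ℤ.≤ g j) (hj : h j ℤ.< ℤ.0ℤ) (leaves : All (Leaves g h j) constraints)
          (descends : ∑ (λ e → c e ℤ.* z e) ℤ.≤ ℤ.0ℤ) → let open Step j gj hj leaves descends in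
          ∃ λ S → Tight q′ y′ S × ¬ Tight q y S
        new-tight gj hj leaves descends = go j refl
          where
          open Step j gj hj leaves descends
          go : ∀ i → i ≡ j → ∃ λ S → Tight q′ y′ S × ¬ Tight q y S
          go (inj₁ e) refl = ⊥-elim (ℤ.<⇒≢ (proj₁ (stuck q′ y′ feasible e (undetermined e (ℤ.<⇒≢ hj)))) (cancel (z e) (y e)))
            where
            cancel : ∀ a b → ℤ.0ℤ ≡ (ℤ.- a) ℤ.* b ℤ.+ b ℤ.* a
            cancel = ℤ-Ring.solve-∀
          go (inj₂ (inj₁ e)) refl = ⊥-elim (ℤ.<⇒≢ (proj₂ (stuck q′ y′ feasible e (undetermined e λ eq → ℤ.<⇒≢ hj (cong ℤ.-_ eq)))) (cancel (z e) (y e) q))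
            where
            cancel : ∀ a b q → (ℤ.- (ℤ.- a)) ℤ.* b ℤ.+ (q ℤ.- b) ℤ.* a ≡ (ℤ.- (ℤ.- a)) ℤ.* q
            cancel = ℤ-Ring.solve-∀
          go (inj₂ (inj₂ S)) refl = S , trans (across-y′ S) (cancel (across S z) (across S y) k q) , λ ti → ℤ.<⇒≢ hj (orth S ti)
            where
            cancel : ∀ a b k q → (ℤ.- a) ℤ.* b ℤ.+ (b ℤ.- k ℤ.* q) ℤ.* a ≡ k ℤ.* ((ℤ.- a) ℤ.* q)
            cancel = ℤ-Ring.solve-∀

      -- The bounds 0 and q on the coordinate e stop every line with z e ≠ 0, so some constraint is
      -- met; tight cuts stay tight on the way and one more joins them.
      improve : ∀ e → z e ≢ ℤ.0ℤ → ∑ (λ e → c e ℤ.* z e) ℤ.≤ ℤ.0ℤ → ∃₂ λ q′ y′ → Feasible′ q′ y′ × tightness q y < tightness q′ y′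
      improve e ne descends with first-leaving g h constraints satisfied
      ... | inj₁ hs = ⊥-elim (ne (ℤ.≤-antisym (subst (ℤ._≤ ℤ.0ℤ) (ℤ.neg-involutive (z e)) (ℤ.neg-mono-≤ (All.lookup hs (∈-upper e)))) (All.lookup hs (∈-lower e))))
      ... | inj₂ (j , j∈ , hj , leaves) =
        let gj = All.lookup satisfied j∈
            open Step j gj hj leaves descends
            (S , new , old) = new-tight j gj hj leaves descends in
        q′ , y′ , feasible ,
        count-strict (tight? q′ y′) (tight? q y) (subsets n)
          (λ S t → isYes-complete (across S y′ ℤ.≟ k ℤ.* q′) (tight-stays S (isYes-sound (across S y ℤ.≟ k ℤ.* q) t)))
          (∈-subsets S) (isYes-complete (across S y′ ℤ.≟ k ℤ.* q′) new) (λ t → old (isYes-sound (across S y ℤ.≟ k ℤ.* q) t))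

    across-neg : ∀ S z → across S (λ e → ℤ.- z e) ≡ ℤ.- across S z
    across-neg S z = trans (trans (∑-cong (λ e → flip-sign (ℤ.+ cr S e) (z e))) (∑-* ℤ.-1ℤ (λ e → ℤ.+ cr S e ℤ.* z e))) (ℤ.-1*i≡-i _)
      where
      flip-sign : ∀ a b → a ℤ.* (ℤ.- b) ≡ ℤ.-1ℤ ℤ.* (a ℤ.* b)
      flip-sign = ℤ-Ring.solve-∀

    -- One of the directions z and -z does not increase the cost, and the hypotheses on z are
    -- symmetric.
    improve-either : ∀ q y → Feasible′ q y → ∀ z → Supported z → (∀ S → Tight q y S → across S z ≡ ℤ.0ℤ) → ∀ e → z e ≢ ℤ.0ℤ →
                     ∃₂ λ q′ y′ → Feasible′ q′ y′ × tightness q y < tightness q′ y′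
    improve-either q y F z supp orth e ne with ∑ (λ e → c e ℤ.* z e) ℤ.≤? ℤ.0ℤ
    ... | yes d = Line.improve q y F z supp orth e ne d
    ... | no ¬d = Line.improve q y F (λ e → ℤ.- z e) (λ e ¬u → cong ℤ.-_ (supp e ¬u))
                    (λ S ti → trans (across-neg S z) (cong ℤ.-_ (orth S ti))) e
                    (λ eq → ne (trans (sym (ℤ.neg-involutive (z e))) (cong ℤ.-_ eq)))
                    (subst (ℤ._≤ ℤ.0ℤ) (sym cost-neg) (ℤ.neg-mono-≤ (ℤ.<⇒≤ (ℤ.≰⇒> ¬d))))
      where
      flip-sign : ∀ a b → a ℤ.* (ℤ.- b) ≡ ℤ.-1ℤ ℤ.* (a ℤ.* b)
      flip-sign = ℤ-Ring.solve-∀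
      cost-neg : ∑ (λ e → c e ℤ.* (ℤ.- z e)) ≡ ℤ.- ∑ (λ e → c e ℤ.* z e)
      cost-neg = trans (trans (∑-cong (λ e → flip-sign (c e) (z e))) (∑-* ℤ.-1ℤ (λ e → c e ℤ.* z e))) (ℤ.-1*i≡-i _)

    -- A feasible solution with the largest number of tight sets is extreme.
    extreme-exists : ∀ q y → Feasible′ q y → ¬ ¬ (∃₂ λ q y → Feasible′ q y × Extreme q y)
    extreme-exists q y F none = go (length (subsets n)) q y F (m≤m+n _ _)
      where
      go : ∀ fuel q y → Feasible′ q y → length (subsets n) ≤ fuel + tightness q y → ⊥
      go fuel q y F le = none (q , y , F , λ z supp orth e → case z e ℤ.≟ ℤ.0ℤ of λ where
          (yes eq) → eq
          (no ne)  → ⊥-elim (continue fuel le (improve-either q y F z supp orth e ne)))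
        where
        continue : ∀ fuel → length (subsets n) ≤ fuel + tightness q y → (∃₂ λ q′ y′ → Feasible′ q′ y′ × tightness q y < tightness q′ y′) → ⊥
        continue zero       le (q′ , y′ , F′ , lt) = <⇒≱ lt (≤-trans (List.length-filter _ (subsets n)) le)
        continue (suc fuel) le (q′ , y′ , F′ , lt) = go fuel q′ y′ F′ (≤-trans le (≤-trans (≤-reflexive (sym (+-suc fuel _))) (+-monoʳ-≤ fuel lt)))

-- Laminar families of tight sets

every : (f : Bool → Bool) → T (f true ∧ f false) → ∀ b → T (f b)
every f t true  = proj₁ (T-∧ {f true} t)
every f t false = proj₂ (T-∧ {f true} t)

every₂ : (f : Bool → Bool → Bool) → T ((f true true ∧ f true false) ∧ (f false true ∧ f false false)) → ∀ a b → T (f a b)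
every₂ f t a = every (f a) (every (λ a → f a true ∧ f a false) t a)

-- How one edge meets two vertex sets is described by four Booleans, so inequalities between cut
-- values on a single edge reduce to a table of sixteen entries, checked by evaluation.
every₄ : (f : Bool → Bool → Bool → Bool → Bool) →
  T (let g = λ a b → (f a b true true ∧ f a b true false) ∧ (f a b false true ∧ f a b false false) in
     (g true true ∧ g true false) ∧ (g false true ∧ g false false)) → ∀ a b c d → T (f a b c d)
every₄ f t a b = every₂ (f a b) (every₂ (λ a b → (f a b true true ∧ f a b true false) ∧ (f a b false true ∧ f a b false false)) t a b)

module VertexSets {n : ℕ} where

  infix 4 _∈ˢ_ _⊆ˢ_
  infixr 7 _∩ˢ_
  infixr 6 _∪ˢ_ _∖ˢ_

  _∈ˢ_ : Fin n → Vec Bool n → Set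
  v ∈ˢ S = T (lookup S v)

  _∩ˢ_ _∪ˢ_ _∖ˢ_ : Vec Bool n → Vec Bool n → Vec Bool n
  S ∩ˢ R = Vec.zipWith _∧_ S R
  S ∪ˢ R = Vec.zipWith _∨_ S R
  S ∖ˢ R = Vec.zipWith (λ a b → a ∧ not b) S R

  _⊆ˢ_ Disjoint : Vec Bool n → Vec Bool n → Set
  S ⊆ˢ R       = ∀ v → v ∈ˢ S → v ∈ˢ R
  Disjoint S R = ∀ v → v ∈ˢ S → ¬ v ∈ˢ R

  ∈-∩⁻ : ∀ S R v → v ∈ˢ S ∩ˢ R → v ∈ˢ S × v ∈ˢ R
  ∈-∩⁻ S R v t = T-∧ (subst T (Vec.lookup-zipWith _∧_ v S R) t)

  ∈-∩⁺ : ∀ S R v → v ∈ˢ S → v ∈ˢ R → v ∈ˢ S ∩ˢ R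
  ∈-∩⁺ S R v s r = subst T (sym (Vec.lookup-zipWith _∧_ v S R)) (∧-T s r)

  ∈-∪⁻ : ∀ S R v → v ∈ˢ S ∪ˢ R → v ∈ˢ S ⊎ v ∈ˢ R
  ∈-∪⁻ S R v t with lookup S v | lookup R v | subst T (Vec.lookup-zipWith _∨_ v S R) t
  ... | true  | _    | _ = inj₁ tt
  ... | false | true | _ = inj₂ tt

  ∈-∪⁺ : ∀ S R v → v ∈ˢ S ⊎ v ∈ˢ R → v ∈ˢ S ∪ˢ R
  ∈-∪⁺ S R v t = subst T (sym (Vec.lookup-zipWith _∨_ v S R)) (go t)
    where
    go : ∀ {a b} → T a ⊎ T b → T (a ∨ b)
    go {true}          _        = tt
    go {false} {true}  _        = tt
    go {false} {false} (inj₁ ())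
    go {false} {false} (inj₂ ())

  ∈-∖⁻ : ∀ S R v → v ∈ˢ S ∖ˢ R → v ∈ˢ S × ¬ v ∈ˢ R
  ∈-∖⁻ S R v t = let (s , r) = T-∧ (subst T (Vec.lookup-zipWith (λ a b → a ∧ not b) v S R) t) in s , T-not r

  ∈-∖⁺ : ∀ S R v → v ∈ˢ S → ¬ v ∈ˢ R → v ∈ˢ S ∖ˢ R
  ∈-∖⁺ S R v s r = subst T (sym (Vec.lookup-zipWith (λ a b → a ∧ not b) v S R)) (∧-T s (not-T r))

  data NonCrossing (S R : Vec Bool n) : Set where
    sub  : S ⊆ˢ R → NonCrossing S R
    sup  : R ⊆ˢ S → NonCrossing S R
    disj : Disjoint S R → NonCrossing S R

  record Crossing (S R : Vec Bool n) : Set where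
    field
      both  : ∃ λ v → v ∈ˢ S × v ∈ˢ R
      left  : ∃ λ v → v ∈ˢ S × ¬ v ∈ˢ R
      right : ∃ λ v → v ∈ˢ R × ¬ v ∈ˢ S

  NonCrossing-sym : ∀ {S R} → NonCrossing S R → NonCrossing R S
  NonCrossing-sym (sub p)  = sup p
  NonCrossing-sym (sup p)  = sub p
  NonCrossing-sym (disj p) = disj (λ v r s → p v s r)

  noncrossing-or-crossing : ∀ S R → NonCrossing S R ⊎ Crossing S R
  noncrossing-or-crossing S R with Fin.any? (λ v → Bool.T? (lookup S v ∧ not (lookup R v)))
  ... | no none = inj₁ (sub (λ v s → case Bool.T? (lookup R v) of λ where
          (yes r) → r
          (no ¬r) → ⊥-elim (none (v , ∧-T s (not-T ¬r)))))
  ... | yes (v₁ , t₁) with Fin.any? (λ v → Bool.T? (lookup R v ∧ not (lookup S v)))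
  ... | no none = inj₁ (sup (λ v r → case Bool.T? (lookup S v) of λ where
          (yes s) → s
          (no ¬s) → ⊥-elim (none (v , ∧-T r (not-T ¬s)))))
  ... | yes (v₂ , t₂) with Fin.any? (λ v → Bool.T? (lookup S v ∧ lookup R v))
  ... | no none = inj₁ (disj (λ v s r → none (v , ∧-T s r)))
  ... | yes (v₃ , t₃) = inj₂ (record
          { both = v₃ , T-∧ t₃ ; left = v₁ , proj₁ (T-∧ t₁) , T-not (proj₂ (T-∧ {lookup S v₁} t₁))
          ; right = v₂ , proj₁ (T-∧ t₂) , T-not (proj₂ (T-∧ {lookup R v₂} t₂)) })

  data Corner (S R : Vec Bool n) : Vec Bool n → Set where
    meet  : Corner S R (S ∩ˢ R)
    join  : Corner S R (S ∪ˢ R)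
    minus : Corner S R (S ∖ˢ R)
    minusʳ : Corner S R (R ∖ˢ S)

  corner-noncrossing : ∀ {S R X} → Corner S R X → NonCrossing X S
  corner-noncrossing {S} {R} meet   = sub (λ v x → proj₁ (∈-∩⁻ S R v x))
  corner-noncrossing {S} {R} join   = sup (λ v s → ∈-∪⁺ S R v (inj₁ s))
  corner-noncrossing {S} {R} minus  = sub (λ v x → proj₁ (∈-∖⁻ S R v x))
  corner-noncrossing {S} {R} minusʳ = disj (λ v x → proj₂ (∈-∖⁻ R S v x))

  minus-noncrossing : ∀ {Q} S R → Crossing S R → NonCrossing Q S → NonCrossing Q R → NonCrossing (S ∖ˢ R) Q
  minus-noncrossing S R cross (disj p) _        = disj (λ v x q → p v q (proj₁ (∈-∖⁻ S R v x)))
  minus-noncrossing S R cross (sup p)  (sub q)  = let (v , s , ¬r) = Crossing.left cross in ⊥-elim (¬r (q v (p v s)))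
  minus-noncrossing S R cross (sup p)  (sup q)  = sub (λ v x → p v (proj₁ (∈-∖⁻ S R v x)))
  minus-noncrossing S R cross (sup p)  (disj q) = let (v , s , r) = Crossing.both cross in ⊥-elim (q v (p v s) r)
  minus-noncrossing S R cross (sub p)  (sub q)  = disj (λ v x r → proj₂ (∈-∖⁻ S R v x) (q v r))
  minus-noncrossing S R cross (sub p)  (sup q)  = let (v , r , ¬s) = Crossing.right cross in ⊥-elim (¬s (p v (q v r)))
  minus-noncrossing S R cross (sub p)  (disj q) = sup (λ v r → ∈-∖⁺ S R v (p v r) (q v r))

  crossing-sym : ∀ {S R} → Crossing S R → Crossing R S
  crossing-sym c = record { both = let (v , s , r) = Crossing.both c in v , r , s ; left = Crossing.right c ; right = Crossing.left c }

  -- Uncrossing makes progress because of this: a corner of two crossing sets crosses nothing that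
  -- both sets leave uncrossed.
  corner-stays-noncrossing : ∀ {Q S R X} → Corner S R X → Crossing S R → NonCrossing Q S → NonCrossing Q R → NonCrossing X Q
  corner-stays-noncrossing {Q} {S} {R} meet cross (disj p) _        = disj (λ v x q → p v q (proj₁ (∈-∩⁻ S R v x)))
  corner-stays-noncrossing {Q} {S} {R} meet cross (sup p)  _        = sub (λ v x → p v (proj₁ (∈-∩⁻ S R v x)))
  corner-stays-noncrossing {Q} {S} {R} meet cross (sub p)  (sub q)  = sup (λ v x → ∈-∩⁺ S R v (p v x) (q v x))
  corner-stays-noncrossing {Q} {S} {R} meet cross (sub p)  (sup q)  = sub (λ v x → q v (proj₂ (∈-∩⁻ S R v x)))
  corner-stays-noncrossing {Q} {S} {R} meet cross (sub p)  (disj q) = disj (λ v x r → q v r (proj₂ (∈-∩⁻ S R v x)))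
  corner-stays-noncrossing {Q} {S} {R} join cross (sub p)  _        = sup (λ v x → ∈-∪⁺ S R v (inj₁ (p v x)))
  corner-stays-noncrossing {Q} {S} {R} join cross _        (sub q)  = sup (λ v x → ∈-∪⁺ S R v (inj₂ (q v x)))
  corner-stays-noncrossing {Q} {S} {R} join cross (sup p)  (sup q)  = sub (λ v x → [ p v , q v ]′ (∈-∪⁻ S R v x))
  corner-stays-noncrossing {Q} {S} {R} join cross (disj p) (disj q) = disj (λ v x r → [ p v r , q v r ]′ (∈-∪⁻ S R v x))
  corner-stays-noncrossing {Q} {S} {R} join cross (sup p)  (disj q) = let (v , s , r) = Crossing.both cross in ⊥-elim (q v (p v s) r)
  corner-stays-noncrossing {Q} {S} {R} join cross (disj p) (sup q)  = let (v , s , r) = Crossing.both cross in ⊥-elim (p v (q v r) s)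
  corner-stays-noncrossing {Q} {S} {R} minus  cross p q = minus-noncrossing S R cross p q
  corner-stays-noncrossing {Q} {S} {R} minusʳ cross p q = minus-noncrossing R S (crossing-sym cross) q p

open VertexSets public

module CutCounts {n m : ℕ} (ends : Fin m → Fin n × Fin n) where

  open Cuts ends using (VSet; cr)

  src tgt : Fin m → Fin n
  src e = proj₁ (ends e)
  tgt e = proj₂ (ends e)

  mem : VSet → Fin n → ℕ
  mem S v = bit (lookup S v)

  ins : VSet → Fin m → ℕ
  ins S e = bit (lookup S (src e) ∧ lookup S (tgt e))

  cr-ins : ∀ S e → cr S e + (ins S e + ins S e) ≡ mem S (src e) + mem S (tgt e)
  cr-ins S e = go (lookup S (src e)) (lookup S (tgt e))
    where
    go : ∀ a b → bit (a xor b) + (bit (a ∧ b) + bit (a ∧ b)) ≡ bit a + bit b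
    go true  true  = refl
    go true  false = refl
    go false true  = refl
    go false false = refl

  meet-join-≤ : ∀ S R e → cr (S ∩ˢ R) e + cr (S ∪ˢ R) e ≤ cr S e + cr R e
  meet-join-≤ S R e
    rewrite Vec.lookup-zipWith (_∧_) (src e) S R
          | Vec.lookup-zipWith (_∧_) (tgt e) S R
          | Vec.lookup-zipWith (_∨_) (src e) S R
          | Vec.lookup-zipWith (_∨_) (tgt e) S R =
    ≤ᵇ⇒≤ _ _ (every₄ (λ a b c d → bit ((a ∧ c) xor (b ∧ d)) + bit ((a ∨ c) xor (b ∨ d)) ℕ.≤ᵇ bit (a xor b) + bit (c xor d)) tt (lookup S (src e)) (lookup S (tgt e)) (lookup R (src e)) (lookup R (tgt e)))

  minus-minus-≤ : ∀ S R e → cr (S ∖ˢ R) e + cr (R ∖ˢ S) e ≤ cr S e + cr R e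
  minus-minus-≤ S R e
    rewrite Vec.lookup-zipWith (λ a b → a ∧ not b) (src e) S R
          | Vec.lookup-zipWith (λ a b → a ∧ not b) (tgt e) S R
          | Vec.lookup-zipWith (λ a b → a ∧ not b) (src e) R S
          | Vec.lookup-zipWith (λ a b → a ∧ not b) (tgt e) R S =
    ≤ᵇ⇒≤ _ _ (every₄ (λ a b c d → bit ((a ∧ not c) xor (b ∧ not d)) + bit ((c ∧ not a) xor (d ∧ not b)) ℕ.≤ᵇ bit (a xor b) + bit (c xor d)) tt (lookup S (src e)) (lookup S (tgt e)) (lookup R (src e)) (lookup R (tgt e)))

  -- This and the next three say that a boundary edge of S or R is a boundary edge of one of two
  -- adjacent corners. They exclude that adjacent corners are both irrelevant.
  meet-minus-≥ : ∀ S R e → cr S e ≤ cr (S ∩ˢ R) e + cr (S ∖ˢ R) e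
  meet-minus-≥ S R e
    rewrite Vec.lookup-zipWith (_∧_) (src e) S R
          | Vec.lookup-zipWith (_∧_) (tgt e) S R
          | Vec.lookup-zipWith (λ a b → a ∧ not b) (src e) S R
          | Vec.lookup-zipWith (λ a b → a ∧ not b) (tgt e) S R =
    ≤ᵇ⇒≤ _ _ (every₄ (λ a b c d → bit (a xor b) ℕ.≤ᵇ bit ((a ∧ c) xor (b ∧ d)) + bit ((a ∧ not c) xor (b ∧ not d))) tt (lookup S (src e)) (lookup S (tgt e)) (lookup R (src e)) (lookup R (tgt e)))

  meet-minusʳ-≥ : ∀ S R e → cr R e ≤ cr (S ∩ˢ R) e + cr (R ∖ˢ S) e
  meet-minusʳ-≥ S R e
    rewrite Vec.lookup-zipWith (_∧_) (src e) S R
          | Vec.lookup-zipWith (_∧_) (tgt e) S R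
          | Vec.lookup-zipWith (λ a b → a ∧ not b) (src e) R S
          | Vec.lookup-zipWith (λ a b → a ∧ not b) (tgt e) R S =
    ≤ᵇ⇒≤ _ _ (every₄ (λ a b c d → bit (c xor d) ℕ.≤ᵇ bit ((a ∧ c) xor (b ∧ d)) + bit ((c ∧ not a) xor (d ∧ not b))) tt (lookup S (src e)) (lookup S (tgt e)) (lookup R (src e)) (lookup R (tgt e)))

  join-minus-≥ : ∀ S R e → cr R e ≤ cr (S ∪ˢ R) e + cr (S ∖ˢ R) e
  join-minus-≥ S R e
    rewrite Vec.lookup-zipWith (_∨_) (src e) S R
          | Vec.lookup-zipWith (_∨_) (tgt e) S R
          | Vec.lookup-zipWith (λ a b → a ∧ not b) (src e) S R
          | Vec.lookup-zipWith (λ a b → a ∧ not b) (tgt e) S R =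
    ≤ᵇ⇒≤ _ _ (every₄ (λ a b c d → bit (c xor d) ℕ.≤ᵇ bit ((a ∨ c) xor (b ∨ d)) + bit ((a ∧ not c) xor (b ∧ not d))) tt (lookup S (src e)) (lookup S (tgt e)) (lookup R (src e)) (lookup R (tgt e)))

  join-minusʳ-≥ : ∀ S R e → cr S e ≤ cr (S ∪ˢ R) e + cr (R ∖ˢ S) e
  join-minusʳ-≥ S R e
    rewrite Vec.lookup-zipWith (_∨_) (src e) S R
          | Vec.lookup-zipWith (_∨_) (tgt e) S R
          | Vec.lookup-zipWith (λ a b → a ∧ not b) (src e) R S
          | Vec.lookup-zipWith (λ a b → a ∧ not b) (tgt e) R S =
    ≤ᵇ⇒≤ _ _ (every₄ (λ a b c d → bit (a xor b) ℕ.≤ᵇ bit ((a ∨ c) xor (b ∨ d)) + bit ((c ∧ not a) xor (d ∧ not b))) tt (lookup S (src e)) (lookup S (tgt e)) (lookup R (src e)) (lookup R (tgt e)))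

module Uncross {n m : ℕ} (ends : Fin m → Fin n × Fin n)
  (k : ℤ) (U fix : Fin m → Bool) (c : Fin m → ℤ) (β q : ℤ) (y : Fin m → ℤ)
  (F : Cuts.Feas ends k U fix c β q y) (strict : ∀ e → T (U e) → ℤ.0ℤ ℤ.< y e × y e ℤ.< q)
  where

  open Cuts ends using (VSet; cr; across)
  open CutCounts ends using (meet-join-≤; minus-minus-≤; meet-minus-≥; meet-minusʳ-≥; join-minus-≥; join-minusʳ-≥)
  open Cuts.Feas F using (lower; covered)

  Tight : VSet → Set
  Tight S = across S y ≡ k ℤ.* q

  Supported : (Fin m → ℤ) → Set
  Supported z = ∀ e → ¬ T (U e) → z e ≡ ℤ.0ℤ

  Irrelevant : VSet → Set
  Irrelevant S = ∀ e → T (U e) → cr S e ≡ 0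

  irrelevant-across : ∀ {S z} → Irrelevant S → Supported z → across S z ≡ ℤ.0ℤ
  irrelevant-across {S} {z} irr supp = ∑-zero (λ e → case Bool.T? (U e) of λ where
    (yes u) → cong (λ j → ℤ.+ j ℤ.* z e) (irr e u)
    (no ¬u) → trans (cong (ℤ.+ cr S e ℤ.*_) (supp e ¬u)) (ℤ.*-zeroʳ (ℤ.+ cr S e)))

  bit-cases : ∀ b → bit b ≡ 0 ⊎ bit b ≡ 1
  bit-cases true  = inj₂ refl
  bit-cases false = inj₁ refl

  -- Open edges are strictly below q, so a set whose boundary is full has no open edge there.
  irrelevant-or-large : ∀ S → Irrelevant S ⊎ k ℤ.* q ℤ.≤ across S y
  irrelevant-or-large S with covered S
  ... | inj₂ le   = inj₂ le
  ... | inj₁ full = inj₁ (λ e u → case bit-cases _ of λ where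
    (inj₁ eq) → eq
    (inj₂ eq) → ⊥-elim (ℤ.<⇒≢ (proj₂ (strict e u)) (full e eq)))

  across-+ : ∀ X Y z → across X z ℤ.+ across Y z ≡ ∑ (λ e → ℤ.+ (cr X e + cr Y e) ℤ.* z e)
  across-+ X Y z = trans (sym (∑-+ (λ e → ℤ.+ cr X e ℤ.* z e) (λ e → ℤ.+ cr Y e ℤ.* z e)))
    (∑-cong (λ e → sym (ℤ.*-distribʳ-+ (z e) (ℤ.+ cr X e) (ℤ.+ cr Y e))))

  record Uncrossed (S R : VSet) : Set where
    field
      {X Y}    : VSet
      corner-X : Corner S R X
      corner-Y : Corner S R Y
      tight-X  : Tight X
      tight-Y  : Tight Y
      modular  : ∀ z → Supported z → across X z ℤ.+ across Y z ≡ across S z ℤ.+ across R z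

  -- Both corners have value at least k q and together at most 2 k q, so equality holds. As y is
  -- positive on open edges, the edgewise inequality is an equality on each of them, which makes the
  -- rows additive on vectors supported there.
  uncross-pair : ∀ {S R X Y} → Corner S R X → Corner S R Y → (∀ e → cr X e + cr Y e ≤ cr S e + cr R e) →
                 Tight S → Tight R → k ℤ.* q ℤ.≤ across X y → k ℤ.* q ℤ.≤ across Y y → Uncrossed S R
  uncross-pair {S} {R} {X} {Y} cX cY le tS tR lX lY = record
    { corner-X = cX ; corner-Y = cY
    ; tight-X = ℤ.≤-antisym (ℤ.≮⇒≥ (λ lt → ℤ.<⇒≱ (ℤ.+-mono-<-≤ lt lY) total≤)) lX
    ; tight-Y = ℤ.≤-antisym (ℤ.≮⇒≥ (λ lt → ℤ.<⇒≱ (ℤ.+-mono-≤-< lX lt) total≤)) lY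
    ; modular = λ z supp → trans (across-+ X Y z) (trans (∑-cong (λ e → case Bool.T? (U e) of λ where
        (yes u) → cong (λ j → ℤ.+ j ℤ.* z e) (same e u)
        (no ¬u) → trans (trans (cong (ℤ.+ (cr X e + cr Y e) ℤ.*_) (supp e ¬u)) (ℤ.*-zeroʳ (ℤ.+ (cr X e + cr Y e))))
                        (sym (trans (cong (ℤ.+ (cr S e + cr R e) ℤ.*_) (supp e ¬u)) (ℤ.*-zeroʳ (ℤ.+ (cr S e + cr R e)))))))
        (sym (across-+ S R z)))
    }
    where
    le′ : ∀ e → ℤ.+ (cr X e + cr Y e) ℤ.* y e ℤ.≤ ℤ.+ (cr S e + cr R e) ℤ.* y e
    le′ e = ℤ.*-monoʳ-≤-nonNeg (y e) ⦃ ℤ.nonNegative (lower e) ⦄ (ℤ.+≤+ (le e))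
    total≤ : across X y ℤ.+ across Y y ℤ.≤ k ℤ.* q ℤ.+ k ℤ.* q
    total≤ = subst₂ ℤ._≤_ (sym (across-+ X Y y)) (trans (sym (across-+ S R y)) (cong₂ ℤ._+_ tS tR)) (∑-mono le′)
    same : ∀ e → T (U e) → cr X e + cr Y e ≡ cr S e + cr R e
    same e u with m≤n⇒m<n∨m≡n (le e)
    ... | inj₂ eq = eq
    ... | inj₁ lt = ⊥-elim (ℤ.<⇒≱ (subst₂ ℤ._<_ (sym (across-+ X Y y)) (trans (sym (across-+ S R y)) (cong₂ ℤ._+_ tS tR))
                      (∑-strict le′ e (ℤ.*-monoʳ-<-pos (y e) ⦃ ℤ.positive (proj₁ (strict e u)) ⦄ (ℤ.+<+ lt))))
                      (ℤ.+-mono-≤ lX lY))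

  irrelevant-cover : ∀ S X Y → (∀ e → cr S e ≤ cr X e + cr Y e) → Irrelevant X → Irrelevant Y → Irrelevant S
  irrelevant-cover S X Y le iX iY e u = n≤0⇒n≡0 (subst (cr S e ≤_) (cong₂ _+_ (iX e u) (iY e u)) (le e))

  -- If neither intersection and union nor the two differences are both constrained, two adjacent
  -- corners are irrelevant. They cover the open boundary of S or of R, which would then be
  -- irrelevant as well.
  uncross : ∀ S R → Tight S → Tight R → ¬ Irrelevant S → ¬ Irrelevant R → Uncrossed S R
  uncross S R tS tR rS rR with irrelevant-or-large (S ∩ˢ R) | irrelevant-or-large (S ∪ˢ R) | irrelevant-or-large (S ∖ˢ R) | irrelevant-or-large (R ∖ˢ S)
  ... | inj₂ l₁ | inj₂ l₂ | _       | _       = uncross-pair meet join (meet-join-≤ S R) tS tR l₁ l₂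
  ... | _       | _       | inj₂ l₁ | inj₂ l₂ = uncross-pair minus minusʳ (minus-minus-≤ S R) tS tR l₁ l₂
  ... | inj₁ i  | _       | inj₁ j  | _       = ⊥-elim (rS (irrelevant-cover S (S ∩ˢ R) (S ∖ˢ R) (meet-minus-≥ S R) i j))
  ... | inj₁ i  | _       | _       | inj₁ j  = ⊥-elim (rR (irrelevant-cover R (S ∩ˢ R) (R ∖ˢ S) (meet-minusʳ-≥ S R) i j))
  ... | _       | inj₁ i  | inj₁ j  | _       = ⊥-elim (rR (irrelevant-cover R (S ∪ˢ R) (S ∖ˢ R) (join-minus-≥ S R) i j))
  ... | _       | inj₁ i  | _       | inj₁ j  = ⊥-elim (rS (irrelevant-cover S (S ∪ˢ R) (R ∖ˢ S) (join-minusʳ-≥ S R) i j))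

meets : ∀ {n} → Vec Bool n → Vec Bool n → Bool
meets []      []      = false
meets (a ∷ S) (b ∷ X) = (a ∧ b) ∨ meets S X

meets-complete : ∀ {n} (S X : Vec Bool n) v → T (lookup S v) → T (lookup X v) → T (meets S X)
meets-complete (true ∷ S) (true ∷ X) zero    s x = tt
meets-complete (a ∷ S)    (b ∷ X)    (suc v) s x with a ∧ b
... | true  = tt
... | false = meets-complete S X v s x

meets-sound : ∀ {n} (S X : Vec Bool n) → T (meets S X) → ∃ λ v → T (lookup S v) × T (lookup X v)
meets-sound []          []          ()
meets-sound (true ∷ S)  (true ∷ X)  t = zero , tt , tt
meets-sound (true ∷ S)  (false ∷ X) t = let (v , p) = meets-sound S X t in suc v , p
meets-sound (false ∷ S) (b ∷ X)     t = let (v , p) = meets-sound S X t in suc v , p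

-- A strict superset comes later.
Ordered : ∀ {n} → Vec Bool n → Vec Bool n → Set
Ordered X S = S ⊆ˢ X → X ⊆ˢ S

subsets-ordered : ∀ n → AllPairs Ordered (subsets n)
subsets-ordered zero    = [] ∷ []
subsets-ordered (suc n) = AllPairs.++⁺ (AllPairs.map⁺ (AllPairs.map (keep false) (subsets-ordered n))) (AllPairs.map⁺ (AllPairs.map (keep true) (subsets-ordered n)))
  (All.map⁺ (All.universal (λ X → All.map⁺ (All.universal (λ S S⊆X → ⊥-elim (S⊆X zero tt)) (subsets n))) (subsets n)))
  where
  keep : ∀ b {X S : Vec Bool n} → Ordered X S → Ordered (b ∷ X) (b ∷ S)
  keep b o S⊆X zero    = id
  keep b o S⊆X (suc v) = o (λ v → S⊆X (suc v)) v

module Laminar {n m : ℕ} (ends : Fin m → Fin n × Fin n)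
  (k : ℤ) (U fix : Fin m → Bool) (c : Fin m → ℤ) (β q : ℤ) (y : Fin m → ℤ)
  (F : Cuts.Feas ends k U fix c β q y) (strict : ∀ e → T (U e) → ℤ.0ℤ ℤ.< y e × y e ℤ.< q)
  (extreme : ∀ z → (∀ e → ¬ T (U e) → z e ≡ ℤ.0ℤ) → (∀ S → Cuts.across ends S y ≡ k ℤ.* q → Cuts.across ends S z ≡ ℤ.0ℤ) → ∀ e → z e ≡ ℤ.0ℤ)
  where

  open Cuts ends using (VSet; cr; across)
  open Uncross ends k U fix c β q y F strict using (Tight; Supported; Irrelevant; irrelevant-across; irrelevant-cover; uncross; module Uncrossed)

  inside outside : VSet → List VSet → List VSet
  inside  S P = List.filterᵇ (meets S) P
  outside S P = List.filterᵇ (λ X → not (meets S X)) P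

  Orthogonal : List VSet → (Fin m → ℤ) → Set
  Orthogonal K z = All (λ X → across X z ≡ ℤ.0ℤ) K

  -- K is a laminar family, listed from the last set added to the first, and P
  -- consists of its maximal members. Every set is independent of the earlier ones.
  data Family : List VSet → List VSet → Set where
    []  : Family [] []
    add : ∀ {K P} S → Family K P → Tight S → All (λ X → X ⊆ˢ S ⊎ Disjoint X S) P →
          ∀ z → Supported z → Orthogonal P z → across S z ≢ ℤ.0ℤ → Family (S ∷ K) (S ∷ outside S P)

  maximal-⊆ : ∀ {K P X} → Family K P → X ∈ P → X ∈ K
  maximal-⊆ (add S L _ _ _ _ _ _) (here eq)  = here eq
  maximal-⊆ (add {P = P} S L _ _ _ _ _ _) (there X∈) = there (maximal-⊆ L (proj₁ (∈-filter⁻ (λ X → Bool.T? (not (meets S X))) {xs = P} X∈)))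

  independent-relevant : ∀ S {z} → Supported z → across S z ≢ ℤ.0ℤ → ¬ Irrelevant S
  independent-relevant S supp ne irr = ne (irrelevant-across {S} irr supp)

  members : ∀ {K P} → Family K P → All (λ S → Tight S × ¬ Irrelevant S) K
  members []                           = []
  members (add S L t _ z supp _ ne) = (t , independent-relevant S supp ne) ∷ members L

  Spans : List VSet → VSet → Set
  Spans K S = Tight S → All (NonCrossing S) K → ∀ z → Supported z → Orthogonal K z → across S z ≡ ℤ.0ℤ

  Result : List VSet → List VSet → Set
  Result l K = ∃₂ λ K′ P′ → Family K′ P′ × AllPairs NonCrossing K′ × (∀ {X} → X ∈ K → X ∈ K′) × All (Spans K′) l

  -- A set is kept exactly when it is independent of the sets kept before it;
  -- this is not decidable, hence the double negation.
  process : ∀ l → AllPairs Ordered l → ∀ {K P} → Family K P → AllPairs NonCrossing K →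
            (∀ {X} → X ∈ K → All (Ordered X) l) → ¬ ¬ Result l K
  process []      _          {K} {P} L nc ord none = none (K , P , L , nc , id , [])
  process (S ∷ l) (oS ∷ ol) {K} {P} L nc ord none =
    process l ol L nc (λ X∈ → All.tail (ord X∈)) λ (K′ , P′ , L′ , nc′ , K⊆K′ , spans) →
      none (K′ , P′ , L′ , nc′ , K⊆K′ , (λ tight ncs z supp orth → case across S z ℤ.≟ ℤ.0ℤ of λ where
        (yes eq) → eq
        (no ne)  → ⊥-elim (keep tight (restrict K⊆K′ ncs) z supp (restrict K⊆K′ orth) ne)) ∷ spans)
    where
    restrict : ∀ {K′} {Q : VSet → Set} → (∀ {X} → X ∈ K → X ∈ K′) → All Q K′ → All Q K
    restrict K⊆K′ all = All.tabulate (λ X∈ → All.lookup all (K⊆K′ X∈))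
    keep : Tight S → All (NonCrossing S) K → ∀ z → Supported z → Orthogonal K z → across S z ≢ ℤ.0ℤ → ⊥
    keep tight ncs z supp orth ne =
      process l ol (add S L tight (All.tabulate (λ X∈ → below (maximal-⊆ L X∈))) z supp (All.tabulate (λ X∈ → All.lookup orth (maximal-⊆ L X∈))) ne)
        (ncs ∷ nc) (λ { (here refl) → oS ; (there X∈) → All.tail (ord X∈) }) λ (K′ , P′ , L′ , nc′ , K⊆K′ , spans) →
          none (K′ , P′ , L′ , nc′ , (λ X∈ → K⊆K′ (there X∈)) , (λ _ _ z _ orth → All.lookup orth (K⊆K′ (here refl))) ∷ spans)
      where
      below : ∀ {X} → X ∈ K → X ⊆ˢ S ⊎ Disjoint X S
      below X∈ with All.lookup ncs X∈
      -- Strict supersets are enumerated later, so a set contained in an earlier member has the same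
      -- vertices.
      ... | sub S⊆X  = inj₁ (All.head (ord X∈) S⊆X)
      ... | sup X⊆S  = inj₁ X⊆S
      ... | disj S∥X = inj₂ (λ v x s → S∥X v s x)

  -- R is uncrossed with one member of K after the other. Since z vanishes on the member, the values
  -- of z on the two corners add up to its value on R, so one of the corners is again a witness; it
  -- crosses no member treated before.
  noncrossing-witness : ∀ K → AllPairs NonCrossing K → All (λ S → Tight S × ¬ Irrelevant S) K → ∀ z → Supported z → Orthogonal K z →
    ∀ R → Tight R → across R z ≢ ℤ.0ℤ → ∃ λ R′ → Tight R′ × across R′ z ≢ ℤ.0ℤ × All (NonCrossing R′) K
  noncrossing-witness []      _          _                  z supp _            R tR ne = R , tR , ne , []
  noncrossing-witness (S ∷ K) (ncS ∷ nc) ((tS , rS) ∷ tr) z supp (zS ∷ orth) R tR ne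
    with noncrossing-witness K nc tr z supp orth R tR ne
  ... | R′ , tR′ , ne′ , ncs with noncrossing-or-crossing R′ S
  ... | inj₁ ok = R′ , tR′ , ne′ , ok ∷ ncs
  ... | inj₂ cross with uncross S R′ tS tR′ rS (independent-relevant R′ supp ne′)
  ... | un with across (Uncrossed.X un) z ℤ.≟ ℤ.0ℤ
  ... | no nX = X , tight-X , nX , corner-noncrossing corner-X ∷
                All.zipWith (λ (p , r) → corner-stays-noncrossing corner-X (crossing-sym cross) (NonCrossing-sym p) (NonCrossing-sym r)) (ncS , ncs)
    where open Uncrossed un
  ... | yes zX = Y , tight-Y , nY , corner-noncrossing corner-Y ∷
                 All.zipWith (λ (p , r) → corner-stays-noncrossing corner-Y (crossing-sym cross) (NonCrossing-sym p) (NonCrossing-sym r)) (ncS , ncs)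
    where
    open Uncrossed un
    nY : across Y z ≢ ℤ.0ℤ
    nY zY = ne′ (trans (sym (ℤ.+-identityˡ (across R′ z))) (trans (cong (ℤ._+ across R′ z) (sym zS)) (trans (sym (modular z supp)) (cong₂ ℤ._+_ zX zY))))

  -- With fewer members than open edges, some nonzero z would be orthogonal to the family.
  -- Extremality yields a tight set on which z does not vanish, and uncrossing replaces it by one
  -- that crosses no member. But the family spans all such sets.
  family-exists : ¬ ¬ (∃₂ λ K P → Family K P × size-of U ≤ length K)
  family-exists none = process (subsets n) (subsets-ordered n) [] [] (λ ()) λ (K , P , L , nc , _ , spans) →
    none (K , P , L , ≮⇒≥ λ lt →
      let (z , (e , ne) , supp , orth) = nontrivial-solution (map (λ S e → ℤ.+ cr S e) K) U (subst (_< size-of U) (sym (List.length-map _ K)) lt)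
          orthK = All.map⁻ orth
      in ne (extreme z supp (λ R tR → case across R z ℤ.≟ ℤ.0ℤ of λ where
           (yes eq) → eq
           (no nR)  → let (R′ , tR′ , nR′ , ncs) = noncrossing-witness K nc (members L) z supp orthK R tR nR in
                      ⊥-elim (nR′ (All.lookup spans (∈-subsets R′) tR′ ncs z supp orthK))) e))

-- Counting a laminar family

Σᴺ : ∀ {m} → (Fin m → ℕ) → ℕ
Σᴺ {zero}  f = 0
Σᴺ {suc m} f = f zero + Σᴺ (f ∘ suc)

Σᴺ-cong : ∀ {m} {f g : Fin m → ℕ} → (∀ e → f e ≡ g e) → Σᴺ f ≡ Σᴺ g
Σᴺ-cong {zero}  eq = refl
Σᴺ-cong {suc m} eq = cong₂ _+_ (eq zero) (Σᴺ-cong (eq ∘ suc))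

Σᴺ-mono : ∀ {m} {f g : Fin m → ℕ} → (∀ e → f e ≤ g e) → Σᴺ f ≤ Σᴺ g
Σᴺ-mono {zero}  le = z≤n
Σᴺ-mono {suc m} le = +-mono-≤ (le zero) (Σᴺ-mono (le ∘ suc))

Σᴺ-+ : ∀ {m} (f g : Fin m → ℕ) → Σᴺ (λ e → f e + g e) ≡ Σᴺ f + Σᴺ g
Σᴺ-+ {zero}  f g = refl
Σᴺ-+ {suc m} f g = trans (cong (f zero + g zero +_) (Σᴺ-+ (f ∘ suc) (g ∘ suc))) (shuffle (f zero) (g zero) (Σᴺ (f ∘ suc)) (Σᴺ (g ∘ suc)))
  where
  shuffle : ∀ a b c d → (a + b) + (c + d) ≡ (a + c) + (b + d)
  shuffle = ℕ-Ring.solve-∀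

Σᴺ-* : ∀ {m} a (f : Fin m → ℕ) → Σᴺ (λ e → a * f e) ≡ a * Σᴺ f
Σᴺ-* {zero}  a f = sym (*-zeroʳ a)
Σᴺ-* {suc m} a f = trans (cong (a * f zero +_) (Σᴺ-* a (f ∘ suc))) (sym (*-distribˡ-+ a (f zero) _))

Σᴺ-size : ∀ {m} (U : Fin m → Bool) → Σᴺ (λ e → bit (U e)) ≡ size-of U
Σᴺ-size {zero}  U = refl
Σᴺ-size {suc m} U = cong (bit (U zero) +_) (Σᴺ-size (U ∘ suc))

∑-Σᴺ : ∀ {m} (f : Fin m → ℕ) → ∑ (λ e → ℤ.+ f e) ≡ ℤ.+ Σᴺ f
∑-Σᴺ {zero}  f = refl
∑-Σᴺ {suc m} f = cong (λ t → ℤ.+ f zero ℤ.+ t) (∑-Σᴺ (f ∘ suc))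

sumOver-filter : ∀ {A : Set} (f : A → ℕ) (p : A → Bool) xs →
                 sumOver f xs ≡ sumOver f (List.filterᵇ p xs) + sumOver f (List.filterᵇ (λ x → not (p x)) xs)
sumOver-filter f p []       = refl
sumOver-filter f p (x ∷ xs) with p x
... | true  = trans (cong (f x +_) (sumOver-filter f p xs)) (sym (+-assoc (f x) _ _))
... | false = trans (cong (f x +_) (sumOver-filter f p xs)) (shuffle (f x) (sumOver f (List.filterᵇ p xs)) _)
  where
  shuffle : ∀ a b c → a + (b + c) ≡ b + (a + c)
  shuffle = ℕ-Ring.solve-∀

length-sum : ∀ {A : Set} (xs : List A) → length xs ≡ sumOver (λ _ → 1) xs
length-sum []       = refl
length-sum (x ∷ xs) = cong suc (length-sum xs)

sumOver-zero : ∀ {A : Set} (f : A → ℕ) xs → All (λ x → f x ≡ 0) xs → sumOver f xs ≡ 0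
sumOver-zero f []       []       = refl
sumOver-zero f (x ∷ xs) (e ∷ es) = cong₂ _+_ e (sumOver-zero f xs es)

bit-T : ∀ {b} → T b → bit b ≡ 1
bit-T {true} _ = refl

bit-¬T : ∀ {b} → ¬ T b → bit b ≡ 0
bit-¬T {true}  f = ⊥-elim (f tt)
bit-¬T {false} f = refl

bit-≤1 : ∀ b → bit b ≤ 1
bit-≤1 true  = ≤-refl
bit-≤1 false = z≤n

≤-bit-∧ : ∀ {j} a b → j ≤ bit a → j ≤ bit b → j ≤ bit (a ∧ b)
≤-bit-∧ true  b p q = q
≤-bit-∧ false b p q = p

size-≤ : ∀ {m} (U : Fin m → Bool) → size-of U ≤ m
size-≤ {zero}  U = z≤n
size-≤ {suc m} U = +-mono-≤ (bit-≤1 (U zero)) (size-≤ (U ∘ suc))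

Σᴺ-term : ∀ {m} (e : Fin m) (f : Fin m → ℕ) → f e ≤ Σᴺ f
Σᴺ-term zero    f = m≤m+n _ _
Σᴺ-term (suc e) f = ≤-trans (Σᴺ-term e (f ∘ suc)) (m≤n+m _ (f zero))

bit-∧-≤ˡ : ∀ a b → bit (a ∧ b) ≤ bit a
bit-∧-≤ˡ true  b = bit-≤1 b
bit-∧-≤ˡ false b = z≤n

bit-∧-≤ʳ : ∀ a b → bit (a ∧ b) ≤ bit b
bit-∧-≤ʳ true  b = ≤-refl
bit-∧-≤ʳ false b = z≤n

sumOver-mono : ∀ {A : Set} {f g : A → ℕ} xs → (∀ x → f x ≤ g x) → sumOver f xs ≤ sumOver g xs
sumOver-mono []       le = z≤n
sumOver-mono (x ∷ xs) le = +-mono-≤ (le x) (sumOver-mono xs le)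

module Counting {n m : ℕ} (ends : Fin m → Fin n × Fin n)
  (k : ℤ) (U fix : Fin m → Bool) (c : Fin m → ℤ) (β q : ℤ) (y : Fin m → ℤ)
  (F : Cuts.Feas ends k U fix c β q y) (strict : ∀ e → T (U e) → ℤ.0ℤ ℤ.< y e × y e ℤ.< q)
  (extreme : ∀ z → (∀ e → ¬ T (U e) → z e ≡ ℤ.0ℤ) → (∀ S → Cuts.across ends S y ≡ k ℤ.* q → Cuts.across ends S z ≡ ℤ.0ℤ) → ∀ e → z e ≡ ℤ.0ℤ)
  where

  open Cuts ends using (VSet; cr; across)
  open CutCounts ends using (src; tgt; mem; ins; cr-ins)
  open Uncross ends k U fix c β q y F strict using (Tight; Supported; Irrelevant; irrelevant-or-large; bit-cases)
  open Laminar ends k U fix c β q y F strict extreme using (Family; []; add; inside; outside; Orthogonal; maximal-⊆; independent-relevant; members)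
  open Cuts.Feas F using (q-pos; upper; fixed)

  crP insP : List VSet → Fin m → ℕ
  crP  P e = sumOver (λ X → cr X e) P
  insP P e = sumOver (λ X → ins X e) P

  memP : List VSet → Fin n → ℕ
  memP P v = sumOver (λ X → mem X v) P

  crP-insP : ∀ P e → crP P e + (insP P e + insP P e) ≡ memP P (src e) + memP P (tgt e)
  crP-insP []      e = refl
  crP-insP (X ∷ P) e = trans (shuffle (cr X e) (crP P e) (ins X e) (insP P e))
    (trans (cong₂ _+_ (cr-ins X e) (crP-insP P e)) (shuffle′ (mem X (src e)) (mem X (tgt e)) (memP P (src e)) (memP P (tgt e))))
    where
    shuffle : ∀ a b c d → (a + b) + ((c + d) + (c + d)) ≡ (a + (c + c)) + (b + (d + d))
    shuffle = ℕ-Ring.solve-∀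
    shuffle′ : ∀ a b c d → (a + b) + (c + d) ≡ (a + c) + (b + d)
    shuffle′ = ℕ-Ring.solve-∀

  insP-src : ∀ P e → insP P e ≤ memP P (src e)
  insP-src P e = sumOver-mono P (λ X → bit-∧-≤ˡ (lookup X (src e)) (lookup X (tgt e)))

  insP-tgt : ∀ P e → insP P e ≤ memP P (tgt e)
  insP-tgt P e = sumOver-mono P (λ X → bit-∧-≤ʳ (lookup X (src e)) (lookup X (tgt e)))

  split : ∀ S P (f : VSet → ℕ) → sumOver f P ≡ sumOver f (inside S P) + sumOver f (outside S P)
  split S P f = sumOver-filter f (meets S) P

  inside-⊆ : ∀ {S P X} → All (λ X → X ⊆ˢ S ⊎ Disjoint X S) P → X ∈ inside S P → X ∈ P × X ⊆ˢ S
  inside-⊆ {S} {P} {X} alts X∈ with ∈-filter⁻ (λ X → Bool.T? (meets S X)) {xs = P} X∈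
  ... | X∈P , t with All.lookup alts X∈P
  ... | inj₁ X⊆S = X∈P , X⊆S
  ... | inj₂ d   = let (v , s , x) = meets-sound S X t in ⊥-elim (d v x s)

  outside-∉ : ∀ {S P X v} → X ∈ outside S P → v ∈ˢ S → ¬ v ∈ˢ X
  outside-∉ {S} {P} {X} {v} X∈ s x = T-not (proj₂ (∈-filter⁻ (λ X → Bool.T? (not (meets S X))) {xs = P} X∈)) (meets-complete S X v s x)

  -- The maximal members are pairwise disjoint: a new set absorbs each old one that it meets. Stated
  -- as a count, this is directly usable in sums over edge ends.
  disjoint-members : ∀ {K P} → Family K P → ∀ v → memP P v ≤ 1
  disjoint-members [] v = z≤n
  disjoint-members (add {P = P} S L _ _ _ _ _ _) v with Bool.T? (lookup S v)
  ... | yes s = ≤-reflexive (cong₂ _+_ (bit-T s) (sumOver-zero (λ X → mem X v) (outside S P) (All.tabulate (λ X∈ → bit-¬T (outside-∉ {S} {P} X∈ s)))))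
  ... | no ¬s = ≤-trans (≤-trans (≤-reflexive (cong (_+ memP (outside S P) v) (bit-¬T ¬s))) (≤-trans (m≤n+m _ (memP (inside S P) v)) (≤-reflexive (sym (split S P (λ X → mem X v)))))) (disjoint-members L v)

  inside-≤ : ∀ {K P} → Family K P → ∀ S → All (λ X → X ⊆ˢ S ⊎ Disjoint X S) P → ∀ v → memP (inside S P) v ≤ mem S v
  inside-≤ {P = P} L S alts v with Bool.T? (lookup S v)
  ... | yes s = ≤-trans (≤-trans (m≤m+n _ (memP (outside S P) v)) (≤-reflexive (sym (split S P (λ X → mem X v))))) (≤-trans (disjoint-members L v) (≤-reflexive (sym (bit-T s))))
  ... | no ¬s = ≤-reflexive (trans (sumOver-zero (λ X → mem X v) (inside S P) (All.tabulate (λ X∈ → bit-¬T (λ x → ¬s (proj₂ (inside-⊆ {S} {P} alts X∈) v x))))) (sym (bit-¬T ¬s)))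

  across-crP : ∀ Q z → Orthogonal Q z → ∑ (λ e → ℤ.+ crP Q e ℤ.* z e) ≡ ℤ.0ℤ
  across-crP []      z []       = ∑-zero {m} (λ e → ℤ.*-zeroˡ (z e))
  across-crP (X ∷ Q) z (o ∷ os) = trans (∑-cong (λ e → ℤ.*-distribʳ-+ (z e) (ℤ.+ cr X e) (ℤ.+ crP Q e)))
    (trans (∑-+ (λ e → ℤ.+ cr X e ℤ.* z e) (λ e → ℤ.+ crP Q e ℤ.* z e)) (cong₂ ℤ._+_ o (across-crP Q z os)))

  inside-orthogonal : ∀ {S P z} → Orthogonal P z → Orthogonal (inside S P) z
  inside-orthogonal {S} {P} orth = All.tabulate (λ X∈ → All.lookup orth (proj₁ (∈-filter⁻ (λ X → Bool.T? (meets S X)) {xs = P} X∈)))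

  -- If S and the members of Q had equal counts on every open edge, orthogonality to Q would make z
  -- vanish on S too. With the children of S as Q this turns linear independence into a concrete
  -- edge.
  distinguishing-edge : ∀ S Q z → Supported z → Orthogonal Q z → across S z ≢ ℤ.0ℤ → ∃ λ e → T (U e) × cr S e ≢ crP Q e
  distinguishing-edge S Q z supp orth ne with Fin.any? (λ e → Bool.T? (U e ∧ not (cr S e ℕ.≡ᵇ crP Q e)))
  ... | yes (e , t) = e , proj₁ (T-∧ t) , λ eq → T-not (proj₂ (T-∧ {U e} t)) (≡⇒≡ᵇ (cr S e) (crP Q e) eq)
  ... | no none     = ⊥-elim (ne (trans (∑-cong same) (across-crP Q z orth)))
    where
    same : ∀ e → ℤ.+ cr S e ℤ.* z e ≡ ℤ.+ crP Q e ℤ.* z e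
    same e with Bool.T? (U e) | cr S e ≟ crP Q e
    ... | yes u | yes eq = cong (λ j → ℤ.+ j ℤ.* z e) eq
    ... | yes u | no  ne = ⊥-elim (none (e , ∧-T u (not-T (λ t → ne (≡ᵇ⇒≡ (cr S e) (crP Q e) t)))))
    ... | no ¬u | _      = trans (trans (cong (ℤ.+ cr S e ℤ.*_) (supp e ¬u)) (ℤ.*-zeroʳ (ℤ.+ cr S e)))
                                 (sym (trans (cong (ℤ.+ crP Q e ℤ.*_) (supp e ¬u)) (ℤ.*-zeroʳ (ℤ.+ crP Q e))))

  -- Token counting when every open edge has value below one half

  module Half (half : ∀ e → T (U e) → y e ℤ.+ y e ℤ.< q) where

    -- An edge gives its value to the sets it crosses and a full unit to the sets containing it.
    charge : (Fin m → ℕ) → (Fin m → ℕ) → Fin m → ℤ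
    charge f g e = if U e then y e ℤ.* ℤ.+ f e ℤ.+ q ℤ.* ℤ.+ g e else ℤ.0ℤ

    G : List VSet → ℤ
    G P = ∑ (charge (crP P) (insP P))

    charge-+ : ∀ f f′ g g′ e → charge (λ e → f e + f′ e) (λ e → g e + g′ e) e ≡ charge f g e ℤ.+ charge f′ g′ e
    charge-+ f f′ g g′ e with U e
    ... | true  = distribute (y e) (ℤ.+ f e) (ℤ.+ f′ e) q (ℤ.+ g e) (ℤ.+ g′ e)
      where
      distribute : ∀ y a b q c d → y ℤ.* (a ℤ.+ b) ℤ.+ q ℤ.* (c ℤ.+ d) ≡ (y ℤ.* a ℤ.+ q ℤ.* c) ℤ.+ (y ℤ.* b ℤ.+ q ℤ.* d)
      distribute = ℤ-Ring.solve-∀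
    ... | false = refl

    G-cons : ∀ X P → G (X ∷ P) ≡ ∑ (charge (cr X) (ins X)) ℤ.+ G P
    G-cons X P = trans (∑-cong (charge-+ (cr X) (crP P) (ins X) (insP P))) (∑-+ (charge (cr X) (ins X)) (charge (crP P) (insP P)))

    G-split : ∀ S P → G P ≡ G (inside S P) ℤ.+ G (outside S P)
    G-split S P = trans (∑-cong (λ e → trans (charge-cong (crP P) (λ e → crP (inside S P) e + crP (outside S P) e) (insP P) (λ e → insP (inside S P) e + insP (outside S P) e) e (split S P (λ X → cr X e)) (split S P (λ X → ins X e)))
                                              (charge-+ (crP (inside S P)) (crP (outside S P)) (insP (inside S P)) (insP (outside S P)) e)))
                        (∑-+ (charge (crP (inside S P)) (insP (inside S P))) (charge (crP (outside S P)) (insP (outside S P))))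
      where
      charge-cong : ∀ (f f′ g g′ : Fin m → ℕ) e → f e ≡ f′ e → g e ≡ g′ e → charge f g e ≡ charge f′ g′ e
      charge-cong f f′ g g′ e p q′ = cong₂ (λ a b → if U e then y e ℤ.* ℤ.+ a ℤ.+ q ℤ.* ℤ.+ b else ℤ.0ℤ) p q′

    -- The charge of a tight set is integral because the determined edges contribute integrally.
    tight-integral : ∀ X → Tight X → ∃ λ j → ∑ (charge (cr X) (ins X)) ≡ q ℤ.* j
    tight-integral X tX = k ℤ.+ ∑ whole , (begin
      ∑ (charge (cr X) (ins X))                                          ≡⟨ ∑-cong edge ⟩
      ∑ (λ e → ℤ.+ cr X e ℤ.* y e ℤ.+ q ℤ.* whole e)                     ≡⟨ ∑-+ (λ e → ℤ.+ cr X e ℤ.* y e) (λ e → q ℤ.* whole e) ⟩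
      across X y ℤ.+ ∑ (λ e → q ℤ.* whole e)                             ≡⟨ cong₂ ℤ._+_ tX (∑-* q whole) ⟩
      k ℤ.* q ℤ.+ q ℤ.* ∑ whole                                          ≡⟨ factor k q (∑ whole) ⟩
      q ℤ.* (k ℤ.+ ∑ whole)                                              ∎)
      where
      open ≡-Reasoning
      whole : Fin m → ℤ
      whole e = if U e then ℤ.+ ins X e else (if fix e then ℤ.- ℤ.+ cr X e else ℤ.0ℤ)
      factor : ∀ k q w → k ℤ.* q ℤ.+ q ℤ.* w ≡ q ℤ.* (k ℤ.+ w)
      factor = ℤ-Ring.solve-∀
      edge : ∀ e → charge (cr X) (ins X) e ≡ ℤ.+ cr X e ℤ.* y e ℤ.+ q ℤ.* whole e
      edge e with U e | fixed e
      ... | true  | _ = cong (ℤ._+ q ℤ.* ℤ.+ ins X e) (ℤ.*-comm (y e) (ℤ.+ cr X e))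
      ... | false | fx with fix e | fx id
      ... | true  | eq = trans (cancel (ℤ.+ cr X e) q) (cong (λ t → ℤ.+ cr X e ℤ.* t ℤ.+ q ℤ.* ℤ.- ℤ.+ cr X e) (sym eq))
        where
        cancel : ∀ a q → ℤ.0ℤ ≡ a ℤ.* q ℤ.+ q ℤ.* (ℤ.- a)
        cancel = ℤ-Ring.solve-∀
      ... | false | eq = trans (cancel (ℤ.+ cr X e) q) (cong (λ t → ℤ.+ cr X e ℤ.* t ℤ.+ q ℤ.* ℤ.0ℤ) (sym eq))
        where
        cancel : ∀ a q → ℤ.0ℤ ≡ a ℤ.* ℤ.0ℤ ℤ.+ q ℤ.* ℤ.0ℤ
        cancel = ℤ-Ring.solve-∀

    integral : ∀ Q → All Tight Q → ∃ λ j → G Q ≡ q ℤ.* j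
    integral []      []       = ℤ.0ℤ , trans (∑-zero {m} (λ e → empty e)) (sym (ℤ.*-zeroʳ q))
      where
      empty : ∀ e → charge (λ _ → 0) (λ _ → 0) e ≡ ℤ.0ℤ
      empty e with U e
      ... | true  = vanish (y e) q
        where
        vanish : ∀ a b → a ℤ.* ℤ.0ℤ ℤ.+ b ℤ.* ℤ.0ℤ ≡ ℤ.0ℤ
        vanish = ℤ-Ring.solve-∀
      ... | false = refl
    integral (X ∷ Q) (t ∷ ts) = let (i , ei) = tight-integral X t; (j , ej) = integral Q ts in
      i ℤ.+ j , trans (G-cons X Q) (trans (cong₂ ℤ._+_ ei ej) (sym (ℤ.*-distribˡ-+ q i j)))

    2y : Fin m → ℤ
    2y e = y e ℤ.+ y e

    compare : ∀ cS r iS i d d₃ y q → cS + (d₃ + d₃) ≡ r + d → iS ≡ i + d₃ →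
      y ℤ.* ℤ.+ cS ℤ.+ q ℤ.* ℤ.+ iS ≡ (y ℤ.* ℤ.+ r ℤ.+ q ℤ.* ℤ.+ i) ℤ.+ (y ℤ.* ℤ.+ d ℤ.+ (q ℤ.- (y ℤ.+ y)) ℤ.* ℤ.+ d₃)
    compare cS r iS i d d₃ y q e₁ refl = begin
      y ℤ.* ℤ.+ cS ℤ.+ q ℤ.* (ℤ.+ i ℤ.+ ℤ.+ d₃)                                              ≡⟨ rearrange y q (ℤ.+ cS) (ℤ.+ i) (ℤ.+ d₃) ⟩
      y ℤ.* (ℤ.+ cS ℤ.+ (ℤ.+ d₃ ℤ.+ ℤ.+ d₃)) ℤ.+ q ℤ.* ℤ.+ i ℤ.+ (q ℤ.- (y ℤ.+ y)) ℤ.* ℤ.+ d₃  ≡⟨ cong (λ t → y ℤ.* t ℤ.+ q ℤ.* ℤ.+ i ℤ.+ (q ℤ.- (y ℤ.+ y)) ℤ.* ℤ.+ d₃) (cong ℤ.+_ e₁) ⟩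
      y ℤ.* (ℤ.+ r ℤ.+ ℤ.+ d) ℤ.+ q ℤ.* ℤ.+ i ℤ.+ (q ℤ.- (y ℤ.+ y)) ℤ.* ℤ.+ d₃                 ≡⟨ rearrange′ y q (ℤ.+ r) (ℤ.+ d) (ℤ.+ i) ((q ℤ.- (y ℤ.+ y)) ℤ.* ℤ.+ d₃) ⟩
      (y ℤ.* ℤ.+ r ℤ.+ q ℤ.* ℤ.+ i) ℤ.+ (y ℤ.* ℤ.+ d ℤ.+ (q ℤ.- (y ℤ.+ y)) ℤ.* ℤ.+ d₃)         ∎
      where
      open ≡-Reasoning
      rearrange : ∀ y q c i d → y ℤ.* c ℤ.+ q ℤ.* (i ℤ.+ d) ≡ y ℤ.* (c ℤ.+ (d ℤ.+ d)) ℤ.+ q ℤ.* i ℤ.+ (q ℤ.- (y ℤ.+ y)) ℤ.* d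
      rearrange = ℤ-Ring.solve-∀
      rearrange′ : ∀ y q r d i t → y ℤ.* (r ℤ.+ d) ℤ.+ q ℤ.* i ℤ.+ t ≡ (y ℤ.* r ℤ.+ q ℤ.* i) ℤ.+ (y ℤ.* d ℤ.+ t)
      rearrange′ = ℤ-Ring.solve-∀

    module Difference {K P} (L : Family K P) S (alts : All (λ X → X ⊆ˢ S ⊎ Disjoint X S) P) (e : Fin m) where
      Q : List VSet
      Q = inside S P
      -- `d` counts the ends of e that lie in S but in no child of S, and `d₃` tells whether e lies
      -- inside S but inside no child. In these terms S is charged y d + (q - 2y) d₃ more than its
      -- children for e, and the second coefficient is positive because y is below q/2.
      d d₃ : ℕ
      d  = (mem S (src e) ∸ memP Q (src e)) + (mem S (tgt e) ∸ memP Q (tgt e))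
      d₃ = ins S e ∸ insP Q e
      ins≤ : insP Q e ≤ ins S e
      ins≤ = ≤-bit-∧ (lookup S (src e)) (lookup S (tgt e)) (≤-trans (insP-src Q e) (inside-≤ L S alts (src e))) (≤-trans (insP-tgt Q e) (inside-≤ L S alts (tgt e)))
      ins-eq : ins S e ≡ insP Q e + d₃
      ins-eq = sym (m+[n∸m]≡n ins≤)
      cr-eq : cr S e + (d₃ + d₃) ≡ crP Q e + d
      cr-eq = +-cancelʳ-≡ (insP Q e + insP Q e) _ _ (begin
        cr S e + (d₃ + d₃) + (insP Q e + insP Q e)                        ≡⟨ shuffle (cr S e) d₃ (insP Q e) ⟩
        cr S e + ((insP Q e + d₃) + (insP Q e + d₃))                      ≡⟨ cong (λ t → cr S e + (t + t)) ins-eq ⟨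
        cr S e + (ins S e + ins S e)                                      ≡⟨ cr-ins S e ⟩
        mem S (src e) + mem S (tgt e)                                     ≡⟨ cong₂ _+_ (m+[n∸m]≡n (inside-≤ L S alts (src e))) (m+[n∸m]≡n (inside-≤ L S alts (tgt e))) ⟨
        (memP Q (src e) + (mem S (src e) ∸ memP Q (src e))) + (memP Q (tgt e) + (mem S (tgt e) ∸ memP Q (tgt e)))
                                                                          ≡⟨ shuffle′ (memP Q (src e)) (mem S (src e) ∸ memP Q (src e)) (memP Q (tgt e)) (mem S (tgt e) ∸ memP Q (tgt e)) ⟩
        (memP Q (src e) + memP Q (tgt e)) + d                             ≡⟨ cong (_+ d) (crP-insP Q e) ⟨
        (crP Q e + (insP Q e + insP Q e)) + d                             ≡⟨ shuffle″ (crP Q e) (insP Q e + insP Q e) d ⟩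
        crP Q e + d + (insP Q e + insP Q e)                               ∎)
        where
        open ≡-Reasoning
        shuffle : ∀ a b c → a + (b + b) + (c + c) ≡ a + ((c + b) + (c + b))
        shuffle = ℕ-Ring.solve-∀
        shuffle′ : ∀ a b c d → (a + b) + (c + d) ≡ (a + c) + (b + d)
        shuffle′ = ℕ-Ring.solve-∀
        shuffle″ : ∀ a b c → (a + b) + c ≡ a + c + b
        shuffle″ = ℕ-Ring.solve-∀
      gain : ℤ
      gain = y e ℤ.* ℤ.+ d ℤ.+ (q ℤ.- 2y e) ℤ.* ℤ.+ d₃
      charge-gain : T (U e) → charge (cr S) (ins S) e ≡ charge (crP Q) (insP Q) e ℤ.+ gain
      charge-gain u with U e | u
      ... | true | _ = compare (cr S e) (crP Q e) (ins S e) (insP Q e) d d₃ (y e) q cr-eq ins-eq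
      q-2y>0 : T (U e) → ℤ.0ℤ ℤ.< q ℤ.- 2y e
      q-2y>0 u = subst (ℤ._< q ℤ.- 2y e) (ℤ.+-inverseʳ (2y e)) (ℤ.+-monoˡ-< (ℤ.- 2y e) (half e u))
      gain-nonneg : T (U e) → ℤ.0ℤ ℤ.≤ gain
      gain-nonneg u = ℤ.+-mono-≤ (*-nonneg (ℤ.<⇒≤ (proj₁ (strict e u))) (ℤ.+≤+ z≤n)) (*-nonneg (ℤ.<⇒≤ (q-2y>0 u)) (ℤ.+≤+ z≤n))
      gain-pos : T (U e) → cr S e ≢ crP Q e → ℤ.0ℤ ℤ.< gain
      gain-pos u ne with d₃ ≟ 0
      ... | no d₃≢0 = ℤ.+-mono-≤-< (*-nonneg (ℤ.<⇒≤ (proj₁ (strict e u))) (ℤ.+≤+ z≤n)) (*-pos (q-2y>0 u) (ℤ.+<+ (n≢0⇒n>0 d₃≢0)))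
      ... | yes eq = ℤ.+-mono-<-≤ (*-pos (proj₁ (strict e u)) (ℤ.+<+ (n≢0⇒n>0 λ d≡0 → ne (begin
              cr S e                  ≡⟨ +-identityʳ _ ⟨
              cr S e + 0              ≡⟨ cong (λ t → cr S e + (t + t)) eq ⟨
              cr S e + (d₃ + d₃)      ≡⟨ cr-eq ⟩
              crP Q e + d             ≡⟨ cong (crP Q e +_) d≡0 ⟩
              crP Q e + 0             ≡⟨ +-identityʳ _ ⟩
              crP Q e                 ∎)))) (*-nonneg (ℤ.<⇒≤ (q-2y>0 u)) (ℤ.+≤+ z≤n))
        where open ≡-Reasoning

    charged-outside : ∀ f g e → ¬ T (U e) → charge f g e ≡ ℤ.0ℤ
    charged-outside f g e ¬u with U e
    ... | true  = ⊥-elim (¬u tt)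
    ... | false = refl

    -- No edge charges S less than its children together, and the edge that distinguishes S from
    -- them charges it more.
    child-charge-< : ∀ {K P} (L : Family K P) S → All (λ X → X ⊆ˢ S ⊎ Disjoint X S) P →
      ∀ z → Supported z → Orthogonal P z → across S z ≢ ℤ.0ℤ → G (inside S P) ℤ.< ∑ (charge (cr S) (ins S))
    child-charge-< {K} {P} L S alts z supp orth ne =
      let (e , u , d) = distinguishing-edge S (inside S P) z supp (inside-orthogonal {S} orth) ne in
      ∑-strict le e (subst₂ ℤ._<_ (ℤ.+-identityʳ _) (sym (Difference.charge-gain L S alts e u)) (ℤ.+-monoʳ-< (charge (crP (inside S P)) (insP (inside S P)) e) (Difference.gain-pos L S alts e u d)))
      where
      le : ∀ e → charge (crP (inside S P)) (insP (inside S P)) e ℤ.≤ charge (cr S) (ins S) e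
      le e with Bool.T? (U e)
      ... | yes u = subst₂ ℤ._≤_ (ℤ.+-identityʳ _) (sym (Difference.charge-gain L S alts e u)) (ℤ.+-monoʳ-≤ (charge (crP (inside S P)) (insP (inside S P)) e) (Difference.gain-nonneg L S alts e u))
      ... | no ¬u = ℤ.≤-reflexive (trans (charged-outside (crP (inside S P)) (insP (inside S P)) e ¬u) (sym (charged-outside (cr S) (ins S) e ¬u)))

    tight-maximal : ∀ {K P} → Family K P → All Tight P
    tight-maximal L = All.tabulate (λ X∈ → proj₁ (All.lookup (members L) (maximal-⊆ L X∈)))

    -- The charges of a tight set and of its children are both multiples of q, so the strict excess
    -- is at least q. Each set added to the family thus contributes at least one unit.
    charge-count : ∀ {K P} → Family K P → ∃ λ j → G P ≡ q ℤ.* j × ℤ.+ length K ℤ.≤ j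
    charge-count [] = let (j , e) = integral [] [] in j , e , ℤ.≤-reflexive (sym (zero-case j e))
      where
      zero-case : ∀ j → G [] ≡ q ℤ.* j → j ≡ ℤ.0ℤ
      zero-case j e = ℤ.*-cancelˡ-≡ q j ℤ.0ℤ ⦃ ℤ.≢-nonZero (λ q≡0 → ℤ.<⇒≢ q-pos (sym q≡0)) ⦄ (trans (sym e) (proj₂ (integral [] [])))
    charge-count (add {K} {P} S L tS alts z supp orth ne) =
      let (j , ej , le)  = charge-count L
          (s , es)       = tight-integral S tS
          (i , ei)       = integral (inside S P) (All.tabulate (λ X∈ → All.lookup (tight-maximal L) (proj₁ (inside-⊆ {S} {P} alts X∈))))
          i<s            = ℤ.*-cancelˡ-<-nonNeg q ⦃ ℤ.nonNegative (ℤ.<⇒≤ q-pos) ⦄ (subst₂ ℤ._<_ ei es (child-charge-< L S alts z supp orth ne))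
      in j ℤ.+ (s ℤ.- i) , (begin
        G (S ∷ outside S P)                                                ≡⟨ G-cons S (outside S P) ⟩
        ∑ (charge (cr S) (ins S)) ℤ.+ G (outside S P)                      ≡⟨ complete (∑ (charge (cr S) (ins S))) (G (outside S P)) (G (inside S P)) ⟩
        (G (inside S P) ℤ.+ G (outside S P)) ℤ.+ (∑ (charge (cr S) (ins S)) ℤ.- G (inside S P))
                                                                           ≡⟨ cong₂ ℤ._+_ (trans (sym (G-split S P)) ej) (cong₂ ℤ._-_ es ei) ⟩
        q ℤ.* j ℤ.+ (q ℤ.* s ℤ.- q ℤ.* i)                                  ≡⟨ factor q j s i ⟩
        q ℤ.* (j ℤ.+ (s ℤ.- i))                                            ∎) ,
        subst (ℤ._≤ j ℤ.+ (s ℤ.- i)) (ℤ.+-comm (ℤ.+ length K) ℤ.1ℤ) (ℤ.+-mono-≤ le (step i s i<s))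
      where
      open ≡-Reasoning
      complete : ∀ a b c → a ℤ.+ b ≡ (c ℤ.+ b) ℤ.+ (a ℤ.- c)
      complete = ℤ-Ring.solve-∀
      factor : ∀ q j s i → q ℤ.* j ℤ.+ (q ℤ.* s ℤ.- q ℤ.* i) ≡ q ℤ.* (j ℤ.+ (s ℤ.- i))
      factor = ℤ-Ring.solve-∀
      step : ∀ i s → i ℤ.< s → ℤ.1ℤ ℤ.≤ s ℤ.- i
      step i s i<s = subst (ℤ._≤ s ℤ.- i) (cancel i) (ℤ.+-monoˡ-≤ (ℤ.- i) (ℤ.i<j⇒suc[i]≤j i<s))
        where
        cancel : ∀ i → (ℤ.1ℤ ℤ.+ i) ℤ.- i ≡ ℤ.1ℤ
        cancel = ℤ-Ring.solve-∀

    unit : Fin m → ℤ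
    unit e = if U e then q else ℤ.0ℤ

    ∑-unit : ∑ unit ≡ q ℤ.* ℤ.+ size-of U
    ∑-unit = trans (∑-cong (λ e → eq e)) (trans (∑-* q (λ e → ℤ.+ bit (U e))) (cong (q ℤ.*_) (trans (∑-Σᴺ (λ e → bit (U e))) (cong ℤ.+_ (Σᴺ-size U)))))
      where
      eq : ∀ e → unit e ≡ q ℤ.* ℤ.+ bit (U e)
      eq e with U e
      ... | true  = sym (ℤ.*-identityʳ q)
      ... | false = sym (ℤ.*-zeroʳ q)

    -- By disjointness an edge either lies inside one maximal set and gives q, or crosses at most
    -- two of them and gives at most 2y, which is below q.
    edge-charge-≤ : ∀ {K P} → Family K P → ∀ e → charge (crP P) (insP P) e ℤ.≤ unit e × (T (U e) → crP P e ≢ 0 → charge (crP P) (insP P) e ℤ.< unit e)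
    edge-charge-≤ {P = P} L e with U e | half e | strict e
    ... | false | _  | _  = ℤ.≤-refl , λ ()
    ... | true  | hf | st = go (crP P e) (insP P e) (≤-trans (≤-reflexive (crP-insP P e)) (+-mono-≤ (disjoint-members L (src e)) (disjoint-members L (tgt e))))
      where
      only : ∀ r → y e ℤ.* ℤ.+ r ℤ.+ q ℤ.* ℤ.0ℤ ≡ y e ℤ.* ℤ.+ r
      only r = trans (cong (λ t → y e ℤ.* ℤ.+ r ℤ.+ t) (ℤ.*-zeroʳ q)) (ℤ.+-identityʳ _)
      small : ∀ r → r ≤ 2 → y e ℤ.* ℤ.+ r ℤ.+ q ℤ.* ℤ.0ℤ ℤ.< q
      small r r≤2 = ℤ.≤-<-trans (subst₂ ℤ._≤_ (sym (only r)) (twice (y e)) (ℤ.*-monoˡ-≤-nonNeg (y e) ⦃ ℤ.nonNegative (ℤ.<⇒≤ (proj₁ (st tt))) ⦄ (ℤ.+≤+ r≤2))) (hf tt)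
        where
        twice : ∀ a → a ℤ.* ℤ.+ 2 ≡ a ℤ.+ a
        twice = ℤ-Ring.solve-∀
      go : ∀ r i → r + (i + i) ≤ 2 → (y e ℤ.* ℤ.+ r ℤ.+ q ℤ.* ℤ.+ i ℤ.≤ q) × (T true → r ≢ 0 → y e ℤ.* ℤ.+ r ℤ.+ q ℤ.* ℤ.+ i ℤ.< q)
      go r       zero    le = let lt = small r (subst (_≤ 2) (+-identityʳ r) le) in ℤ.<⇒≤ lt , λ _ _ → lt
      go zero    (suc zero) le = ℤ.≤-reflexive (one (y e) q) , λ _ ne → ⊥-elim (ne refl)
        where
        one : ∀ a q → a ℤ.* ℤ.0ℤ ℤ.+ q ℤ.* ℤ.1ℤ ≡ q
        one = ℤ-Ring.solve-∀
      go zero    (suc (suc i)) le = contradiction (subst (_≤ 2) (cong (λ t → suc (suc t)) (+-suc i (suc i))) le) (λ { (s≤s (s≤s ())) })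
      go (suc r) (suc i) le = contradiction (subst (_≤ 2) (cong suc (trans (+-suc r (i + suc i)) (cong suc (trans (cong (r +_) (+-suc i i)) (+-suc r (i + i)))))) le) (λ { (s≤s (s≤s ())) })

    -- The total charge is at least q per set. It is less than q per open edge, because the last set
    -- added is maximal and has an open edge on its boundary. Hence there would be fewer sets than
    -- open edges.
    none-undetermined : ∀ {K P} → Family K P → size-of U ≤ length K → ∀ e → ¬ T (U e)
    none-undetermined [] le e u = contradiction (≤-trans (≤-reflexive (sym (size-without e U u))) le) (λ ())
    none-undetermined L@(add {K} {P} S _ _ _ z supp orth ne) le e u =
      let (j , ej , K≤j) = charge-count L
          (e′ , u′ , d)  = distinguishing-edge S [] z supp [] ne
          lt             = ∑-strict (λ e → proj₁ (edge-charge-≤ L e)) e′ (proj₂ (edge-charge-≤ L e′) u′ (λ eq → d (n≤0⇒n≡0 (≤-trans (m≤m+n (cr S e′) _) (≤-reflexive eq)))))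
          j<U            = ℤ.*-cancelˡ-<-nonNeg q ⦃ ℤ.nonNegative (ℤ.<⇒≤ q-pos) ⦄ (subst₂ ℤ._<_ ej ∑-unit lt)
      in ℤ.<⇒≱ j<U (ℤ.≤-trans (ℤ.+≤+ le) K≤j)

  -- Open edges compared with the edges of an arbitrary cover

  module Unit (κ : ℕ) (k≡κ : k ≡ ℤ.+ κ) (D : Fin m → Bool)
    (D-covers : ∀ S → (∀ e → cr S e ≡ 1 → T (D e)) ⊎ κ ≤ Σᴺ (λ e → bit (D e) * cr S e)) where

    degrees : (Fin n → ℕ) → ℕ
    degrees f = Σᴺ (λ e → bit (D e) * (f (src e) + f (tgt e)))

    degrees-mono : ∀ {f g} → (∀ v → f v ≤ g v) → degrees f ≤ degrees g
    degrees-mono le = Σᴺ-mono (λ e → *-monoʳ-≤ (bit (D e)) (+-mono-≤ (le (src e)) (le (tgt e))))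

    degrees-+ : ∀ f g → degrees (λ v → f v + g v) ≡ degrees f + degrees g
    degrees-+ f g = trans (Σᴺ-cong (λ e → shuffle (bit (D e)) (f (src e)) (g (src e)) (f (tgt e)) (g (tgt e))))
                          (Σᴺ-+ (λ e → bit (D e) * (f (src e) + f (tgt e))) (λ e → bit (D e) * (g (src e) + g (tgt e))))
      where
      shuffle : ∀ d a b c e → d * ((a + b) + (c + e)) ≡ d * (a + c) + d * (b + e)
      shuffle = ℕ-Ring.solve-∀

    -- A relevant set has at least κ edges of the graph on its boundary, hence κ edges of D.
    degree-large : ∀ R → ¬ Irrelevant R → κ ≤ degrees (mem R)
    degree-large R rel = ≤-trans boundary (Σᴺ-mono (λ e → *-monoʳ-≤ (bit (D e)) (≤-trans (m≤m+n _ _) (≤-reflexive (cr-ins R e)))))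
      where
      large : k ℤ.* q ℤ.≤ across R y
      large with irrelevant-or-large R
      ... | inj₁ irr = ⊥-elim (rel irr)
      ... | inj₂ le  = le
      many : κ ≤ Σᴺ (cr R)
      many = ℤ.drop‿+≤+ (ℤ.*-cancelʳ-≤-pos (ℤ.+ κ) (ℤ.+ Σᴺ (cr R)) q ⦃ ℤ.positive q-pos ⦄ (begin
        ℤ.+ κ ℤ.* q                                ≡⟨ cong (ℤ._* q) k≡κ ⟨
        k ℤ.* q                                    ≤⟨ large ⟩
        across R y                                 ≤⟨ ∑-mono (λ e → ℤ.*-monoˡ-≤-nonNeg (ℤ.+ cr R e) (upper e)) ⟩
        ∑ (λ e → ℤ.+ cr R e ℤ.* q)                 ≡⟨ ∑-cong (λ e → ℤ.*-comm (ℤ.+ cr R e) q) ⟩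
        ∑ (λ e → q ℤ.* ℤ.+ cr R e)                 ≡⟨ ∑-* q (λ e → ℤ.+ cr R e) ⟩
        q ℤ.* ∑ (λ e → ℤ.+ cr R e)                 ≡⟨ cong (q ℤ.*_) (∑-Σᴺ (cr R)) ⟩
        q ℤ.* ℤ.+ Σᴺ (cr R)                        ≡⟨ ℤ.*-comm q _ ⟩
        ℤ.+ Σᴺ (cr R) ℤ.* q                        ∎))
        where open ℤ.≤-Reasoning
      boundary : κ ≤ Σᴺ (λ e → bit (D e) * cr R e)
      boundary with D-covers R
      ... | inj₂ le   = le
      ... | inj₁ full = ≤-trans many (Σᴺ-mono (λ e → case bit-cases (lookup R (src e) xor lookup R (tgt e)) of λ where
          (inj₁ eq) → ≤-trans (≤-reflexive eq) z≤n
          (inj₂ eq) → ≤-reflexive (trans eq (trans (sym eq) (trans (sym (*-identityˡ (cr R e))) (cong (_* cr R e) (sym (bit-T (full e eq)))))))))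

    -- If no open edge crossed the difference, S and C would have the same open boundary edges, and
    -- z would vanish on S as it does on C.
    difference-relevant : ∀ S C z → C ⊆ˢ S → Supported z → across C z ≡ ℤ.0ℤ → across S z ≢ ℤ.0ℤ → ¬ Irrelevant (S ∖ˢ C)
    difference-relevant S C z C⊆S supp zC ne irr = ne (trans (∑-cong same) zC)
      where
      table : ∀ s t a b → (T a → T s) → (T b → T t) → bit ((s ∧ not a) xor (t ∧ not b)) ≡ 0 → bit (s xor t) ≡ bit (a xor b)
      table true  true  true  true  _ _ _ = refl
      table true  true  false false _ _ _ = refl
      table true  false true  false _ _ _ = refl
      table false true  false true  _ _ _ = refl
      table false false false false _ _ _ = refl
      table false _     true  _     f _ _ = ⊥-elim (f tt)
      table _     false _     true  _ f _ = ⊥-elim (f tt)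
      same : ∀ e → ℤ.+ cr S e ℤ.* z e ≡ ℤ.+ cr C e ℤ.* z e
      same e with Bool.T? (U e)
      ... | yes u = cong (λ j → ℤ.+ j ℤ.* z e) (table (lookup S (src e)) (lookup S (tgt e)) (lookup C (src e)) (lookup C (tgt e)) (C⊆S (src e)) (C⊆S (tgt e))
                      (trans (sym (cong₂ (λ a b → bit (a xor b)) (Vec.lookup-zipWith (λ a b → a ∧ not b) (src e) S C) (Vec.lookup-zipWith (λ a b → a ∧ not b) (tgt e) S C))) (irr e u)))
      ... | no ¬u = trans (trans (cong (ℤ.+ cr S e ℤ.*_) (supp e ¬u)) (ℤ.*-zeroʳ (ℤ.+ cr S e)))
                          (sym (trans (cong (ℤ.+ cr C e ℤ.*_) (supp e ¬u)) (ℤ.*-zeroʳ (ℤ.+ cr C e))))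

    mem-minus : ∀ S C v → C ⊆ˢ S → mem (S ∖ˢ C) v + mem C v ≡ mem S v
    mem-minus S C v C⊆S = trans (cong (λ b → bit b + mem C v) (Vec.lookup-zipWith (λ a b → a ∧ not b) v S C)) (table (lookup S v) (lookup C v) (C⊆S v))
      where
      table : ∀ s a → (T a → T s) → bit (s ∧ not a) + bit a ≡ bit s
      table true  true  _ = refl
      table true  false _ = refl
      table false false _ = refl
      table false true  f = ⊥-elim (f tt)

    -- p is the number of members with at most one child. Such a member owns a relevant vertex set,
    -- namely itself or its difference from the child; the owned sets are disjoint, and each meets
    -- at least κ ends of edges of D. A member with two or more children reduces the number of
    -- maximal sets, which pays for it.
    few-children : ∀ {K P} → Family K P → ∃ λ p → length K + length P ≤ p + p × κ * p ≤ degrees (memP P)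
    few-children [] = 0 , z≤n , subst (_≤ degrees (memP [])) (sym (*-zeroʳ κ)) z≤n
    few-children (add {K} {P} S L tS alts z supp orth ne) with few-children L | inside S P in eq | inside-≤ L S alts
    ... | p , le , dg | [] | _ = suc p , (begin
        suc (length K) + suc (length (outside S P))       ≡⟨ cong suc (+-suc (length K) _) ⟩
        suc (suc (length K + length (outside S P)))       ≡⟨ cong (λ t → suc (suc (length K + t))) out ⟩
        suc (suc (length K + length P))                   ≤⟨ s≤s (s≤s le) ⟩
        suc (suc (p + p))                                 ≡⟨ cong suc (+-suc p p) ⟨
        suc p + suc p                                     ∎) , (begin
        κ * suc p                                         ≡⟨ *-suc κ p ⟩
        κ + κ * p                                         ≤⟨ +-mono-≤ (degree-large S (independent-relevant S supp ne)) dg ⟩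
        degrees (mem S) + degrees (memP P)                ≡⟨ degrees-+ (mem S) (memP P) ⟨
        degrees (λ v → mem S v + memP P v)                ≤⟨ degrees-mono (λ v → +-monoʳ-≤ (mem S v) (≤-reflexive (trans (split S P (λ X → mem X v)) (cong (λ Q → memP Q v + memP (outside S P) v) eq)))) ⟩
        degrees (memP (S ∷ outside S P))                  ∎)
      where
      open ≤-Reasoning
      out : length (outside S P) ≡ length P
      out = trans (length-sum (outside S P)) (trans (sym (trans (split S P (λ _ → 1)) (cong (λ Q → sumOver (λ _ → 1) Q + sumOver (λ _ → 1) (outside S P)) eq))) (sym (length-sum P)))
    ... | p , le , dg | C ∷ [] | _ = suc p , (begin
        suc (length K) + suc (length (outside S P))       ≡⟨ cong suc (trans (cong (length K +_) out) refl) ⟩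
        suc (length K + length P)                         ≤⟨ m≤n⇒m≤1+n (s≤s le) ⟩
        suc (suc (p + p))                                 ≡⟨ cong suc (+-suc p p) ⟨
        suc p + suc p                                     ∎) , (begin
        κ * suc p                                         ≡⟨ *-suc κ p ⟩
        κ + κ * p                                         ≤⟨ +-mono-≤ (degree-large (S ∖ˢ C) (difference-relevant S C z C⊆S supp (All.lookup orth C∈P) ne)) dg ⟩
        degrees (mem (S ∖ˢ C)) + degrees (memP P)         ≡⟨ degrees-+ (mem (S ∖ˢ C)) (memP P) ⟨
        degrees (λ v → mem (S ∖ˢ C) v + memP P v)         ≤⟨ degrees-mono (λ v → ≤-reflexive (begin-equality
          mem (S ∖ˢ C) v + memP P v                                ≡⟨ cong (mem (S ∖ˢ C) v +_) (trans (split S P (λ X → mem X v)) (cong (λ Q → memP Q v + memP (outside S P) v) eq)) ⟩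
          mem (S ∖ˢ C) v + ((mem C v + 0) + memP (outside S P) v)  ≡⟨ shuffle (mem (S ∖ˢ C) v) (mem C v) (memP (outside S P) v) ⟩
          (mem (S ∖ˢ C) v + mem C v) + memP (outside S P) v        ≡⟨ cong (_+ memP (outside S P) v) (mem-minus S C v C⊆S) ⟩
          mem S v + memP (outside S P) v                           ∎)) ⟩
        degrees (memP (S ∷ outside S P))                  ∎)
      where
      open ≤-Reasoning
      C∈ : C ∈ inside S P
      C∈ = subst (C ∈_) (sym eq) (here refl)
      C∈P : C ∈ P
      C∈P = proj₁ (inside-⊆ {S} {P} alts C∈)
      C⊆S : C ⊆ˢ S
      C⊆S = proj₂ (inside-⊆ {S} {P} alts C∈)
      out : suc (length (outside S P)) ≡ length P
      out = trans (cong suc (length-sum (outside S P))) (trans (sym (trans (split S P (λ _ → 1)) (cong (λ Q → sumOver (λ _ → 1) Q + sumOver (λ _ → 1) (outside S P)) eq))) (sym (length-sum P)))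
      shuffle : ∀ a b c → a + ((b + 0) + c) ≡ (a + b) + c
      shuffle = ℕ-Ring.solve-∀
    ... | p , le , dg | C ∷ C′ ∷ Q | child≤ = p , (begin
        suc (length K) + suc (length (outside S P))       ≡⟨ cong suc (+-suc (length K) _) ⟩
        suc (suc (length K + length (outside S P)))       ≡⟨ trans (cong suc (sym (+-suc (length K) _))) (sym (+-suc (length K) _)) ⟩
        length K + suc (suc (length (outside S P)))       ≤⟨ +-monoʳ-≤ (length K) out ⟩
        length K + length P                               ≤⟨ le ⟩
        p + p                                             ∎) , (begin
        κ * p                                             ≤⟨ dg ⟩
        degrees (memP P)                                  ≤⟨ degrees-mono (λ v → ≤-trans (≤-reflexive (trans (split S P (λ X → mem X v)) (cong (λ Q → memP Q v + memP (outside S P) v) eq)))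
                                                                                          (+-monoˡ-≤ (memP (outside S P) v) (child≤ v))) ⟩
        degrees (memP (S ∷ outside S P))                  ∎)
      where
      open ≤-Reasoning
      out : suc (suc (length (outside S P))) ≤ length P
      out = ≤-trans (s≤s (s≤s (≤-trans (≤-reflexive (length-sum (outside S P))) (m≤n+m _ (sumOver (λ _ → 1) Q)))))
              (≤-reflexive (trans (sym (trans (split S P (λ _ → 1)) (cong (λ Q → sumOver (λ _ → 1) Q + sumOver (λ _ → 1) (outside S P)) eq))) (sym (length-sum P))))

    -- The 4 is 2 times 2: there are at most 2p members, and every edge of D has two ends.
    undetermined-few : ∀ {K P} → Family K P → size-of U ≤ length K → κ * size-of U ≤ 4 * size-of D
    undetermined-few {K} {P} L le with few-children L
    ... | p , K≤ , dg = begin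
      κ * size-of U                          ≤⟨ *-monoʳ-≤ κ (≤-trans le (≤-trans (m≤m+n _ _) K≤)) ⟩
      κ * (p + p)                            ≡⟨ *-distribˡ-+ κ p p ⟩
      κ * p + κ * p                          ≤⟨ +-mono-≤ bound bound ⟩
      2 * size-of D + 2 * size-of D          ≡⟨ shuffle (size-of D) ⟩
      4 * size-of D                          ∎
      where
      open ≤-Reasoning
      shuffle : ∀ a → 2 * a + 2 * a ≡ 4 * a
      shuffle = ℕ-Ring.solve-∀
      bound : κ * p ≤ 2 * size-of D
      bound = begin
        κ * p                                ≤⟨ dg ⟩
        degrees (memP P)                     ≤⟨ degrees-mono (disjoint-members L) ⟩
        Σᴺ (λ e → bit (D e) * 2)             ≡⟨ Σᴺ-cong (λ e → *-comm (bit (D e)) 2) ⟩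
        Σᴺ (λ e → 2 * bit (D e))             ≡⟨ Σᴺ-* 2 (λ e → bit (D e)) ⟩
        2 * Σᴺ (λ e → bit (D e))             ≡⟨ cong (2 *_) (Σᴺ-size D) ⟩
        2 * size-of D                        ∎

-- Correctness of the cut oracle

sumOver-tabulate : ∀ {m} {A : Set} (f : A → ℕ) (g : Fin m → A) → sumOver f (tabulate g) ≡ Σᴺ (λ e → f (g e))
sumOver-tabulate {zero}  f g = refl
sumOver-tabulate {suc m} f g = cong (f (g zero) +_) (sumOver-tabulate f (g ∘ suc))

sumOver-concatMap : ∀ {A B : Set} (f : B → ℕ) (g : A → List B) xs → sumOver f (concatMap g xs) ≡ sumOver (λ x → sumOver f (g x)) xs
sumOver-concatMap f g []       = refl
sumOver-concatMap f g (x ∷ xs) = trans (sumOver-++ f (g x) _) (cong (sumOver f (g x) +_) (sumOver-concatMap f g xs))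

sumOver-units : ∀ j n → sumOver (λ _ → j) (units n) ≡ n * j
sumOver-units j zero    = refl
sumOver-units j (suc n) = cong (j +_) (sumOver-units j n)

sumOver-cong : ∀ {A : Set} {f g : A → ℕ} xs → (∀ x → f x ≡ g x) → sumOver f xs ≡ sumOver g xs
sumOver-cong []       eq = refl
sumOver-cong (x ∷ xs) eq = cong₂ _+_ (eq x) (sumOver-cong xs eq)

nth : ∀ {n} → Vec Bool n → ℕ → Bool
nth []      i       = false
nth (b ∷ S) zero    = b
nth (b ∷ S) (suc i) = nth S i

nth-toℕ : ∀ {n} (S : Vec Bool n) v → nth S (toℕ v) ≡ lookup S v
nth-toℕ (b ∷ S) zero    = refl
nth-toℕ (b ∷ S) (suc v) = nth-toℕ S v

not-xor-not : ∀ a b → (not a xor not b) ≡ (a xor b)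
not-xor-not true  true  = refl
not-xor-not true  false = refl
not-xor-not false true  = refl
not-xor-not false false = refl

exits-both : ∀ S a → exits S a + exits S (flip a) ≡ bit (crosses S a)
exits-both S (u , v) = table (S u) (S v)
  where
  table : ∀ a b → bit (a ∧ not b) + bit (b ∧ not a) ≡ bit (a xor b)
  table true  true  = refl
  table true  false = refl
  table false true  = refl
  table false false = refl

module Network {n m : ℕ} (ends : Fin m → Fin n × Fin n) (cst : Fin m → ℕ) where

  arcAt : Fin m → ℕ × ℕ
  arcAt e = toℕ (proj₁ (ends e)) , toℕ (proj₂ (ends e))

  itemAt : (lo hi : Fin m → Bool) (x : Fin m → ℕ) → Fin m → Carrier Item
  itemAt lo hi x e = (((toℕ e , arcAt e) , cst e) , (lo e , hi e)) , x e

  itemsOf : (lo hi : Fin m → Bool) (x : Fin m → ℕ) → Items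
  itemsOf lo hi x = tabulate (itemAt lo hi x)

  cutValue : (ℕ → Bool) → (Fin m → ℕ) → ℕ
  cutValue S y = Σᴺ (λ e → bit (crosses S (arcAt e)) * y e)

  cutValue-nth : ∀ (S : Vec Bool n) y → cutValue (nth S) y ≡ Σᴺ (λ e → Cuts.cr ends S e * y e)
  cutValue-nth S y = Σᴺ-cong (λ e → cong (λ b → bit b * y e) (cong₂ _xor_ (nth-toℕ S (proj₁ (ends e))) (nth-toℕ S (proj₂ (ends e)))))

  cutValue-tabulate : ∀ (S : ℕ → Bool) y → cutValue S y ≡ Σᴺ (λ e → Cuts.cr ends (Vec.tabulate (S ∘ toℕ)) e * y e)
  cutValue-tabulate S y = Σᴺ-cong (λ e → cong (λ b → bit b * y e) (sym (cong₂ _xor_ (Vec.lookup∘tabulate (S ∘ toℕ) (proj₁ (ends e))) (Vec.lookup∘tabulate (S ∘ toℕ) (proj₂ (ends e))))))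

  module Oracle (p : Carrier Par) (lo hi : Fin m → Bool) (x : Fin m → ℕ) where

    rs : Items
    rs = itemsOf lo hi x

    y : Fin m → ℕ
    y e = clip (gridOf p) (lo e) (hi e) (x e + padOf p)

    outdeg-arcs : ∀ S → outdeg S (arcsOf p rs) ≡ cutValue S y
    outdeg-arcs S = begin
      outdeg S (arcsOf p rs)                                     ≡⟨ sumOver-concatMap (exits S) (λ r → concatMap (λ _ → arcOf r ∷ flip (arcOf r) ∷ []) (units (lifted p r))) rs ⟩
      sumOver (λ r → outdeg S (concatMap (λ _ → arcOf r ∷ flip (arcOf r) ∷ []) (units (lifted p r)))) rs
                                                                 ≡⟨ sumOver-cong rs copies ⟩
      sumOver (λ r → bit (crosses S (arcOf r)) * lifted p r) rs  ≡⟨ sumOver-tabulate (λ r → bit (crosses S (arcOf r)) * lifted p r) (itemAt lo hi x) ⟩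
      cutValue S y                                               ∎
      where
      open ≡-Reasoning
      copies : ∀ r → outdeg S (concatMap (λ _ → arcOf r ∷ flip (arcOf r) ∷ []) (units (lifted p r))) ≡ bit (crosses S (arcOf r)) * lifted p r
      copies r = trans (sumOver-concatMap (exits S) (λ _ → arcOf r ∷ flip (arcOf r) ∷ []) (units (lifted p r)))
        (trans (sumOver-units _ (lifted p r)) (trans (*-comm (lifted p r) _) (cong (_* lifted p r)
          (trans (cong (exits S (arcOf r) +_) (+-identityʳ _)) (exits-both S (arcOf r))))))

    cutsAt : Carrier Item → List (ℕ × Arcs)
    cutsAt r = if gridOf p ℕ.≤ᵇ lifted p r then [] else cutFrom (cutOf p) (arcOf r) (arcsOf p rs)

    record Violated (c : ℕ × Arcs) : Set where
      field
        edge       : Fin m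
        fractional : y edge < gridOf p
        separates  : T (crosses (side c) (arcAt edge))
        small      : cutValue (side c) y ≤ cutOf p

    cutFrom-sound : ∀ N a A {c} → c ∈ cutFrom N a A → T (crosses (side c) a) × outdeg (side c) A ≤ N
    cutFrom-sound N a A {c} c∈ = go (Search.reached (proj₁ a) Q (proj₂ a)) refl c∈
      where
      Q : Arcs
      Q = Search.search (proj₁ a) (Search.residual (proj₁ a) N (proj₂ a) A)
      go : ∀ b → Search.reached (proj₁ a) Q (proj₂ a) ≡ b → c ∈ (if b then [] else (proj₁ a , Q) ∷ []) → T (crosses (side c) a) × outdeg (side c) A ≤ N
      go false eq (here refl) = subst T (sym (cong₂ _xor_ (T⇒≡ (Search.reached-source (proj₁ a) Q)) eq)) tt ,
                                Search.small-cut (proj₁ a) N (proj₂ a) A (λ t → subst T eq t)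
        where
        T⇒≡ : ∀ {b} → T b → b ≡ true
        T⇒≡ {true} _ = refl

    cutFrom-complete : ∀ N a A → cutFrom N a A ≡ [] → ∀ S → T (S (proj₁ a)) → ¬ T (S (proj₂ a)) → N < outdeg S A
    cutFrom-complete N a A e S s t = go (Search.reached (proj₁ a) Q (proj₂ a)) refl e
      where
      Q : Arcs
      Q = Search.search (proj₁ a) (Search.residual (proj₁ a) N (proj₂ a) A)
      go : ∀ b → Search.reached (proj₁ a) Q (proj₂ a) ≡ b → (if b then [] else (proj₁ a , Q) ∷ []) ≡ [] → N < outdeg S A
      go true eq _ = Search.all-cuts-large (proj₁ a) N (proj₂ a) A (subst T (sym eq) tt) S s t
      go false eq ()

    cuts-sound : ∀ {c} → c ∈ cuts p rs → Violated c
    cuts-sound {c} c∈ with find (∈-concatMap⁻ cutsAt {xs = rs} c∈)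
    ... | r , r∈ , q with ∈-tabulate⁻ r∈
    ... | e , refl = go (gridOf p ℕ.≤ᵇ y e) refl q
      where
      go : ∀ b → (gridOf p ℕ.≤ᵇ y e) ≡ b → c ∈ (if b then [] else cutFrom (cutOf p) (arcAt e) (arcsOf p rs)) → Violated c
      go false eq q = record
        { edge = e ; fractional = ≰⇒> (λ le → subst T eq (≤⇒≤ᵇ le)) ; separates = proj₁ (cutFrom-sound (cutOf p) (arcAt e) (arcsOf p rs) q)
        ; small = subst (_≤ cutOf p) (outdeg-arcs (side c)) (proj₂ (cutFrom-sound (cutOf p) (arcAt e) (arcsOf p rs) q)) }

    concatMap-empty : ∀ {A B : Set} (f : A → List B) xs → concatMap f xs ≡ [] → ∀ {x} → x ∈ xs → f x ≡ []
    concatMap-empty f (x ∷ xs) e (here refl) = List.++-conicalˡ (f x) _ e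
    concatMap-empty f (x ∷ xs) e (there x∈)  = concatMap-empty f xs (List.++-conicalʳ (f x) _ e) x∈

    cuts-complete : cuts p rs ≡ [] → ∀ S e → y e < gridOf p → T (crosses S (arcAt e)) → cutOf p < cutValue S y
    cuts-complete none S e frac sep = go (gridOf p ℕ.≤ᵇ y e) refl (concatMap-empty cutsAt rs none (∈-tabulate⁺ e))
      where
      either : ∀ a b → T (a xor b) → (T a × ¬ T b) ⊎ (T (not a) × ¬ T (not b))
      either true  false _ = inj₁ (tt , id)
      either false true  _ = inj₂ (tt , id)
      go : ∀ b → (gridOf p ℕ.≤ᵇ y e) ≡ b → (if b then [] else cutFrom (cutOf p) (arcAt e) (arcsOf p rs)) ≡ [] → cutOf p < cutValue S y
      go true  eq _ = ⊥-elim (<⇒≱ frac (≤ᵇ⇒≤ _ _ (subst T (sym eq) tt)))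
      go false eq q with either (S (proj₁ (arcAt e))) (S (proj₂ (arcAt e))) sep
      ... | inj₁ (s , t) = subst (cutOf p <_) (outdeg-arcs S) (cutFrom-complete (cutOf p) (arcAt e) (arcsOf p rs) q S s t)
      -- The search starts at the first end of the edge. If this end lies outside S, the complement
      -- of S is used, which has the same boundary.
      ... | inj₂ (s , t) = subst (cutOf p <_) (trans (outdeg-arcs (not ∘ S)) (Σᴺ-cong (λ e → cong (λ b → bit b * y e) (not-xor-not (S (proj₁ (arcAt e))) (S (proj₂ (arcAt e)))))))
                             (cutFrom-complete (cutOf p) (arcAt e) (arcsOf p rs) q (not ∘ S) s t)

-- Correctness of the relaxation method

square : ℤ → ℤ
square a = a ℤ.* a

square-nonneg : ∀ a → ℤ.0ℤ ℤ.≤ square a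
square-nonneg a with ℤ.≤-total ℤ.0ℤ a
... | inj₁ 0≤a = *-nonneg 0≤a 0≤a
... | inj₂ a≤0 = subst (ℤ.0ℤ ℤ.≤_) (even a) (*-nonneg (ℤ.neg-mono-≤ a≤0) (ℤ.neg-mono-≤ a≤0))
  where
  even : ∀ a → (ℤ.- a) ℤ.* (ℤ.- a) ≡ a ℤ.* a
  even = ℤ-Ring.solve-∀

square-mono : ∀ {a b} → ℤ.0ℤ ℤ.≤ a → a ℤ.≤ b → square a ℤ.≤ square b
square-mono {a} {b} 0≤a a≤b = ℤ.≤-trans (ℤ.*-monoˡ-≤-nonNeg a ⦃ ℤ.nonNegative 0≤a ⦄ a≤b) (ℤ.*-monoʳ-≤-nonNeg b ⦃ ℤ.nonNegative (ℤ.≤-trans 0≤a a≤b) ⦄ a≤b)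

closer-below : ∀ {t a b} → t ℤ.≤ a → a ℤ.≤ b → square (a ℤ.- t) ℤ.≤ square (b ℤ.- t)
closer-below {t} t≤a a≤b = square-mono (ℤ.i≤j⇒0≤j-i t≤a) (ℤ.+-monoˡ-≤ (ℤ.- t) a≤b)

closer-above : ∀ {t a b} → b ℤ.≤ a → a ℤ.≤ t → square (a ℤ.- t) ℤ.≤ square (b ℤ.- t)
closer-above {t} {a} {b} b≤a a≤t = subst₂ ℤ._≤_ (swap t a) (swap t b) (square-mono (ℤ.i≤j⇒0≤j-i a≤t) (ℤ.+-monoʳ-≤ t (ℤ.neg-mono-≤ b≤a)))
  where
  swap : ∀ t a → (t ℤ.- a) ℤ.* (t ℤ.- a) ≡ (a ℤ.- t) ℤ.* (a ℤ.- t)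
  swap = ℤ-Ring.solve-∀

-- Accepted points are fixed points, so all steps can be run and acceptance tested at the end:
-- either it was reached on the way and kept, or every step lowered the potential.
iter-progress : ∀ {A : Set} (f : A → A) (ok : A → Bool) (Φ : A → ℤ) (δ : ℤ) (P : A → Set) →
  (∀ x → P x → P (f x)) → (∀ x → T (ok x) → f x ≡ x) → (∀ x → P x → ¬ T (ok x) → Φ (f x) ℤ.+ δ ℤ.≤ Φ x) →
  ∀ n x → P x → T (ok (iter n f x)) ⊎ Φ (iter n f x) ℤ.+ ℤ.+ n ℤ.* δ ℤ.≤ Φ x
iter-progress f ok Φ δ P pres fix dec zero    x Px = inj₂ (ℤ.≤-reflexive (trans (cong (λ t → Φ x ℤ.+ t) (ℤ.*-zeroˡ δ)) (ℤ.+-identityʳ (Φ x))))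
iter-progress f ok Φ δ P pres fix dec (suc n) x Px with Bool.T? (ok x)
... | yes t = inj₁ (subst (λ y → T (ok y)) (sym (iter-fixed f (suc n) (fix x t))) t)
... | no ¬t with iter-progress f ok Φ δ P pres fix dec n (f x) (pres x Px)
... | inj₁ t = inj₁ t
... | inj₂ le = inj₂ (ℤ.≤-trans (ℤ.≤-reflexive (rearrange (Φ (iter n f (f x))) (ℤ.+ n) δ)) (ℤ.≤-trans (ℤ.+-monoˡ-≤ δ le) (dec x Px ¬t)))
  where
  rearrange : ∀ a n d → a ℤ.+ (ℤ.1ℤ ℤ.+ n) ℤ.* d ≡ (a ℤ.+ n ℤ.* d) ℤ.+ d
  rearrange = ℤ-Ring.solve-∀

Σᴺ-bump : ∀ {m} {f g : Fin m → ℕ} {V} e → (∀ e → f e ≤ g e) → f e + V ≤ g e → Σᴺ f + V ≤ Σᴺ g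
Σᴺ-bump {f = f} {V = V} zero le bump = ≤-trans (≤-reflexive (shuffle (f zero) (Σᴺ (f ∘ suc)) V)) (+-mono-≤ bump (Σᴺ-mono (λ e → le (suc e))))
  where
  shuffle : ∀ a b c → a + b + c ≡ (a + c) + b
  shuffle = ℕ-Ring.solve-∀
Σᴺ-bump {f = f} {V = V} (suc e) le bump = ≤-trans (≤-reflexive (+-assoc (f zero) _ V)) (+-mono-≤ (le zero) (Σᴺ-bump e (λ e → le (suc e)) bump))

Σᴺ-bounded : ∀ {m} {f : Fin m → ℕ} {C} → (∀ e → f e ≤ C) → Σᴺ f ≤ m * C
Σᴺ-bounded {zero}  le = z≤n
Σᴺ-bounded {suc m} le = +-mono-≤ (le zero) (Σᴺ-bounded (λ e → le (suc e)))

m≤suc-pred[m] : ∀ j → j ≤ suc (ℕ.pred j)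
m≤suc-pred[m] zero    = z≤n
m≤suc-pred[m] (suc j) = ≤-refl

-- The inequalities between the parameters that make the method correct, kept apart from the values
-- chosen for them.
record Setting : Set where
  field
    {n m}    : ℕ
    ends     : Fin m → Fin n × Fin n
    cst      : Fin m → ℕ
    p        : Carrier Par
    κ        : ℕ
    κ-pos    : 0 < κ
    cut-eq   : cutOf p ≡ ℕ.pred (gridOf p * κ)
    m≤V      : m ≤ padOf p
    costs≤W  : Σᴺ (λ e → cst e * cst e) ≤ slackOf p
    steps    : m * (gridOf p * gridOf p) < stepsOf p
    N-pos    : 0 < gridOf p
    loss     : slackOf p + padOf p * Σᴺ cst ≤ lossOf p

module Relaxation (𝓢 : Setting) (lo hi : Fin (Setting.m 𝓢) → Bool) (lo⇒hi : ∀ e → T (lo e) → T (hi e)) (β : ℕ) where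

  open Setting 𝓢
  open Network ends cst using (arcAt; itemAt; itemsOf; cutValue; cutValue-nth; cutValue-tabulate; module Oracle)

  N V W : ℕ
  N = gridOf p
  V = padOf p
  W = slackOf p

  U : Fin m → Bool
  U e = hi e ∧ not (lo e)

  Feasᵍ : ℕ → ℤ → (Fin m → ℤ) → Set
  Feasᵍ β = Cuts.Feas ends (ℤ.+ κ) U lo (λ e → ℤ.+ (N * cst e)) (ℤ.+ β)

  floorAt capAt : Fin m → ℕ
  floorAt e = if lo e then N else 0
  capAt   e = if hi e then N else 0

  rsOf : (Fin m → ℕ) → Items
  rsOf = itemsOf lo hi

  up : ℕ × Arcs → (Fin m → ℕ) → Fin m → ℕ
  up c x e = clip N (lo e) (hi e) (x e + bit (crosses (side c) (arcAt e)))

  down : (Fin m → ℕ) → Fin m → ℕ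
  down x e = clip N (lo e) (hi e) (x e ∸ cst e)

  next : (Fin m → ℕ) → Fin m → ℕ
  next x = caseList (cuts p (rsOf x)) (if spend (rsOf x) ℕ.≤ᵇ β + W then x else down x) (λ c _ → up c x)

  ok : (Fin m → ℕ) → Bool
  ok x = accepted p β (rsOf x)

  adjust-next : ∀ x → adjust p β (rsOf x) ≡ rsOf (next x)
  adjust-next x = go (cuts p (rsOf x)) (spend (rsOf x) ℕ.≤ᵇ β + W)
    where
    go : ∀ l b → caseList l (if b then rsOf x else pushDown p (rsOf x)) (λ c _ → pushUp p c (rsOf x)) ≡
                 rsOf (caseList l (if b then x else down x) (λ c _ → up c x))
    go []      true  = refl
    go []      false = List.map-tabulate (itemAt lo hi x) (λ r → place N r (posOf r ∸ costOf r))
    go (c ∷ _) b     = List.map-tabulate (itemAt lo hi x) (λ r → place N r (posOf r + bit (crosses (side c) (arcOf r))))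

  origin : Fin m → ℕ
  origin e = clip N (lo e) (hi e) 0

  final : Fin m → ℕ
  final = iter (stepsOf p) next origin

  settle-final : ∀ x → settle p β (rsOf x) ≡ rsOf final
  settle-final x = trans (cong (iter (stepsOf p) (adjust p β)) (List.map-tabulate (itemAt lo hi x) (λ r → place N r 0))) (go (stepsOf p) origin)
    where
    go : ∀ j x → iter j (adjust p β) (rsOf x) ≡ rsOf (iter j next x)
    go zero    x = refl
    go (suc j) x = trans (cong (iter j (adjust p β)) (adjust-next x)) (go j (next x))

  query-final : ∀ x → query p (rsOf x , β) ≡ ok final
  query-final x = cong (accepted p β) (settle-final x)

  Boxed : (Fin m → ℕ) → Set
  Boxed x = ∀ e → floorAt e ≤ x e × x e ≤ capAt e

  floor≤cap : ∀ e → floorAt e ≤ capAt e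
  floor≤cap e with lo e | hi e | lo⇒hi e
  ... | true  | true  | _ = ≤-refl
  ... | true  | false | f = ⊥-elim (f tt)
  ... | false | _     | _ = z≤n

  clip-boxed : (z : Fin m → ℕ) → Boxed (λ e → clip N (lo e) (hi e) (z e))
  clip-boxed z e = m≤n⊔m (z e ℕ.⊓ capAt e) (floorAt e) , ⊔-lub (m⊓n≤n (z e) (capAt e)) (floor≤cap e)

  next-boxed : ∀ x → Boxed x → Boxed (next x)
  next-boxed x bx with cuts p (rsOf x) | spend (rsOf x) ℕ.≤ᵇ β + W
  ... | c ∷ _ | _     = clip-boxed (λ e → x e + bit (crosses (side c) (arcAt e)))
  ... | []    | true  = bx
  ... | []    | false = clip-boxed (λ e → x e ∸ cst e)

  next-fixed : ∀ x → T (ok x) → next x ≡ x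
  next-fixed x t with cuts p (rsOf x) | spend (rsOf x) ℕ.≤ᵇ β + W
  ... | [] | true = refl

  spend-rsOf : ∀ x → spend (rsOf x) ≡ Σᴺ (λ e → cst e * x e)
  spend-rsOf x = sumOver-tabulate (λ r → costOf r * posOf r) (itemAt lo hi x)

  -- The squared distance Φ to the feasible solution (scaled by q²) drops by at least q² in each step.
  module Progress (q : ℤ) (y : Fin m → ℤ) (F : Feasᵍ β q y) where

    open Cuts.Feas F

    t : Fin m → ℤ
    t e = ℤ.+ N ℤ.* y e

    t≤N : ∀ e → t e ℤ.≤ q ℤ.* ℤ.+ N
    t≤N e = ℤ.≤-trans (ℤ.*-monoˡ-≤-nonNeg (ℤ.+ N) (upper e)) (ℤ.≤-reflexive (ℤ.*-comm (ℤ.+ N) q))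

    t-floor : ∀ e → q ℤ.* ℤ.+ floorAt e ℤ.≤ t e
    t-floor e with lo e in eq | fixed e
    ... | true  | fx = ℤ.≤-reflexive (trans (ℤ.*-comm q (ℤ.+ N)) (cong (ℤ.+ N ℤ.*_) (sym (fx (λ u → T-not (proj₂ (T-∧ {hi e} u)) tt)))))
    ... | false | _  = ℤ.≤-trans (ℤ.≤-reflexive (ℤ.*-zeroʳ q)) (*-nonneg {ℤ.+ N} {y e} (ℤ.+≤+ z≤n) (lower e))

    t-cap : ∀ e → t e ℤ.≤ q ℤ.* ℤ.+ capAt e
    t-cap e with hi e | lo e | lo⇒hi e | fixed e
    ... | true  | _     | _  | _  = t≤N e
    ... | false | true  | lh | _  = ⊥-elim (lh tt)
    ... | false | false | _  | fx = ℤ.≤-reflexive (trans (cong (ℤ.+ N ℤ.*_) (fx id)) (trans (ℤ.*-zeroʳ (ℤ.+ N)) (sym (ℤ.*-zeroʳ q))))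

    q≥0 : ℤ.0ℤ ℤ.≤ q
    q≥0 = ℤ.<⇒≤ q-pos

    q*-mono : ∀ {a b} → a ≤ b → q ℤ.* ℤ.+ a ℤ.≤ q ℤ.* ℤ.+ b
    q*-mono le = ℤ.*-monoˡ-≤-nonNeg q ⦃ ℤ.nonNegative q≥0 ⦄ (ℤ.+≤+ le)

    dist : ℕ → Fin m → ℤ
    dist z e = square (q ℤ.* ℤ.+ z ℤ.- t e)

    -- Projection onto an interval that contains the target cannot increase the distance, so steps
    -- may be analysed without the clipping.
    clip-closer : ∀ z e → dist (clip N (lo e) (hi e) z) e ℤ.≤ dist z e
    clip-closer z e = ℤ.≤-trans (raise (z ℕ.⊓ capAt e)) (lower-to z)
      where
      raise : ∀ z → dist (z ℕ.⊔ floorAt e) e ℤ.≤ dist z e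
      raise z with ≤-total z (floorAt e)
      ... | inj₁ le = subst (λ a → dist a e ℤ.≤ dist z e) (sym (m≤n⇒m⊔n≡n le)) (closer-above (q*-mono le) (t-floor e))
      ... | inj₂ le = ℤ.≤-reflexive (cong (λ a → dist a e) (m≥n⇒m⊔n≡m le))
      lower-to : ∀ z → dist (z ℕ.⊓ capAt e) e ℤ.≤ dist z e
      lower-to z with ≤-total z (capAt e)
      ... | inj₁ le = ℤ.≤-reflexive (cong (λ a → dist a e) (m≤n⇒m⊓n≡m le))
      ... | inj₂ le = subst (λ a → dist a e ℤ.≤ dist z e) (sym (m≥n⇒m⊓n≡n le)) (closer-below (t-cap e) (q*-mono le))

    Φ : (Fin m → ℕ) → ℤ
    Φ x = ∑ (λ e → dist (x e) e)

    t-nonneg : ∀ e → ℤ.0ℤ ℤ.≤ t e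
    t-nonneg e = *-nonneg {ℤ.+ N} {y e} (ℤ.+≤+ z≤n) (lower e)

    expand : ∀ q x t d → square (q ℤ.* (x ℤ.+ d) ℤ.- t) ≡ square (q ℤ.* x ℤ.- t) ℤ.+ ((q ℤ.+ q) ℤ.* (d ℤ.* (q ℤ.* x ℤ.- t)) ℤ.+ (q ℤ.* q) ℤ.* (d ℤ.* d))
    expand = expand′
      where
      expand′ : ∀ q x t d → (q ℤ.* (x ℤ.+ d) ℤ.- t) ℤ.* (q ℤ.* (x ℤ.+ d) ℤ.- t) ≡
                (q ℤ.* x ℤ.- t) ℤ.* (q ℤ.* x ℤ.- t) ℤ.+ ((q ℤ.+ q) ℤ.* (d ℤ.* (q ℤ.* x ℤ.- t)) ℤ.+ (q ℤ.* q) ℤ.* (d ℤ.* d))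
      expand′ = ℤ-Ring.solve-∀

    shift-sum : ∀ x (d : Fin m → ℤ) →
      ∑ (λ e → square (q ℤ.* (ℤ.+ x e ℤ.+ d e) ℤ.- t e)) ≡
      Φ x ℤ.+ ((q ℤ.+ q) ℤ.* ∑ (λ e → d e ℤ.* (q ℤ.* ℤ.+ x e ℤ.- t e)) ℤ.+ (q ℤ.* q) ℤ.* ∑ (λ e → d e ℤ.* d e))
    shift-sum x d = trans (∑-cong (λ e → expand q (ℤ.+ x e) (t e) (d e)))
      (trans (∑-+ (λ e → dist (x e) e) _) (cong (λ s → Φ x ℤ.+ s) (trans (∑-+ (λ e → (q ℤ.+ q) ℤ.* (d e ℤ.* (q ℤ.* ℤ.+ x e ℤ.- t e))) _)
        (cong₂ ℤ._+_ (∑-* (q ℤ.+ q) (λ e → d e ℤ.* (q ℤ.* ℤ.+ x e ℤ.- t e))) (∑-* (q ℤ.* q) (λ e → d e ℤ.* d e))))))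

    -- A displacement d whose inner product with the error is at most -q A and whose norm is below 2 A.
    descend : ∀ x (d : Fin m → ℤ) A B → ∑ (λ e → d e ℤ.* (q ℤ.* ℤ.+ x e ℤ.- t e)) ℤ.+ q ℤ.* A ℤ.≤ ℤ.0ℤ → ∑ (λ e → d e ℤ.* d e) ℤ.≤ B → B ℤ.+ ℤ.1ℤ ℤ.≤ A ℤ.+ A →
      ∑ (λ e → square (q ℤ.* (ℤ.+ x e ℤ.+ d e) ℤ.- t e)) ℤ.+ q ℤ.* q ℤ.≤ Φ x
    descend x d A B inner norm BA = begin
      ∑ (λ e → square (q ℤ.* (ℤ.+ x e ℤ.+ d e) ℤ.- t e)) ℤ.+ q ℤ.* q     ≡⟨ cong (ℤ._+ q ℤ.* q) (shift-sum x d) ⟩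
      (Φ x ℤ.+ ((q ℤ.+ q) ℤ.* I ℤ.+ (q ℤ.* q) ℤ.* D)) ℤ.+ q ℤ.* q       ≡⟨ rearrange (Φ x) q I D A ⟩
      Φ x ℤ.+ ((q ℤ.+ q) ℤ.* (I ℤ.+ q ℤ.* A) ℤ.+ (q ℤ.* q) ℤ.* ((D ℤ.+ ℤ.1ℤ) ℤ.- (A ℤ.+ A)))
        ≤⟨ ℤ.+-monoʳ-≤ (Φ x) (ℤ.+-mono-≤ (ℤ.*-monoˡ-≤-nonNeg (q ℤ.+ q) ⦃ ℤ.nonNegative (ℤ.+-mono-≤ q≥0 q≥0) ⦄ inner)
                                          (ℤ.*-monoˡ-≤-nonNeg (q ℤ.* q) ⦃ ℤ.nonNegative (*-nonneg q≥0 q≥0) ⦄ (ℤ.i≤j⇒i-j≤0 (ℤ.≤-trans (ℤ.+-monoˡ-≤ ℤ.1ℤ norm) BA)))) ⟩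
      Φ x ℤ.+ ((q ℤ.+ q) ℤ.* ℤ.0ℤ ℤ.+ (q ℤ.* q) ℤ.* ℤ.0ℤ)                ≡⟨ vanish (Φ x) (q ℤ.+ q) (q ℤ.* q) ⟩
      Φ x                                                                ∎
      where
      open ℤ.≤-Reasoning
      I D : ℤ
      I = ∑ (λ e → d e ℤ.* (q ℤ.* ℤ.+ x e ℤ.- t e))
      D = ∑ (λ e → d e ℤ.* d e)
      rearrange : ∀ Φ q I D A → (Φ ℤ.+ ((q ℤ.+ q) ℤ.* I ℤ.+ (q ℤ.* q) ℤ.* D)) ℤ.+ q ℤ.* q ≡
                  Φ ℤ.+ ((q ℤ.+ q) ℤ.* (I ℤ.+ q ℤ.* A) ℤ.+ (q ℤ.* q) ℤ.* ((D ℤ.+ ℤ.1ℤ) ℤ.- (A ℤ.+ A)))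
      rearrange = ℤ-Ring.solve-∀
      vanish : ∀ a b c → a ℤ.+ (b ℤ.* ℤ.0ℤ ℤ.+ c ℤ.* ℤ.0ℤ) ≡ a
      vanish = ℤ-Ring.solve-∀

    -- The step is along -c. The spending exceeds the budget of the target by at least W + 1, while
    -- the squared length of c is at most W; this is `descend` with A = W + 1 and B = W.
    down-progress : ∀ x → β + W < spend (rsOf x) → Φ (down x) ℤ.+ q ℤ.* q ℤ.≤ Φ x
    down-progress x over = ℤ.≤-trans (ℤ.+-monoˡ-≤ (q ℤ.* q) (∑-mono (λ e → ℤ.≤-trans (clip-closer (x e ∸ cst e) e) (monus e))))
        (descend x d (ℤ.+ suc W) (ℤ.+ W) inner norm (ℤ.+≤+ (≤-trans (≤-reflexive (+-comm W 1)) (m≤m+n (suc W) (suc W)))))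
      where
      d : Fin m → ℤ
      d e = ℤ.- ℤ.+ cst e
      monus : ∀ e → dist (x e ∸ cst e) e ℤ.≤ square (q ℤ.* (ℤ.+ x e ℤ.+ d e) ℤ.- t e)
      monus e with ≤-total (cst e) (x e)
      ... | inj₁ le = ℤ.≤-reflexive (cong (λ a → square (q ℤ.* a ℤ.- t e)) (sym (trans (ℤ.m-n≡m⊖n (x e) (cst e)) (ℤ.⊖-≥ le))))
      ... | inj₂ le = closer-above (ℤ.*-monoˡ-≤-nonNeg q ⦃ ℤ.nonNegative q≥0 ⦄ (ℤ.≤-trans (ℤ.i≤j⇒i-j≤0 (ℤ.+≤+ le)) (ℤ.+≤+ z≤n)))
                                   (ℤ.≤-trans (ℤ.≤-reflexive (trans (cong (λ a → q ℤ.* ℤ.+ a) (m≤n⇒m∸n≡0 le)) (ℤ.*-zeroʳ q))) (t-nonneg e))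
      norm : ∑ (λ e → d e ℤ.* d e) ℤ.≤ ℤ.+ W
      norm = ℤ.≤-trans (ℤ.≤-reflexive (trans (∑-cong (λ e → trans (even (ℤ.+ cst e)) (sym (ℤ.pos-* (cst e) (cst e))))) (∑-Σᴺ (λ e → cst e * cst e)))) (ℤ.+≤+ costs≤W)
        where
        even : ∀ a → (ℤ.- a) ℤ.* (ℤ.- a) ≡ a ℤ.* a
        even = ℤ-Ring.solve-∀
      inner : ∑ (λ e → d e ℤ.* (q ℤ.* ℤ.+ x e ℤ.- t e)) ℤ.+ q ℤ.* ℤ.+ suc W ℤ.≤ ℤ.0ℤ
      inner = begin
        ∑ (λ e → d e ℤ.* (q ℤ.* ℤ.+ x e ℤ.- t e)) ℤ.+ q ℤ.* ℤ.+ suc W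
          ≡⟨ cong (ℤ._+ q ℤ.* ℤ.+ suc W) (trans (∑-cong (λ e → distribute (ℤ.+ cst e) q (ℤ.+ x e) (ℤ.+ N) (y e))) (trans (∑-+ (λ e → (ℤ.- q) ℤ.* (ℤ.+ cst e ℤ.* ℤ.+ x e)) (λ e → (ℤ.+ N ℤ.* ℤ.+ cst e) ℤ.* y e))
               (cong₂ ℤ._+_ (trans (∑-* (ℤ.- q) (λ e → ℤ.+ cst e ℤ.* ℤ.+ x e)) (cong ((ℤ.- q) ℤ.*_) (trans (∑-cong (λ e → sym (ℤ.pos-* (cst e) (x e)))) (trans (∑-Σᴺ (λ e → cst e * x e)) (cong ℤ.+_ (sym (spend-rsOf x)))))))
                            (∑-cong (λ e → cong (ℤ._* y e) (sym (ℤ.pos-* N (cst e)))))))) ⟩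
        ((ℤ.- q) ℤ.* ℤ.+ spend (rsOf x) ℤ.+ ∑ (λ e → ℤ.+ (N * cst e) ℤ.* y e)) ℤ.+ q ℤ.* ℤ.+ suc W
          ≤⟨ ℤ.+-monoˡ-≤ (q ℤ.* ℤ.+ suc W) (ℤ.+-mono-≤ (ℤ.*-monoˡ-≤-nonPos (ℤ.- q) ⦃ ℤ.nonPositive (ℤ.neg-mono-≤ q≥0) ⦄ (ℤ.+≤+ over)) budget) ⟩
        ((ℤ.- q) ℤ.* ℤ.+ suc (β + W) ℤ.+ ℤ.+ β ℤ.* q) ℤ.+ q ℤ.* ℤ.+ suc W
          ≡⟨ cancel q (ℤ.+ β) (ℤ.+ W) ⟩
        ℤ.0ℤ ∎
        where
        open ℤ.≤-Reasoning
        distribute : ∀ c q x N y → (ℤ.- c) ℤ.* (q ℤ.* x ℤ.- N ℤ.* y) ≡ (ℤ.- q) ℤ.* (c ℤ.* x) ℤ.+ (N ℤ.* c) ℤ.* y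
        distribute = ℤ-Ring.solve-∀
        cancel : ∀ q β W → ((ℤ.- q) ℤ.* (ℤ.1ℤ ℤ.+ (β ℤ.+ W)) ℤ.+ β ℤ.* q) ℤ.+ q ℤ.* (ℤ.1ℤ ℤ.+ W) ≡ ℤ.0ℤ
        cancel = ℤ-Ring.solve-∀

    module _ (x : Fin m → ℕ) (bx : Boxed x) where
      open Oracle p lo hi x using (Violated) renaming (y to x⁺)

      -- An edge below its target after padding has been cut off neither from above nor from below,
      -- so it received the full padding.
      padded : ∀ e → q ℤ.* ℤ.+ x⁺ e ℤ.< t e → x⁺ e ≡ x e + V
      padded e lt with lo e | hi e | t-cap e | t-floor e
      ... | true  | _     | _   | _  = ⊥-elim (ℤ.<⇒≱ (ℤ.<-≤-trans lt (t≤N e)) (q*-mono (m≤n⊔m ((x e + V) ℕ.⊓ _) N)))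
      ... | false | false | cap | _  = ⊥-elim (ℤ.<⇒≱ (ℤ.<-≤-trans lt cap) (q*-mono z≤n))
      ... | false | true  | cap | _  with ≤-total (x e + V) N
      ... | inj₁ le = trans (⊔-identityʳ _) (m≤n⇒m⊓n≡m le)
      ... | inj₂ le = ⊥-elim (ℤ.<⇒≱ (ℤ.<-≤-trans lt cap) (q*-mono (≤-reflexive (sym (trans (⊔-identityʳ _) (m≥n⇒m⊓n≡n le))))))

      x≤x⁺ : ∀ e → x e ≤ x⁺ e
      x≤x⁺ e = ≤-trans (⊓-glb (m≤m+n (x e) V) (proj₂ (bx e))) (m≤m⊔n _ (floorAt e))

      -- The cut misses its target even after padding, and some boundary edge is then below its own
      -- target and was padded by the full V. Hence the unpadded cut misses its target by at least
      -- V. This is `descend` with A = B = V; it needs V ≥ 1, which the existence of an edge gives.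
      up-progress : ∀ c → Violated c → Φ (up c x) ℤ.+ q ℤ.* q ℤ.≤ Φ x
      up-progress c v = ℤ.≤-trans (ℤ.+-monoˡ-≤ (q ℤ.* q) (∑-mono (λ e → ℤ.≤-trans (clip-closer (x e + bit (crosses (side c) (arcAt e))) e)
            (ℤ.≤-reflexive (cong (λ j → dist (x e + j) e) (cr-tabulate e))))))
          (descend x (λ e → ℤ.+ χ e) (ℤ.+ V) (ℤ.+ V) inner norm (ℤ.+≤+ (+-monoʳ-≤ V (≤-trans (m<n⇒0<n (Fin.toℕ<n edge)) m≤V))))
        where
        open Violated v
        S : Vec Bool n
        S = Vec.tabulate (side c ∘ toℕ)
        χ : Fin m → ℕ
        χ = Cuts.cr ends S
        cr-tabulate : ∀ e → bit (crosses (side c) (arcAt e)) ≡ χ e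
        cr-tabulate e = cong bit (sym (cong₂ _xor_ (Vec.lookup∘tabulate (side c ∘ toℕ) (proj₁ (ends e))) (Vec.lookup∘tabulate (side c ∘ toℕ) (proj₂ (ends e)))))
        bound : (Fin m → ℕ) → ℕ
        bound z = Σᴺ (λ e → χ e * z e)
        T⁺ : ℤ
        T⁺ = ∑ (λ e → ℤ.+ χ e ℤ.* t e)
        bound-∑ : ∀ z → q ℤ.* ℤ.+ bound z ≡ ∑ (λ e → ℤ.+ χ e ℤ.* (q ℤ.* ℤ.+ z e))
        bound-∑ z = trans (cong (q ℤ.*_) (sym (∑-Σᴺ (λ e → χ e * z e)))) (trans (sym (∑-* q (λ e → ℤ.+ (χ e * z e))))
          (∑-cong (λ e → trans (cong (q ℤ.*_) (ℤ.pos-* (χ e) (z e))) (swap q (ℤ.+ χ e) (ℤ.+ z e)))))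
          where
          swap : ∀ a b c → a ℤ.* (b ℤ.* c) ≡ b ℤ.* (a ℤ.* c)
          swap = ℤ-Ring.solve-∀
        χ-edge : χ edge ≡ 1
        χ-edge = trans (sym (cr-tabulate edge)) (bit-T separates)
        small′ : bound x⁺ < N * κ
        small′ = ≤-trans (s≤s (≤-trans (≤-reflexive (sym (cutValue-tabulate (side c) x⁺))) (≤-trans small (≤-reflexive cut-eq))))
                   (≤-reflexive (suc-pred (N * κ) ⦃ ℕ.>-nonZero (*-mono-≤ (≤-trans (s≤s z≤n) fractional) κ-pos) ⦄))
        below : q ℤ.* ℤ.+ bound x⁺ ℤ.≤ T⁺ × ∃ λ f → χ f ≡ 1 × q ℤ.* ℤ.+ x⁺ f ℤ.< t f
        below with covered S
        ... | inj₁ full = subst (ℤ._≤ T⁺) (sym (bound-∑ x⁺)) (∑-mono each) , edge , χ-edge ,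
                subst (q ℤ.* ℤ.+ x⁺ edge ℤ.<_) (sym (t-full edge χ-edge)) (ℤ.*-monoˡ-<-pos q ⦃ ℤ.positive q-pos ⦄ (ℤ.+<+ fractional))
          where
          t-full : ∀ e → χ e ≡ 1 → t e ≡ q ℤ.* ℤ.+ N
          t-full e eq = trans (cong (ℤ.+ N ℤ.*_) (full e eq)) (ℤ.*-comm (ℤ.+ N) q)
          each : ∀ e → ℤ.+ χ e ℤ.* (q ℤ.* ℤ.+ x⁺ e) ℤ.≤ ℤ.+ χ e ℤ.* t e
          each e with lookup S (proj₁ (ends e)) xor lookup S (proj₂ (ends e)) | t-full e
          ... | true  | tf = ℤ.*-monoˡ-≤-nonNeg ℤ.1ℤ (ℤ.≤-trans (q*-mono (clip-≤ N (lo e) (hi e) (x e + V))) (ℤ.≤-reflexive (sym (tf refl))))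
          ... | false | _  = ℤ.≤-refl
        ... | inj₂ large with Fin.any? (λ f → (χ f ≟ 1) ×-dec (q ℤ.* ℤ.+ x⁺ f ℤ.<? t f))
        ... | yes found = ℤ.<⇒≤ under , found
          where
          under : q ℤ.* ℤ.+ bound x⁺ ℤ.< T⁺
          under = ℤ.<-≤-trans (ℤ.*-monoˡ-<-pos q ⦃ ℤ.positive q-pos ⦄ (ℤ.+<+ small′)) (capacity large)
            where
            capacity : ℤ.+ κ ℤ.* q ℤ.≤ Cuts.across ends S y → q ℤ.* ℤ.+ (N * κ) ℤ.≤ T⁺
            capacity le = ℤ.≤-trans (ℤ.≤-reflexive (trans (cong (q ℤ.*_) (ℤ.pos-* N κ)) (swap q (ℤ.+ N) (ℤ.+ κ))))
                (ℤ.≤-trans (ℤ.*-monoˡ-≤-nonNeg (ℤ.+ N) le) (ℤ.≤-reflexive (trans (sym (∑-* (ℤ.+ N) (λ e → ℤ.+ χ e ℤ.* y e))) (∑-cong (λ e → swap′ (ℤ.+ N) (ℤ.+ χ e) (y e))))))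
              where
              swap : ∀ q N κ → q ℤ.* (N ℤ.* κ) ≡ N ℤ.* (κ ℤ.* q)
              swap = ℤ-Ring.solve-∀
              swap′ : ∀ a b c → a ℤ.* (b ℤ.* c) ≡ b ℤ.* (a ℤ.* c)
              swap′ = ℤ-Ring.solve-∀
        ... | no none = ⊥-elim (ℤ.<⇒≱ (ℤ.<-≤-trans (ℤ.*-monoˡ-<-pos q ⦃ ℤ.positive q-pos ⦄ (ℤ.+<+ small′)) capacity) (subst (T⁺ ℤ.≤_) (sym (bound-∑ x⁺)) (∑-mono each)))
          where
          swap : ∀ q N κ → q ℤ.* (N ℤ.* κ) ≡ N ℤ.* (κ ℤ.* q)
          swap = ℤ-Ring.solve-∀
          swap′ : ∀ a b c → a ℤ.* (b ℤ.* c) ≡ b ℤ.* (a ℤ.* c)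
          swap′ = ℤ-Ring.solve-∀
          capacity : q ℤ.* ℤ.+ (N * κ) ℤ.≤ T⁺
          capacity = ℤ.≤-trans (ℤ.≤-reflexive (trans (cong (q ℤ.*_) (ℤ.pos-* N κ)) (swap q (ℤ.+ N) (ℤ.+ κ))))
                (ℤ.≤-trans (ℤ.*-monoˡ-≤-nonNeg (ℤ.+ N) large) (ℤ.≤-reflexive (trans (sym (∑-* (ℤ.+ N) (λ e → ℤ.+ χ e ℤ.* y e))) (∑-cong (λ e → swap′ (ℤ.+ N) (ℤ.+ χ e) (y e))))))
          each : ∀ e → ℤ.+ χ e ℤ.* t e ℤ.≤ ℤ.+ χ e ℤ.* (q ℤ.* ℤ.+ x⁺ e)
          each e with lookup S (proj₁ (ends e)) xor lookup S (proj₂ (ends e)) in eq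
          ... | true  = ℤ.*-monoˡ-≤-nonNeg ℤ.1ℤ (ℤ.≮⇒≥ (λ lt → none (e , cong bit eq , lt)))
          ... | false = ℤ.≤-refl
        padding : bound x + V ≤ bound x⁺
        padding = let (f , χf , lt) = proj₂ below in
          Σᴺ-bump f (λ e → *-monoʳ-≤ (χ e) (x≤x⁺ e))
            (≤-reflexive (trans (cong (λ j → j * x f + V) χf) (trans (cong (_+ V) (+-identityʳ (x f))) (trans (sym (padded f lt)) (trans (sym (+-identityʳ (x⁺ f))) (cong (_* x⁺ f) (sym χf)))))))
        norm : ∑ (λ e → ℤ.+ χ e ℤ.* ℤ.+ χ e) ℤ.≤ ℤ.+ V
        norm = ℤ.≤-trans (ℤ.≤-reflexive (trans (∑-cong (λ e → sym (ℤ.pos-* (χ e) (χ e)))) (∑-Σᴺ (λ e → χ e * χ e))))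
          (ℤ.+≤+ (≤-trans (Σᴺ-bounded (λ e → *-mono-≤ (bit-≤1 (lookup S (proj₁ (ends e)) xor lookup S (proj₂ (ends e)))) (bit-≤1 (lookup S (proj₁ (ends e)) xor lookup S (proj₂ (ends e))))))
                          (≤-trans (≤-reflexive (*-identityʳ m)) m≤V)))
        inner : ∑ (λ e → ℤ.+ χ e ℤ.* (q ℤ.* ℤ.+ x e ℤ.- t e)) ℤ.+ q ℤ.* ℤ.+ V ℤ.≤ ℤ.0ℤ
        inner = begin
          ∑ (λ e → ℤ.+ χ e ℤ.* (q ℤ.* ℤ.+ x e ℤ.- t e)) ℤ.+ q ℤ.* ℤ.+ V
            ≡⟨ cong (ℤ._+ q ℤ.* ℤ.+ V) (trans (∑-cong (λ e → distribute (ℤ.+ χ e) (q ℤ.* ℤ.+ x e) (t e))) (trans (∑-+ (λ e → ℤ.+ χ e ℤ.* (q ℤ.* ℤ.+ x e)) (λ e → ℤ.-1ℤ ℤ.* (ℤ.+ χ e ℤ.* t e)))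
                 (cong₂ ℤ._+_ (sym (bound-∑ x)) (trans (∑-* ℤ.-1ℤ (λ e → ℤ.+ χ e ℤ.* t e)) (ℤ.-1*i≡-i T⁺))))) ⟩
          (q ℤ.* ℤ.+ bound x ℤ.- T⁺) ℤ.+ q ℤ.* ℤ.+ V        ≡⟨ gather q (ℤ.+ bound x) T⁺ (ℤ.+ V) ⟩
          q ℤ.* ℤ.+ (bound x + V) ℤ.- T⁺                    ≤⟨ ℤ.i≤j⇒i-j≤0 (ℤ.≤-trans (q*-mono padding) (proj₁ below)) ⟩
          ℤ.0ℤ                                              ∎
          where
          open ℤ.≤-Reasoning
          distribute : ∀ c a t → c ℤ.* (a ℤ.- t) ≡ c ℤ.* a ℤ.+ ℤ.-1ℤ ℤ.* (c ℤ.* t)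
          distribute = ℤ-Ring.solve-∀
          gather : ∀ q b T V → (q ℤ.* b ℤ.- T) ℤ.+ q ℤ.* V ≡ q ℤ.* (b ℤ.+ V) ℤ.- T
          gather = ℤ-Ring.solve-∀

    next-progress : ∀ x → Boxed x → ¬ T (ok x) → Φ (next x) ℤ.+ q ℤ.* q ℤ.≤ Φ x
    next-progress x bx ¬t = go (cuts p (rsOf x)) refl (spend (rsOf x) ℕ.≤ᵇ β + W) refl ¬t
      where
      go : ∀ l → cuts p (rsOf x) ≡ l → ∀ b → (spend (rsOf x) ℕ.≤ᵇ β + W) ≡ b → ¬ T (caseList l true (λ _ _ → false) ∧ b) →
           Φ (caseList l (if b then x else down x) (λ c _ → up c x)) ℤ.+ q ℤ.* q ℤ.≤ Φ x
      go (c ∷ cs) el b     eb ¬t = up-progress x bx c (Oracle.cuts-sound p lo hi x (subst (c ∈_) (sym el) (here refl)))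
      go []       el true  eb ¬t = ⊥-elim (¬t tt)
      go []       el false eb ¬t = down-progress x (≰⇒> (λ le → subst T eb (≤⇒≤ᵇ le)))

    -- The initial squared distance is at most m N² q² and each unsuccessful step removes q², so
    -- fewer than `stepsOf p` of them are possible.
    accepts : T (ok final)
    accepts = [ id , (λ le → ⊥-elim (exhausted final le)) ]′
      (iter-progress next ok Φ (q ℤ.* q) Boxed next-boxed next-fixed next-progress (stepsOf p) origin (clip-boxed (λ _ → 0)))
      where
      open ℤ.≤-Reasoning
      far : ∀ e → dist 0 e ℤ.≤ (q ℤ.* q) ℤ.* ℤ.+ (N * N)
      far e = ℤ.≤-trans (ℤ.≤-reflexive (negate q (t e))) (ℤ.≤-trans (square-mono (t-nonneg e) (t≤N e)) (ℤ.≤-reflexive (trans (regroup′ q (ℤ.+ N)) (cong ((q ℤ.* q) ℤ.*_) (sym (ℤ.pos-* N N))))))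
        where
        negate : ∀ q t → (q ℤ.* ℤ.0ℤ ℤ.- t) ℤ.* (q ℤ.* ℤ.0ℤ ℤ.- t) ≡ t ℤ.* t
        negate = ℤ-Ring.solve-∀
        regroup′ : ∀ q N → (q ℤ.* N) ℤ.* (q ℤ.* N) ≡ (q ℤ.* q) ℤ.* (N ℤ.* N)
        regroup′ = ℤ-Ring.solve-∀
      exhausted : ∀ z → ¬ (Φ z ℤ.+ ℤ.+ stepsOf p ℤ.* (q ℤ.* q) ℤ.≤ Φ origin)
      exhausted z le = ℤ.<⇒≱ (begin-strict
        Φ origin                                              ≤⟨ ∑-mono (λ e → ℤ.≤-trans (clip-closer 0 e) (far e)) ⟩
        ∑ {m} (λ _ → (q ℤ.* q) ℤ.* ℤ.+ (N * N))              ≡⟨ ∑-* {m} (q ℤ.* q) (λ _ → ℤ.+ (N * N)) ⟩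
        (q ℤ.* q) ℤ.* ∑ {m} (λ _ → ℤ.+ (N * N))              ≡⟨ cong ((q ℤ.* q) ℤ.*_) (∑-Σᴺ {m} (λ _ → N * N)) ⟩
        (q ℤ.* q) ℤ.* ℤ.+ Σᴺ {m} (λ _ → N * N)               <⟨ ℤ.*-monoˡ-<-pos (q ℤ.* q) ⦃ ℤ.positive (*-pos q-pos q-pos) ⦄ (ℤ.+<+ (≤-trans (s≤s (Σᴺ-bounded {m} (λ _ → ≤-refl))) steps)) ⟩
        (q ℤ.* q) ℤ.* ℤ.+ stepsOf p                          ≡⟨ ℤ.*-comm (q ℤ.* q) (ℤ.+ stepsOf p) ⟩
        ℤ.+ stepsOf p ℤ.* (q ℤ.* q)                          ∎)
        (ℤ.≤-trans (ℤ.≤-reflexive (sym (ℤ.+-identityˡ _))) (ℤ.≤-trans (ℤ.+-monoˡ-≤ (ℤ.+ stepsOf p ℤ.* (q ℤ.* q)) (∑-nonneg (λ e → square-nonneg (q ℤ.* ℤ.+ z e ℤ.- t e)))) le))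

  query-complete : ∀ x q y → Feasᵍ β q y → T (query p (rsOf x , β))
  query-complete x q y F = subst T (sym (query-final x)) (Progress.accepts q y F)

  final-boxed : Boxed final
  final-boxed = iter-invariant Boxed next-boxed (stepsOf p) origin (clip-boxed (λ _ → 0))

  module Accepted (z : Fin m → ℕ) (boxed : Boxed z) (okay : T (ok z)) where

    open Oracle p lo hi z using (y; cuts-complete) public

    if-≤ : ∀ b → (if b then N else 0) ≤ N
    if-≤ true  = ≤-refl
    if-≤ false = z≤n

    no-cuts : cuts p (rsOf z) ≡ []
    no-cuts = go (cuts p (rsOf z)) (proj₁ (T-∧ okay))
      where
      go : ∀ {A : Set} (l : List A) → T (caseList l true (λ _ _ → false)) → l ≡ []
      go [] _ = refl
    cheap : spend (rsOf z) ≤ β + W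
    cheap = ≤ᵇ⇒≤ _ _ (proj₂ (T-∧ {caseList (cuts p (rsOf z)) true (λ _ _ → false)} okay))
    determined : ∀ e → ¬ T (U e) → ℤ.+ y e ≡ (if lo e then ℤ.+ N else ℤ.0ℤ)
    determined e ¬u with lo e | hi e
    ... | true  | _     = cong ℤ.+_ (m≤n⇒m⊔n≡n (≤-trans (m⊓n≤n (z e + V) _) (if-≤ _)))
    ... | false | true  = ⊥-elim (¬u tt)
    ... | false | false = cong ℤ.+_ (trans (⊔-identityʳ _) (⊓-zeroʳ (z e + V)))
    large : ∀ S → (∀ e → Cuts.cr ends S e ≡ 1 → ℤ.+ y e ≡ ℤ.+ N) ⊎ ℤ.+ κ ℤ.* ℤ.+ N ℤ.≤ Cuts.across ends S (λ e → ℤ.+ y e)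
    large S with Fin.any? (λ e → (Cuts.cr ends S e ≟ 1) ×-dec (y e <? N))
    ... | no none = inj₁ (λ e eq → cong ℤ.+_ (≤-antisym (clip-≤ N (lo e) (hi e) (z e + V)) (≮⇒≥ (λ lt → none (e , eq , lt)))))
    ... | yes (e , eq , lt) = inj₂ (ℤ.≤-trans (ℤ.≤-reflexive (trans (sym (ℤ.pos-* κ N)) (cong ℤ.+_ (*-comm κ N))))
            (ℤ.≤-trans (ℤ.+≤+ (≤-trans (m≤suc-pred[m] (N * κ)) (subst (λ j → suc j ≤ cutValue (nth S) y) cut-eq (cuts-complete no-cuts (nth S) e lt (crossing e eq)))))
              (ℤ.≤-reflexive (trans (cong ℤ.+_ (cutValue-nth S y)) (trans (sym (∑-Σᴺ (λ e → Cuts.cr ends S e * y e))) (∑-cong (λ e → ℤ.pos-* (Cuts.cr ends S e) (y e))))))))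
      where
      crossing : ∀ e → Cuts.cr ends S e ≡ 1 → T (crosses (nth S) (arcAt e))
      crossing e eq = subst T (sym (cong₂ _xor_ (nth-toℕ S (proj₁ (ends e))) (nth-toℕ S (proj₂ (ends e))))) (from (lookup S (proj₁ (ends e)) xor lookup S (proj₂ (ends e))) eq)
        where
        from : ∀ b → bit b ≡ 1 → T b
        from true _ = tt
    y≤ : ∀ e → y e ≤ z e + V
    y≤ e = ⊔-lub (m⊓n≤m (z e + V) (capAt e)) (≤-trans (proj₁ (boxed e)) (m≤m+n (z e) V))
    spent : Σᴺ (λ e → cst e * y e) ≤ β + lossOf p
    spent = begin
      Σᴺ (λ e → cst e * y e)                                   ≤⟨ Σᴺ-mono (λ e → *-monoʳ-≤ (cst e) (y≤ e)) ⟩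
      Σᴺ (λ e → cst e * (z e + V))                         ≡⟨ Σᴺ-cong (λ e → trans (*-distribˡ-+ (cst e) (z e) V) (cong (cst e * z e +_) (*-comm (cst e) V))) ⟩
      Σᴺ (λ e → cst e * z e + V * cst e)                   ≡⟨ Σᴺ-+ (λ e → cst e * z e) (λ e → V * cst e) ⟩
      Σᴺ (λ e → cst e * z e) + Σᴺ (λ e → V * cst e)        ≡⟨ cong₂ _+_ (sym (spend-rsOf z)) (Σᴺ-* V cst) ⟩
      spend (rsOf z) + V * Σᴺ cst                          ≤⟨ +-monoˡ-≤ (V * Σᴺ cst) cheap ⟩
      β + W + V * Σᴺ cst                                       ≡⟨ +-assoc β W _ ⟩
      β + (W + V * Σᴺ cst)                                     ≤⟨ +-monoʳ-≤ β loss ⟩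
      β + lossOf p                                             ∎
      where open ≤-Reasoning
    paid : ∑ (λ e → ℤ.+ (N * cst e) ℤ.* ℤ.+ y e) ℤ.≤ ℤ.+ (β + lossOf p) ℤ.* ℤ.+ N
    paid = ℤ.≤-trans (ℤ.≤-reflexive (trans (∑-cong (λ e → trans (sym (ℤ.pos-* (N * cst e) (y e))) (cong ℤ.+_ (*-assoc N (cst e) (y e)))))
                                           (trans (∑-Σᴺ (λ e → N * (cst e * y e))) (cong ℤ.+_ (Σᴺ-* N (λ e → cst e * y e))))))
             (ℤ.≤-trans (ℤ.+≤+ (*-monoʳ-≤ N spent)) (ℤ.≤-reflexive (trans (cong ℤ.+_ (*-comm N (β + lossOf p))) (ℤ.pos-* (β + lossOf p) N))))

    -- The padded point satisfies all cut constraints exactly, not only up to the padding.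
    padded-feasible : Feasᵍ (β + lossOf p) (ℤ.+ N) (λ e → ℤ.+ y e)
    padded-feasible = record
      { q-pos = ℤ.+<+ N-pos ; lower = λ e → ℤ.+≤+ z≤n ; upper = λ e → ℤ.+≤+ (clip-≤ N (lo e) (hi e) (z e + V))
      ; fixed = determined ; covered = large ; budget = paid }

  -- The converse of `query-complete` up to the loss: this covers the slack granted by the budget
  -- test and the cost of the padding.
  query-sound : ∀ x → T (query p (rsOf x , β)) → ∃ λ (y : Fin m → ℕ) → Feasᵍ (β + lossOf p) (ℤ.+ N) (λ e → ℤ.+ y e)
  query-sound x t = Accepted.y final final-boxed okay , Accepted.padded-feasible final final-boxed okay
    where
    okay : T (ok final)
    okay = subst T (query-final x) t

-- Correctness of the decisions

¬T⇒≡ : ∀ {b} → ¬ T b → b ≡ false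
¬T⇒≡ {true}  f = ⊥-elim (f tt)
¬T⇒≡ {false} f = refl

set : ∀ {m} → Fin m → Bool → (Fin m → Bool) → Fin m → Bool
set e b f e′ = if toℕ e′ ℕ.≡ᵇ toℕ e then b else f e′

set-same : ∀ {m} (e : Fin m) b f → set e b f e ≡ b
set-same e b f with toℕ e ℕ.≡ᵇ toℕ e | ≡⇒≡ᵇ (toℕ e) (toℕ e) refl
... | true | _ = refl

set-other : ∀ {m} {e e′ : Fin m} b f → e′ ≢ e → set e b f e′ ≡ f e′
set-other {e = e} {e′} b f ne with toℕ e′ ℕ.≡ᵇ toℕ e in eq
... | true  = ⊥-elim (ne (Fin.toℕ-injective (≡ᵇ⇒≡ (toℕ e′) (toℕ e) (subst T (sym eq) tt))))
... | false = refl

Σᴺ-update : ∀ {m} (e : Fin m) {f g : Fin m → ℕ} {d} → (∀ e′ → e′ ≢ e → g e′ ≡ f e′) → g e ≡ f e + d → Σᴺ g ≡ Σᴺ f + d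
Σᴺ-update zero {f} {g} {d} other at = trans (cong₂ _+_ at (Σᴺ-cong (λ e → other (suc e) (λ ())))) (shuffle (f zero) d _)
  where
  shuffle : ∀ a b c → a + b + c ≡ a + c + b
  shuffle = ℕ-Ring.solve-∀
Σᴺ-update (suc e) {f} other at = trans (cong₂ _+_ (other zero (λ ())) (Σᴺ-update e (λ e′ ne → other (suc e′) (λ eq → ne (Fin.suc-injective eq))) at)) (sym (+-assoc (f zero) _ _))

count-map : ∀ {A B : Set} (f : A → B) p xs → count p (map f xs) ≡ count (λ x → p (f x)) xs
count-map f p []       = refl
count-map f p (x ∷ xs) with p (f x)
... | true  = cong suc (count-map f p xs)
... | false = count-map f p xs

open-items : Carrier Guess → ℕ
open-items s = count undecided (proj₁ s)

mark-decides : ∀ b i r → idxOf r ≡ i → ¬ T (undecided (mark b b i r))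
mark-decides b i r eq t with idxOf r ℕ.≡ᵇ i | ≡⇒≡ᵇ (idxOf r) i eq
mark-decides true  i r eq t | true | _ = t
mark-decides false i r eq t | true | _ = t

mark-only : ∀ b i r → T (undecided (mark b b i r)) → T (undecided r)
mark-only b i r t with idxOf r ℕ.≡ᵇ i
mark-only true  i r () | true
mark-only false i r () | true
... | false = t

move-decides : ∀ b rs {r} → r ∈ rs → T (undecided r) → count undecided (map (mark b b (idxOf r)) rs) < count undecided rs
move-decides b rs {r} r∈ u = subst (_< count undecided rs) (sym (count-map (mark b b (idxOf r)) undecided rs))
  (count-strict undecided (λ r′ → undecided (mark b b (idxOf r) r′)) rs (λ r′ → mark-only b (idxOf r) r′) r∈ u (mark-decides b (idxOf r) r refl))

move-progress : ∀ p s → (move p s ≡ s × All (λ s′ → ¬ T (query p s′)) (moves p s)) ⊎ open-items (move p s) < open-items s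
move-progress p s = [ inj₁ , (λ (s′ , s′∈ , _ , eq) → inj₂ (subst (λ t → open-items t < open-items s) (sym eq) (smaller s′ (∈-moves⁻ p s s′∈)))) ]′ (move-result p s)
  where
  smaller : ∀ s′ → (∃ λ r → r ∈ proj₁ s × T (undecided r) × (s′ ≡ dropped p s r ⊎ s′ ≡ taken p s r)) → open-items s′ < open-items s
  smaller s′ (r , r∈ , u , inj₁ eq) = subst (λ t → open-items t < open-items s) (sym eq) (move-decides false (proj₁ s) r∈ u)
  smaller s′ (r , r∈ , u , inj₂ eq) = subst (λ t → open-items t < open-items s) (sym eq) (move-decides true (proj₁ s) r∈ u)

iter-settles : ∀ {A : Set} (f : A → A) (μ : A → ℕ) (P : A → Set) → (∀ x → (f x ≡ x × P x) ⊎ μ (f x) < μ x) → ∀ n x → μ x ≤ n → P (iter n f x)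
iter-settles f μ P dec n x le with dec x
... | inj₁ (eq , Px) = subst P (sym (iter-fixed f n eq)) Px
iter-settles f μ P dec zero    x le | inj₂ lt = contradiction (≤-trans lt le) (λ ())
iter-settles f μ P dec (suc n) x le | inj₂ lt = iter-settles f μ P dec n (f x) (ℕ.s≤s⁻¹ (≤-trans lt le))

AllRejected : Carrier Par → Carrier Guess → Set
AllRejected p s = All (λ s′ → ¬ T (query p s′)) (moves p s)

decide-stuck : ∀ p s → AllRejected p (decide p s)
decide-stuck p s = iter-settles (move p) open-items (AllRejected p) (move-progress p) (length (proj₁ s)) s
                     (List.length-filter (λ r → Bool.T? (undecided r)) (proj₁ s))

module Decisions (𝓢 : Setting) where

  open Setting 𝓢
  open Network ends cst using (itemAt; itemsOf)

  N : ℕ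
  N = gridOf p

  open? : (lo hi : Fin m → Bool) → Fin m → Bool
  open? lo hi e = hi e ∧ not (lo e)

  Feas′ : (lo hi : Fin m → Bool) → ℕ → ℤ → (Fin m → ℤ) → Set
  Feas′ lo hi β = Cuts.Feas ends (ℤ.+ κ) (open? lo hi) lo (λ e → ℤ.+ (N * cst e)) (ℤ.+ β)

  guess : (lo hi : Fin m → Bool) → ℕ → Carrier Guess
  guess lo hi β = itemsOf lo hi (λ _ → 0) , β

  paid : (Fin m → Bool) → ℕ
  paid lo = Σᴺ (λ e → bit (lo e) * cst e)

  -- Values never exceed N and vanish outside the allowed edges, so a cut of fractional value at
  -- least κ contains at least κ allowed edges, and a full cut consists of allowed edges only.
  feas-covers : ∀ {lo hi β y} → (∀ e → T (lo e) → T (hi e)) → Feas′ lo hi β (ℤ.+ N) y →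
                ∀ S → (∀ e → Cuts.cr ends S e ≡ 1 → T (hi e)) ⊎ κ ≤ Σᴺ (λ e → bit (hi e) * Cuts.cr ends S e)
  feas-covers {lo} {hi} {β} {y} lo⇒hi F S = Sum.map (λ full e e∈ → allowed e (full e e∈)) enough (covered S)
    where
    open Cuts.Feas F
    dropped-zero : ∀ e → ¬ T (hi e) → y e ≡ ℤ.0ℤ
    dropped-zero e ¬h = trans (fixed e (λ u → ¬h (proj₁ (T-∧ u)))) (cong (λ b → if b then ℤ.+ N else ℤ.0ℤ) (¬T⇒≡ (λ l → ¬h (lo⇒hi e l))))
    allowed : ∀ e → y e ≡ ℤ.+ N → T (hi e)
    allowed e eq = Dec.decidable-stable (Bool.T? (hi e)) (λ ¬h → ℤ.<⇒≢ (ℤ.+<+ N-pos) (trans (sym (dropped-zero e ¬h)) eq))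
    each : ∀ e → ℤ.+ Cuts.cr ends S e ℤ.* y e ℤ.≤ ℤ.+ N ℤ.* ℤ.+ (bit (hi e) * Cuts.cr ends S e)
    each e with Bool.T? (hi e)
    ... | yes h = ℤ.≤-trans (ℤ.*-monoˡ-≤-nonNeg (ℤ.+ Cuts.cr ends S e) (upper e)) (ℤ.≤-reflexive (trans (ℤ.*-comm (ℤ.+ Cuts.cr ends S e) (ℤ.+ N))
                    (cong (λ j → ℤ.+ N ℤ.* ℤ.+ j) (sym (trans (cong (_* Cuts.cr ends S e) (bit-T h)) (*-identityˡ _))))))
    ... | no ¬h = ℤ.≤-reflexive (trans (cong (ℤ.+ Cuts.cr ends S e ℤ.*_) (dropped-zero e ¬h)) (trans (ℤ.*-zeroʳ (ℤ.+ Cuts.cr ends S e))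
                    (sym (trans (cong (λ j → ℤ.+ N ℤ.* ℤ.+ (j * Cuts.cr ends S e)) (bit-¬T ¬h)) (ℤ.*-zeroʳ (ℤ.+ N))))))
    enough : ℤ.+ κ ℤ.* ℤ.+ N ℤ.≤ ∑ (λ e → ℤ.+ Cuts.cr ends S e ℤ.* y e) → κ ≤ Σᴺ (λ e → bit (hi e) * Cuts.cr ends S e)
    enough large = ℤ.drop‿+≤+ (ℤ.*-cancelʳ-≤-pos (ℤ.+ κ) (ℤ.+ Σᴺ (λ e → bit (hi e) * Cuts.cr ends S e)) (ℤ.+ N) ⦃ ℤ.positive (ℤ.+<+ N-pos) ⦄ (begin
      ℤ.+ κ ℤ.* ℤ.+ N                                                     ≤⟨ large ⟩
      ∑ (λ e → ℤ.+ Cuts.cr ends S e ℤ.* y e)                              ≤⟨ ∑-mono each ⟩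
      ∑ (λ e → ℤ.+ N ℤ.* ℤ.+ (bit (hi e) * Cuts.cr ends S e))             ≡⟨ ∑-* (ℤ.+ N) (λ e → ℤ.+ (bit (hi e) * Cuts.cr ends S e)) ⟩
      ℤ.+ N ℤ.* ∑ (λ e → ℤ.+ (bit (hi e) * Cuts.cr ends S e))             ≡⟨ cong (ℤ.+ N ℤ.*_) (∑-Σᴺ (λ e → bit (hi e) * Cuts.cr ends S e)) ⟩
      ℤ.+ N ℤ.* ℤ.+ Σᴺ (λ e → bit (hi e) * Cuts.cr ends S e)              ≡⟨ ℤ.*-comm (ℤ.+ N) _ ⟩
      ℤ.+ Σᴺ (λ e → bit (hi e) * Cuts.cr ends S e) ℤ.* ℤ.+ N              ∎))
      where open ℤ.≤-Reasoning

  feas-budget : ∀ {lo hi β y} → Feas′ lo hi β (ℤ.+ N) y → N * paid lo ≤ β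
  feas-budget {lo} {hi} {β} {y} F = ℤ.drop‿+≤+ (ℤ.*-cancelʳ-≤-pos (ℤ.+ (N * paid lo)) (ℤ.+ β) (ℤ.+ N) ⦃ ℤ.positive (ℤ.+<+ N-pos) ⦄ (begin
      ℤ.+ (N * paid lo) ℤ.* ℤ.+ N                                         ≡⟨ cong (ℤ._* ℤ.+ N) (trans (cong ℤ.+_ (sym (Σᴺ-* N (λ e → bit (lo e) * cst e)))) (sym (∑-Σᴺ (λ e → N * (bit (lo e) * cst e))))) ⟩
      ∑ (λ e → ℤ.+ (N * (bit (lo e) * cst e))) ℤ.* ℤ.+ N                  ≡⟨ trans (ℤ.*-comm _ (ℤ.+ N)) (sym (∑-* (ℤ.+ N) (λ e → ℤ.+ (N * (bit (lo e) * cst e))))) ⟩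
      ∑ (λ e → ℤ.+ N ℤ.* ℤ.+ (N * (bit (lo e) * cst e)))                  ≤⟨ ∑-mono each ⟩
      ∑ (λ e → ℤ.+ (N * cst e) ℤ.* y e)                                   ≤⟨ budget ⟩
      ℤ.+ β ℤ.* ℤ.+ N                                                     ∎))
    where
    open ℤ.≤-Reasoning
    open Cuts.Feas F
    each : ∀ e → ℤ.+ N ℤ.* ℤ.+ (N * (bit (lo e) * cst e)) ℤ.≤ ℤ.+ (N * cst e) ℤ.* y e
    each e with lo e | fixed e
    ... | true  | fx = ℤ.≤-reflexive (trans (ℤ.*-comm (ℤ.+ N) _) (cong₂ ℤ._*_ (cong (λ j → ℤ.+ (N * j)) (*-identityˡ (cst e))) (sym (fx (λ u → T-not (proj₂ (T-∧ {hi e} u)) tt)))))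
    ... | false | _  = ℤ.≤-trans (ℤ.≤-reflexive (trans (cong (λ j → ℤ.+ N ℤ.* ℤ.+ j) (*-zeroʳ N)) (ℤ.*-zeroʳ (ℤ.+ N)))) (*-nonneg {ℤ.+ (N * cst e)} {y e} (ℤ.+≤+ z≤n) (lower e))

  -- The indicator vector of an integral cover is a feasible point with denominator 1.
  cover-accepted : ∀ {lo hi D : Fin m → Bool} → (∀ e → T (lo e) → T (D e)) → (∀ e → T (D e) → T (hi e)) →
    (∀ S → (∀ e → Cuts.cr ends S e ≡ 1 → T (D e)) ⊎ κ ≤ Σᴺ (λ e → bit (D e) * Cuts.cr ends S e)) → T (query p (guess lo hi (N * paid D)))
  cover-accepted {lo} {hi} {D} lo⇒D D⇒hi covers = Relaxation.query-complete 𝓢 lo hi (λ e l → D⇒hi e (lo⇒D e l)) (N * paid D) (λ _ → 0) ℤ.1ℤ (λ e → ℤ.+ bit (D e)) record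
    { q-pos = ℤ.+<+ (s≤s z≤n)
    ; lower = λ e → ℤ.+≤+ z≤n
    ; upper = λ e → ℤ.+≤+ (bit-≤1 (D e))
    ; fixed = fixed
    ; covered = λ S → Sum.map
        (λ full e e∈ → cong ℤ.+_ (bit-T (full e e∈)))
        (λ large → ℤ.≤-trans (ℤ.≤-reflexive (ℤ.*-identityʳ (ℤ.+ κ))) (ℤ.≤-trans (ℤ.+≤+ large)
          (ℤ.≤-reflexive (trans (sym (∑-Σᴺ (λ e → bit (D e) * Cuts.cr ends S e))) (∑-cong (λ e → trans (ℤ.pos-* (bit (D e)) (Cuts.cr ends S e)) (ℤ.*-comm (ℤ.+ bit (D e)) _)))))))
        (covers S)
    ; budget = ℤ.≤-reflexive (trans (∑-cong (λ e → trans (sym (ℤ.pos-* (N * cst e) (bit (D e)))) (cong ℤ.+_ (trans (*-assoc N (cst e) (bit (D e))) (cong (N *_) (*-comm (cst e) (bit (D e))))))))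
        (trans (∑-Σᴺ (λ e → N * (bit (D e) * cst e))) (trans (cong ℤ.+_ (Σᴺ-* N (λ e → bit (D e) * cst e))) (sym (ℤ.*-identityʳ _))))) }
    where
    fixed : ∀ e → ¬ T (open? lo hi e) → ℤ.+ bit (D e) ≡ (if lo e then ℤ.1ℤ else ℤ.0ℤ)
    fixed e ¬u with Bool.T? (lo e)
    ... | yes t = trans (cong ℤ.+_ (bit-T (lo⇒D e t))) (sym (cong (λ b → if b then ℤ.1ℤ else ℤ.0ℤ) (Bool.T-≡ .Equivalence.to t)))
    ... | no ¬t = trans (cong ℤ.+_ (bit-¬T (λ d → ¬u (∧-T (D⇒hi e d) (not-T ¬t))))) (sym (cong (λ b → if b then ℤ.1ℤ else ℤ.0ℤ) (¬T⇒≡ ¬t)))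

  module _ (lo₀ hi₀ : Fin m → Bool) (base : ℕ) where

    -- `account` sets aside one loss for every open edge, so that deciding an edge only spends its
    -- own reserve; the remaining growth of the budget is paid by the taken edges.
    record Inv (lo hi : Fin m → Bool) (β : ℕ) : Set where
      field
        lo⇒hi    : ∀ e → T (lo e) → T (hi e)
        lo₀⇒lo   : ∀ e → T (lo₀ e) → T (lo e)
        hi⇒hi₀   : ∀ e → T (hi e) → T (hi₀ e)
        solution : ∃ λ y → Feas′ lo hi β (ℤ.+ N) y
        account  : β + size-of (open? lo hi) * lossOf p ≤ base + raiseOf p * paid lo

    module MoveAt {lo hi : Fin m → Bool} {β : ℕ} (I : Inv lo hi β) (e : Fin m) (u : T (open? lo hi e)) where
      open Inv I

      e-hi : T (hi e)
      e-hi = proj₁ (T-∧ u)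

      e-¬lo : ¬ T (lo e)
      e-¬lo = T-not (proj₂ (T-∧ {hi e} u))

      module _ (b : Bool) where
        lo′ hi′ : Fin m → Bool
        lo′ = set e b lo
        hi′ = set e b hi

        lo′⇒hi′ : ∀ e′ → T (lo′ e′) → T (hi′ e′)
        lo′⇒hi′ e′ t with toℕ e′ ℕ.≡ᵇ toℕ e
        ... | true  = t
        ... | false = lo⇒hi e′ t

        open-e : open? lo′ hi′ e ≡ false
        open-e = trans (cong₂ (λ a b → a ∧ not b) (set-same e b hi) (set-same e b lo)) (closed b)
          where
          closed : ∀ b → b ∧ not b ≡ false
          closed true  = refl
          closed false = refl

        open-other : ∀ {e′} → e′ ≢ e → open? lo′ hi′ e′ ≡ open? lo hi e′
        open-other ne = cong₂ (λ a b → a ∧ not b) (set-other b hi ne) (set-other b lo ne)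

        closes : size-of (open? lo hi) ≡ suc (size-of (open? lo′ hi′))
        closes = trans (size-without e (open? lo hi) u) (cong suc (size-cong same))
          where
          same : ∀ e′ → without e (open? lo hi) e′ ≡ open? lo′ hi′ e′
          same e′ with e Fin.≟ e′
          ... | yes refl = trans (Bool.∧-zeroʳ _) (sym open-e)
          ... | no ne    = trans (Bool.∧-identityʳ _) (sym (open-other (λ eq → ne (sym eq))))

        marked : map (mark b b (toℕ e)) (itemsOf lo hi (λ _ → 0)) ≡ itemsOf lo′ hi′ (λ _ → 0)
        marked = trans (List.map-tabulate (itemAt lo hi (λ _ → 0)) (mark b b (toℕ e))) (List.tabulate-cong same)
          where
          same : ∀ e′ → mark b b (toℕ e) (itemAt lo hi (λ _ → 0) e′) ≡ itemAt lo′ hi′ (λ _ → 0) e′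
          same e′ with toℕ e′ ℕ.≡ᵇ toℕ e
          ... | true  = refl
          ... | false = refl

        fixed-other : ∀ {q y} → Feas′ lo hi β q y → ∀ {e′} → e′ ≢ e → ¬ T (open? lo′ hi′ e′) → y e′ ≡ (if lo′ e′ then q else ℤ.0ℤ)
        fixed-other {q} {y} F {e′} ne ¬u = trans (Cuts.Feas.fixed F e′ (λ u → ¬u (subst T (sym (open-other ne)) u))) (cong (λ b → if b then q else ℤ.0ℤ) (sym (set-other b lo ne)))

      paid-take : paid (set e true lo) ≡ paid lo + cst e
      paid-take = Σᴺ-update e (λ e′ ne → cong (λ b → bit b * cst e′) (set-other true lo ne))
        (trans (cong (λ b → bit b * cst e) (set-same e true lo)) (trans (+-identityʳ (cst e)) (cong (λ j → j * cst e + cst e) (sym (bit-¬T e-¬lo)))))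

      paid-drop : paid (set e false lo) ≡ paid lo
      paid-drop = Σᴺ-cong λ e′ → case e′ Fin.≟ e of λ where
        (yes refl) → cong (λ j → j * cst e) (trans (cong bit (set-same e false lo)) (sym (bit-¬T e-¬lo)))
        (no ne)    → cong (λ b → bit b * cst e′) (set-other false lo ne)

      drop-inv : T (query p (guess (set e false lo) (set e false hi) β)) → Inv (set e false lo) (set e false hi) (β + lossOf p)
      drop-inv t = record
        { lo⇒hi = lo′⇒hi′ false
        ; lo₀⇒lo = λ e′ t → case e′ Fin.≟ e of λ where
            (yes refl) → ⊥-elim (e-¬lo (lo₀⇒lo e t))
            (no ne)    → subst T (sym (set-other false lo ne)) (lo₀⇒lo e′ t)
        ; hi⇒hi₀ = λ e′ t → case e′ Fin.≟ e of λ where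
            (yes refl) → hi⇒hi₀ e e-hi
            (no ne)    → hi⇒hi₀ e′ (subst T (set-other false hi ne) t)
        ; solution = let (y , F) = Relaxation.query-sound 𝓢 (set e false lo) (set e false hi) (lo′⇒hi′ false) β (λ _ → 0) t in (λ e → ℤ.+ y e) , F
        ; account = ≤-trans (≤-reflexive (+-assoc β (lossOf p) _)) (≤-trans (≤-reflexive (cong (λ j → β + j * lossOf p) (sym (closes false))))
                      (≤-trans account (≤-reflexive (cong (λ j → base + raiseOf p * j) (sym paid-drop))))) }

      take-inv : T (query p (guess (set e true lo) (set e true hi) (β + raiseOf p * cst e))) →
                 Inv (set e true lo) (set e true hi) (β + raiseOf p * cst e + lossOf p)
      take-inv t = record
        { lo⇒hi = lo′⇒hi′ true
        ; lo₀⇒lo = λ e′ t → case e′ Fin.≟ e of λ where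
            (yes refl) → subst T (sym (set-same e true lo)) tt
            (no ne)    → subst T (sym (set-other true lo ne)) (lo₀⇒lo e′ t)
        ; hi⇒hi₀ = λ e′ t → case e′ Fin.≟ e of λ where
            (yes refl) → hi⇒hi₀ e e-hi
            (no ne)    → hi⇒hi₀ e′ (subst T (set-other true hi ne) t)
        ; solution = let (y , F) = Relaxation.query-sound 𝓢 (set e true lo) (set e true hi) (lo′⇒hi′ true) (β + raiseOf p * cst e) (λ _ → 0) t in (λ e → ℤ.+ y e) , F
        ; account = begin
            β + raiseOf p * cst e + lossOf p + size-of (open? (set e true lo) (set e true hi)) * lossOf p
              ≡⟨ shuffle β (raiseOf p * cst e) (lossOf p) _ ⟩
            β + (lossOf p + size-of (open? (set e true lo) (set e true hi)) * lossOf p) + raiseOf p * cst e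
              ≡⟨ cong (λ j → β + j * lossOf p + raiseOf p * cst e) (closes true) ⟨
            β + size-of (open? lo hi) * lossOf p + raiseOf p * cst e
              ≤⟨ +-monoˡ-≤ (raiseOf p * cst e) account ⟩
            base + raiseOf p * paid lo + raiseOf p * cst e
              ≡⟨ +-assoc base _ _ ⟩
            base + (raiseOf p * paid lo + raiseOf p * cst e)
              ≡⟨ cong (base +_) (trans (sym (*-distribˡ-+ (raiseOf p) (paid lo) (cst e))) (cong (raiseOf p *_) (sym paid-take))) ⟩
            base + raiseOf p * paid (set e true lo) ∎ }
        where
        open ≤-Reasoning
        shuffle : ∀ a b c d → a + b + c + d ≡ a + (c + d) + b
        shuffle = ℕ-Ring.solve-∀

    State : Carrier Guess → Set
    State s = ∃₂ λ lo hi → ∃ λ β → s ≡ guess lo hi β × Inv lo hi β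

    module _ {lo hi β} (I : Inv lo hi β) (s′ : Carrier Guess) (accepted : T (query p s′)) (e : Fin m) (u : T (open? lo hi e)) where
      open MoveAt I e u using (marked; drop-inv; take-inv)

      after-drop : s′ ≡ dropped p (guess lo hi β) (itemAt lo hi (λ _ → 0) e) → State (proj₁ s′ , proj₂ s′ + lossOf p)
      after-drop eq = set e false lo , set e false hi , β + lossOf p ,
          cong (λ s → proj₁ s , proj₂ s + lossOf p) eq′ , drop-inv (subst (λ s → T (query p s)) eq′ accepted)
        where
        eq′ : s′ ≡ guess (set e false lo) (set e false hi) β
        eq′ = trans eq (cong (λ l → l , β) (marked false))

      after-take : s′ ≡ taken p (guess lo hi β) (itemAt lo hi (λ _ → 0) e) → State (proj₁ s′ , proj₂ s′ + lossOf p)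
      after-take eq = set e true lo , set e true hi , β + raiseOf p * cst e + lossOf p ,
          cong (λ s → proj₁ s , proj₂ s + lossOf p) eq′ , take-inv (subst (λ s → T (query p s)) eq′ accepted)
        where
        eq′ : s′ ≡ guess (set e true lo) (set e true hi) (β + raiseOf p * cst e)
        eq′ = trans eq (cong (λ l → l , β + raiseOf p * cst e) (marked true))

    after-move : ∀ {lo hi β} → Inv lo hi β → ∀ s′ → T (query p s′) →
      (∃ λ r → r ∈ itemsOf lo hi (λ _ → 0) × T (undecided r) × (s′ ≡ dropped p (guess lo hi β) r ⊎ s′ ≡ taken p (guess lo hi β) r)) →
      State (proj₁ s′ , proj₂ s′ + lossOf p)
    after-move {lo} {hi} {β} I s′ accepted (r , r∈ , u , which) =
      let (e , r≡) = ∈-tabulate⁻ r∈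
          u′ = subst (λ r → T (undecided r)) r≡ u
      in [ (λ eq → after-drop I s′ accepted e u′ (trans eq (cong (dropped p (guess lo hi β)) r≡))) ,
           (λ eq → after-take I s′ accepted e u′ (trans eq (cong (taken p (guess lo hi β)) r≡))) ]′ which

    move-state : ∀ s → State s → State (move p s)
    move-state s st@(lo , hi , β , eq , I) = [ (λ (same , _) → subst State (sym same) st)
      , (λ (s′ , s′∈ , accepted , eq′) → subst State (sym eq′) (after-move I s′ accepted (∈-moves⁻ p (guess lo hi β) (subst (λ t → s′ ∈ moves p t) eq s′∈)))) ]′ (move-result p s)

    decide-state : ∀ s → State s → State (decide p s)
    decide-state s = iter-invariant State move-state (length (proj₁ s)) s

    module Stuck {lo hi : Fin m → Bool} {β : ℕ} (I : Inv lo hi β) (none : All (λ s′ → ¬ T (query p s′)) (moves p (guess lo hi β))) where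

      module _ {q y} (F : Feas′ lo hi β q y) (e : Fin m) (u : T (open? lo hi e)) where
        open Cuts.Feas F
        open MoveAt I e u using (marked; lo′⇒hi′; fixed-other)

        in-moves : dropped p (guess lo hi β) (itemAt lo hi (λ _ → 0) e) ∈ moves p (guess lo hi β) × taken p (guess lo hi β) (itemAt lo hi (λ _ → 0) e) ∈ moves p (guess lo hi β)
        in-moves = ∈-moves⁺ p (guess lo hi β) (∈-tabulate⁺ e) u

        nonzero : y e ≢ ℤ.0ℤ
        nonzero y≡0 = All.lookup none (proj₁ in-moves) (subst (λ l → T (query p (l , β))) (sym (marked false)) (Relaxation.query-complete 𝓢 (set e false lo) (set e false hi) (lo′⇒hi′ false) β (λ _ → 0) q y record
          { q-pos = q-pos ; lower = lower ; upper = upper ; covered = covered ; budget = budget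
          ; fixed = λ e′ ¬u → case e′ Fin.≟ e of λ where
              (yes refl) → trans y≡0 (cong (λ b → if b then q else ℤ.0ℤ) (sym (set-same e false lo)))
              (no ne)    → fixed-other false F ne ¬u }))

        -- Rounding y e up to q would be paid for by the raised budget.
        not-takeable : ¬ (ℤ.+ N ℤ.* q ℤ.≤ ℤ.+ raiseOf p ℤ.* q ℤ.+ ℤ.+ N ℤ.* y e)
        not-takeable le = All.lookup none (proj₂ in-moves) (subst (λ l → T (query p (l , β + raiseOf p * cst e))) (sym (marked true)) (Relaxation.query-complete 𝓢 (set e true lo) (set e true hi) (lo′⇒hi′ true) (β + raiseOf p * cst e) (λ _ → 0) q y⁺ record
          { q-pos = q-pos
          ; lower = λ e′ → ℤ.≤-trans (lower e′) (y≤y⁺ e′)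
          ; upper = y⁺≤q
          ; covered = λ S → case covered S of λ where
              (inj₁ full)  → inj₁ (λ e′ e∈ → ℤ.≤-antisym (y⁺≤q e′) (ℤ.≤-trans (ℤ.≤-reflexive (sym (full e′ e∈))) (y≤y⁺ e′)))
              (inj₂ large) → inj₂ (ℤ.≤-trans large (∑-mono (λ e′ → ℤ.*-monoˡ-≤-nonNeg (ℤ.+ Cuts.cr ends S e′) (y≤y⁺ e′))))
          ; fixed = λ e′ ¬u → case e′ Fin.≟ e of λ where
              (yes refl) → trans y⁺-e (cong (λ b → if b then q else ℤ.0ℤ) (sym (set-same e true lo)))
              (no ne)    → trans (y⁺-other ne) (fixed-other true F ne ¬u)
          ; budget = cost }))
          where
          y⁺ : Fin m → ℤ
          y⁺ e′ = if Dec.isYes (e Fin.≟ e′) then q else y e′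
          y⁺-e : y⁺ e ≡ q
          y⁺-e with e Fin.≟ e
          ... | yes _ = refl
          ... | no ne = ⊥-elim (ne refl)
          y⁺-other : ∀ {e′} → e′ ≢ e → y⁺ e′ ≡ y e′
          y⁺-other {e′} ne with e Fin.≟ e′
          ... | yes eq = ⊥-elim (ne (sym eq))
          ... | no _   = refl
          y≤y⁺ : ∀ e′ → y e′ ℤ.≤ y⁺ e′
          y≤y⁺ e′ with e Fin.≟ e′
          ... | yes _ = upper e′
          ... | no _  = ℤ.≤-refl
          y⁺≤q : ∀ e′ → y⁺ e′ ℤ.≤ q
          y⁺≤q e′ with e Fin.≟ e′
          ... | yes _ = ℤ.≤-refl
          ... | no _  = upper e′
          ∑-update : ∀ {k} (i : Fin k) {f g : Fin k → ℤ} {d} → (∀ j → j ≢ i → g j ≡ f j) → g i ≡ f i ℤ.+ d → ∑ g ≡ ∑ f ℤ.+ d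
          ∑-update zero {f} {g} {d} other at = trans (cong₂ ℤ._+_ at (∑-cong (λ j → other (suc j) (λ ())))) (shuffle (f zero) d _)
            where
            shuffle : ∀ a b c → (a ℤ.+ b) ℤ.+ c ≡ (a ℤ.+ c) ℤ.+ b
            shuffle = ℤ-Ring.solve-∀
          ∑-update (suc i) {f} other at = trans (cong₂ ℤ._+_ (other zero (λ ())) (∑-update i (λ j ne → other (suc j) (λ eq → ne (Fin.suc-injective eq))) at)) (sym (ℤ.+-assoc (f zero) _ _))
          c : Fin m → ℤ
          c e = ℤ.+ (N * cst e)
          cost : ∑ (λ e → c e ℤ.* y⁺ e) ℤ.≤ ℤ.+ (β + raiseOf p * cst e) ℤ.* q
          cost = begin
            ∑ (λ e → c e ℤ.* y⁺ e)                                                 ≡⟨ ∑-update e (λ j ne → cong (c j ℤ.*_) (y⁺-other ne)) (trans (cong (c e ℤ.*_) y⁺-e) (complete (c e) q (y e))) ⟩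
            ∑ (λ e → c e ℤ.* y e) ℤ.+ c e ℤ.* (q ℤ.- y e)                          ≤⟨ ℤ.+-mono-≤ budget extra ⟩
            ℤ.+ β ℤ.* q ℤ.+ ℤ.+ (raiseOf p * cst e) ℤ.* q                          ≡⟨ ℤ.*-distribʳ-+ q (ℤ.+ β) (ℤ.+ (raiseOf p * cst e)) ⟨
            ℤ.+ (β + raiseOf p * cst e) ℤ.* q                                      ∎
            where
            open ℤ.≤-Reasoning
            complete : ∀ c q y → c ℤ.* q ≡ c ℤ.* y ℤ.+ c ℤ.* (q ℤ.- y)
            complete = ℤ-Ring.solve-∀
            pull : ∀ N c q y → (N ℤ.* c) ℤ.* (q ℤ.- y) ≡ c ℤ.* (N ℤ.* q ℤ.- N ℤ.* y)
            pull = ℤ-Ring.solve-∀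
            cancel : ∀ a b → (a ℤ.+ b) ℤ.- b ≡ a
            cancel = ℤ-Ring.solve-∀
            push : ∀ c r q → c ℤ.* (r ℤ.* q) ≡ (r ℤ.* c) ℤ.* q
            push = ℤ-Ring.solve-∀
            extra : c e ℤ.* (q ℤ.- y e) ℤ.≤ ℤ.+ (raiseOf p * cst e) ℤ.* q
            extra = begin
              c e ℤ.* (q ℤ.- y e)                                  ≡⟨ cong (ℤ._* (q ℤ.- y e)) (ℤ.pos-* N (cst e)) ⟩
              (ℤ.+ N ℤ.* ℤ.+ cst e) ℤ.* (q ℤ.- y e)                ≡⟨ pull (ℤ.+ N) (ℤ.+ cst e) q (y e) ⟩
              ℤ.+ cst e ℤ.* (ℤ.+ N ℤ.* q ℤ.- ℤ.+ N ℤ.* y e)        ≤⟨ ℤ.*-monoˡ-≤-nonNeg (ℤ.+ cst e) (ℤ.≤-trans (ℤ.+-monoˡ-≤ (ℤ.- (ℤ.+ N ℤ.* y e)) le) (ℤ.≤-reflexive (cancel (ℤ.+ raiseOf p ℤ.* q) (ℤ.+ N ℤ.* y e)))) ⟩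
              ℤ.+ cst e ℤ.* (ℤ.+ raiseOf p ℤ.* q)                  ≡⟨ push (ℤ.+ cst e) (ℤ.+ raiseOf p) q ⟩
              (ℤ.+ raiseOf p ℤ.* ℤ.+ cst e) ℤ.* q                  ≡⟨ cong (ℤ._* q) (ℤ.pos-* (raiseOf p) (cst e)) ⟨
              ℤ.+ (raiseOf p * cst e) ℤ.* q                        ∎

      U : Fin m → Bool
      U = open? lo hi

      stuck : ∀ q y → Feas′ lo hi β q y → ∀ e → T (U e) → ℤ.0ℤ ℤ.< y e × y e ℤ.< q
      stuck q y F e u = ℤ.≤∧≢⇒< (lower e) (λ eq → nonzero F e u (sym eq)) ,
                        ℤ.≤∧≢⇒< (upper e) (λ eq → not-takeable F e u (ℤ.≤-trans (ℤ.≤-reflexive (sym (ℤ.+-identityˡ _)))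
                          (ℤ.+-mono-≤ (*-nonneg {ℤ.+ raiseOf p} {q} (ℤ.+≤+ z≤n) (ℤ.<⇒≤ q-pos)) (ℤ.≤-reflexive (cong (ℤ.+ N ℤ.*_) (sym eq))))))
        where open Cuts.Feas F

      open Cuts.Extremes ends (ℤ.+ κ) U lo (λ e → ℤ.+ (N * cst e)) (ℤ.+ β) stuck using (extreme-exists)

      -- When the raise is half the grid size, an open edge with 2y ≥ q could be taken. So every
      -- feasible point has all open edges below one half, and counting on an extreme one leaves no
      -- open edge.
      all-decided : N ≡ raiseOf p + raiseOf p → ∀ e → ¬ T (U e)
      all-decided N≡ e u = let (y₀ , F₀) = Inv.solution I in
        extreme-exists (ℤ.+ N) y₀ F₀ λ (q , y , F , ext) →
        let open Laminar ends (ℤ.+ κ) U lo (λ e → ℤ.+ (N * cst e)) (ℤ.+ β) q y F (stuck q y F) ext using (family-exists)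
            open Counting ends (ℤ.+ κ) U lo (λ e → ℤ.+ (N * cst e)) (ℤ.+ β) q y F (stuck q y F) ext using (module Half)
        in family-exists λ (K , P , L , le) → Half.none-undetermined (λ e u → ℤ.≰⇒> (λ q≤2y → not-takeable F e u (rounds q (y e) q≤2y))) L le e u
        where
        rounds : ∀ q y → q ℤ.≤ y ℤ.+ y → ℤ.+ N ℤ.* q ℤ.≤ ℤ.+ raiseOf p ℤ.* q ℤ.+ ℤ.+ N ℤ.* y
        rounds q y le = begin
          ℤ.+ N ℤ.* q                                              ≡⟨ cong (λ j → ℤ.+ j ℤ.* q) N≡ ⟩
          (ℤ.+ h ℤ.+ ℤ.+ h) ℤ.* q                                  ≡⟨ ℤ.*-distribʳ-+ q (ℤ.+ h) (ℤ.+ h) ⟩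
          ℤ.+ h ℤ.* q ℤ.+ ℤ.+ h ℤ.* q                              ≤⟨ ℤ.+-monoʳ-≤ (ℤ.+ h ℤ.* q) (ℤ.*-monoˡ-≤-nonNeg (ℤ.+ h) le) ⟩
          ℤ.+ h ℤ.* q ℤ.+ ℤ.+ h ℤ.* (y ℤ.+ y)                      ≡⟨ cong (λ t → ℤ.+ h ℤ.* q ℤ.+ t) (regroup′ (ℤ.+ h) y) ⟩
          ℤ.+ h ℤ.* q ℤ.+ (ℤ.+ h ℤ.+ ℤ.+ h) ℤ.* y                  ≡⟨ cong (λ j → ℤ.+ h ℤ.* q ℤ.+ ℤ.+ j ℤ.* y) N≡ ⟨
          ℤ.+ h ℤ.* q ℤ.+ ℤ.+ N ℤ.* y                              ∎
          where
          open ℤ.≤-Reasoning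
          h : ℕ
          h = raiseOf p
          regroup′ : ∀ h y → h ℤ.* (y ℤ.+ y) ≡ (h ℤ.+ h) ℤ.* y
          regroup′ = ℤ-Ring.solve-∀

      -- No feasible point has an open edge at 0 or at q, so an extreme one is determined by tight
      -- cuts alone and the count against D applies.
      few-undecided : ∀ D → (∀ S → (∀ e → Cuts.cr ends S e ≡ 1 → T (D e)) ⊎ κ ≤ Σᴺ (λ e → bit (D e) * Cuts.cr ends S e)) → κ * size-of U ≤ 4 * size-of D
      few-undecided D covers = ≮⇒≥ λ lt → let (y₀ , F₀) = Inv.solution I in
        extreme-exists (ℤ.+ N) y₀ F₀ λ (q , y , F , ext) →
        let open Laminar ends (ℤ.+ κ) U lo (λ e → ℤ.+ (N * cst e)) (ℤ.+ β) q y F (stuck q y F) ext using (family-exists)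
            open Counting ends (ℤ.+ κ) U lo (λ e → ℤ.+ (N * cst e)) (ℤ.+ β) q y F (stuck q y F) ext using (module Unit)
        in family-exists λ (K , P , L , le) → <⇒≱ lt (Unit.undetermined-few κ refl D covers L le)

-- Correctness of the algorithm

Σᴺ-≤-cancel : ∀ {a b} h → 0 < h → h * a ≤ h * b → a ≤ b
Σᴺ-≤-cancel (suc h) _ le = *-cancelˡ-≤ (suc h) le

tabulate-numberFrom : ∀ {m} {A : Set} i (f : Fin m → A) → numberFrom i (tabulate f) ≡ tabulate (λ e → i + toℕ e , f e)
tabulate-numberFrom {zero}  i f = refl
tabulate-numberFrom {suc m} i f = cong₂ _∷_ (cong (_, f zero) (sym (+-identityʳ i)))
  (trans (tabulate-numberFrom (suc i) (f ∘ suc)) (List.tabulate-cong (λ e → cong (_, f (suc e)) (sym (+-suc i (toℕ e))))))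

module _ (C P R : ℕ) (p : ℕ → Bool) (sound : ∀ j → T (p j) → suc j * P ≤ R) (complete : ∀ j → suc j * P ≤ R → T (p j)) where

  private
    down : ∀ j → T (p (suc j)) → T (p j)
    down j t = complete j (≤-trans (m≤n+m (suc j * P) P) (sound (suc j) t))

  count-quotient-≤ : countBelow C p * P ≤ R
  count-quotient-≤ with countBelow C p | proj₁ (countBelow-threshold C p down)
  ... | zero  | _ = z≤n
  ... | suc c | f = sound c (f c refl)

  -- Rounding down loses at most one unit as long as the cap does not interfere. The premise ensures
  -- this; it holds for the edges that are no dearer than the guessed one.
  count-quotient-≥ : R ≤ C * P → R ≤ suc (countBelow C p) * P
  count-quotient-≥ R≤ with m≤n⇒m<n∨m≡n (countBelow-≤ C p)
  ... | inj₁ lt = <⇒≤ (≰⇒> (λ le → proj₂ (countBelow-threshold C p down) lt (complete _ le)))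
  ... | inj₂ eq = ≤-trans R≤ (≤-trans (≤-reflexive (cong (_* P) (sym eq))) (m≤n+m _ P))

  count-quotient-full : R ≡ C * P → countBelow C p ≡ C
  count-quotient-full R≡ with m≤n⇒m<n∨m≡n (countBelow-≤ C p)
  ... | inj₁ lt = ⊥-elim (proj₂ (countBelow-threshold C p down) lt (complete _ (≤-trans (*-monoˡ-≤ P lt) (≤-reflexive (sym R≡)))))
  ... | inj₂ eq = eq

module _ {A : Set} (choose : A → A → A) (_⊑_ : A → A → Set) (P : A → Set)
  (⊑-trans : ∀ a b c → P b → a ⊑ b → b ⊑ c → a ⊑ c) (⊑-refl : ∀ a → a ⊑ a)
  (choose-⊑ : ∀ a b → (choose a b ≡ a ⊎ choose a b ≡ b) × choose a b ⊑ a × choose a b ⊑ b) where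

  foldl-best : ∀ a as → All P (a ∷ as) → foldl choose a as ∈ a ∷ as × All (foldl choose a as ⊑_) (a ∷ as)
  foldl-best a []       _              = here refl , ⊑-refl a ∷ []
  foldl-best a (b ∷ as) (pa ∷ pb ∷ ps) =
    let (pick , x⊑a , x⊑b) = choose-⊑ a b
        px = [ (λ eq → subst P (sym eq) pa) , (λ eq → subst P (sym eq) pb) ]′ pick
        (r∈ , rs) = foldl-best (choose a b) as (px ∷ ps)
    in member pick r∈ , ⊑-trans _ _ a px (All.head rs) x⊑a ∷ ⊑-trans _ _ b px (All.head rs) x⊑b ∷ All.tail rs
    where
    member : ∀ {x r} → x ≡ a ⊎ x ≡ b → r ∈ x ∷ as → r ∈ a ∷ b ∷ as
    member pick (here eq)  = [ (λ e → here (trans eq e)) , (λ e → there (here (trans eq e))) ]′ pick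
    member pick (there r∈) = there (there r∈)

module Choice where

  wt : Carrier Cand → ℕ
  wt c = proj₁ (proj₁ c)

  pr qr : Carrier Cand → ℕ
  pr c = value (proj₁ (proj₂ (proj₁ c)))
  qr c = value (proj₂ (proj₂ (proj₁ c)))

  Better : Carrier Cand → Carrier Cand → Set
  Better c d = wt c * (pr c * qr d) ≤ wt d * (pr d * qr c)

  value-product : ∀ w xs ys → value (repeat w (times xs ys)) ≡ w * (value xs * value ys)
  value-product w xs ys = trans (value-repeat w (times xs ys)) (cong (w *_) (value-times xs ys))

  noWorse-sound : ∀ c d → T (noWorse c d) → Better c d
  noWorse-sound c d t = subst₂ _≤_ (value-product (wt c) (proj₁ (proj₂ (proj₁ c))) (proj₂ (proj₂ (proj₁ d)))) (value-product (wt d) (proj₁ (proj₂ (proj₁ d))) (proj₂ (proj₂ (proj₁ c))))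
    (proj₁ (leqList-correct (repeat (wt c) (times (proj₁ (proj₂ (proj₁ c))) (proj₂ (proj₂ (proj₁ d))))) (repeat (wt d) (times (proj₁ (proj₂ (proj₁ d))) (proj₂ (proj₂ (proj₁ c)))))) t)

  noWorse-complete : ∀ c d → Better c d → T (noWorse c d)
  noWorse-complete c d le = proj₂ (leqList-correct (repeat (wt c) (times (proj₁ (proj₂ (proj₁ c))) (proj₂ (proj₂ (proj₁ d))))) (repeat (wt d) (times (proj₁ (proj₂ (proj₁ d))) (proj₂ (proj₂ (proj₁ c))))))
    (subst₂ _≤_ (sym (value-product (wt c) (proj₁ (proj₂ (proj₁ c))) (proj₂ (proj₂ (proj₁ d))))) (sym (value-product (wt d) (proj₁ (proj₂ (proj₁ d))) (proj₂ (proj₂ (proj₁ c))))) le)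

  Better-trans : ∀ c d e → 0 < qr d → Better c d → Better d e → Better c e
  Better-trans c d e q-pos cd de = Σᴺ-≤-cancel (qr d) q-pos (begin
    qr d * (wt c * (pr c * qr e))     ≡⟨ shuffle (qr d) (wt c) (pr c) (qr e) ⟩
    qr e * (wt c * (pr c * qr d))     ≤⟨ *-monoʳ-≤ (qr e) cd ⟩
    qr e * (wt d * (pr d * qr c))     ≡⟨ shuffle (qr e) (wt d) (pr d) (qr c) ⟩
    qr c * (wt d * (pr d * qr e))     ≤⟨ *-monoʳ-≤ (qr c) de ⟩
    qr c * (wt e * (pr e * qr d))     ≡⟨ shuffle (qr c) (wt e) (pr e) (qr d) ⟩
    qr d * (wt e * (pr e * qr c))     ∎)
    where
    open ≤-Reasoning
    shuffle : ∀ a b c d → a * (b * (c * d)) ≡ d * (b * (c * a))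
    shuffle = ℕ-Ring.solve-∀

  choose-better : ∀ c d → (choose c d ≡ c ⊎ choose c d ≡ d) × Better (choose c d) c × Better (choose c d) d
  choose-better c d with noWorse c d in eq
  ... | true  = inj₁ refl , ≤-refl , noWorse-sound c d (subst T (sym eq) tt)
  ... | false = inj₂ refl , <⇒≤ (≰⇒> (λ le → subst T eq (noWorse-complete c d le))) , ≤-refl

  best : ∀ c cs → All (λ d → 0 < qr d) (c ∷ cs) → foldl choose c cs ∈ c ∷ cs × All (Better (foldl choose c cs)) (c ∷ cs)
  best = foldl-best choose Better (λ d → 0 < qr d) Better-trans (λ c → ≤-refl) choose-better

empty-or-max : ∀ {m} (D : Fin m → Bool) (f : Fin m → ℕ) → (∀ e → ¬ T (D e)) ⊎ (∃ λ e₀ → T (D e₀) × ∀ e → T (D e) → f e ≤ f e₀)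
empty-or-max {zero}  D f = inj₁ (λ ())
empty-or-max {suc m} D f with Bool.T? (D zero) | empty-or-max (D ∘ suc) (f ∘ suc)
... | no ¬d | inj₁ none            = inj₁ (λ { zero → ¬d ; (suc e) → none e })
... | no ¬d | inj₂ (e₀ , d₀ , max) = inj₂ (suc e₀ , d₀ , λ { zero d → ⊥-elim (¬d d) ; (suc e) d → max e d })
... | yes d | inj₁ none            = inj₂ (zero , d , λ { zero _ → ≤-refl ; (suc e) d′ → ⊥-elim (none e d′) })
... | yes d | inj₂ (e₀ , d₀ , max) with ≤-total (f zero) (f (suc e₀))
... | inj₁ le = inj₂ (suc e₀ , d₀ , λ { zero _ → le ; (suc e) d′ → max e d′ })
... | inj₂ ge = inj₂ (zero , d , λ { zero _ → ≤-refl ; (suc e) d′ → ≤-trans (max e d′) ge })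

∈-downFrom : ∀ {j n} → j < n → j ∈ List.downFrom n
∈-downFrom {j} {suc n} (s≤s j≤n) with m≤n⇒m<n∨m≡n j≤n
... | inj₁ lt   = there (∈-downFrom lt)
... | inj₂ refl = here refl

module _ (p : Carrier Par) (es : List (Carrier IEdge)) where

  private
    bs : List ℕ
    bs = List.downFrom (suc (length es * length es))

  ∈-candidates⁻ : ∀ {c} → c ∈ candidates p es → ∃₂ λ e b → e ∈ es × c ∈ attempt p es e b
  ∈-candidates⁻ c∈ =
    let (e , e∈ , c∈′)  = find (∈-concatMap⁻ (λ e → concatMap (λ b → attempt p es e b) bs) {xs = es} c∈)
        (b , _ , c∈″)   = find (∈-concatMap⁻ (λ b → attempt p es e b) {xs = bs} c∈′)
    in e , b , e∈ , c∈″

  ∈-candidates⁺ : ∀ {e b} → e ∈ es → b ≤ length es * length es → ∀ {c} → c ∈ attempt p es e b → c ∈ candidates p es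
  ∈-candidates⁺ {e} e∈ b≤ c∈ = ∈-concatMap⁺ (λ e → concatMap (λ b → attempt p es e b) bs)
    (lose e∈ (∈-concatMap⁺ (λ b → attempt p es e b) (lose (∈-downFrom (s≤s b≤)) c∈)))

-- The cost of the edge e is value (num e) / value (den e), or I e in units of 1/D.
record Weighted : Set where
  field
    {n m}    : ℕ
    ends     : Fin m → Fin n × Fin n
    num den  : Fin m → List ℕ
    κ        : ℕ
    κ-pos    : 0 < κ
    I        : Fin m → ℕ
    D        : ℕ
    D-pos    : 0 < D
    den-pos  : ∀ e → 0 < value (den e)
    I-eq     : ∀ e → I e * value (den e) ≡ value (num e) * D
    loopless : ∀ e → proj₁ (ends e) ≢ proj₂ (ends e)

module Solve (𝓦 : Weighted) where

  open Weighted 𝓦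

  arcOf′ : Fin m → ℕ × ℕ
  arcOf′ e = toℕ (proj₁ (ends e)) , toℕ (proj₂ (ends e))

  edge : Fin m → Carrier IEdge
  edge e = toℕ e , (arcOf′ e , (num e , den e))

  L : List (Carrier IEdge)
  L = tabulate edge

  length-L : length L ≡ m
  length-L = List.length-tabulate edge

  Covers : (Fin m → Bool) → Set
  Covers H = ∀ S → (∀ e → Cuts.cr ends S e ≡ 1 → T (H e)) ⊎ κ ≤ Σᴺ (λ e → bit (H e) * Cuts.cr ends S e)

  compare-I : ∀ a b e f → (a * (value (num e) * value (den f)) ≤ b * (value (num f) * value (den e)) → a * I e ≤ b * I f) ×
                          (a * I e ≤ b * I f → a * (value (num e) * value (den f)) ≤ b * (value (num f) * value (den e)))
  compare-I a b e f =
    (λ le → Σᴺ-≤-cancel (value (den e) * value (den f)) (*-mono-≤ (den-pos e) (den-pos f)) (subst₂ _≤_ (sym (left a e f)) (sym (right b e f)) (*-monoʳ-≤ D le))) ,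
    (λ le → Σᴺ-≤-cancel D D-pos (subst₂ _≤_ (left a e f) (right b e f) (*-monoʳ-≤ (value (den e) * value (den f)) le)))
    where
    left : ∀ a e f → (value (den e) * value (den f)) * (a * I e) ≡ D * (a * (value (num e) * value (den f)))
    left a e f = trans (pull (value (den e)) (value (den f)) a (I e)) (trans (cong (λ t → a * value (den f) * t) (I-eq e)) (push a (value (den f)) (value (num e)) D))
      where
      pull : ∀ q r a i → (q * r) * (a * i) ≡ a * r * (i * q)
      pull = ℕ-Ring.solve-∀
      push : ∀ a r p d → a * r * (p * d) ≡ d * (a * (p * r))
      push = ℕ-Ring.solve-∀
    right : ∀ b e f → (value (den e) * value (den f)) * (b * I f) ≡ D * (b * (value (num f) * value (den e)))
    right b e f = trans (cong (_* (b * I f)) (*-comm (value (den e)) (value (den f)))) (left b f e)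

  module Guessed (e₀ : Fin m) where

    ĉ : Fin m → ℕ
    ĉ e = scaled m (edge e₀) (edge e)

    lo₀ hi₀ : Fin m → Bool
    lo₀ e = toℕ e ℕ.≡ᵇ toℕ e₀
    hi₀ e = noDearer (edge e) (edge e₀)

    private
      P R : Fin m → ℕ
      P e = value (num e₀) * value (den e)
      R e = m * (value (num e) * value (den e₀))
      test : Fin m → ℕ → Bool
      test e j = leqList (repeat (suc j) (times (num e₀) (den e))) (repeat m (times (num e) (den e₀)))
      sound : ∀ e j → T (test e j) → suc j * P e ≤ R e
      sound e j t = subst₂ _≤_ (Choice.value-product (suc j) (num e₀) (den e)) (Choice.value-product m (num e) (den e₀))
        (proj₁ (leqList-correct (repeat (suc j) (times (num e₀) (den e))) (repeat m (times (num e) (den e₀)))) t)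
      complete : ∀ e j → suc j * P e ≤ R e → T (test e j)
      complete e j le = proj₂ (leqList-correct (repeat (suc j) (times (num e₀) (den e))) (repeat m (times (num e) (den e₀))))
        (subst₂ _≤_ (sym (Choice.value-product (suc j) (num e₀) (den e))) (sym (Choice.value-product m (num e) (den e₀))) le)

    ĉ≤m : ∀ e → ĉ e ≤ m
    ĉ≤m e = countBelow-≤ m (test e)

    ĉ-lower : ∀ e → ĉ e * I e₀ ≤ m * I e
    ĉ-lower e = proj₁ (compare-I (ĉ e) m e₀ e) (count-quotient-≤ m (P e) (R e) (test e) (sound e) (complete e))

    hi₀-complete : ∀ e → I e ≤ I e₀ → T (hi₀ e)
    hi₀-complete e le = proj₂ (leqList-correct (times (num e) (den e₀)) (times (num e₀) (den e)))
      (subst₂ _≤_ (trans (+-identityʳ _) (sym (value-times (num e) (den e₀)))) (trans (+-identityʳ _) (sym (value-times (num e₀) (den e))))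
        (proj₂ (compare-I 1 1 e e₀) (subst₂ _≤_ (sym (+-identityʳ (I e))) (sym (+-identityʳ (I e₀))) le)))

    ĉ-upper : ∀ e → T (hi₀ e) → m * I e ≤ suc (ĉ e) * I e₀
    ĉ-upper e t = proj₁ (compare-I m (suc (ĉ e)) e e₀) (count-quotient-≥ m (P e) (R e) (test e) (sound e) (complete e)
      (*-monoʳ-≤ m (subst₂ _≤_ (value-times (num e) (den e₀)) (value-times (num e₀) (den e)) (proj₁ (leqList-correct (times (num e) (den e₀)) (times (num e₀) (den e))) t))))

    ĉ-full : ∀ e → value (num e) * value (den e₀) ≡ value (num e₀) * value (den e) → ĉ e ≡ m
    ĉ-full e eq = count-quotient-full m (P e) (R e) (test e) (sound e) (complete e) (cong (m *_) eq)

    ĉ-self : ĉ e₀ ≡ m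
    ĉ-self = ĉ-full e₀ refl

    module Variant (b : Bool) where

      p : Carrier Par
      p = parameters b m κ

      N Δ r : ℕ
      N = gridSize m
      Δ = errorOf m
      r = if b then scaleOf m else 0

      grid-eq : gridOf p ≡ N
      grid-eq = cong gridOf (parameters-≡ b m κ)

      raise-eq : raiseOf p ≡ r
      raise-eq = cong raiseOf (parameters-≡ b m κ)

      loss-eq : lossOf p ≡ Δ
      loss-eq = cong lossOf (parameters-≡ b m κ)

      slack-eq : slackOf p ≡ m * m * m
      slack-eq = cong slackOf (parameters-≡ b m κ)

      pad-eq : padOf p ≡ m
      pad-eq = cong padOf (parameters-≡ b m κ)

      Σĉ≤ : Σᴺ ĉ ≤ m * m
      Σĉ≤ = Σᴺ-bounded ĉ≤m

      cut-eq : cutOf p ≡ ℕ.pred (gridOf p * κ)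
      cut-eq = trans (cong cutOf (parameters-≡ b m κ)) (cong (λ N → ℕ.pred (N * κ)) (sym grid-eq))

      m≤V : m ≤ padOf p
      m≤V = ≤-reflexive (sym pad-eq)

      costs≤W : Σᴺ (λ e → ĉ e * ĉ e) ≤ slackOf p
      costs≤W = ≤-trans (Σᴺ-bounded (λ e → *-mono-≤ (ĉ≤m e) (ĉ≤m e))) (≤-reflexive (trans (sym (*-assoc m m m)) (sym slack-eq)))

      enough-steps : m * (gridOf p * gridOf p) < stepsOf p
      enough-steps = ≤-reflexive (trans (cong (λ N → suc (m * (N * N))) grid-eq) (sym (cong stepsOf (parameters-≡ b m κ))))

      N-pos : 0 < gridOf p
      N-pos = subst (0 <_) (sym grid-eq) (s≤s z≤n)

      loss≥ : slackOf p + padOf p * Σᴺ ĉ ≤ lossOf p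
      loss≥ = subst₂ _≤_ (cong₂ (λ s v → s + v * Σᴺ ĉ) (sym slack-eq) (sym pad-eq)) (sym loss-eq)
                (+-monoʳ-≤ (m * m * m) (≤-trans (*-monoʳ-≤ m Σĉ≤) (≤-reflexive (sym (*-assoc m m m)))))

      open Network ends ĉ using (itemsOf)

      setting : Setting
      setting = record { ends = ends ; cst = ĉ ; p = p ; κ = κ ; κ-pos = κ-pos ; cut-eq = cut-eq ; m≤V = m≤V
                       ; costs≤W = costs≤W ; steps = enough-steps ; N-pos = N-pos ; loss = loss≥ }

      open Decisions setting using (open?; paid) public
      open Decisions setting using (guess; feas-covers; feas-budget; cover-accepted; Inv; module Inv; State; decide-state; module Stuck)

      items-eq : map (item (length L) (edge e₀)) L ≡ itemsOf lo₀ hi₀ (λ _ → 0)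
      items-eq = trans (cong (λ C → map (item C (edge e₀)) L) length-L) (List.map-tabulate edge (item m (edge e₀)))

      lo₀⇒hi₀ : ∀ e → T (lo₀ e) → T (hi₀ e)
      lo₀⇒hi₀ e t = hi₀-complete e (≤-reflexive (cong I (Fin.toℕ-injective (≡ᵇ⇒≡ (toℕ e) (toℕ e₀) t))))

      -- The guessed edge counts as taken with rounded cost m but never needs a raise. Subtracting
      -- `r * m` here removes the credit that `account` would otherwise grant for it.
      X base : ℕ → ℕ
      X b′    = N * b′ + suc m * Δ
      base b′ = X b′ ∸ r * m

      paid≥m : ∀ {lo} → (∀ e → T (lo₀ e) → T (lo e)) → m ≤ paid lo
      paid≥m {lo} lo₀⇒lo = ≤-trans (≤-reflexive (trans (sym ĉ-self) (trans (sym (+-identityʳ (ĉ e₀))) (cong (λ j → j * ĉ e₀) (sym (bit-T (lo₀⇒lo e₀ (≡⇒≡ᵇ (toℕ e₀) (toℕ e₀) refl))))))))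
        (Σᴺ-term e₀ (λ e → bit (lo e) * ĉ e))

      initial : ∀ b′ → T (query p (itemsOf lo₀ hi₀ (λ _ → 0) , N * b′)) → Inv lo₀ hi₀ (base b′) lo₀ hi₀ (N * b′ + lossOf p)
      initial b′ t = record
        { lo⇒hi = lo₀⇒hi₀ ; lo₀⇒lo = λ _ → id ; hi⇒hi₀ = λ _ → id
        ; solution = let (y , F) = Relaxation.query-sound setting lo₀ hi₀ lo₀⇒hi₀ (N * b′) (λ _ → 0) t in (λ e → ℤ.+ y e) , F
        ; account = begin
            N * b′ + lossOf p + size-of (open? lo₀ hi₀) * lossOf p      ≡⟨ cong (λ d → N * b′ + d + size-of (open? lo₀ hi₀) * d) loss-eq ⟩
            N * b′ + Δ + size-of (open? lo₀ hi₀) * Δ                    ≡⟨ +-assoc (N * b′) Δ _ ⟩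
            N * b′ + suc (size-of (open? lo₀ hi₀)) * Δ                  ≤⟨ +-monoʳ-≤ (N * b′) (*-monoˡ-≤ Δ (s≤s (size-≤ (open? lo₀ hi₀)))) ⟩
            X b′                                                        ≤⟨ m≤n+m∸n (X b′) (r * m) ⟩
            r * m + base b′                                             ≡⟨ +-comm (r * m) (base b′) ⟩
            base b′ + r * m                                             ≤⟨ +-monoʳ-≤ (base b′) (*-mono-≤ (≤-reflexive (sym raise-eq)) (paid≥m {lo₀} (λ _ → id))) ⟩
            base b′ + raiseOf p * paid lo₀                              ∎ }
        where open ≤-Reasoning

      record Outcome (b′ : ℕ) (rs : Items) : Set where
        field
          lo hi    : Fin m → Bool
          items    : rs ≡ itemsOf lo hi (λ _ → 0)
          covers   : Covers hi
          lo⇒hi    : ∀ e → T (lo e) → T (hi e)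
          hi⇒hi₀   : ∀ e → T (hi e) → T (hi₀ e)
          spent    : N * paid lo ≤ base b′ + r * paid lo
          decided  : b ≡ true → ∀ e → ¬ T (open? lo hi e)
          few      : ∀ D → Covers D → κ * size-of (open? lo hi) ≤ 4 * size-of D

      outcome : ∀ b′ → T (query p (itemsOf lo₀ hi₀ (λ _ → 0) , N * b′)) → Outcome b′ (proj₁ (decide p (itemsOf lo₀ hi₀ (λ _ → 0) , N * b′ + lossOf p)))
      outcome b′ t = from (decide-state lo₀ hi₀ (base b′) s₀ (lo₀ , hi₀ , N * b′ + lossOf p , refl , initial b′ t)) (decide-stuck p s₀)
        where
        s₀ : Carrier Guess
        s₀ = itemsOf lo₀ hi₀ (λ _ → 0) , N * b′ + lossOf p
        from : ∀ {s} → State lo₀ hi₀ (base b′) s → AllRejected p s → Outcome b′ (proj₁ s)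
        from {s} (lo , hi , β , eq , inv) none = record
          { lo = lo ; hi = hi ; items = cong proj₁ eq ; lo⇒hi = Inv.lo⇒hi inv ; hi⇒hi₀ = Inv.hi⇒hi₀ inv
          ; covers = feas-covers (Inv.lo⇒hi inv) (proj₂ (Inv.solution inv))
          ; spent = ≤-trans (subst (λ N → N * paid lo ≤ β) grid-eq (feas-budget (proj₂ (Inv.solution inv)))) (≤-trans (≤-trans (m≤m+n β _) (Inv.account inv)) (≤-reflexive (cong (λ r → base b′ + r * paid lo) raise-eq)))
          ; decided = λ { b≡ → Stuck.all-decided lo₀ hi₀ (base b′) inv none′ (trans grid-eq (cong (λ h → h + h) (sym (trans raise-eq (cong (λ b → if b then scaleOf m else 0) b≡))))) }
          ; few = Stuck.few-undecided lo₀ hi₀ (base b′) inv none′ }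
          where
          none′ : AllRejected p (guess lo hi β)
          none′ = subst (AllRejected p) eq none

      query-cover : ∀ D → Covers D → T (D e₀) → (∀ e → T (D e) → I e ≤ I e₀) → T (query p (itemsOf lo₀ hi₀ (λ _ → 0) , N * Σᴺ (λ e → bit (D e) * ĉ e)))
      query-cover D cov De₀ dearest = subst (λ N → T (query p (guess lo₀ hi₀ (N * paid D)))) grid-eq
        (cover-accepted (λ e t → subst (λ e → T (D e)) (sym (Fin.toℕ-injective (≡ᵇ⇒≡ (toℕ e) (toℕ e₀) t))) De₀) (λ e d → hi₀-complete e (dearest e d)) cov)

  open Choice

  weightOf : Fin m → (Fin m → Bool) → ℕ
  weightOf e₀ H = Σᴺ (λ e → if H e then suc (Guessed.ĉ e₀ e) else 0)

  record Valid (c : Carrier Cand) : Set where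
    field
      e₀     : Fin m
      H      : Fin m → Bool
      bits   : proj₂ c ≡ tabulate H
      price  : proj₂ (proj₁ c) ≡ (num e₀ , den e₀)
      weigh  : wt c ≡ weightOf e₀ H
      covers : Covers H
      cheap  : ∀ e → T (H e) → T (Guessed.hi₀ e₀ e)

    pr-eq : pr c ≡ value (num e₀)
    pr-eq = cong (value ∘ proj₁) price

    qr-eq : qr c ≡ value (den e₀)
    qr-eq = cong (value ∘ proj₂) price

  module _ (b : Bool) (e₀ : Fin m) where
    open Guessed e₀ using (ĉ; lo₀; hi₀; module Variant)
    open Variant b using (p; N; grid-eq; items-eq; Outcome; module Outcome; outcome)
    open Network ends ĉ using (itemsOf; itemAt)

    finalItems : ℕ → Items
    finalItems b′ = proj₁ (decide p (itemsOf lo₀ hi₀ (λ _ → 0) , N * b′ + lossOf p))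

    attempt-eq : ∀ b′ → attempt p L (edge e₀) b′ ≡
      (if query p (itemsOf lo₀ hi₀ (λ _ → 0) , N * b′) then candidate (edge e₀) (finalItems b′) ∷ [] else [])
    attempt-eq b′ = cong₂ (λ rs N → if query p (rs , N * b′) then candidate (edge e₀) (proj₁ (decide p (rs , N * b′ + lossOf p))) ∷ [] else []) items-eq grid-eq

    outcome-valid : ∀ {b′ rs} → Outcome b′ rs → Valid (candidate (edge e₀) rs)
    outcome-valid {b′} {rs} o = record
      { e₀ = e₀ ; H = hi ; price = refl ; covers = covers ; cheap = hi⇒hi₀
      ; bits  = trans (cong (map allowedOf) items) (List.map-tabulate (itemAt lo hi (λ _ → 0)) allowedOf)
      ; weigh = trans (cong weight items) (sumOver-tabulate (λ r → if allowedOf r then suc (costOf r) else 0) (itemAt lo hi (λ _ → 0))) }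
      where open Outcome o

    attempt-valid : ∀ b′ {c} → c ∈ attempt p L (edge e₀) b′ → Valid c
    attempt-valid b′ {c} c∈ = go (query p (itemsOf lo₀ hi₀ (λ _ → 0) , N * b′)) refl (subst (c ∈_) (attempt-eq b′) c∈)
      where
      go : ∀ x → query p (itemsOf lo₀ hi₀ (λ _ → 0) , N * b′) ≡ x → c ∈ (if x then candidate (edge e₀) (finalItems b′) ∷ [] else []) → Valid c
      go true eq (here c≡) = subst Valid (sym c≡) (outcome-valid (outcome b′ (subst T (sym eq) tt)))

    attempt-success : ∀ b′ → T (query p (itemsOf lo₀ hi₀ (λ _ → 0) , N * b′)) → candidate (edge e₀) (finalItems b′) ∈ attempt p L (edge e₀) b′
    attempt-success b′ t = subst (candidate (edge e₀) (finalItems b′) ∈_) (sym (attempt-eq b′)) (go _ t)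
      where
      go : ∀ x → T x → candidate (edge e₀) (finalItems b′) ∈ (if x then candidate (edge e₀) (finalItems b′) ∷ [] else [])
      go true _ = here refl

  module _ (b : Bool) where

    allCandidates : List (Carrier Cand)
    allCandidates = candidates (parameters b m κ) L

    candidates-valid : ∀ {c} → c ∈ allCandidates → Valid c
    candidates-valid {c} c∈ =
      let (e , b′ , e∈ , c∈′) = ∈-candidates⁻ (parameters b m κ) L c∈
          (e₀ , e≡)           = ∈-tabulate⁻ e∈
      in attempt-valid b e₀ b′ (subst (λ e → c ∈ attempt (parameters b m κ) L e b′) e≡ c∈′)

    attempt-candidate : ∀ e₀ b′ → b′ ≤ m * m → ∀ {c} → c ∈ attempt (parameters b m κ) L (edge e₀) b′ → c ∈ allCandidates
    attempt-candidate e₀ b′ b′≤ = ∈-candidates⁺ (parameters b m κ) L (∈-tabulate⁺ e₀) (subst (λ l → b′ ≤ l * l) (sym length-L) b′≤)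

    solve-eq : solve b κ L ≡ caseList allCandidates (map (λ _ → true) L) (λ c cs → proj₂ (foldl choose c cs))
    solve-eq = cong (λ l → caseList (candidates (parameters b l κ) L) (map (λ _ → true) L) (λ c cs → proj₂ (foldl choose c cs))) length-L

    -- The candidate obtained from the correct guess for a cover C.
    record Good (C : Fin m → Bool) : Set where
      field
        e₀   : Fin m
        c    : Carrier Cand
        c∈   : c ∈ allCandidates
        b′   : ℕ
        b′≡  : b′ ≡ Σᴺ (λ e → bit (C e) * Guessed.ĉ e₀ e)
        m≤b′ : m ≤ b′
        rs   : Items
        c≡   : c ≡ candidate (edge e₀) rs
        out  : Guessed.Variant.Outcome e₀ b b′ rs

    good : ∀ C → Covers C → Fin m → Good C
    good C cov e with empty-or-max C I
    ... | inj₁ none = ⊥-elim (uncovered (cov S))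
      where
      -- A single end of `e` bounds a cut through `e`, as there are no loops. Hence a cover is not
      -- empty and has a dearest edge.
      S : Vec Bool n
      S = Vec.tabulate (λ v → Dec.isYes (proj₁ (ends e) Fin.≟ v))
      separated : Cuts.cr ends S e ≡ 1
      separated = trans (cong₂ (λ a b → bit (a xor b)) (Vec.lookup∘tabulate (λ v → Dec.isYes (proj₁ (ends e) Fin.≟ v)) (proj₁ (ends e)))
                                                       (Vec.lookup∘tabulate (λ v → Dec.isYes (proj₁ (ends e) Fin.≟ v)) (proj₂ (ends e)))) isolated
        where
        isolated : bit (Dec.isYes (proj₁ (ends e) Fin.≟ proj₁ (ends e)) xor Dec.isYes (proj₁ (ends e) Fin.≟ proj₂ (ends e))) ≡ 1
        isolated with proj₁ (ends e) Fin.≟ proj₁ (ends e) | proj₁ (ends e) Fin.≟ proj₂ (ends e)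
        ... | yes _ | no _   = refl
        ... | yes _ | yes eq = ⊥-elim (loopless e eq)
        ... | no ne | _      = ⊥-elim (ne refl)
      uncovered : ¬ ((∀ e → Cuts.cr ends S e ≡ 1 → T (C e)) ⊎ κ ≤ Σᴺ (λ e → bit (C e) * Cuts.cr ends S e))
      uncovered (inj₁ full)  = none e (full e separated)
      uncovered (inj₂ large) = <⇒≱ κ-pos (≤-trans large (≤-reflexive (trans (Σᴺ-cong (λ e → cong (_* Cuts.cr ends S e) (bit-¬T (none e)))) (Σᴺ-* {m} 0 (λ _ → 0)))))
    ... | inj₂ (e₀ , Ce₀ , dearest) = record
      { e₀ = e₀ ; c = _ ; c∈ = attempt-candidate e₀ b₀ b₀≤ (attempt-success b e₀ b₀ asked) ; b′ = b₀ ; b′≡ = refl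
      ; m≤b′ = ≤-trans (≤-reflexive (trans (sym ĉ-self) (trans (sym (+-identityʳ (ĉ e₀))) (cong (_* ĉ e₀) (sym (bit-T Ce₀)))))) (Σᴺ-term e₀ (λ e → bit (C e) * ĉ e))
      ; rs = finalItems b e₀ b₀ ; c≡ = refl ; out = Variant.outcome b b₀ asked }
      where
      open Guessed e₀ using (ĉ; lo₀; hi₀; ĉ≤m; ĉ-self; module Variant)
      b₀ : ℕ
      b₀ = Σᴺ (λ e → bit (C e) * ĉ e)
      b₀≤ : b₀ ≤ m * m
      b₀≤ = Σᴺ-bounded (λ e → ≤-trans (*-mono-≤ (bit-≤1 (C e)) (ĉ≤m e)) (≤-reflexive (*-identityˡ m)))
      asked : T (query (Variant.p b) (Network.itemsOf ends ĉ lo₀ hi₀ (λ _ → 0) , Variant.N b * b₀))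
      asked = Variant.query-cover b C cov Ce₀ dearest

    record Answer : Set where
      field
        H      : Fin m → Bool
        covers : Covers H
        bits   : solve b κ L ≡ tabulate H
        better : ∀ C → Covers C → Fin m → Σ (Good C) λ g → ∃ λ c → ∃ λ (v : Valid c) → Valid.H v ≡ H × Better c (Good.c g)

    answer : Answer
    answer = pick allCandidates refl
      where
      pick : ∀ l → allCandidates ≡ l → Answer
      pick [] eq = record
        { H = λ _ → true ; covers = λ S → inj₁ (λ _ _ → tt)
        ; bits = trans solve-eq (trans (cong (λ l → caseList l (map (λ _ → true) L) (λ c cs → proj₂ (foldl choose c cs))) eq) (List.map-tabulate edge (λ _ → true)))
        ; better = λ C cov e → ⊥-elim (case subst (Good.c (good C cov e) ∈_) eq (Good.c∈ (good C cov e)) of λ ()) }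
      pick (c ∷ cs) eq = record
        { H = Valid.H v ; covers = Valid.covers v
        ; bits = trans solve-eq (trans (cong (λ l → caseList l (map (λ _ → true) L) (λ c cs → proj₂ (foldl choose c cs))) eq) (Valid.bits v))
        ; better = λ C cov e → let g = good C cov e in g , r , v , refl , All.lookup (proj₂ top) (subst (Good.c g ∈_) eq (Good.c∈ g)) }
        where
        valid : ∀ {d} → d ∈ c ∷ cs → Valid d
        valid d∈ = candidates-valid (subst (_ ∈_) (sym eq) d∈)
        r : Carrier Cand
        r = foldl choose c cs
        top : r ∈ c ∷ cs × All (Better r) (c ∷ cs)
        top = best c cs (All.tabulate (λ d∈ → subst (0 <_) (sym (Valid.qr-eq (valid d∈))) (den-pos (Valid.e₀ (valid d∈)))))
        v : Valid r
        v = valid (proj₁ top)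

  open Answer

  error<scale : suc m * errorOf m < scaleOf m
  error<scale = ≤-refl

  cost : (Fin m → Bool) → ℕ
  cost K = Σᴺ (λ e → bit (K e) * I e)

  -- The estimates below are multiplied by m and divided by it in the end, which requires an edge;
  -- without edges the sum is 0.
  by-edge : ∀ (f : Fin m → ℕ) {B : ℕ} → (Fin m → Σᴺ f ≤ B) → Σᴺ f ≤ B
  by-edge f g with Fin.any? {n = m} (λ _ → yes tt)
  ... | yes (e , _) = g e
  ... | no none     = ≤-trans (Σᴺ-mono {g = λ _ → 0} (λ e → ⊥-elim (none (e , tt)))) (≤-trans (≤-reflexive (Σᴺ-* {m} 0 (λ _ → 0))) z≤n)

  -- All edges are decided, so the weight of the kept set is at most its rounded cost plus m, one
  -- unit of rounding per edge. `paid+m≤` bounds this by twice the rounded cost of C. Comparing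
  -- candidates in true units transfers the bound to the one that was chosen.
  half-ratio : (A : Answer true) → ∀ C → Covers C → cost (H A) ≤ 2 * cost C
  half-ratio A C cov = by-edge (λ e → bit (H A e) * I e) (λ e → let (g , c , v , eq , bt) = better A C cov e in subst (λ K → cost K ≤ 2 * cost C) eq (compare e g c v bt))
    where
    compare : Fin m → (g : Good true C) → ∀ c (v : Valid c) → Better c (Good.c g) → cost (Valid.H v) ≤ 2 * cost C
    compare e g c v bt = Σᴺ-≤-cancel m (≤-trans (s≤s z≤n) (Fin.toℕ<n e)) (begin
      m * Σᴺ (λ e → bit (Valid.H v e) * I e)                        ≡⟨ Σᴺ-* m (λ e → bit (Valid.H v e) * I e) ⟨
      Σᴺ (λ e → m * (bit (Valid.H v e) * I e))                      ≤⟨ Σᴺ-mono priced ⟩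
      Σᴺ (λ e → I f * (if Valid.H v e then suc (Guessed.ĉ f e) else 0))
                                                                    ≡⟨ trans (Σᴺ-* (I f) (λ e → if Valid.H v e then suc (Guessed.ĉ f e) else 0)) (trans (cong (I f *_) (sym (Valid.weigh v))) (*-comm (I f) (wt c))) ⟩
      wt c * I f                                                    ≤⟨ proj₁ (compare-I (wt c) (wt d) f e₀) (subst₂ _≤_ (cong₂ (λ p q → wt c * (p * q)) (Valid.pr-eq v) (cong qr c≡)) (cong₂ (λ p q → wt d * (p * q)) (cong pr c≡) (Valid.qr-eq v)) bt) ⟩
      wt d * I e₀                                                   ≤⟨ *-monoˡ-≤ (I e₀) weight≤ ⟩
      (b′ + b′) * I e₀                                              ≡⟨ cong (λ t → (t + t) * I e₀) b′≡ ⟩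
      (Σᴺ (λ e → bit (C e) * ĉ e) + Σᴺ (λ e → bit (C e) * ĉ e)) * I e₀
                                                                    ≡⟨ twice (Σᴺ (λ e → bit (C e) * ĉ e)) (I e₀) ⟩
      2 * (I e₀ * Σᴺ (λ e → bit (C e) * ĉ e))                       ≤⟨ *-monoʳ-≤ 2 (≤-trans (≤-reflexive (sym (Σᴺ-* (I e₀) (λ e → bit (C e) * ĉ e)))) (Σᴺ-mono lowered)) ⟩
      2 * Σᴺ (λ e → m * (bit (C e) * I e))                          ≡⟨ trans (cong (2 *_) (Σᴺ-* m (λ e → bit (C e) * I e))) (swap 2 m (Σᴺ (λ e → bit (C e) * I e))) ⟩
      m * (2 * Σᴺ (λ e → bit (C e) * I e))                          ∎)
      where
      open ≤-Reasoning
      open Good g renaming (c to d)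
      open Guessed e₀ using (ĉ; ĉ-lower; ĉ-upper; module Variant)
      open Variant true using (r; base; paid; module Outcome)
      open Outcome out
      f : Fin m
      f = Valid.e₀ v
      twice : ∀ a b → (a + a) * b ≡ 2 * (b * a)
      twice = ℕ-Ring.solve-∀
      swap : ∀ a b c → a * (b * c) ≡ b * (a * c)
      swap = ℕ-Ring.solve-∀
      priced : ∀ e → m * (bit (Valid.H v e) * I e) ≤ I f * (if Valid.H v e then suc (Guessed.ĉ f e) else 0)
      priced e with Valid.H v e | Valid.cheap v e
      ... | true  | ch = ≤-trans (≤-reflexive (cong (m *_) (*-identityˡ (I e)))) (≤-trans (Guessed.ĉ-upper f e (ch tt)) (≤-reflexive (*-comm (suc (Guessed.ĉ f e)) (I f))))
      ... | false | _  = ≤-trans (≤-reflexive (*-zeroʳ m)) z≤n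
      lowered : ∀ e → I e₀ * (bit (C e) * ĉ e) ≤ m * (bit (C e) * I e)
      lowered e with C e
      ... | true  = ≤-trans (≤-reflexive (trans (cong (I e₀ *_) (*-identityˡ (ĉ e))) (*-comm (I e₀) (ĉ e)))) (≤-trans (ĉ-lower e) (≤-reflexive (cong (m *_) (sym (*-identityˡ (I e))))))
      ... | false = ≤-trans (≤-reflexive (*-zeroʳ (I e₀))) z≤n
      h : ℕ
      h = scaleOf m
      spentᶜ : ℕ
      spentᶜ = paid lo
      taken≤ : h * (spentᶜ + m) ≤ (h + h) * b′ + suc m * errorOf m
      taken≤ = begin
        h * (spentᶜ + m)                                  ≡⟨ *-distribˡ-+ h spentᶜ m ⟩
        -- The grid size is 2h and the raise is h, so half of the left side of `spent` cancels
        -- against the raise.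
        h * spentᶜ + h * m                                ≤⟨ +-monoˡ-≤ (h * m) (+-cancelʳ-≤ (h * spentᶜ) (h * spentᶜ) (base b′) (≤-trans (≤-reflexive (sym (*-distribʳ-+ spentᶜ h h))) spent)) ⟩
        base b′ + h * m                                 ≡⟨ m∸n+n≡m (≤-trans (*-mono-≤ (m≤m+n h h) m≤b′) (m≤m+n _ _)) ⟩
        (h + h) * b′ + suc m * errorOf m                ∎
      paid+m≤ : spentᶜ + m ≤ b′ + b′
      -- All excesses together are less than h, so division by h leaves a strict inequality below
      -- the next integer.
      paid+m≤ = ℕ.s≤s⁻¹ (*-cancelˡ-< h (spentᶜ + m) (suc (b′ + b′)) (begin-strict
        h * (spentᶜ + m)                                  ≤⟨ taken≤ ⟩
        (h + h) * b′ + suc m * errorOf m                <⟨ +-monoʳ-< ((h + h) * b′) error<scale ⟩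
        (h + h) * b′ + h                                ≡⟨ gather h b′ ⟩
        h * suc (b′ + b′)                               ∎))
        where
        gather : ∀ h b → (h + h) * b + h ≡ h * suc (b + b)
        gather = ℕ-Ring.solve-∀
      weight≤ : wt d ≤ b′ + b′
      weight≤ = ≤-trans (≤-reflexive (trans (cong wt c≡) (Valid.weigh (outcome-valid true e₀ out)))) (≤-trans (Σᴺ-mono each) (≤-trans (≤-reflexive (trans (Σᴺ-+ (λ e → bit (lo e) * ĉ e) (λ _ → 1)) (cong (spentᶜ +_) ones))) paid+m≤))
        where
        ones : ∀ {k} → Σᴺ {k} (λ _ → 1) ≡ k
        ones {zero}  = refl
        ones {suc k} = cong suc ones
        each : ∀ e → (if hi e then suc (ĉ e) else 0) ≤ bit (lo e) * ĉ e + 1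
        each e with hi e | lo e | decided refl e
        ... | true  | true  | _ = ≤-reflexive (trans (+-comm 1 (ĉ e)) (cong (_+ 1) (sym (*-identityˡ (ĉ e)))))
        ... | true  | false | f = ⊥-elim (f tt)
        ... | false | _     | _ = z≤n

  size-Σᴺ : ∀ {k} (U : Fin k → Bool) a → Σᴺ (λ e → bit (U e) * a) ≡ a * size-of U
  size-Σᴺ U a = trans (Σᴺ-cong (λ e → *-comm (bit (U e)) a)) (trans (Σᴺ-* a (λ e → bit (U e))) (cong (a *_) (Σᴺ-size U)))

  -- All rounded costs equal m, so weights compare cardinalities and rounding loses nothing. The
  -- edges taken are no more than those of C because the raise is 0, and the undecided ones, which
  -- are all kept, are bounded by `few`.
  unit-ratio : (∀ e → value (num e) ≡ value (den e)) → (A : Answer false) → ∀ C → Covers C → κ * size-of (H A) ≤ (κ + 4) * size-of C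
  unit-ratio units A C cov = subst (_≤ (κ + 4) * size-of C) (trans (Σᴺ-* κ (λ e → bit (H A e))) (cong (κ *_) (Σᴺ-size (H A))))
      (by-edge (λ e → κ * bit (H A e)) (λ e → let (g , c , v , eq , bt) = better A C cov e in
        subst (_≤ (κ + 4) * size-of C) (sym (trans (Σᴺ-* κ (λ e → bit (H A e))) (cong (κ *_) (Σᴺ-size (H A)))))
          (subst (λ K → κ * size-of K ≤ (κ + 4) * size-of C) eq (compare e g c v bt))))
    where
    full : ∀ e₀ e → Guessed.ĉ e₀ e ≡ m
    full e₀ e = Guessed.ĉ-full e₀ e (trans (cong₂ _*_ (units e) (sym (units e₀))) (*-comm (value (den e)) (value (num e₀))))
    weight-size : ∀ e₀ K → weightOf e₀ K ≡ suc m * size-of K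
    weight-size e₀ K = trans (Σᴺ-cong each) (size-Σᴺ K (suc m))
      where
      each : ∀ e → (if K e then suc (Guessed.ĉ e₀ e) else 0) ≡ bit (K e) * suc m
      each e with K e
      ... | true  = trans (cong suc (full e₀ e)) (sym (*-identityˡ (suc m)))
      ... | false = refl
    compare : Fin m → (g : Good false C) → ∀ c (v : Valid c) → Better c (Good.c g) → κ * size-of (Valid.H v) ≤ (κ + 4) * size-of C
    compare e g c v bt = begin
      κ * size-of (Valid.H v)                                ≤⟨ *-monoʳ-≤ κ smaller ⟩
      κ * size-of hi                                         ≤⟨ *-monoʳ-≤ κ split ⟩
      κ * (size-of lo + size-of (open? lo hi))               ≡⟨ *-distribˡ-+ κ _ _ ⟩
      κ * size-of lo + κ * size-of (open? lo hi)             ≤⟨ +-mono-≤ (*-monoʳ-≤ κ taken≤) (few C cov) ⟩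
      κ * size-of C + 4 * size-of C                          ≡⟨ *-distribʳ-+ (size-of C) κ 4 ⟨
      (κ + 4) * size-of C                                    ∎
      where
      open ≤-Reasoning
      open Good g renaming (c to d)
      open Guessed e₀ using (ĉ; ĉ-full; module Variant)
      open Variant false using (paid; open?; module Outcome)
      open Outcome out
      f : Fin m
      f = Valid.e₀ v
      0<m : 0 < m
      0<m = ≤-trans (s≤s z≤n) (Fin.toℕ<n e)
      lighter : wt c ≤ wt d
      lighter = Σᴺ-≤-cancel (value (den f) * value (den e₀)) (*-mono-≤ (den-pos f) (den-pos e₀)) (subst₂ _≤_
        (trans (cong₂ (λ p q → wt c * (p * q)) (trans (Valid.pr-eq v) (units f)) (cong qr c≡)) (*-comm (wt c) (value (den f) * value (den e₀))))
        (trans (cong₂ (λ p q → wt d * (p * q)) (trans (cong pr c≡) (units e₀)) (Valid.qr-eq v)) (trans (*-comm (wt d) (value (den e₀) * value (den f))) (cong (_* wt d) (*-comm (value (den e₀)) (value (den f)))))) bt)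
      smaller : size-of (Valid.H v) ≤ size-of hi
      smaller = Σᴺ-≤-cancel (suc m) (s≤s z≤n) (subst₂ _≤_ (trans (Valid.weigh v) (weight-size f (Valid.H v)))
        (trans (cong wt c≡) (trans (Valid.weigh (outcome-valid false e₀ out)) (weight-size e₀ hi))) lighter)
      split : size-of hi ≤ size-of lo + size-of (open? lo hi)
      split = subst₂ _≤_ (Σᴺ-size hi) (trans (Σᴺ-+ (λ e → bit (lo e)) (λ e → bit (open? lo hi e))) (cong₂ _+_ (Σᴺ-size lo) (Σᴺ-size (open? lo hi)))) (Σᴺ-mono each)
        where
        each : ∀ e → bit (hi e) ≤ bit (lo e) + bit (open? lo hi e)
        each e with hi e | lo e
        ... | true  | true  = s≤s z≤n
        ... | true  | false = ≤-refl
        ... | false | _     = z≤n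
      h : ℕ
      h = gridSize m
      paid-lo : paid lo ≡ m * size-of lo
      paid-lo = trans (Σᴺ-cong (λ e → cong (bit (lo e) *_) (full e₀ e))) (size-Σᴺ lo m)
      b′-C : b′ ≡ m * size-of C
      b′-C = trans b′≡ (trans (Σᴺ-cong (λ e → cong (bit (C e) *_) (full e₀ e))) (size-Σᴺ C m))
      paid≤ : paid lo ≤ b′
      -- With raise 0 the whole error need only stay below the grid size for integrality to remove
      -- it.
      paid≤ = ℕ.s≤s⁻¹ (*-cancelˡ-< h (paid lo) (suc b′) (begin-strict
        h * paid lo                              ≤⟨ ≤-trans spent (≤-reflexive (+-identityʳ (h * b′ + suc m * errorOf m))) ⟩
        h * b′ + suc m * errorOf m               <⟨ +-monoʳ-< (h * b′) (≤-trans error<scale (m≤m+n (scaleOf m) (scaleOf m))) ⟩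
        h * b′ + h                               ≡⟨ trans (+-comm (h * b′) h) (sym (*-suc h b′)) ⟩
        h * suc b′                               ∎))
      taken≤ : size-of lo ≤ size-of C
      taken≤ = Σᴺ-≤-cancel m 0<m (subst₂ _≤_ paid-lo b′-C paid≤)

-- Fault tolerance as a condition on cuts

module CutCondition (G : Multigraph) where

  open Multigraph G using (order; edges; ends; loopless; Vertex; EdgeSet; Joins; Walk; stop; step; vertices; HasPath)
  open Cuts ends using (cr)

  infix 4 _∈ₛ_
  _∈ₛ_ : ∀ {n} → Fin n → Subset.Subset n → Set
  _∈ₛ_ = Subset._∈_

  Covering : ℕ → (Fin edges → Bool) → Set
  Covering κ H = ∀ S → (∀ e → cr S e ≡ 1 → T (H e)) ⊎ κ ≤ Σᴺ (λ e → bit (H e) * cr S e)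

  ∈⇒T : ∀ {n} {x : Fin n} (p : Subset.Subset n) → x ∈ₛ p → T (lookup p x)
  ∈⇒T p x∈p = subst T (sym (Vec.[]=⇒lookup x∈p)) tt

  T⇒∈ : ∀ {n} {x : Fin n} (p : Subset.Subset n) → T (lookup p x) → x ∈ₛ p
  T⇒∈ {x = x} p t = Vec.lookup⇒[]= x p (Bool.T-≡ .Equivalence.to t)

  ∣∣-Σᴺ : ∀ {n} (p : Subset.Subset n) → Subset.∣ p ∣ ≡ Σᴺ (λ x → bit (lookup p x))
  ∣∣-Σᴺ []          = refl
  ∣∣-Σᴺ (false ∷ p) = ∣∣-Σᴺ p
  ∣∣-Σᴺ (true ∷ p)  = cong suc (∣∣-Σᴺ p)

  x∈p─q⇒x∉q : ∀ {n} {x : Fin n} (p q : Subset.Subset n) → x ∈ₛ p Subset.─ q → ¬ x ∈ₛ q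
  x∈p─q⇒x∉q (_ ∷ p) (false ∷ q) (there x∈) (there x∈q) = x∈p─q⇒x∉q p q x∈ x∈q
  x∈p─q⇒x∉q (_ ∷ p) (true ∷ q)  (there x∈) (there x∈q) = x∈p─q⇒x∉q p q x∈ x∈q

  separated : ∀ {e u v} (S : Vec Bool order) → Joins e u v → lookup S u ≢ lookup S v → cr S e ≡ 1
  separated {e} S j ne = either j
    where
    distinct : ∀ a b → a ≢ b → bit (a xor b) ≡ 1
    distinct false false ne = ⊥-elim (ne refl)
    distinct false true  ne = refl
    distinct true  false ne = refl
    distinct true  true  ne = ⊥-elim (ne refl)
    either : Joins e _ _ → cr S e ≡ 1
    either (inj₁ eq) = trans (cong (λ p → bit (lookup S (proj₁ p) xor lookup S (proj₂ p))) eq) (distinct _ _ ne)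
    either (inj₂ eq) = trans (cong (λ p → bit (lookup S (proj₁ p) xor lookup S (proj₂ p))) eq) (distinct _ _ (ne ∘ sym))

  walk-crosses : ∀ {X u v} (S : Vec Bool order) → Walk X u v → lookup S u ≢ lookup S v → ∃ λ e → e ∈ₛ X × cr S e ≡ 1
  walk-crosses S stop ne = ⊥-elim (ne refl)
  walk-crosses S (step {u} {v} e e∈X j w) ne with lookup S u Bool.≟ lookup S v
  ... | yes eq = walk-crosses S w (ne ∘ trans eq)
  ... | no ne′ = e , e∈X , separated S j ne′

  suffix : ∀ {X u v t} (w : Walk X v t) → Unique (vertices w) → u ∈ vertices w → HasPath X u t
  suffix stop           unique       (here refl) = stop , unique
  suffix (step e p j w) unique       (here refl) = step e p j w , unique
  suffix (step e p j w) (_ ∷ unique) (there u∈w) = suffix w unique u∈w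

  path : ∀ {X u v} → Walk X u v → HasPath X u v
  path stop = stop , [] ∷ []
  path (step {u = u} e e∈X j w) with path w
  ... | w′ , unique with Any.any? (u Fin.≟_) (vertices w′)
  ... | yes u∈w′ = suffix w′ unique u∈w′
  ... | no  u∉w′ = step e e∈X j w′ , All.¬Any⇒All¬ (vertices w′) u∉w′ ∷ unique

  _▸_by_ : ∀ {X u v w e} → Walk X u v → Joins e v w → e ∈ₛ X → Walk X u w
  stop           ▸ j by e∈X = step _ e∈X j stop
  step f p j′ wk ▸ j by e∈X = step f p j′ (wk ▸ j by e∈X)

  insert-size : ∀ {n} (p : Subset.Subset n) x → ¬ T (lookup p x) → Subset.∣ p [ x ]≔ true ∣ ≡ suc Subset.∣ p ∣
  insert-size (false ∷ p) zero    ¬t = refl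
  insert-size (true ∷ p)  zero    ¬t = ⊥-elim (¬t tt)
  insert-size (false ∷ p) (suc x) ¬t = insert-size p x ¬t
  insert-size (true ∷ p)  (suc x) ¬t = cong suc (insert-size p x ¬t)

  module _ (X : EdgeSet) (s : Vertex) where

    record Reached (R : Vec Bool order) : Set where
      field
        source : T (lookup R s)
        walks  : ∀ v → T (lookup R v) → Walk X s v

    Closed : Vec Bool order → Set
    Closed R = ∀ e → e ∈ₛ X → cr R e ≢ 1

    insert : ∀ {R e u v} → Reached R → Joins e u v → e ∈ₛ X → T (lookup R u) → ¬ T (lookup R v) → Reached (R [ v ]≔ true)
    insert {R} {e} {u} {v} reached j e∈X u∈R v∉R = record { source = extends s source ; walks = walks′ }
      where
      open Reached reached
      extends : ∀ x → T (lookup R x) → T (lookup (R [ v ]≔ true) x)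
      extends x t = subst T (sym (Vec.lookup∘update′ {i = x} {v} (λ { refl → v∉R t }) R true)) t
      walks′ : ∀ x → T (lookup (R [ v ]≔ true) x) → Walk X s x
      walks′ x t with x Fin.≟ v
      ... | yes refl = walks u u∈R ▸ j by e∈X
      ... | no  x≢v  = walks x (subst T (Vec.lookup∘update′ x≢v R true) t)

    frontier : ∀ {R} → Reached R → ∀ e → e ∈ₛ X → cr R e ≡ 1 → ∃ λ v → ¬ T (lookup R v) × Reached (R [ v ]≔ true)
    frontier {R} reached e e∈X crosses = either (ends e) refl (lookup R (proj₁ (ends e))) (lookup R (proj₂ (ends e))) refl refl crosses
      where
      either : ∀ p → ends e ≡ p → ∀ a b → lookup R (proj₁ p) ≡ a → lookup R (proj₂ p) ≡ b → bit (a xor b) ≡ 1 →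
               ∃ λ v → ¬ T (lookup R v) × Reached (R [ v ]≔ true)
      either (x , y) eq true  false x∈ y∈ _ = y , subst T y∈ , insert reached (inj₁ eq) e∈X (subst T (sym x∈) tt) (subst T y∈)
      either (x , y) eq false true  x∈ y∈ _ = x , subst T x∈ , insert reached (inj₂ eq) e∈X (subst T (sym y∈) tt) (subst T x∈)

    grow : ∀ fuel R → order < Subset.∣ R ∣ + fuel → Reached R → ∃ λ R′ → Reached R′ × Closed R′
    grow zero       R lt reached = ⊥-elim (<⇒≱ lt (≤-trans (≤-reflexive (+-identityʳ _)) (Subset.∣p∣≤n R)))
    grow (suc fuel) R lt reached with Fin.any? (λ e → e Subset.∈? X ×-dec (cr R e ℕ.≟ 1))
    ... | no  none                  = R , reached , λ e e∈X crosses → none (e , e∈X , crosses)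
    ... | yes (e , e∈X , crosses)   = let (v , v∉R , reached′) = frontier reached e e∈X crosses in
      grow fuel (R [ v ]≔ true) (≤-trans lt (≤-reflexive (trans (+-suc _ fuel) (cong (_+ fuel) (sym (insert-size R v v∉R)))))) reached′

    component : ∃ λ R → Reached R × Closed R
    component = grow (suc order) (Vec.replicate order false [ s ]≔ true) (m≤n+m (suc order) _)
      record { source = subst T (sym (Vec.lookup∘update s (Vec.replicate order false) true)) tt ; walks = walks }
      where
      walks : ∀ v → T (lookup (Vec.replicate order false [ s ]≔ true) v) → Walk X s v
      walks v t with v Fin.≟ s
      ... | yes refl = stop
      ... | no  v≢s  = ⊥-elim (subst T (trans (Vec.lookup∘update′ v≢s (Vec.replicate order false) true) (Vec.lookup-replicate v false)) t)

  FaultTolerant : ℕ → EdgeSet → Set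
  FaultTolerant k H = ∀ (s t : Vertex) (F : EdgeSet) → Subset.∣ F ∣ < k → HasPath (Subset.⊤ Subset.─ F) s t → HasPath (H Subset.─ F) s t

  bit-* : ∀ a b → bit (a ∧ b) ≡ bit a * bit b
  bit-* false b = refl
  bit-* true  b = sym (+-identityʳ (bit b))

  T-bit : ∀ {b} → bit b ≡ 1 → T b
  T-bit {true} _ = tt

  -- If H has fewer than k edges on the boundary of S, all of them may fail. A boundary edge missing
  -- from H survives and joins its two ends, while no walk in what is left of H crosses the
  -- boundary. So no edge is missing.
  tolerant⇒covering : ∀ {k} H → FaultTolerant k H → Covering k (lookup H)
  tolerant⇒covering {k} H tolerant S with k ≤? Σᴺ (λ e → bit (lookup H e) * cr S e)
  ... | yes k≤ = inj₂ k≤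
  ... | no  k≰ = inj₁ λ e crosses → Dec.decidable-stable (Bool.T? (lookup H e)) (missing e crosses)
    where
    crossing : Fin edges → Bool
    crossing e = lookup S (proj₁ (ends e)) xor lookup S (proj₂ (ends e))
    F : EdgeSet
    F = Vec.tabulate (λ e → lookup H e ∧ crossing e)
    F-lookup : ∀ e → lookup F e ≡ lookup H e ∧ crossing e
    F-lookup = Vec.lookup∘tabulate _
    F-size : Subset.∣ F ∣ < k
    F-size = subst (_< k) (sym (trans (∣∣-Σᴺ F) (Σᴺ-cong (λ e → trans (cong bit (F-lookup e)) (bit-* (lookup H e) (crossing e)))))) (≰⇒> k≰)
    missing : ∀ e → cr S e ≡ 1 → ¬ ¬ T (lookup H e)
    missing e crosses e∉H = let (e′ , e′∈ , crosses′) = walk-crosses S (proj₁ detour) ends-differ in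
      x∈p─q⇒x∉q H F e′∈ (T⇒∈ F (subst T (sym (F-lookup e′)) (∧-T (∈⇒T H (Subset.p─q⊆p H F e′∈)) (T-bit crosses′))))
      where
      u = proj₁ (ends e)
      v = proj₂ (ends e)
      ends-differ : lookup S u ≢ lookup S v
      ends-differ eq = case trans (sym crosses) (trans (cong (λ b → bit (b xor lookup S v)) eq) (cong bit (Bool.xor-same (lookup S v)))) of λ ()
      e∉F : ¬ e ∈ₛ F
      e∉F e∈F = e∉H (proj₁ (T-∧ (subst T (F-lookup e) (∈⇒T F e∈F))))
      detour : HasPath (H Subset.─ F) u v
      detour = tolerant u v F F-size (step e (Subset.x∈p∧x∉q⇒x∈p─q Subset.∈⊤ e∉F) (inj₁ refl) stop , ((loopless e ∷ []) ∷ [] ∷ []))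

  -- Let R be the component of s after the faults. The boundary edges of R in H have all failed, so
  -- there are fewer than κ of them, and H must contain the whole boundary. But a surviving walk out
  -- of R uses an edge of it that has not failed.
  covering⇒tolerant : ∀ {k κ} H → (∀ j → j ≤ edges → j < k → j < κ) → Covering κ (lookup H) → FaultTolerant k H
  covering⇒tolerant {k} {κ} H small covering s t F F<k (w , _) with component (H Subset.─ F) s
  ... | R , reached , closed with Bool.T? (lookup R t)
  ... | yes t∈R = path (Reached.walks reached t t∈R)
  ... | no  t∉R = ⊥-elim (case covering R of λ where
      (inj₁ all)  → closed e (Subset.x∈p∧x∉q⇒x∈p─q (T⇒∈ H (all e across-R)) e∉F) across-R
      (inj₂ many) → <⇒≱ F<κ (≤-trans many (≤-trans (Σᴺ-mono boundary) (≤-reflexive (sym (∣∣-Σᴺ F))))))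
    where
    F<κ : Subset.∣ F ∣ < κ
    F<κ = small _ (Subset.∣p∣≤n F) F<k
    escape : ∃ λ e → e ∈ₛ Subset.⊤ Subset.─ F × cr R e ≡ 1
    escape = walk-crosses R w (λ eq → t∉R (subst T eq (Reached.source reached)))
    e = proj₁ escape
    across-R = proj₂ (proj₂ escape)
    e∉F : ¬ e ∈ₛ F
    e∉F = x∈p─q⇒x∉q Subset.⊤ F (proj₁ (proj₂ escape))
    boundary : ∀ f → bit (lookup H f) * cr R f ≤ bit (lookup F f)
    boundary f with Bool.T? (lookup F f) | Bool.T? (lookup H f) | cr R f ℕ.≟ 1
    ... | yes f∈F | _       | _      = ≤-trans (*-mono-≤ (bit-≤1 (lookup H f)) (bit-≤1 _)) (≤-reflexive (sym (bit-T f∈F)))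
    ... | no  _   | no f∉H  | _      = ≤-trans (≤-reflexive (cong (_* cr R f) (bit-¬T f∉H))) z≤n
    ... | no  f∉F | yes f∈H | yes c  = ⊥-elim (closed f (Subset.x∈p∧x∉q⇒x∈p─q (T⇒∈ H f∈H) (f∉F ∘ ∈⇒T F)) c)
    ... | no  _   | yes f∈H | no  ¬c = ≤-trans (≤-reflexive (trans (cong (bit (lookup H f) *_) (n<1⇒n≡0 (≤∧≢⇒< (bit-≤1 _) ¬c))) (*-zeroʳ (bit (lookup H f))))) z≤n

-- Rational costs

ι : ℕ → ℚ
ι n = ℤ.+ n ℚ./ 1

private
  ιᵘ : ℕ → ℚᵘ
  ιᵘ n = mkℚᵘ (ℤ.+ n) 0

  ι-ιᵘ : ∀ n → ℚ.toℚᵘ (ι n) ℚᵘ.≃ ιᵘ n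
  ι-ιᵘ n = ℚ.toℚᵘ-fromℚᵘ (ιᵘ n)

ι-scale : ∀ q a b → ℚᵘ.↥ q ℤ.* ℤ.+ a ≡ ℤ.+ b ℤ.* ℚᵘ.↧ q → ℚ.fromℚᵘ q ℚ.* ι a ≡ ι b
ι-scale q@(mkℚᵘ n d) a b eq = ℚ.toℚᵘ-injective
  (ℚᵘ.≃-trans (ℚ.toℚᵘ-homo-* (ℚ.fromℚᵘ q) (ι a))
  (ℚᵘ.≃-trans (ℚᵘ.*-cong (ℚ.toℚᵘ-fromℚᵘ q) (ι-ιᵘ a))
  (ℚᵘ.≃-trans (ℚᵘ.*≡* (trans (ℤ.*-identityʳ _) (trans eq (cong (λ j → ℤ.+ b ℤ.* ℤ.+ j) (sym (*-identityʳ (suc d)))))))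
  (ℚᵘ.≃-sym (ι-ιᵘ b)))))

ι-+ : ∀ a b → ι a ℚ.+ ι b ≡ ι (a + b)
ι-+ a b = ℚ.toℚᵘ-injective
  (ℚᵘ.≃-trans (ℚ.toℚᵘ-homo-+ (ι a) (ι b))
  (ℚᵘ.≃-trans (ℚᵘ.+-cong (ι-ιᵘ a) (ι-ιᵘ b))
  (ℚᵘ.≃-trans (ℚᵘ.*≡* (cong (ℤ._* ℤ.1ℤ) (cong₂ ℤ._+_ (ℤ.*-identityʳ (ℤ.+ a)) (ℤ.*-identityʳ (ℤ.+ b)))))
  (ℚᵘ.≃-sym (ι-ιᵘ (a + b))))))

ι-* : ∀ a b → ι a ℚ.* ι b ≡ ι (a * b)
ι-* a b = ι-scale (ιᵘ a) b (a * b) (trans (sym (ℤ.pos-* a b)) (sym (ℤ.*-identityʳ (ℤ.+ (a * b)))))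

ι-mono : ∀ {a b} → a ≤ b → ι a ℚ.≤ ι b
ι-mono {a} {b} a≤b = ℚ.toℚᵘ-cancel-≤ (ℚᵘ.≤-respˡ-≃ (ℚᵘ.≃-sym (ι-ιᵘ a)) (ℚᵘ.≤-respʳ-≃ (ℚᵘ.≃-sym (ι-ιᵘ b))
  (ℚᵘ.*≤* (ℤ.*-monoʳ-≤-nonNeg ℤ.1ℤ (ℤ.+≤+ a≤b)))))

sum-scaled : ∀ {m} (H : Fin m → Bool) (c : Fin m → ℚ) (I : Fin m → ℕ) D → (∀ e → c e ℚ.* ι D ≡ ι (I e)) →
             sum (λ e → if H e then c e else 0ℚ) ℚ.* ι D ≡ ι (Σᴺ (λ e → bit (H e) * I e))
sum-scaled {zero}  H c I D scaled = ℚ.*-zeroˡ (ι D)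
sum-scaled {suc m} H c I D scaled = begin
  (first ℚ.+ rest) ℚ.* ι D              ≡⟨ ℚ.*-distribʳ-+ (ι D) first rest ⟩
  first ℚ.* ι D ℚ.+ rest ℚ.* ι D        ≡⟨ cong₂ ℚ._+_ (term (H zero)) (sum-scaled (H ∘ suc) (c ∘ suc) (I ∘ suc) D (scaled ∘ suc)) ⟩
  ι (bit (H zero) * I zero) ℚ.+ ι more  ≡⟨ ι-+ (bit (H zero) * I zero) more ⟩
  ι (Σᴺ (λ e → bit (H e) * I e))        ∎
  where
  open ≡-Reasoning
  first = if H zero then c zero else 0ℚ
  more  = Σᴺ (λ e → bit (H (suc e)) * I (suc e))
  rest  = sum (λ e → if H (suc e) then c (suc e) else 0ℚ)
  term : ∀ b → (if b then c zero else 0ℚ) ℚ.* ι D ≡ ι (bit b * I zero)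
  term false = ℚ.*-zeroˡ (ι D)
  term true  = trans (scaled zero) (cong ι (sym (+-identityʳ (I zero))))

ratio : ∀ X Y ρ A B p q D .⦃ _ : NonZero q ⦄ .⦃ _ : NonZero D ⦄ → X ℚ.* ι D ≡ ι A → Y ℚ.* ι D ≡ ι B → ρ ℚ.* ι q ≡ ι p →
        q * A ≤ p * B → X ℚ.≤ ρ ℚ.* Y
ratio X Y ρ A B p q D X≡ Y≡ ρ≡ le =
  ℚ.*-cancelʳ-≤-pos (ι D) ⦃ ℚ.normalize-pos D 1 ⦄ (ℚ.*-cancelʳ-≤-pos (ι q) ⦃ ℚ.normalize-pos q 1 ⦄
    (subst₂ ℚ._≤_ (sym left) (sym right) (ι-mono le)))
  where
  open ≡-Reasoning
  left : X ℚ.* ι D ℚ.* ι q ≡ ι (q * A)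
  left = trans (cong (ℚ._* ι q) X≡) (trans (ι-* A q) (cong ι (*-comm A q)))
  right : ρ ℚ.* Y ℚ.* ι D ℚ.* ι q ≡ ι (p * B)
  right = begin
    ρ ℚ.* Y ℚ.* ι D ℚ.* ι q   ≡⟨ cong (ℚ._* ι q) (trans (ℚ.*-assoc ρ Y (ι D)) (cong (ρ ℚ.*_) Y≡)) ⟩
    ρ ℚ.* ι B ℚ.* ι q               ≡⟨ ℚ.*-assoc ρ (ι B) (ι q) ⟩
    ρ ℚ.* (ι B ℚ.* ι q)             ≡⟨ cong (ρ ℚ.*_) (ℚ.*-comm (ι B) (ι q)) ⟩
    ρ ℚ.* (ι q ℚ.* ι B)             ≡⟨ ℚ.*-assoc ρ (ι q) (ι B) ⟨
    ρ ℚ.* ι q ℚ.* ι B               ≡⟨ cong (ℚ._* ι B) ρ≡ ⟩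
    ι p ℚ.* ι B                           ≡⟨ ι-* p B ⟩
    ι (p * B)                             ∎

common-denominator : ∀ {m} (d : Fin m → ℕ) → (∀ e → 0 < d e) → ∃ λ D → ∃ λ (r : Fin m → ℕ) → ∀ e → r e * d e ≡ suc D
common-denominator {zero}  d d-pos = 0 , (λ ()) , λ ()
common-denominator {suc m} d d-pos with common-denominator (d ∘ suc) (d-pos ∘ suc) | d zero in d₀-eq | d-pos zero
... | D , r , eq | suc d₀ | _ = D + d₀ * suc D , (λ { zero → suc D ; (suc e) → suc d₀ * r e }) ,
  λ { zero → trans (cong (suc D *_) d₀-eq) (*-comm (suc D) (suc d₀)) ; (suc e) → trans (*-assoc (suc d₀) (r e) (d (suc e))) (cong (suc d₀ *_) (eq e)) }

ι-cost : ∀ c → 0ℚ ℚ.≤ c → ∀ r D → r * ℚ.↧ₙ c ≡ D → c ℚ.* ι D ≡ ι (ℤ.∣ ℚ.↥ c ∣ * r)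
ι-cost c@(mkℚ n d-1 _) 0≤c r D eq = subst (λ q → q ℚ.* ι D ≡ ι (ℤ.∣ n ∣ * r)) (ℚ.fromℚᵘ-toℚᵘ c) (ι-scale (mkℚᵘ n d-1) D (ℤ.∣ n ∣ * r) (begin
  n ℤ.* ℤ.+ D                             ≡⟨ cong (ℤ._* ℤ.+ D) (ℤ.0≤i⇒+∣i∣≡i n≥0) ⟨
  ℤ.+ ℤ.∣ n ∣ ℤ.* ℤ.+ D                   ≡⟨ ℤ.pos-* ℤ.∣ n ∣ D ⟨
  ℤ.+ (ℤ.∣ n ∣ * D)                       ≡⟨ cong ℤ.+_ (trans (cong (ℤ.∣ n ∣ *_) (sym eq)) (sym (*-assoc ℤ.∣ n ∣ r (suc d-1)))) ⟩
  ℤ.+ (ℤ.∣ n ∣ * r * suc d-1)             ≡⟨ ℤ.pos-* (ℤ.∣ n ∣ * r) (suc d-1) ⟩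
  ℤ.+ (ℤ.∣ n ∣ * r) ℤ.* ℤ.+ suc d-1       ∎))
  where
  open ≡-Reasoning
  n≥0 : ℤ.0ℤ ℤ.≤ n
  n≥0 = ℤ.nonNegative⁻¹ n ⦃ ℚ.nonNegative 0≤c ⦄

-- Encodings, and the approximation guarantees

enc-tabulate : ∀ A {n} (f : Fin n → Carrier A) → enc (Lst A) (tabulate f) ≡ encodeList (tabulate (enc A ∘ f))
enc-tabulate A {zero}  f = refl
enc-tabulate A {suc n} f = cong (enc A (f zero) ·_) (enc-tabulate A (f ∘ suc))

enc-subset : ∀ {n} (f : Fin n → Bool) → enc (Lst Bit) (tabulate f) ≡ encodeSubset (Vec.tabulate f)
enc-subset {zero}  f = refl
enc-subset {suc n} f = cong (encodeBool (f zero) ·_) (enc-subset (f ∘ suc))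

truncate-binary : ∀ K n → truncate K (binary n) ≡ K ℕ.⊓ n
truncate-binary K n = trans (truncate-⊓ K (binary n)) (cong (K ℕ.⊓_) (value-binary n))

truncate-toℕ : ∀ {n} (v : Fin n) → truncate n (binary (toℕ v)) ≡ toℕ v
truncate-toℕ {n} v = trans (truncate-binary n (toℕ v)) (m≥n⇒m⊓n≡n (<⇒≤ (Fin.toℕ<n v)))

four-over : ∀ k .⦃ _ : NonZero k ⦄ → (ℤ.+ 4 ℚ./ k) ℚ.* ι k ≡ ι 4
four-over (suc k) = ι-scale (mkℚᵘ (ℤ.+ 4) k) (suc k) 4 refl

one-plus : ∀ k .⦃ _ : NonZero k ⦄ → (1ℚ ℚ.+ (ℤ.+ 4) ℚ./ k) ℚ.* ι k ≡ ι (k + 4)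
one-plus k = trans (ℚ.*-distribʳ-+ (ι k) 1ℚ ((ℤ.+ 4) ℚ./ k)) (trans (cong₂ ℚ._+_ (ℚ.*-identityˡ (ι k)) (four-over k)) (ι-+ k 4))

-- If the cap K = 4m + 1 applies, then 4b < K, and an a above b would give K a ≥ K b + K > (K + 4)
-- b. So a ≤ b, and the inequality holds for every k.
unbounded : ∀ k {m a b} → b ≤ m → (suc (4 * m) ℕ.⊓ k) * a ≤ (suc (4 * m) ℕ.⊓ k + 4) * b → k * a ≤ (k + 4) * b
unbounded k {m} {a} {b} b≤m le with ≤-total k (suc (4 * m))
... | inj₁ k≤ = subst (λ j → j * a ≤ (j + 4) * b) (m≥n⇒m⊓n≡n k≤) le
... | inj₂ k≥ = *-mono-≤ (m≤m+n k 4) (≮⇒≥ λ b<a → <⇒≱ (lt b<a) (subst (λ j → j * a ≤ (j + 4) * b) (m≤n⇒m⊓n≡m k≥) le))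
  where
  K = suc (4 * m)
  lt : b < a → (K + 4) * b < K * a
  lt b<a = begin-strict
    (K + 4) * b     ≡⟨ *-distribʳ-+ b K 4 ⟩
    K * b + 4 * b   <⟨ +-monoʳ-< (K * b) (s≤s (*-monoʳ-≤ 4 b≤m)) ⟩
    K * b + K       ≡⟨ trans (+-comm (K * b) K) (sym (*-suc K b)) ⟩
    K * suc b       ≤⟨ *-monoʳ-≤ K b<a ⟩
    K * a           ∎
    where open ≤-Reasoning

algorithm-≡ : ∀ b r {k es} → connectivityOf r ≡ k → edgesOf r ≡ es → algorithm b r ≡ solve b k es
algorithm-≡ b r refl refl = refl

module OnInstance (𝓘 : Instance) where

  open Instance 𝓘
  open CutCondition graph using (Covering; tolerant⇒covering; covering⇒tolerant)

  rawEdge : Fin edges → ℕ × (ℕ × (ℕ × ℕ))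
  rawEdge e = toℕ (proj₁ (ends e)) , (toℕ (proj₂ (ends e)) , (ℤ.∣ ℚ.↥ cost e ∣ , ℚ.↧ₙ cost e))

  raw : Carrier Raw
  raw = k , (tabulate {n = order} toℕ , tabulate rawEdge)

  enc-raw : encodeInstance 𝓘 ≡ enc Raw raw
  enc-raw = sym (cong (encodeℕ k ·_) (cong₂ _·_ (enc-tabulate Bin toℕ) (enc-tabulate (Bin ⊗ (Bin ⊗ (Bin ⊗ Bin))) rawEdge)))

  num den : Fin edges → List ℕ
  num e = binary ℤ.∣ ℚ.↥ cost e ∣
  den e = binary (ℚ.↧ₙ cost e)

  -- With m edges every k > m imposes the same condition; the cap 4m + 1 is small enough for unary
  -- arithmetic and large enough for the ratio 1 + 4/k to survive.
  κ : ℕ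
  κ = suc (4 * edges) ℕ.⊓ k

  connectivityOf-raw : connectivityOf raw ≡ κ
  connectivityOf-raw = trans (truncate-binary (suc (4 * length (tabulate rawEdge))) k) (cong (λ m → suc (4 * m) ℕ.⊓ k) (List.length-tabulate rawEdge))

  κ-pos : 0 < κ
  κ-pos = ⊓-glb (s≤s z≤n) (ℕ.>-nonZero⁻¹ k)

  denominators : ∃ λ D → ∃ λ (r : Fin edges → ℕ) → ∀ e → r e * ℚ.↧ₙ cost e ≡ suc D
  denominators = common-denominator (λ e → ℚ.↧ₙ cost e) (λ _ → s≤s z≤n)

  D : ℕ
  D = suc (proj₁ denominators)

  I : Fin edges → ℕ
  I e = ℤ.∣ ℚ.↥ cost e ∣ * proj₁ (proj₂ denominators) e

  I-cost : ∀ e → cost e ℚ.* ι D ≡ ι (I e)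
  I-cost e = ι-cost (cost e) (cost-nonneg e) (proj₁ (proj₂ denominators) e) D (proj₂ (proj₂ denominators) e)

  I-eq : ∀ e → I e * value (den e) ≡ value (num e) * D
  I-eq e = trans (cong (I e *_) (value-binary (ℚ.↧ₙ cost e)))
    (trans (*-assoc ℤ.∣ ℚ.↥ cost e ∣ _ (ℚ.↧ₙ cost e)) (cong₂ _*_ (sym (value-binary ℤ.∣ ℚ.↥ cost e ∣)) (proj₂ (proj₂ denominators) e)))

  den-pos : ∀ e → 0 < value (den e)
  den-pos e = ≤-trans (s≤s z≤n) (≤-reflexive (sym (value-binary (ℚ.↧ₙ cost e))))

  weighted : Weighted
  weighted = record { ends = ends ; num = num ; den = den ; κ = κ ; κ-pos = κ-pos ; I = I ; D = D ; D-pos = s≤s z≤n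
                    ; den-pos = den-pos ; I-eq = I-eq ; loopless = loopless }

  open Solve weighted using (L; Answer; answer; half-ratio; unit-ratio)

  abstract
    answers : ∀ b → Answer b
    answers = answer

  output : Bool → EdgeSet
  output b = Vec.tabulate (Answer.H (answers b))

  output-lookup : ∀ b e → lookup (output b) e ≡ Answer.H (answers b) e
  output-lookup b = Vec.lookup∘tabulate (Answer.H (answers b))

  edgesOf-raw : edgesOf raw ≡ L
  edgesOf-raw = begin
    numbered (map (decodeEdge (length (tabulate {n = order} toℕ))) (tabulate rawEdge))
      ≡⟨ cong (λ n → numbered (map (decodeEdge n) (tabulate rawEdge))) (List.length-tabulate {n = order} toℕ) ⟩
    numbered (map (decodeEdge order) (tabulate rawEdge))    ≡⟨ cong numbered (List.map-tabulate rawEdge (decodeEdge order)) ⟩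
    numbered (tabulate (decodeEdge order ∘ rawEdge))        ≡⟨ numbered-correct (tabulate (decodeEdge order ∘ rawEdge)) ⟩
    numberFrom 0 (tabulate (decodeEdge order ∘ rawEdge))    ≡⟨ tabulate-numberFrom 0 (decodeEdge order ∘ rawEdge) ⟩
    tabulate (λ e → toℕ e , decodeEdge order (rawEdge e))   ≡⟨ List.tabulate-cong (λ e → cong (λ a → toℕ e , (a , (num e , den e)))
                                                                  (cong₂ _,_ (truncate-toℕ (proj₁ (ends e))) (truncate-toℕ (proj₂ (ends e))))) ⟩
    L  ∎
    where open ≡-Reasoning

  algorithm-raw : ∀ b → algorithm b raw ≡ solve b κ L
  algorithm-raw b = algorithm-≡ b raw {κ} {L} connectivityOf-raw edgesOf-raw

  output-code : ∀ b → enc (Lst Bit) (algorithm b raw) ≡ encodeSubset (output b)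
  output-code b = begin
    enc (Lst Bit) (algorithm b raw)                      ≡⟨ cong (enc (Lst Bit)) (algorithm-raw b) ⟩
    enc (Lst Bit) (solve b κ L)                          ≡⟨ cong (enc (Lst Bit)) (Answer.bits (answers b)) ⟩
    enc (Lst Bit) (tabulate (Answer.H (answers b)))      ≡⟨ enc-subset (Answer.H (answers b)) ⟩
    encodeSubset (output b)                              ∎
    where open ≡-Reasoning

  scaled-output : ∀ b (c : Fin edges → ℕ) → Σᴺ (λ e → bit (lookup (output b) e) * c e) ≡ Σᴺ (λ e → bit (Answer.H (answers b) e) * c e)
  scaled-output b c = Σᴺ-cong (λ e → cong (λ h → bit h * c e) (output-lookup b e))

  output-covering : ∀ b → Covering κ (lookup (output b))
  output-covering b S = Sum.map
    (λ all e c → subst T (sym (output-lookup b e)) (all e c))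
    (λ many → ≤-trans many (≤-reflexive (sym (scaled-output b (Cuts.cr ends S)))))
    (Answer.covers (answers b) S)

  output-feasible : ∀ b → Feasible (output b)
  output-feasible b = covering⇒tolerant {k} {κ} (output b) (λ j j≤m j<k → ⊓-glb (s≤s (≤-trans j≤m (m≤n*m edges 4))) j<k) (output-covering b)

  feasible⇒covering : ∀ C → Feasible C → Covering κ (lookup C)
  feasible⇒covering C feasible S = Sum.map id (≤-trans (m⊓n≤n (suc (4 * edges)) k)) (tolerant⇒covering C feasible S)

  scaledCost : EdgeSet → ℕ
  scaledCost C = Σᴺ (λ e → bit (lookup C e) * I e)

  totalCost-scaled : ∀ C → totalCost C ℚ.* ι D ≡ ι (scaledCost C)
  totalCost-scaled C = sum-scaled (lookup C) cost I D I-cost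

  output-half : ∀ C → Feasible C → totalCost (output true) ℚ.≤ (ℤ.+ 2 ℚ./ 1) ℚ.* totalCost C
  output-half C feasible = ratio (totalCost (output true)) (totalCost C) (ℤ.+ 2 ℚ./ 1) (scaledCost (output true)) (scaledCost C) 2 1 D
    (totalCost-scaled (output true)) (totalCost-scaled C) (ι-* 2 1) (begin
      1 * scaledCost (output true)                          ≡⟨ +-identityʳ (scaledCost (output true)) ⟩
      scaledCost (output true)                              ≡⟨ scaled-output true I ⟩
      Σᴺ (λ e → bit (Answer.H (answers true) e) * I e)      ≤⟨ half-ratio (answers true) (lookup C) (feasible⇒covering C feasible) ⟩
      2 * scaledCost C                                      ∎)
    where open ≤-Reasoning

  module _ (units : UnitCosts 𝓘) where

    totalCost-size : ∀ C → totalCost C ℚ.* ι 1 ≡ ι (size-of (lookup C))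
    totalCost-size C = trans (sum-scaled (lookup C) cost (λ _ → 1) 1 (λ e → trans (cong (ℚ._* ι 1) (units e)) (ι-* 1 1)))
      (cong ι (trans (Σᴺ-cong (λ e → *-identityʳ (bit (lookup C e)))) (Σᴺ-size (lookup C))))

    num≡den : ∀ e → value (num e) ≡ value (den e)
    num≡den e = trans (cong (λ c → value (binary ℤ.∣ ℚ.↥ c ∣)) (units e)) (sym (cong (λ c → value (binary (ℚ.↧ₙ c))) (units e)))

    output-unit : ∀ C → Feasible C → totalCost (output false) ℚ.≤ (1ℚ ℚ.+ (ℤ.+ 4) ℚ./ k) ℚ.* totalCost C
    output-unit C feasible = ratio (totalCost (output false)) (totalCost C) (1ℚ ℚ.+ (ℤ.+ 4) ℚ./ k)
      (size-of (lookup (output false))) (size-of (lookup C)) (k + 4) k 1 (totalCost-size (output false)) (totalCost-size C) (one-plus k)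
      (unbounded k (size-≤ (lookup C)) (subst (λ a → κ * a ≤ (κ + 4) * size-of (lookup C)) (sym (size-cong (output-lookup false)))
        (unit-ratio num≡den (answers false) (lookup C) (feasible⇒covering C feasible))))

Instances : Coded
Carrier Instances = Instance
enc Instances     = encodeInstance

solver : ∀ b → PT Instances (Lst Bit) (λ 𝓘 → algorithm b (OnInstance.raw 𝓘))
solver b = _∙_ {Y = Raw} {f = OnInstance.raw} (algorithmPT b) (reinterpret OnInstance.enc-raw)

program : ∀ {X Y f} → PT X Y f → Program
program F = record { extraVars = 2 ; body = cmd F }

program-computes : ∀ {X Y f} (F : PT X Y f) → ∃₂ λ a d → ∀ x → ∃ λ t →
                   Computes (program F) (enc X x) (enc Y (f x)) t × t ≤ a * size (enc X x) ^ d
program-computes {X} {Y} {f} F with monomial-bound (time F ⟨ arg ⊞ con 2 ⟩)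
... | a , d , bound = suc a , d , λ x → let open Run (run F x nil) in
  duration , (_ , execution , refl) , ≤-trans in-time (bound (size (enc X x)) (size-pos (enc X x)))

admits : ∀ {f} → PT Instances (Lst Bit) f → (C : Instance → Set) (ρ : Instance → ℚ) (H : ∀ 𝓘 → Instance.EdgeSet 𝓘) →
         (∀ 𝓘 → enc (Lst Bit) (f 𝓘) ≡ encodeSubset (H 𝓘)) → (∀ 𝓘 → Instance.Feasible 𝓘 (H 𝓘)) →
         (∀ 𝓘 → C 𝓘 → let open Instance 𝓘 in ∀ K → Feasible K → totalCost (H 𝓘) ℚ.≤ ρ 𝓘 ℚ.* totalCost K) →
         AdmitsApproximationRatio C ρ
admits F C ρ H code feasible guarantee with program-computes F
... | a , d , computes = program F , a , d , λ 𝓘 c → let (t , computed , in-time) = computes 𝓘 in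
  H 𝓘 , t , subst (λ o → Computes (program F) (encodeInstance 𝓘) o t) (code 𝓘) computed , in-time ,
  feasible 𝓘 , λ H* optimal → guarantee 𝓘 c H* (proj₁ optimal)

theoremD2 :
    AdmitsApproximationRatio (λ _ → ⊤) (λ _ → (ℤ.+ 2) ℚ./ 1)
    × AdmitsApproximationRatio UnitCosts (λ I → let open Instance I in 1ℚ ℚ.+ (ℤ.+ 4) ℚ./ k)
theoremD2 =
  admits (solver true) (λ _ → ⊤) (λ _ → (ℤ.+ 2) ℚ./ 1) (λ 𝓘 → OnInstance.output 𝓘 true)
    (λ 𝓘 → OnInstance.output-code 𝓘 true) (λ 𝓘 → OnInstance.output-feasible 𝓘 true) (λ 𝓘 _ → OnInstance.output-half 𝓘) ,
  admits (solver false) UnitCosts (λ I → let open Instance I in 1ℚ ℚ.+ (ℤ.+ 4) ℚ./ k) (λ 𝓘 → OnInstance.output 𝓘 false)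
    (λ 𝓘 → OnInstance.output-code 𝓘 false) (λ 𝓘 → OnInstance.output-feasible 𝓘 false) OnInstance.output-unit
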